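{- Let $q$ be a prime power with $q\notin\{3,4,5,7,9,11,16,17,23,25,29,49\}$, and let $E$ be an elliptic curve over the finite field $\mathbb{F}_q$ with quadratic twist $E'$. Then there is a unique integer $t$ with $|t|\le 2\sqrt{q}$ such that $\lambda(E)$ divides $q+1-t$ and $\lambda(E')$ divides $q+1+t$.
   Context: For an elliptic curve $E$ over $\mathbb{F}_q$, $E(\mathbb{F}_q)$ denotes its finite abelian group of $\mathbb{F}_q$-rational points, and $\lambda(E)=\mathrm{lcm}\{|P| : P\in E(\mathbb{F}_q)\}$ is the exponent of this group (here $|P|$ is the order of $P$). The quadratic twist $E'$ of $E$ is an elliptic curve over $\mathbb{F}_q$ that is isomorphic to $E$ over the quadratic extension $\mathbb{F}_{q^2}$ but is the nontrivial quadratic twist of $E$; the group orders satisfy $\#E(\mathbb{F}_q)+\#E'(\mathbb{F}_q)=2(q+1)$. -}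

module Defs where

open import Level using (0ℓ)
open import Data.Nat using (ℕ; zero; suc)
import Data.Nat as ℕ
open import Data.Nat.LCM using (lcm)
open import Data.Fin using (Fin)
open import Data.List using (List; []; _∷_; map; concatMap; filter; length; foldr; allFin; upTo)
open import Data.Maybe using (Maybe; just; nothing)
open import Data.Product using (_×_; _,_)
open import Data.Bool using (Bool; true; false; if_then_else_)
open import Relation.Binary.PropositionalEquality using (_≡_; _≢_)
open import Relation.Binary.Definitions using (DecidableEquality)
open import Relation.Nullary using (¬_; Dec; yes; no)
open import Relation.Nullary.Decidable using (does)
open import Algebra.Structures using (IsCommutativeRing)
open import Function.Bundles using (_↔_; Inverse)

record FiniteField : Set₁ where
  infixl 6 _+_ _-_
  infixl 7 _*_ _/_
  field
    Carrier : Set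
    _+_ _*_ : Carrier → Carrier → Carrier
    -_      : Carrier → Carrier
    0# 1#   : Carrier
    isCommutativeRing : IsCommutativeRing _≡_ _+_ _*_ -_ 0# 1#
    _⁻¹     : Carrier → Carrier
    inverseʳ : ∀ x → x ≢ 0# → x * (x ⁻¹) ≡ 1#
    0≢1     : 0# ≢ 1#
    _≟_     : DecidableEquality Carrier
    size    : ℕ
    enum    : Carrier ↔ Fin size

  _-_ : Carrier → Carrier → Carrier
  x - y = x + (- y)

  _/_ : Carrier → Carrier → Carrier
  x / y = x * (y ⁻¹)

  fromℕ : ℕ → Carrier
  fromℕ zero    = 0#
  fromℕ (suc n) = 1# + fromℕ n

  elements : List Carrier
  elements = map (Inverse.from enum) (allFin size)

module _ (F : FiniteField) where
  open FiniteField F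

  record Weierstrass : Set where
    constructor weier
    field a₁ a₂ a₃ a₄ a₆ : Carrier

  -- discriminant (Silverman, III.1)
  disc : Weierstrass → Carrier
  disc (weier a₁ a₂ a₃ a₄ a₆) =
    let b₂ = a₁ * a₁ + fromℕ 4 * a₂
        b₄ = fromℕ 2 * a₄ + a₁ * a₃
        b₆ = a₃ * a₃ + fromℕ 4 * a₆
        b₈ = a₁ * a₁ * a₆ + fromℕ 4 * a₂ * a₆ - a₁ * a₃ * a₄
               + a₂ * a₃ * a₃ - a₄ * a₄
    in (- (b₂ * b₂ * b₈)) - fromℕ 8 * b₄ * b₄ * b₄
         - fromℕ 27 * b₆ * b₆ + fromℕ 9 * b₂ * b₄ * b₆

  record EllipticCurve : Set where
    constructor ell
    field
      eqn       : Weierstrass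
      nonsingular : disc eqn ≢ 0#

  -- projective points: nothing = point at infinity O, just (x , y) affine
  RawPoint : Set
  RawPoint = Maybe (Carrier × Carrier)

  onCurve : Weierstrass → Carrier → Carrier → Bool
  onCurve (weier a₁ a₂ a₃ a₄ a₆) x y =
    does ((y * y + a₁ * x * y + a₃ * y) ≟
          (x * x * x + a₂ * x * x + a₄ * x + a₆))

  points : Weierstrass → List RawPoint
  points W = nothing ∷ concatMap (λ x → concatMap (λ y →
               if onCurve W x y then just (x , y) ∷ [] else []) elements) elements

  -- chord-and-tangent group law (Silverman, Algorithm III.2.3)
  add : Weierstrass → RawPoint → RawPoint → RawPoint
  add W nothing Q = Q
  add W P nothing = P
  add (weier a₁ a₂ a₃ a₄ a₆) (just (x₁ , y₁)) (just (x₂ , y₂)) with does (x₁ ≟ x₂)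
  ... | true with does ((y₁ + y₂ + a₁ * x₂ + a₃) ≟ 0#)
  ...   | true  = nothing
  ...   | false =
          let d = fromℕ 2 * y₁ + a₁ * x₁ + a₃
              l = (fromℕ 3 * x₁ * x₁ + fromℕ 2 * a₂ * x₁ + a₄ - a₁ * y₁) / d
              v = ((- (x₁ * x₁ * x₁)) + a₄ * x₁ + fromℕ 2 * a₆ - a₃ * y₁) / d
              x₃ = l * l + a₁ * l - a₂ - x₁ - x₂
          in just (x₃ , (- ((l + a₁) * x₃)) - v - a₃)
  add (weier a₁ a₂ a₃ a₄ a₆) (just (x₁ , y₁)) (just (x₂ , y₂)) | false =
          let l = (y₂ - y₁) / (x₂ - x₁)
              v = (y₁ * x₂ - y₂ * x₁) / (x₂ - x₁)
              x₃ = l * l + a₁ * l - a₂ - x₁ - x₂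
          in just (x₃ , (- ((l + a₁) * x₃)) - v - a₃)

  smul : Weierstrass → ℕ → RawPoint → RawPoint
  smul W zero    P = nothing
  smul W (suc n) P = add W P (smul W n P)

  isO : RawPoint → Bool
  isO nothing  = true
  isO (just _) = false

  -- order of P: least n ≥ 1 with n • P = O, searched among 1 … N where
  -- N = #E(F) (the order of an element divides the group order).
  orderSearch : Weierstrass → RawPoint → List ℕ → ℕ
  orderSearch W P []       = 0
  orderSearch W P (n ∷ ns) = if isO (smul W n P) then n else orderSearch W P ns

  order : Weierstrass → RawPoint → ℕ
  order W P = orderSearch W P (map suc (upTo (length (points W))))

  exponent : EllipticCurve → ℕ
  exponent E = foldr lcm 1 (map (order (EllipticCurve.eqn E)) (points (EllipticCurve.eqn E)))

  -- Quadratic twist.  Let D ∈ F be such that X² + X + D has no root in F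
  -- (so F(θ), θ² + θ + D = 0, is the quadratic extension).  Writing
  -- η = a₁x + a₃, f = x³ + a₂x² + a₄x + a₆, the twist of E is
  --     y² + ηy = f − D(η² + 4f) = u f − D η²,   u = 1 − 4D  (≠ 0),
  -- brought to Weierstrass form by x = uX, y = u²Y.
  TwistParam : Carrier → Set
  TwistParam D = ∀ x → x * x + x + D ≢ 0#

  twistEqn : Carrier → Weierstrass → Weierstrass
  twistEqn D (weier a₁ a₂ a₃ a₄ a₆) =
    let u  = 1# - fromℕ 4 * D
        u² = u * u
        u³ = u² * u
        u⁴ = u² * u²
    in weier (a₁ / u) (a₂ / u - D * a₁ * a₁ / u²) (a₃ / u²)
             (a₄ / u² - fromℕ 2 * D * a₁ * a₃ / u³) (a₆ / u³ - D * a₃ * a₃ / u⁴)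

  record IsQuadraticTwist (E E' : EllipticCurve) : Set where
    field
      D     : Carrier
      param : TwistParam D
      eqn≡  : EllipticCurve.eqn E' ≡ twistEqn D (EllipticCurve.eqn E)

{-# OPTIONS --safe #-}
-- The group law is associative because P ↦ (class of the ideal of P) embeds the curve into the class
-- group of its coordinate ring. Let P be the generic point and Φ the Frobenius map. The x-coordinates of
-- Q + P and Q − P are the roots of a quadratic form in the x-coordinate of Q, so the degrees of
-- x(ΦP − nP) have second difference 2: they lie on a parabola n² − τ n + q, whose value at 1 is #E, and
-- as no degree is negative, τ² ≤ 4q (Hasse, after Manin). In the same way x(nP) has degree n², which bounds
-- the n-torsion by n². This and #E + #E′ = 2(q + 1) give the existence of t.
--
-- For uniqueness, E(F) and E′(F) embed into E(K), K the quadratic extension; conjugation acts on them as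
-- 1 and −1, so they meet in 2-torsion. Their sum is killed by L = lcm(λ(E), λ(E′)), whence #E #E′ ≤ 4L²,
-- and ≤ L² if an exponent is odd or q is even. If s ≠ t both work then L divides s − t, so L² ≤ 16q and
-- (q + 1)² ≤ 68q. The finitely many remaining parameters are checked by evaluation. Only q = 13 with orders
-- 12, 16 and exponents 4, 8, and q = 19 with orders 16, 24 and exponents 4, dividing 12, survive; there
-- the group of order 12 or 16 would be the full 4-torsion, and the other group would have too many points of order 2.
module Submission where

open import Defs
open import Level using (0ℓ)
open import Data.Product using (_×_; _,_; ∃; proj₁; proj₂; ∃₂)
open import Data.Sum using (_⊎_; inj₁; inj₂; [_,_]′)
open import Data.Empty using (⊥-elim; ⊥)
open import Data.Unit using (⊤; tt)
open import Relation.Nullary using (yes; no; ¬_; contradiction; Dec)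
open import Data.List.Membership.Propositional using (_∈_; _∉_)
open import Data.List.Relation.Unary.Any using (here; there)
open import Data.List.Relation.Unary.Unique.Propositional using (Unique)
open import Data.Maybe using (just; nothing; Maybe)
open import Algebra.Bundles using (CommutativeRing)
open import Relation.Nullary.Decidable using (does; toWitness; _×-dec_; _⊎-dec_; _→-dec_; ¬?; decidable-stable)
open import Data.List.Relation.Unary.AllPairs using ([]; _∷_)
open import Relation.Binary.Definitions using (tri<; tri≈; tri>; DecidableEquality)
open import Data.List.Membership.Propositional.Properties using (∈-∃++; ∈-map⁺; ∈-map⁻; ∈-filter⁻; ∈-deduplicate⁺; ∈-allFin; ∈-filter⁺; ∈-concat⁺′; ∈-concat⁻′; ∈-++⁻; ∈-cartesianProduct⁻; ∈-cartesianProduct⁺; ∈-deduplicate⁻)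
open import Data.List.Properties using (length-map; length-++; length-tabulate)
open import Function using (_∘_)
open import Relation.Binary.PropositionalEquality using (_≡_; _≢_)
open import Data.Nat using (ℕ)
open import Data.List using (List)

-- No point over the function field F(E) is ever constructed. The x-coordinate of nP or of ΦP - nP
-- is kept as a pair U : V over F[X] with a Bezout identity, and adding P means splitting off the
-- known root of a binary quadratic form. The form stays primitive because the discriminant is a
-- unit, so the new pair is again coprime and its degree can be read off as in Gauss's lemma. The
-- delicate point is the starting value deg x(ΦP - P) = #E: the evident fraction has denominator
-- (X^q - X)², and the cancellation at each a is found by comparing y^q with y in the fibre F[y]/(y²
-- + η(a) y - f(a)), which is F × F, a ring of dual numbers or a field. The same computation for ΦP
-- + P yields #E′. Degrees are natural numbers, so the Hasse bound is applied to whichever of the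
-- two orders is at most q + 1. The argument up to this point is uniform in the characteristic. So
-- is the torsion bound; the price is that the n-torsion is only bounded, through the multiplicities
-- of the denominator of x(nP), and never counted exactly.

-- Reflection: polynomial expressions and their normal forms.

module RingExpr where
  open import Data.Bool using (Bool; true; _∧_)
  open import Data.Fin using (Fin; zero; suc)
  open import Data.List using (List; []; _∷_)
  open import Data.Nat as ℕ using (ℕ; zero; suc)

  -- Polynomials in n variables, dense in each variable; an integer coefficient
  -- is a formal difference of natural numbers.
  Nf : ℕ → Set
  Nf zero    = ℕ × ℕ
  Nf (suc n) = List (Nf n)

  nf-0 : ∀ n → Nf n
  nf-0 zero    = 0 , 0
  nf-0 (suc n) = []

  nf-con : ∀ n → ℕ → Nf n
  nf-con zero    k = k , 0
  nf-con (suc n) k = nf-con n k ∷ []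

  nf-var : ∀ {n} → Fin n → Nf n
  nf-var {suc n} zero    = nf-0 n ∷ nf-con n 1 ∷ []
  nf-var {suc n} (suc i) = nf-var i ∷ []

  nf-add : ∀ n → Nf n → Nf n → Nf n
  nf-add zero    (a , b)  (c , d)  = a ℕ.+ c , b ℕ.+ d
  nf-add (suc n) []       q        = q
  nf-add (suc n) (x ∷ p)  []       = x ∷ p
  nf-add (suc n) (x ∷ p)  (y ∷ q)  = nf-add n x y ∷ nf-add (suc n) p q

  nf-neg : ∀ n → Nf n → Nf n
  nf-neg zero    (a , b) = b , a
  nf-neg (suc n) []      = []
  nf-neg (suc n) (x ∷ p) = nf-neg n x ∷ nf-neg (suc n) p

  mutual
    nf-mul : ∀ n → Nf n → Nf n → Nf n
    nf-mul zero    (a , b) (c , d) = a ℕ.* c ℕ.+ b ℕ.* d , a ℕ.* d ℕ.+ b ℕ.* c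
    nf-mul (suc n) []      q       = []
    nf-mul (suc n) (x ∷ p) []      = []
    nf-mul (suc n) (x ∷ p) (y ∷ q) = nf-add (suc n) (nf-scale n x (y ∷ q)) (nf-0 n ∷ nf-mul (suc n) p (y ∷ q))

    nf-scale : ∀ n → Nf n → List (Nf n) → List (Nf n)
    nf-scale n x []      = []
    nf-scale n x (y ∷ q) = nf-mul n x y ∷ nf-scale n x q

  -- Normal forms keep zero coefficients and unreduced differences, so they are not unique; equality
  -- is tested by asking whether the normal form of a difference vanishes.
  isZero : ∀ n → Nf n → Bool
  isZero zero    (a , b) = a ℕ.≡ᵇ b
  isZero (suc n) []      = true
  isZero (suc n) (x ∷ p) = isZero n x ∧ isZero (suc n) p

  infixl 6 _:+_ _:-_
  infixl 7 _:*_
  infix  8 :-_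
  infix  4 _:=_

  data Expr (n : ℕ) : Set where
    var  : Fin n → Expr n
    con  : ℕ → Expr n
    one  : Expr n
    _:+_ _:*_ _:-_ : Expr n → Expr n → Expr n
    :-_  : Expr n → Expr n

  data Equation (n : ℕ) : Set where
    _:=_ : Expr n → Expr n → Equation n

  nf : ∀ {n} → Expr n → Nf n
  nf {n} (var i)  = nf-var i
  nf {n} (con k)  = nf-con n k
  nf {n} one      = nf-con n 1
  nf {n} (a :+ b) = nf-add n (nf a) (nf b)
  nf {n} (a :* b) = nf-mul n (nf a) (nf b)
  nf {n} (a :- b) = nf-add n (nf a) (nf-neg n (nf b))
  nf {n} (:- a)   = nf-neg n (nf a)

  Fun : ℕ → Set → Set → Set
  Fun zero    A B = B
  Fun (suc n) A B = A → Fun n A B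

  apply-vars : ∀ {n B} k → Fun k (Expr n) B → (Fin k → Expr n) → B
  apply-vars zero    f g = f
  apply-vars (suc k) f g = apply-vars k (f (g zero)) (λ i → g (suc i))

  equation : ∀ n → Fun n (Expr n) (Equation n) → Equation n
  equation n f = apply-vars n f var

  holds? : ∀ {n} → Equation n → Bool
  holds? {n} (l := r) = isZero n (nf (l :- r))

-- Soundness of the ring solver, and consequences of several equations.

module RingSolve (R : CommutativeRing 0ℓ 0ℓ) where
  open CommutativeRing R hiding (zero)
  open import Algebra.Properties.Ring ring
  open import Data.Bool using (true; _∧_; T)
  open import Data.Fin using (Fin; zero; suc)
  open import Data.List using ([]; _∷_)
  open import Data.Nat as ℕ using (ℕ; zero; suc)
  open import Data.Nat.Properties using (≡ᵇ⇒≡)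
  open import Data.Vec using (Vec; []; _∷_; lookup)
  open import Relation.Binary.PropositionalEquality as ≡ using (_≡_)
  open import Relation.Binary.Reasoning.Setoid setoid
  open RingExpr public

  -- The same recursion as `fromℕ`, so that over a finite field `con k` evaluates to `fromℕ k` by
  -- computation for every numeral k.
  κ : ℕ → Carrier
  κ zero    = 0#
  κ (suc n) = 1# + κ n

  κ-+ : ∀ m n → κ (m ℕ.+ n) ≈ κ m + κ n
  κ-+ zero    n = sym (+-identityˡ _)
  κ-+ (suc m) n = trans (+-congˡ (κ-+ m n)) (sym (+-assoc _ _ _))

  κ-* : ∀ m n → κ (m ℕ.* n) ≈ κ m * κ n
  κ-* zero    n = sym (zeroˡ _)
  κ-* (suc m) n = begin
    κ (n ℕ.+ m ℕ.* n)      ≈⟨ κ-+ n (m ℕ.* n) ⟩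
    κ n + κ (m ℕ.* n)      ≈⟨ +-cong (sym (*-identityˡ _)) (κ-* m n) ⟩
    1# * κ n + κ m * κ n   ≈⟨ sym (distribʳ _ _ _) ⟩
    κ (suc m) * κ n        ∎

  +-interchange : ∀ a b c d → (a + b) + (c + d) ≈ (a + c) + (b + d)
  +-interchange a b c d = begin
    (a + b) + (c + d) ≈⟨ +-assoc a b (c + d) ⟩
    a + (b + (c + d)) ≈⟨ +-congˡ (sym (+-assoc b c d)) ⟩
    a + ((b + c) + d) ≈⟨ +-congˡ (+-congʳ (+-comm b c)) ⟩
    a + ((c + b) + d) ≈⟨ +-congˡ (+-assoc c b d) ⟩
    a + (c + (b + d)) ≈⟨ sym (+-assoc a c (b + d)) ⟩
    (a + c) + (b + d) ∎

  *-swap : ∀ a b c → a * (b * c) ≈ b * (a * c)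
  *-swap a b c = trans (sym (*-assoc a b c)) (trans (*-congʳ (*-comm a b)) (*-assoc b a c))

  ⟪_⟫ : ∀ {n} → Nf n → Vec Carrier n → Carrier
  ⟪_⟫ {zero}  (a , b) ρ       = κ a + - κ b
  ⟪_⟫ {suc n} []      (v ∷ ρ) = 0#
  ⟪_⟫ {suc n} (x ∷ p) (v ∷ ρ) = ⟪ x ⟫ ρ + v * ⟪_⟫ {suc n} p (v ∷ ρ)

  ⟪0⟫ : ∀ n ρ → ⟪ nf-0 n ⟫ ρ ≈ 0#
  ⟪0⟫ zero    ρ       = -‿inverseʳ _
  ⟪0⟫ (suc n) (v ∷ ρ) = refl

  ⟪con⟫ : ∀ n k ρ → ⟪ nf-con n k ⟫ ρ ≈ κ k
  ⟪con⟫ zero    k ρ       = trans (+-congˡ -0#≈0#) (+-identityʳ _)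
  ⟪con⟫ (suc n) k (v ∷ ρ) = trans (+-cong (⟪con⟫ n k ρ) (zeroʳ v)) (+-identityʳ _)

  ⟪var⟫ : ∀ {n} (i : Fin n) ρ → ⟪ nf-var i ⟫ ρ ≈ lookup ρ i
  ⟪var⟫ {suc n} zero (v ∷ ρ) = begin
    ⟪ nf-0 n ⟫ ρ + v * (⟪ nf-con n 1 ⟫ ρ + v * 0#)
      ≈⟨ +-cong (⟪0⟫ n ρ) (*-congˡ (trans (+-cong (⟪con⟫ n 1 ρ) (zeroʳ v)) (trans (+-identityʳ _) (+-identityʳ _)))) ⟩
    0# + v * 1#   ≈⟨ trans (+-identityˡ _) (*-identityʳ v) ⟩
    v ∎
  ⟪var⟫ (suc i) (v ∷ ρ) = trans (+-cong (⟪var⟫ i ρ) (zeroʳ v)) (+-identityʳ _)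

  ⟪add⟫ : ∀ n p q ρ → ⟪ nf-add n p q ⟫ ρ ≈ ⟪ p ⟫ ρ + ⟪ q ⟫ ρ
  ⟪add⟫ zero (a , b) (c , d) ρ = begin
    κ (a ℕ.+ c) + - κ (b ℕ.+ d)       ≈⟨ +-cong (κ-+ a c) (-‿cong (κ-+ b d)) ⟩
    (κ a + κ c) + - (κ b + κ d)       ≈⟨ +-congˡ (sym (-‿+-comm _ _)) ⟩
    (κ a + κ c) + (- κ b + - κ d)     ≈⟨ +-interchange _ _ _ _ ⟩
    (κ a + - κ b) + (κ c + - κ d)     ∎
  ⟪add⟫ (suc n) []      q       (v ∷ ρ) = sym (+-identityˡ _)
  ⟪add⟫ (suc n) (x ∷ p) []      (v ∷ ρ) = sym (+-identityʳ _)
  ⟪add⟫ (suc n) (x ∷ p) (y ∷ q) (v ∷ ρ) = begin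
    ⟪ nf-add n x y ⟫ ρ + v * ⟪ nf-add (suc n) p q ⟫ (v ∷ ρ)
      ≈⟨ +-cong (⟪add⟫ n x y ρ) (trans (*-congˡ (⟪add⟫ (suc n) p q (v ∷ ρ))) (distribˡ _ _ _)) ⟩
    (⟪ x ⟫ ρ + ⟪ y ⟫ ρ) + (v * ⟪_⟫ {suc n} p (v ∷ ρ) + v * ⟪_⟫ {suc n} q (v ∷ ρ))
      ≈⟨ +-interchange _ _ _ _ ⟩
    _ ∎

  ⟪neg⟫ : ∀ n p ρ → ⟪ nf-neg n p ⟫ ρ ≈ - ⟪ p ⟫ ρ
  ⟪neg⟫ zero (a , b) ρ = begin
    κ b + - κ a         ≈⟨ +-comm _ _ ⟩
    - κ a + κ b         ≈⟨ +-congˡ (sym (-‿involutive _)) ⟩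
    - κ a + - (- κ b)   ≈⟨ -‿+-comm _ _ ⟩
    - (κ a + - κ b)     ∎
  ⟪neg⟫ (suc n) []      (v ∷ ρ) = sym -0#≈0#
  ⟪neg⟫ (suc n) (x ∷ p) (v ∷ ρ) = begin
    ⟪ nf-neg n x ⟫ ρ + v * ⟪ nf-neg (suc n) p ⟫ (v ∷ ρ)
      ≈⟨ +-cong (⟪neg⟫ n x ρ) (trans (*-congˡ (⟪neg⟫ (suc n) p (v ∷ ρ))) (sym (-‿distribʳ-* _ _))) ⟩
    - ⟪ x ⟫ ρ + - (v * ⟪_⟫ {suc n} p (v ∷ ρ)) ≈⟨ -‿+-comm _ _ ⟩
    _ ∎

  private
    diff-mul : ∀ a b c d → (a * c + b * d) + - (a * d + b * c) ≈ (a + - b) * (c + - d)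
    diff-mul a b c d = sym (begin
      (a + - b) * (c + - d)                     ≈⟨ distribʳ _ _ _ ⟩
      a * (c + - d) + - b * (c + - d)           ≈⟨ +-cong (distribˡ _ _ _) (distribˡ _ _ _) ⟩
      (a * c + a * - d) + (- b * c + - b * - d) ≈⟨ +-congˡ (+-comm _ _) ⟩
      (a * c + a * - d) + (- b * - d + - b * c) ≈⟨ +-interchange _ _ _ _ ⟩
      (a * c + - b * - d) + (a * - d + - b * c)
        ≈⟨ +-cong (+-congˡ (trans (sym (-‿distribˡ-* _ _)) (trans (-‿cong (sym (-‿distribʳ-* _ _))) (-‿involutive _))))
                  (+-cong (sym (-‿distribʳ-* _ _)) (sym (-‿distribˡ-* _ _))) ⟩
      (a * c + b * d) + (- (a * d) + - (b * c)) ≈⟨ +-congˡ (-‿+-comm _ _) ⟩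
      (a * c + b * d) + - (a * d + b * c)       ∎)

  mutual
    ⟪mul⟫ : ∀ n p q ρ → ⟪ nf-mul n p q ⟫ ρ ≈ ⟪ p ⟫ ρ * ⟪ q ⟫ ρ
    ⟪mul⟫ zero (a , b) (c , d) ρ = begin
      κ (a ℕ.* c ℕ.+ b ℕ.* d) + - κ (a ℕ.* d ℕ.+ b ℕ.* c)
        ≈⟨ +-cong (trans (κ-+ (a ℕ.* c) _) (+-cong (κ-* a c) (κ-* b d)))
                  (-‿cong (trans (κ-+ (a ℕ.* d) _) (+-cong (κ-* a d) (κ-* b c)))) ⟩
      (κ a * κ c + κ b * κ d) + - (κ a * κ d + κ b * κ c) ≈⟨ diff-mul _ _ _ _ ⟩
      _ ∎
    ⟪mul⟫ (suc n) []      q       (v ∷ ρ) = sym (zeroˡ _)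
    ⟪mul⟫ (suc n) (x ∷ p) []      (v ∷ ρ) = sym (zeroʳ _)
    ⟪mul⟫ (suc n) (x ∷ p) (y ∷ q) (v ∷ ρ) = begin
      ⟪ nf-add (suc n) (nf-scale n x (y ∷ q)) (nf-0 n ∷ nf-mul (suc n) p (y ∷ q)) ⟫ (v ∷ ρ)
        ≈⟨ ⟪add⟫ (suc n) (nf-scale n x (y ∷ q)) (nf-0 n ∷ nf-mul (suc n) p (y ∷ q)) (v ∷ ρ) ⟩
      ⟪ nf-scale n x (y ∷ q) ⟫ (v ∷ ρ) + (⟪ nf-0 n ⟫ ρ + v * ⟪ nf-mul (suc n) p (y ∷ q) ⟫ (v ∷ ρ))
        ≈⟨ +-cong (⟪scale⟫ n x (y ∷ q) v ρ)
                  (trans (+-cong (⟪0⟫ n ρ) (*-congˡ (⟪mul⟫ (suc n) p (y ∷ q) (v ∷ ρ))))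
                         (trans (+-identityˡ _) (sym (*-assoc _ _ _)))) ⟩
      _ ≈⟨ sym (distribʳ _ _ _) ⟩
      _ ∎

    ⟪scale⟫ : ∀ n x q v ρ → ⟪_⟫ {suc n} (nf-scale n x q) (v ∷ ρ) ≈ ⟪ x ⟫ ρ * ⟪_⟫ {suc n} q (v ∷ ρ)
    ⟪scale⟫ n x []      v ρ = sym (zeroʳ _)
    ⟪scale⟫ n x (y ∷ q) v ρ =
      trans (+-cong (⟪mul⟫ n x y ρ) (trans (*-congˡ (⟪scale⟫ n x q v ρ)) (*-swap _ _ _)))
            (sym (distribˡ _ _ _))

  private
    T-∧ˡ : ∀ {a b} → T (a ∧ b) → T a
    T-∧ˡ {true} _ = _
    T-∧ʳ : ∀ {a b} → T (a ∧ b) → T b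
    T-∧ʳ {true} t = t

  ⟪isZero⟫ : ∀ n p ρ → T (isZero n p) → ⟪ p ⟫ ρ ≈ 0#
  ⟪isZero⟫ zero (a , b) ρ t = trans (+-congˡ (-‿cong (reflexive (≡.cong κ (≡.sym (≡ᵇ⇒≡ a b t)))))) (-‿inverseʳ _)
  ⟪isZero⟫ (suc n) []      (v ∷ ρ) t = refl
  ⟪isZero⟫ (suc n) (x ∷ p) (v ∷ ρ) t =
    trans (+-cong (⟪isZero⟫ n x ρ (T-∧ˡ t)) (trans (*-congˡ (⟪isZero⟫ (suc n) p (v ∷ ρ) (T-∧ʳ {isZero n x} t))) (zeroʳ v))) (+-identityˡ _)

  ⟦_⟧ : ∀ {n} → Expr n → Vec Carrier n → Carrier
  ⟦ var i ⟧  ρ = lookup ρ i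
  ⟦ con k ⟧  ρ = κ k
  ⟦ one ⟧    ρ = 1#
  ⟦ a :+ b ⟧ ρ = ⟦ a ⟧ ρ + ⟦ b ⟧ ρ
  ⟦ a :* b ⟧ ρ = ⟦ a ⟧ ρ * ⟦ b ⟧ ρ
  ⟦ a :- b ⟧ ρ = ⟦ a ⟧ ρ + - ⟦ b ⟧ ρ
  ⟦ :- a ⟧   ρ = - ⟦ a ⟧ ρ

  nf-sound : ∀ {n} (e : Expr n) ρ → ⟪ nf e ⟫ ρ ≈ ⟦ e ⟧ ρ
  nf-sound (var i)  ρ = ⟪var⟫ i ρ
  nf-sound {n} (con k)  ρ = ⟪con⟫ n k ρ
  nf-sound {n} one      ρ = trans (⟪con⟫ n 1 ρ) (+-identityʳ _)
  nf-sound {n} (a :+ b) ρ = trans (⟪add⟫ n (nf a) (nf b) ρ) (+-cong (nf-sound a ρ) (nf-sound b ρ))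
  nf-sound {n} (a :* b) ρ = trans (⟪mul⟫ n (nf a) (nf b) ρ) (*-cong (nf-sound a ρ) (nf-sound b ρ))
  nf-sound {n} (a :- b) ρ = trans (⟪add⟫ n (nf a) (nf-neg n (nf b)) ρ)
    (+-cong (nf-sound a ρ) (trans (⟪neg⟫ n (nf b) ρ) (-‿cong (nf-sound b ρ))))
  nf-sound {n} (:- a)   ρ = trans (⟪neg⟫ n (nf a) ρ) (-‿cong (nf-sound a ρ))

  Holds : ∀ {n} → Equation n → Vec Carrier n → Set
  Holds (l := r) ρ = ⟦ l ⟧ ρ ≈ ⟦ r ⟧ ρ

  ForAll : ∀ n → (Vec Carrier n → Set) → Set
  ForAll zero    P = P []
  ForAll (suc n) P = ∀ x → ForAll n (λ ρ → P (x ∷ ρ))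

  forAll : ∀ n {P : Vec Carrier n → Set} → (∀ ρ → P ρ) → ForAll n P
  forAll zero    h = h []
  forAll (suc n) h x = forAll n (λ ρ → h (x ∷ ρ))

  x-y≈0⇒x≈y : ∀ {x y} → x - y ≈ 0# → x ≈ y
  x-y≈0⇒x≈y {x} {y} h = begin
    x             ≈⟨ sym (+-identityʳ x) ⟩
    x + 0#        ≈⟨ +-congˡ (sym (-‿inverseˡ y)) ⟩
    x + (- y + y) ≈⟨ sym (+-assoc _ _ _) ⟩
    (x - y) + y   ≈⟨ +-congʳ h ⟩
    0# + y        ≈⟨ +-identityˡ y ⟩
    y             ∎

  x≈y⇒x-y≈0 : ∀ {x y} → x ≈ y → x - y ≈ 0#
  x≈y⇒x-y≈0 h = trans (+-congʳ h) (-‿inverseʳ _)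

  abstract
    holds : ∀ {n} (e : Equation n) → T (holds? e) → ∀ ρ → Holds e ρ
    holds {n} (l := r) t ρ = x-y≈0⇒x≈y (trans (sym (nf-sound (l :- r) ρ)) (⟪isZero⟫ n (nf (l :- r)) ρ t))

    solve : ∀ n (f : Fun n (Expr n) (Equation n)) {t : T (holds? (equation n f))} → ForAll n (Holds (equation n f))
    solve n f {t} = forAll n (holds (equation n f) t)

  -- Certificates of ideal membership: the goal minus its right side is a combination of the
  -- hypotheses with explicit cofactors, and `solve` only has to check the resulting polynomial
  -- identity. Most computations with coordinates below take this form.
  linear₁ : ∀ {a b c l r} → a - b ≈ c * (l - r) → l ≈ r → a ≈ b
  linear₁ {c = c} h e = x-y≈0⇒x≈y (trans h (trans (*-congˡ (x≈y⇒x-y≈0 e)) (zeroʳ c)))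

  linear₂ : ∀ {a b c l r c′ l′ r′} → a - b ≈ c * (l - r) + c′ * (l′ - r′) → l ≈ r → l′ ≈ r′ → a ≈ b
  linear₂ {c = c} {c′ = c′} h e e′ = x-y≈0⇒x≈y (trans h (trans (+-cong
    (trans (*-congˡ (x≈y⇒x-y≈0 e)) (zeroʳ c)) (trans (*-congˡ (x≈y⇒x-y≈0 e′)) (zeroʳ c′))) (+-identityˡ _)))

  linear₃ : ∀ {a b c l r c′ l′ r′ c″ l″ r″} →
    a - b ≈ c * (l - r) + c′ * (l′ - r′) + c″ * (l″ - r″) → l ≈ r → l′ ≈ r′ → l″ ≈ r″ → a ≈ b
  linear₃ {c = c} {c′ = c′} {c″ = c″} h e e′ e″ = x-y≈0⇒x≈y (trans h (trans (+-cong (trans (+-cong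
    (trans (*-congˡ (x≈y⇒x-y≈0 e)) (zeroʳ c)) (trans (*-congˡ (x≈y⇒x-y≈0 e′)) (zeroʳ c′))) (+-identityˡ _))
    (trans (*-congˡ (x≈y⇒x-y≈0 e″)) (zeroʳ c″))) (+-identityˡ _)))

  linear₄ : ∀ {a b c l r c′ l′ r′ c″ l″ r″ c‴ l‴ r‴} →
    a - b ≈ c * (l - r) + c′ * (l′ - r′) + c″ * (l″ - r″) + c‴ * (l‴ - r‴) → l ≈ r → l′ ≈ r′ → l″ ≈ r″ → l‴ ≈ r‴ → a ≈ b
  linear₄ {c = c} {c′ = c′} {c″ = c″} {c‴ = c‴} h e e′ e″ e‴ = x-y≈0⇒x≈y (trans h (trans (+-cong (trans (+-cong (trans (+-cong
    (trans (*-congˡ (x≈y⇒x-y≈0 e)) (zeroʳ c)) (trans (*-congˡ (x≈y⇒x-y≈0 e′)) (zeroʳ c′))) (+-identityˡ _))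
    (trans (*-congˡ (x≈y⇒x-y≈0 e″)) (zeroʳ c″))) (+-identityˡ _)) (trans (*-congˡ (x≈y⇒x-y≈0 e‴)) (zeroʳ c‴))) (+-identityˡ _)))

-- Field arithmetic.

module FieldKit (F : FiniteField) where
  open FiniteField F
  open import Relation.Binary.PropositionalEquality

  fieldRing : CommutativeRing 0ℓ 0ℓ
  fieldRing = record { isCommutativeRing = isCommutativeRing }

  open CommutativeRing fieldRing public using (+-comm; +-assoc; +-identityˡ; +-identityʳ; *-comm; *-assoc; *-identityˡ; *-identityʳ; zeroˡ; zeroʳ; -‿inverseˡ; -‿inverseʳ; distribˡ; distribʳ)
  open RingSolve fieldRing public

  inverseˡ : ∀ {x} → x ≢ 0# → (x ⁻¹) * x ≡ 1#
  inverseˡ {x} h = trans (*-comm _ _) (inverseʳ x h)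

  /-cancel : ∀ {y} → y ≢ 0# → ∀ x → (x / y) * y ≡ x
  /-cancel {y} h x = trans (*-assoc _ _ _) (trans (cong (x *_) (inverseˡ h)) (*-identityʳ x))

  *-cancelʳ : ∀ {x y z} → z ≢ 0# → x * z ≡ y * z → x ≡ y
  *-cancelʳ {x} {y} {z} h e = begin
    x               ≡⟨ sym (*-identityʳ x) ⟩
    x * 1#          ≡⟨ cong (x *_) (sym (inverseʳ z h)) ⟩
    x * (z * z ⁻¹)  ≡⟨ sym (*-assoc _ _ _) ⟩
    x * z * z ⁻¹    ≡⟨ cong (_* z ⁻¹) e ⟩
    y * z * z ⁻¹    ≡⟨ *-assoc _ _ _ ⟩
    y * (z * z ⁻¹)  ≡⟨ cong (y *_) (inverseʳ z h) ⟩
    y * 1#          ≡⟨ *-identityʳ y ⟩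
    y               ∎
    where open ≡-Reasoning

  *≡0 : ∀ {x z} → x * z ≡ 0# → z ≢ 0# → x ≡ 0#
  *≡0 e h = *-cancelʳ h (trans e (sym (zeroˡ _)))

  zero-product : ∀ {x y} → x * y ≡ 0# → x ≡ 0# ⊎ y ≡ 0#
  zero-product {x} {y} e with y ≟ 0#
  ... | yes y≡0 = inj₂ y≡0
  ... | no  y≢0 = inj₁ (*≡0 e y≢0)

  *≢0 : ∀ {x y} → x ≢ 0# → y ≢ 0# → x * y ≢ 0#
  *≢0 h k e = h (*≡0 e k)

  ⁻¹≢0 : ∀ {x} → x ≢ 0# → x ⁻¹ ≢ 0#
  ⁻¹≢0 {x} h e = 0≢1 (trans (sym (zeroʳ x)) (trans (cong (x *_) (sym e)) (inverseʳ x h)))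

  x-y≡0⇒x≡y : ∀ {x y} → x - y ≡ 0# → x ≡ y
  x-y≡0⇒x≡y = x-y≈0⇒x≈y

  x-y≢0 : ∀ {x y} → x ≢ y → x - y ≢ 0#
  x-y≢0 h e = h (x-y≡0⇒x≡y e)

  -≢0 : ∀ {x} → x ≢ 0# → - x ≢ 0#
  -≢0 {x} h e = h (trans (solve 1 (λ x → x := :- (:- x)) x) (trans (cong -_ e) (solve 0 (:- con 0 := con 0))))

-- Ring homomorphisms and the transport of equations along them.

module RingHom where
  open import Data.Fin using (zero; suc)
  open import Data.Nat using (zero; suc)
  open import Data.Vec using (Vec; _∷_; lookup; map)
  open RingExpr

  record Hom (A B : CommutativeRing 0ℓ 0ℓ) : Set where
    private
      module A = CommutativeRing A
      module B = CommutativeRing B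
      module SA = RingSolve A
      module SB = RingSolve B
    field
      φ    : A.Carrier → B.Carrier
      cong : ∀ {x y} → x A.≈ y → φ x B.≈ φ y
      +-hom : ∀ x y → φ (x A.+ y) B.≈ φ x B.+ φ y
      *-hom : ∀ x y → φ (x A.* y) B.≈ φ x B.* φ y
      ⊖-hom : ∀ x → φ (A.- x) B.≈ B.- φ x
      0-hom : φ A.0# B.≈ B.0#
      1-hom : φ A.1# B.≈ B.1#

    κ-hom : ∀ n → φ (SA.κ n) B.≈ SB.κ n
    κ-hom zero    = 0-hom
    κ-hom (suc n) = B.trans (+-hom _ _) (B.+-cong 1-hom (κ-hom n))

    eval-hom : ∀ {n} (e : Expr n) ρ → φ (SA.⟦ e ⟧ ρ) B.≈ SB.⟦ e ⟧ (map φ ρ)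
    eval-hom (var i) ρ = B.reflexive (go ρ i)
      where
      open import Relation.Binary.PropositionalEquality using (_≡_; refl)
      open import Data.Fin using (Fin)
      go : ∀ {n} (ρ : Vec A.Carrier n) (i : Fin n) → φ (lookup ρ i) ≡ lookup (map φ ρ) i
      go (x ∷ ρ) zero    = refl
      go (x ∷ ρ) (suc i) = go ρ i
    eval-hom (con k)  ρ = κ-hom k
    eval-hom one      ρ = 1-hom
    eval-hom (a :+ b) ρ = B.trans (+-hom _ _) (B.+-cong (eval-hom a ρ) (eval-hom b ρ))
    eval-hom (a :* b) ρ = B.trans (*-hom _ _) (B.*-cong (eval-hom a ρ) (eval-hom b ρ))
    eval-hom (a :- b) ρ = B.trans (+-hom _ _) (B.+-cong (eval-hom a ρ) (B.trans (⊖-hom _) (B.-‿cong (eval-hom b ρ))))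
    eval-hom (:- a)   ρ = B.trans (⊖-hom _) (B.-‿cong (eval-hom a ρ))

    -- The equation is given once as syntax; read in the source it is by computation the hypothesis
    -- at hand, read in the target it is the image equation.
    transfer : ∀ n (f : Fun n (Expr n) (Equation n)) →
      SA.ForAll n λ ρ → SA.Holds (equation n f) ρ → SB.Holds (equation n f) (map φ ρ)
    transfer n f = SA.forAll n (go (equation n f))
      where
      go : (e : Equation n) → ∀ ρ → SA.Holds e ρ → SB.Holds e (map φ ρ)
      go (l := r) ρ h = B.trans (B.sym (eval-hom l ρ)) (B.trans (cong h) (eval-hom r ρ))

    push : ∀ n (f : Fun n (Expr n) (Expr n)) →
      SA.ForAll n λ ρ → φ (SA.⟦ apply-vars n f var ⟧ ρ) B.≈ SB.⟦ apply-vars n f var ⟧ (map φ ρ)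
    push n f = SA.forAll n (eval-hom (apply-vars n f var))

  _∘h_ : ∀ {A B C} → Hom B C → Hom A B → Hom A C
  _∘h_ {C = C} g f = record
    { φ = λ x → G.φ (F.φ x) ; cong = λ e → G.cong (F.cong e)
    ; +-hom = λ x y → trans (G.cong (F.+-hom x y)) (G.+-hom _ _)
    ; *-hom = λ x y → trans (G.cong (F.*-hom x y)) (G.*-hom _ _)
    ; ⊖-hom = λ x → trans (G.cong (F.⊖-hom x)) (G.⊖-hom _)
    ; 0-hom = trans (G.cong F.0-hom) G.0-hom
    ; 1-hom = trans (G.cong F.1-hom) G.1-hom }
    where
    open CommutativeRing C using (trans)
    module F = Hom f
    module G = Hom g

  idHom : ∀ {A} → Hom A A
  idHom {A} = record { φ = λ x → x ; cong = λ e → e ; +-hom = λ _ _ → refl ; *-hom = λ _ _ → refl ; ⊖-hom = λ _ → refl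
    ; 0-hom = refl ; 1-hom = refl }
    where open CommutativeRing A

-- Polynomials in one variable over a commutative ring.

module Polynomial (A : CommutativeRing 0ℓ 0ℓ) where
  open CommutativeRing A hiding (zero)
  open import Algebra.Properties.Ring ring
  open import Data.List using (List; []; _∷_)
  open import Data.Nat as ℕ using (ℕ; zero; suc; _≤_; _<_; z≤n; s≤s)
  import Data.Nat.Properties as ℕ
  open import Relation.Binary.Reasoning.Setoid setoid
  open RingSolve A
  open RingHom

  Series : Set
  Series = ℕ → Carrier

  -- Cauchy product. The laws of multiplication are proved for sequences, because lists that differ
  -- by trailing zeros stand for the same polynomial.
  conv : Series → Series → Series
  conv f g zero    = f 0 * g 0
  conv f g (suc n) = f 0 * g (suc n) + conv (f ∘ suc) g n

  conv-cong : ∀ {f f′ g g′} → (∀ n → f n ≈ f′ n) → (∀ n → g n ≈ g′ n) → ∀ n → conv f g n ≈ conv f′ g′ n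
  conv-cong p q zero    = *-cong (p 0) (q 0)
  conv-cong p q (suc n) = +-cong (*-cong (p 0) (q (suc n))) (conv-cong (p ∘ suc) q n)

  conv-sucʳ : ∀ f g n → conv f g (suc n) ≈ conv f (g ∘ suc) n + f (suc n) * g 0
  conv-sucʳ f g zero    = refl
  conv-sucʳ f g (suc n) = trans (+-congˡ (conv-sucʳ (f ∘ suc) g n)) (sym (+-assoc _ _ _))

  conv-comm : ∀ f g n → conv f g n ≈ conv g f n
  conv-comm f g zero    = *-comm _ _
  conv-comm f g (suc n) = begin
    f 0 * g (suc n) + conv (f ∘ suc) g n ≈⟨ +-cong (*-comm _ _) (conv-comm (f ∘ suc) g n) ⟩
    g (suc n) * f 0 + conv g (f ∘ suc) n ≈⟨ +-comm _ _ ⟩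
    conv g (f ∘ suc) n + g (suc n) * f 0 ≈⟨ sym (conv-sucʳ g f n) ⟩
    conv g f (suc n)                     ∎

  conv-distribʳ : ∀ f g h n → conv (λ k → f k + g k) h n ≈ conv f h n + conv g h n
  conv-distribʳ f g h zero    = distribʳ _ _ _
  conv-distribʳ f g h (suc n) = trans (+-cong (distribʳ _ _ _) (conv-distribʳ (f ∘ suc) (g ∘ suc) h n)) (+-interchange _ _ _ _)

  conv-scale : ∀ c g h n → conv (λ k → c * g k) h n ≈ c * conv g h n
  conv-scale c g h zero    = *-assoc _ _ _
  conv-scale c g h (suc n) = trans (+-cong (*-assoc _ _ _) (conv-scale c (g ∘ suc) h n)) (sym (distribˡ _ _ _))

  conv-assoc : ∀ f g h n → conv (conv f g) h n ≈ conv f (conv g h) n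
  conv-assoc f g h zero    = *-assoc _ _ _
  conv-assoc f g h (suc n) = begin
    (f 0 * g 0) * h (suc n) + conv (λ k → f 0 * g (suc k) + conv (f ∘ suc) g k) h n
      ≈⟨ +-cong (*-assoc _ _ _) (conv-distribʳ _ _ h n) ⟩
    f 0 * (g 0 * h (suc n)) + (conv (λ k → f 0 * g (suc k)) h n + conv (conv (f ∘ suc) g) h n)
      ≈⟨ +-congˡ (+-cong (conv-scale _ _ h n) (conv-assoc (f ∘ suc) g h n)) ⟩
    f 0 * (g 0 * h (suc n)) + (f 0 * conv (g ∘ suc) h n + conv (f ∘ suc) (conv g h) n)
      ≈⟨ sym (+-assoc _ _ _) ⟩
    (f 0 * (g 0 * h (suc n)) + f 0 * conv (g ∘ suc) h n) + conv (f ∘ suc) (conv g h) n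
      ≈⟨ +-congʳ (sym (distribˡ _ _ _)) ⟩
    _ ∎

  conv-zeroˡ : ∀ {f} g → (∀ n → f n ≈ 0#) → ∀ n → conv f g n ≈ 0#
  conv-zeroˡ g p zero    = trans (*-congʳ (p 0)) (zeroˡ _)
  conv-zeroˡ g p (suc n) = trans (+-cong (trans (*-congʳ (p 0)) (zeroˡ _)) (conv-zeroˡ g (p ∘ suc) n)) (+-identityˡ _)

  Poly : Set
  Poly = List Carrier

  coeff : Poly → Series
  coeff []      n       = 0#
  coeff (c ∷ p) zero    = c
  coeff (c ∷ p) (suc n) = coeff p n

  infix 4 _≋_
  record _≋_ (p q : Poly) : Set where
    constructor coeffwise
    field at : ∀ n → coeff p n ≈ coeff q n
  open _≋_ public

  infixl 6 _⊕_
  infixl 7 _⊗_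
  abstract
    _⊕_ : Poly → Poly → Poly
    []      ⊕ q       = q
    (c ∷ p) ⊕ []      = c ∷ p
    (c ∷ p) ⊕ (d ∷ q) = c + d ∷ p ⊕ q

    scaleBy : Carrier → Poly → Poly
    scaleBy c []      = []
    scaleBy c (d ∷ p) = c * d ∷ scaleBy c p

    ⊖_ : Poly → Poly
    ⊖ []      = []
    ⊖ (c ∷ p) = - c ∷ ⊖ p

    _⊗_ : Poly → Poly → Poly
    []      ⊗ q = []
    (c ∷ p) ⊗ q = scaleBy c q ⊕ (0# ∷ p ⊗ q)

    coeff-⊕ : ∀ p q n → coeff (p ⊕ q) n ≈ coeff p n + coeff q n
    coeff-⊕ []      q       n       = sym (+-identityˡ _)
    coeff-⊕ (c ∷ p) []      n       = sym (+-identityʳ _)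
    coeff-⊕ (c ∷ p) (d ∷ q) zero    = refl
    coeff-⊕ (c ∷ p) (d ∷ q) (suc n) = coeff-⊕ p q n

    coeff-scale : ∀ c p n → coeff (scaleBy c p) n ≈ c * coeff p n
    coeff-scale c []      n       = sym (zeroʳ _)
    coeff-scale c (d ∷ p) zero    = refl
    coeff-scale c (d ∷ p) (suc n) = coeff-scale c p n

    coeff-⊖ : ∀ p n → coeff (⊖ p) n ≈ - coeff p n
    coeff-⊖ []      n       = sym -0#≈0#
    coeff-⊖ (c ∷ p) zero    = refl
    coeff-⊖ (c ∷ p) (suc n) = coeff-⊖ p n

    coeff-⊗ : ∀ p q n → coeff (p ⊗ q) n ≈ conv (coeff p) (coeff q) n
    coeff-⊗ []      q n       = sym (conv-zeroˡ (coeff q) (λ _ → refl) n)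
    coeff-⊗ (c ∷ p) q zero    = trans (coeff-⊕ (scaleBy c q) _ 0) (trans (+-identityʳ _) (coeff-scale c q 0))
    coeff-⊗ (c ∷ p) q (suc n) = trans (coeff-⊕ (scaleBy c q) _ (suc n)) (+-cong (coeff-scale c q (suc n)) (coeff-⊗ p q n))

  const : Carrier → Poly
  const c = c ∷ []

  X : Poly
  X = 0# ∷ 1# ∷ []

  coeff-const⊗ : ∀ c p n → coeff (const c ⊗ p) n ≈ c * coeff p n
  coeff-const⊗ c p zero    = coeff-⊗ (const c) p 0
  coeff-const⊗ c p (suc n) = trans (coeff-⊗ (const c) p (suc n)) (trans (+-congˡ (conv-zeroˡ (coeff p) (λ _ → refl) n)) (+-identityʳ _))

  polyRing : CommutativeRing 0ℓ 0ℓ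
  polyRing = record
    { Carrier = Poly ; _≈_ = _≋_ ; _+_ = _⊕_ ; _*_ = _⊗_ ; -_ = ⊖_ ; 0# = [] ; 1# = const 1#
    ; isCommutativeRing = record
      { isRing = record
        { +-isAbelianGroup = record
          { isGroup = record
            { isMonoid = record
              { isSemigroup = record
                { isMagma = record
                  { isEquivalence = record
                    { refl = coeffwise λ _ → refl
                    ; sym = λ h → coeffwise λ n → sym (at h n)
                    ; trans = λ h k → coeffwise λ n → trans (at h n) (at k n) }
                  ; ∙-cong = λ {p} {p′} {q} {q′} h k → coeffwise λ n → trans (coeff-⊕ p q n)
                      (trans (+-cong (at h n) (at k n)) (sym (coeff-⊕ p′ q′ n))) }
                ; assoc = λ p q r → coeffwise λ n → trans (coeff-⊕ (p ⊕ q) r n) (trans (+-congʳ (coeff-⊕ p q n))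
                    (trans (+-assoc _ _ _) (sym (trans (coeff-⊕ p (q ⊕ r) n) (+-congˡ (coeff-⊕ q r n)))))) }
              ; identity = (λ p → coeffwise λ n → trans (coeff-⊕ [] p n) (+-identityˡ _))
                  , (λ p → coeffwise λ n → trans (coeff-⊕ p [] n) (+-identityʳ _)) }
            ; inverse = (λ p → coeffwise λ n → trans (coeff-⊕ (⊖ p) p n) (trans (+-congʳ (coeff-⊖ p n)) (-‿inverseˡ _)))
                , (λ p → coeffwise λ n → trans (coeff-⊕ p (⊖ p) n) (trans (+-congˡ (coeff-⊖ p n)) (-‿inverseʳ _)))
            ; ⁻¹-cong = λ {p} {q} h → coeffwise λ n → trans (coeff-⊖ p n) (trans (-‿cong (at h n)) (sym (coeff-⊖ q n))) }
          ; comm = λ p q → coeffwise λ n → trans (coeff-⊕ p q n) (trans (+-comm _ _) (sym (coeff-⊕ q p n))) }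
        ; *-cong = λ {p} {p′} {q} {q′} h k → coeffwise λ n → trans (coeff-⊗ p q n)
            (trans (conv-cong (at h) (at k) n) (sym (coeff-⊗ p′ q′ n)))
        ; *-assoc = λ p q r → coeffwise λ n → trans (coeff-⊗ (p ⊗ q) r n) (trans (conv-cong (coeff-⊗ p q) (λ _ → refl) n)
            (trans (conv-assoc (coeff p) (coeff q) (coeff r) n)
            (sym (trans (coeff-⊗ p (q ⊗ r) n) (conv-cong {coeff p} (λ _ → refl) (coeff-⊗ q r) n)))))
        ; *-identity = (λ p → coeffwise λ n → trans (coeff-const⊗ 1# p n) (*-identityˡ _))
            , (λ p → coeffwise λ n → trans (⊗-comm p (const 1#) n) (trans (coeff-const⊗ 1# p n) (*-identityˡ _)))
        ; distrib = (λ p q r → coeffwise λ n → trans (⊗-comm p (q ⊕ r) n) (trans (⊗-distribʳ p q r n)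
              (sym (trans (coeff-⊕ (p ⊗ q) (p ⊗ r) n) (+-cong (⊗-comm p q n) (⊗-comm p r n))))))
            , (λ p q r → coeffwise λ n → trans (⊗-distribʳ p q r n) (sym (coeff-⊕ (q ⊗ p) (r ⊗ p) n))) }
      ; *-comm = λ p q → coeffwise (⊗-comm p q) } }
    where
    ⊗-comm : ∀ p q n → coeff (p ⊗ q) n ≈ coeff (q ⊗ p) n
    ⊗-comm p q n = trans (coeff-⊗ p q n) (trans (conv-comm (coeff p) (coeff q) n) (sym (coeff-⊗ q p n)))

    ⊗-distribʳ : ∀ p q r n → coeff ((q ⊕ r) ⊗ p) n ≈ coeff (q ⊗ p) n + coeff (r ⊗ p) n
    ⊗-distribʳ p q r n = trans (coeff-⊗ (q ⊕ r) p n) (trans (conv-cong (coeff-⊕ q r) (λ _ → refl) n)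
      (trans (conv-distribʳ (coeff q) (coeff r) (coeff p) n)
        (sym (+-cong (coeff-⊗ q p n) (coeff-⊗ r p n)))))

  module EvalIn {T : CommutativeRing 0ℓ 0ℓ} (H : Hom A T) (t : CommutativeRing.Carrier T) where
    private
      module T = CommutativeRing T
      module ST = RingSolve T
      open Hom H

    -- Horner evaluation, giving the universal property of A[X]: a homomorphism on the coefficients
    -- and a value for the variable.
    evalIn : Poly → T.Carrier
    evalIn []      = T.0#
    evalIn (c ∷ p) = φ c T.+ t T.* evalIn p

    evalIn-≋0 : ∀ p → p ≋ [] → evalIn p T.≈ T.0#
    evalIn-≋0 []      h = T.refl
    evalIn-≋0 (c ∷ p) h = T.trans (T.+-cong (T.trans (cong (at h 0)) 0-hom)
      (T.trans (T.*-congˡ (evalIn-≋0 p (coeffwise (at h ∘ suc)))) (T.zeroʳ _))) (T.+-identityˡ _)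

    evalIn-cong : ∀ {p q} → p ≋ q → evalIn p T.≈ evalIn q
    evalIn-cong {[]}    {q}     h = T.sym (evalIn-≋0 q (coeffwise (sym ∘ at h)))
    evalIn-cong {c ∷ p} {[]}    h = evalIn-≋0 (c ∷ p) h
    evalIn-cong {c ∷ p} {d ∷ q} h = T.+-cong (cong (at h 0)) (T.*-congˡ (evalIn-cong {p} {q} (coeffwise (at h ∘ suc))))

    abstract
      evalIn-⊕ : ∀ p q → evalIn (p ⊕ q) T.≈ evalIn p T.+ evalIn q
      evalIn-⊕ []      q       = T.sym (T.+-identityˡ _)
      evalIn-⊕ (c ∷ p) []      = T.sym (T.+-identityʳ _)
      evalIn-⊕ (c ∷ p) (d ∷ q) = T.trans (T.+-cong (+-hom c d) (T.*-congˡ (evalIn-⊕ p q)))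
        (ST.solve 5 (λ c d t x y → c :+ d :+ t :* (x :+ y) := c :+ t :* x :+ (d :+ t :* y)) _ _ t _ _)

      evalIn-scale : ∀ c p → evalIn (scaleBy c p) T.≈ φ c T.* evalIn p
      evalIn-scale c []      = T.sym (T.zeroʳ _)
      evalIn-scale c (d ∷ p) = T.trans (T.+-cong (*-hom c d) (T.*-congˡ (evalIn-scale c p)))
        (ST.solve 4 (λ c d t x → c :* d :+ t :* (c :* x) := c :* (d :+ t :* x)) _ _ t _)

      evalIn-⊖ : ∀ p → evalIn (⊖ p) T.≈ T.- evalIn p
      evalIn-⊖ []      = ST.solve 0 (con 0 := :- con 0)
      evalIn-⊖ (c ∷ p) = T.trans (T.+-cong (⊖-hom c) (T.*-congˡ (evalIn-⊖ p)))
        (ST.solve 3 (λ c t x → :- c :+ t :* :- x := :- (c :+ t :* x)) _ t _)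

      evalIn-⊗ : ∀ p q → evalIn (p ⊗ q) T.≈ evalIn p T.* evalIn q
      evalIn-⊗ []      q = T.sym (T.zeroˡ _)
      evalIn-⊗ (c ∷ p) q = T.trans (evalIn-⊕ (scaleBy c q) _) (T.trans
        (T.+-cong (evalIn-scale c q) (T.+-cong 0-hom (T.*-congˡ (evalIn-⊗ p q))))
        (ST.solve 4 (λ c t x y → c :* y :+ (con 0 :+ t :* (x :* y)) := (c :+ t :* x) :* y) (φ c) t _ _))

    evalIn-X : evalIn X T.≈ t
    evalIn-X = T.trans (T.+-cong 0-hom (T.*-congˡ (T.+-congʳ 1-hom))) (ST.solve 1 (λ t → con 0 :+ t :* (one :+ t :* con 0) := t) t)

    evalInHom : Hom polyRing T
    evalInHom = record { φ = evalIn ; cong = evalIn-cong ; +-hom = evalIn-⊕ ; *-hom = evalIn-⊗ ; ⊖-hom = evalIn-⊖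
      ; 0-hom = T.refl ; 1-hom = T.trans (T.+-cong 1-hom (T.zeroʳ t)) (T.+-identityʳ _) }

  evalHom : Carrier → Hom polyRing A
  evalHom a = EvalIn.evalInHom idHom a

  module _ (a : Carrier) where
    open Hom (evalHom a) public using ()
      renaming (φ to eval; cong to eval-cong; +-hom to eval-⊕; *-hom to eval-⊗; ⊖-hom to eval-⊖)

  eval-const : ∀ a c → eval a (const c) ≈ c
  eval-const a c = trans (+-congˡ (zeroʳ _)) (+-identityʳ _)

  eval-X : ∀ a → eval a X ≈ a
  eval-X a = trans (+-identityˡ _) (trans (*-congˡ (eval-const a 1#)) (*-identityʳ _))

  const-+ : ∀ c d → const (c + d) ≋ const c ⊕ const d
  const-+ c d = coeffwise λ where
    zero    → sym (coeff-⊕ (const c) (const d) 0)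
    (suc n) → sym (trans (coeff-⊕ (const c) (const d) (suc n)) (+-identityˡ _))

  const-* : ∀ c d → const (c * d) ≋ const c ⊗ const d
  const-* c d = coeffwise λ where
    zero    → sym (coeff-const⊗ c (const d) 0)
    (suc n) → sym (trans (coeff-const⊗ c (const d) (suc n)) (zeroʳ _))

  const-⊖ : ∀ c → const (- c) ≋ ⊖ const c
  const-⊖ c = coeffwise λ where
    zero    → sym (coeff-⊖ (const c) 0)
    (suc n) → sym (trans (coeff-⊖ (const c) (suc n)) -0#≈0#)

  const-0 : const 0# ≋ []
  const-0 = coeffwise λ { zero → refl ; (suc n) → refl }

  const-cong : ∀ {c d} → c ≈ d → const c ≋ const d
  const-cong h = coeffwise λ { zero → h ; (suc n) → refl }

  -- Synthetic division by X - a: the coefficients of the quotient are the values at a of the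
  -- successive tails.
  quot : Carrier → Poly → Poly
  quot a []      = []
  quot a (c ∷ p) = eval a p ∷ quot a p

  X-_ : Carrier → Poly
  X- a = - a ∷ 1# ∷ []

  coeff-X⊗ : ∀ p n → coeff (X ⊗ p) n ≈ coeff (0# ∷ p) n
  coeff-X⊗ p zero    = trans (coeff-⊗ X p 0) (zeroˡ _)
  coeff-X⊗ p (suc n) = trans (coeff-⊗ X p (suc n)) (trans (+-cong (zeroˡ _)
    (trans (sym (coeff-⊗ (const 1#) p n)) (coeff-const⊗ 1# p n))) (trans (+-identityˡ _) (*-identityˡ _)))

  coeff-linear : ∀ a p n → coeff ((X- a) ⊗ p) n ≈ - a * coeff p n + coeff (0# ∷ p) n
  coeff-linear a p zero    = trans (coeff-⊗ (X- a) p 0) (sym (+-identityʳ _))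
  coeff-linear a p (suc n) = trans (coeff-⊗ (X- a) p (suc n)) (+-congˡ
    (trans (sym (coeff-⊗ (const 1#) p n)) (trans (coeff-const⊗ 1# p n) (*-identityˡ _))))

  remainder : ∀ a p → p ≋ (X- a) ⊗ quot a p ⊕ const (eval a p)
  remainder a p = coeffwise λ n → sym (trans (coeff-⊕ ((X- a) ⊗ quot a p) _ n) (trans (+-congʳ (coeff-linear a (quot a p) n)) (go p n)))
    where
    go : ∀ p n → (- a * coeff (quot a p) n + coeff (0# ∷ quot a p) n) + coeff (const (eval a p)) n ≈ coeff p n
    go []      zero    = solve 1 (λ a → :- a :* con 0 :+ con 0 :+ con 0 := con 0) a
    go []      (suc n) = solve 1 (λ a → :- a :* con 0 :+ con 0 :+ con 0 := con 0) a
    go (c ∷ p) zero    = solve 3 (λ a c e → :- a :* e :+ con 0 :+ (c :+ a :* e) := c) a c (eval a p)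
    go (c ∷ p) (suc zero) = trans (solve 3 (λ a e q → :- a :* q :+ e :+ con 0 := :- a :* q :+ con 0 :+ e) a (eval a p) (coeff (quot a p) 0)) (go p 0)
    go (c ∷ p) (suc (suc n)) = go p (suc n)

  eval-X- : ∀ a b → eval a (X- b) ≈ a - b
  eval-X- a b = solve 2 (λ a b → :- b :+ a :* (one :+ a :* con 0) := a :- b) a b

  -- Only an upper bound, because over a general ring it is not decidable which leading coefficients
  -- vanish. Over a field `Top` gives the exact degree.
  record Deg≤ (p : Poly) (n : ℕ) : Set where
    constructor deg≤
    field vanish : ∀ m → n < m → coeff p m ≈ 0#
  open Deg≤ public

  deg-cong : ∀ {p q n} → p ≋ q → Deg≤ p n → Deg≤ q n
  deg-cong h d = deg≤ λ m l → trans (sym (at h m)) (vanish d m l)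

  deg-mono : ∀ {p m n} → m ≤ n → Deg≤ p m → Deg≤ p n
  deg-mono m≤n d = deg≤ λ k n<k → vanish d k (ℕ.≤-<-trans m≤n n<k)

  deg-⊕ : ∀ {p q n} → Deg≤ p n → Deg≤ q n → Deg≤ (p ⊕ q) n
  deg-⊕ {p} {q} d e = deg≤ λ m l → trans (coeff-⊕ p q m) (trans (+-cong (vanish d m l) (vanish e m l)) (+-identityˡ _))

  deg-⊖ : ∀ {p n} → Deg≤ p n → Deg≤ (⊖ p) n
  deg-⊖ {p} d = deg≤ λ m l → trans (coeff-⊖ p m) (trans (-‿cong (vanish d m l)) -0#≈0#)

  deg-const : ∀ c → Deg≤ (const c) 0
  deg-const c = deg≤ λ { (suc m) l → refl }

  deg-X- : ∀ a → Deg≤ (X- a) 1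
  deg-X- a = deg≤ λ { (suc (suc m)) l → refl ; (suc zero) (s≤s ()) }

  deg-X : Deg≤ X 1
  deg-X = deg≤ λ { (suc (suc m)) l → refl ; (suc zero) (s≤s ()) }

  private
    conv-top : ∀ m n f g → (∀ k → m < k → f k ≈ 0#) → (∀ k → n < k → g k ≈ 0#) →
      conv f g (m ℕ.+ n) ≈ f m * g n
    conv-top zero    zero    f g df dg = refl
    conv-top zero    (suc n) f g df dg = trans (+-congˡ (conv-zeroˡ g (λ k → df (suc k) (s≤s z≤n)) n)) (+-identityʳ _)
    conv-top (suc m) n       f g df dg = trans
      (+-cong (trans (*-congˡ (dg (suc (m ℕ.+ n)) (s≤s (ℕ.m≤n+m n m)))) (zeroʳ _))
              (conv-top m n (f ∘ suc) g (λ k l → df (suc k) (s≤s l)) dg))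
      (+-identityˡ _)

    conv-above : ∀ m n f g → (∀ k → m < k → f k ≈ 0#) → (∀ k → n < k → g k ≈ 0#) →
      ∀ k → m ℕ.+ n < k → conv f g k ≈ 0#
    conv-above zero n f g df dg (suc k) l = trans
      (+-cong (trans (*-congˡ (dg (suc k) l)) (zeroʳ _)) (conv-zeroˡ g (λ j → df (suc j) (s≤s z≤n)) k)) (+-identityˡ _)
    conv-above (suc m) n f g df dg (suc k) (s≤s l) = trans
      (+-cong (trans (*-congˡ (dg (suc k) (ℕ.m≤n⇒m≤1+n (ℕ.≤-trans (s≤s (ℕ.m≤n+m n m)) l)))) (zeroʳ _))
              (conv-above m n (f ∘ suc) g (λ j l → df (suc j) (s≤s l)) dg k l))
      (+-identityˡ _)

  deg-⊗ : ∀ {p q m n} → Deg≤ p m → Deg≤ q n → Deg≤ (p ⊗ q) (m ℕ.+ n)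
  deg-⊗ {p} {q} {m} {n} d e = deg≤ λ k l → trans (coeff-⊗ p q k) (conv-above m n _ _ (vanish d) (vanish e) k l)

  top-⊗ : ∀ {p q} m n → Deg≤ p m → Deg≤ q n → coeff (p ⊗ q) (m ℕ.+ n) ≈ coeff p m * coeff q n
  top-⊗ {p} {q} m n d e = trans (coeff-⊗ p q (m ℕ.+ n)) (conv-top m n _ _ (vanish d) (vanish e))

  constHom : Hom A polyRing
  constHom = record { φ = const ; cong = const-cong ; +-hom = const-+ ; *-hom = const-* ; ⊖-hom = const-⊖ ; 0-hom = const-0
    ; 1-hom = coeffwise λ _ → refl }

-- Exact degrees over a field.

module FieldPoly (F : FiniteField) where
  open FiniteField F
  open FieldKit F
  open Polynomial fieldRing public
  open import Data.List using ([]; _∷_)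
  open import Data.Nat as ℕ using (ℕ; zero; suc; _≤_; _<_; z≤n; s≤s)
  import Data.Nat.Properties as ℕ
  open import Relation.Binary.PropositionalEquality
  module P = CommutativeRing polyRing

  record Top (p : Poly) (n : ℕ) : Set where
    constructor top
    field
      deg  : Deg≤ p n
      lead : coeff p n ≢ 0#
  open Top public

  top-cong : ∀ {p q n} → p ≋ q → Top p n → Top q n
  top-cong {p} {q} h (top d l) = top (deg-cong h d) (l ∘ trans (at h _))

  top-⊗′ : ∀ {p q m n} → Top p m → Top q n → Top (p ⊗ q) (m ℕ.+ n)
  top-⊗′ {p} {q} {m} {n} (top d l) (top e k) = top (deg-⊗ d e) λ h → *≢0 l k (trans (sym (top-⊗ m n d e)) h)

  top-⊖ : ∀ {p n} → Top p n → Top (⊖ p) n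
  top-⊖ {p} {n} (top d l) = top (deg-⊖ d) λ h → -≢0 l (trans (sym (coeff-⊖ p n)) h)

  top-⊕ : ∀ {p q n} → Top p n → (∀ k → n ≤ k → coeff q k ≡ 0#) → Top (p ⊕ q) n
  top-⊕ {p} {q} {n} (top d l) e = top (deg-⊕ d (deg≤ λ k h → e k (ℕ.<⇒≤ h)))
    λ h → l (trans (sym (+-identityʳ _)) (trans (cong (coeff p n +_) (sym (e n ℕ.≤-refl))) (trans (sym (coeff-⊕ p q n)) h)))

  top-dominates : ∀ {p q k n} → Top p n → Deg≤ q k → k < n → Top (p ⊕ q) n
  top-dominates t d k<n = top-⊕ t λ j n≤j → vanish d j (ℕ.<-≤-trans k<n n≤j)

  top-unique : ∀ {p m n} → Top p m → Top p n → m ≡ n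
  top-unique {m = m} {n} s t with ℕ.<-cmp m n
  ... | tri< m<n _ _ = contradiction (vanish (deg s) n m<n) (lead t)
  ... | tri≈ _ m≡n _ = m≡n
  ... | tri> _ _ n<m = contradiction (vanish (deg t) m n<m) (lead s)

  top-≋0 : ∀ {p n} → Top p n → ¬ p ≋ []
  top-≋0 t h = lead t (at h _)

  zero-or-top : ∀ p → p ≋ [] ⊎ ∃ (Top p)
  zero-or-top [] = inj₁ P.refl
  zero-or-top (c ∷ p) with zero-or-top p
  ... | inj₂ (n , top d l) = inj₂ (suc n , top (deg≤ λ { (suc m) (s≤s h) → vanish d m h }) l)
  ... | inj₁ p≋0 with c ≟ 0#
  ...   | yes c≡0 = inj₁ (coeffwise λ { zero → c≡0 ; (suc n) → at p≋0 n })
  ...   | no  c≢0 = inj₂ (0 , top (deg≤ λ { (suc m) h → at p≋0 m }) c≢0)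

  nonzero-top : ∀ {p} → ¬ p ≋ [] → ∃ (Top p)
  nonzero-top {p} h with zero-or-top p
  ... | inj₁ z = contradiction z h
  ... | inj₂ t = t

  top≤ : ∀ {p m n} → Deg≤ p n → Top p m → m ≤ n
  top≤ {m = m} {n} d t = ℕ.≮⇒≥ λ n<m → lead t (vanish d m n<m)

  poly-zero-product : ∀ {p q} → p ⊗ q ≋ [] → p ≋ [] ⊎ q ≋ []
  poly-zero-product {p} {q} h with zero-or-top p | zero-or-top q
  ... | inj₁ z | _ = inj₁ z
  ... | inj₂ _ | inj₁ z = inj₂ z
  ... | inj₂ (_ , s) | inj₂ (_ , t) = contradiction h (top-≋0 (top-⊗′ s t))

  ⊗≢0 : ∀ {p q} → ¬ p ≋ [] → ¬ q ≋ [] → ¬ p ⊗ q ≋ []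
  ⊗≢0 h k e with poly-zero-product e
  ... | inj₁ z = h z
  ... | inj₂ z = k z

  top-eval : ∀ {p} a → Top p 0 → eval a p ≢ 0#
  top-eval {p} a t h = lead t (trans (sym (trans (eval-cong a {p} {const (coeff p 0)} (coeffwise eq)) (eval-const a _))) h)
    where
    eq : ∀ n → coeff p n ≡ coeff (const (coeff p 0)) n
    eq zero    = refl
    eq (suc n) = vanish (deg t) (suc n) (s≤s z≤n)

  top-X- : ∀ a → Top (X- a) 1
  top-X- a = top (deg-X- a) (0≢1 ∘ sym)

  horner : ∀ c p → (c ∷ p) ≋ const c ⊕ X ⊗ p
  horner c p = coeffwise λ n → sym (trans (coeff-⊕ (const c) (X ⊗ p) n) (trans (cong (coeff (const c) n +_) (coeff-X⊗ p n)) (go n)))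
    where
    go : ∀ n → coeff (const c) n + coeff (0# ∷ p) n ≡ coeff (c ∷ p) n
    go zero    = +-identityʳ _
    go (suc n) = +-identityˡ _

-- The chord and tangent construction.

module Addition (F : FiniteField) (W : Weierstrass F) where
  open FiniteField F
  open Weierstrass W
  open FieldKit F
  open import Relation.Binary.PropositionalEquality

  Point : Set
  Point = RawPoint F

  On : Point → Set
  On nothing        = ⊤
  On (just (x , y)) = y * y + a₁ * x * y + a₃ * y ≡ x * x * x + a₂ * x * x + a₄ * x + a₆

  -- The line y = l x + m meets the curve in x₁, x₂, x₃, with multiplicity.
  record Meets (l m x₁ x₂ x₃ : Carrier) : Set where
    field
      s₁ : x₃ ≡ l * l + a₁ * l - a₂ - x₁ - x₂
      s₂ : a₄ - a₁ * m - a₃ * l - fromℕ 2 * l * m ≡ x₁ * x₂ + x₁ * x₃ + x₂ * x₃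
      s₃ : a₆ - m * a₃ - m * m ≡ - (x₁ * x₂ * x₃)

  module _ {l m x₁ x₂ x₃ : Carrier} where
    private
      α β : Carrier
      α = (a₄ - a₁ * m - a₃ * l - fromℕ 2 * l * m) - (x₁ * x₂ + x₁ * x₃ + x₂ * x₃)
      β = (a₆ - m * a₃ - m * m) - - (x₁ * x₂ * x₃)

    -- Once `s₁` matches the quadratic coefficients, the cubic cut out by the line and (T - x₁)(T -
    -- x₂)(T - x₃) differ by the linear polynomial α T + β, which therefore vanishes at a point of
    -- the curve on the line.
    line-root₁ : ∀ {y} → On (just (x₁ , y)) → y ≡ l * x₁ + m → x₃ ≡ l * l + a₁ * l - a₂ - x₁ - x₂ → α * x₁ + β ≡ 0#
    line-root₁ {y} = linear₃ (solve 11 (λ a₁ a₂ a₃ a₄ a₆ l m x₁ x₂ x₃ y →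
      ((a₄ :- a₁ :* m :- a₃ :* l :- con 2 :* l :* m) :- (x₁ :* x₂ :+ x₁ :* x₃ :+ x₂ :* x₃)) :* x₁
        :+ ((a₆ :- m :* a₃ :- m :* m) :- :- (x₁ :* x₂ :* x₃)) :- con 0
      := :- one :* (y :* y :+ a₁ :* x₁ :* y :+ a₃ :* y :- (x₁ :* x₁ :* x₁ :+ a₂ :* x₁ :* x₁ :+ a₄ :* x₁ :+ a₆))
        :+ (y :+ (l :* x₁ :+ m) :+ a₁ :* x₁ :+ a₃) :* (y :- (l :* x₁ :+ m))
        :+ :- (x₁ :* x₁) :* (x₃ :- (l :* l :+ a₁ :* l :- a₂ :- x₁ :- x₂))) a₁ a₂ a₃ a₄ a₆ l m x₁ x₂ x₃ y)

    line-root₂ : ∀ {y} → On (just (x₂ , y)) → y ≡ l * x₂ + m → x₃ ≡ l * l + a₁ * l - a₂ - x₁ - x₂ → α * x₂ + β ≡ 0#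
    line-root₂ {y} = linear₃ (solve 11 (λ a₁ a₂ a₃ a₄ a₆ l m x₁ x₂ x₃ y →
      ((a₄ :- a₁ :* m :- a₃ :* l :- con 2 :* l :* m) :- (x₁ :* x₂ :+ x₁ :* x₃ :+ x₂ :* x₃)) :* x₂
        :+ ((a₆ :- m :* a₃ :- m :* m) :- :- (x₁ :* x₂ :* x₃)) :- con 0
      := :- one :* (y :* y :+ a₁ :* x₂ :* y :+ a₃ :* y :- (x₂ :* x₂ :* x₂ :+ a₂ :* x₂ :* x₂ :+ a₄ :* x₂ :+ a₆))
        :+ (y :+ (l :* x₂ :+ m) :+ a₁ :* x₂ :+ a₃) :* (y :- (l :* x₂ :+ m))
        :+ :- (x₂ :* x₂) :* (x₃ :- (l :* l :+ a₁ :* l :- a₂ :- x₁ :- x₂))) a₁ a₂ a₃ a₄ a₆ l m x₁ x₂ x₃ y)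

    meets-on : Meets l m x₁ x₂ x₃ → On (just (x₃ , - ((l + a₁) * x₃) - m - a₃))
    meets-on k = linear₃ (solve 10 (λ a₁ a₂ a₃ a₄ a₆ l m x₁ x₂ x₃ →
      let y = :- ((l :+ a₁) :* x₃) :- m :- a₃ in
      y :* y :+ a₁ :* x₃ :* y :+ a₃ :* y :- (x₃ :* x₃ :* x₃ :+ a₂ :* x₃ :* x₃ :+ a₄ :* x₃ :+ a₆)
      := :- (x₃ :* x₃) :* (x₃ :- (l :* l :+ a₁ :* l :- a₂ :- x₁ :- x₂))
        :+ :- x₃ :* ((a₄ :- a₁ :* m :- a₃ :* l :- con 2 :* l :* m) :- (x₁ :* x₂ :+ x₁ :* x₃ :+ x₂ :* x₃))
        :+ :- one :* ((a₆ :- m :* a₃ :- m :* m) :- :- (x₁ :* x₂ :* x₃))) a₁ a₂ a₃ a₄ a₆ l m x₁ x₂ x₃) s₁ s₂ s₃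
      where open Meets k

    meets-from : α ≡ 0# → α * x₁ + β ≡ 0# → x₃ ≡ l * l + a₁ * l - a₂ - x₁ - x₂ → Meets l m x₁ x₂ x₃
    meets-from p q e = record { s₁ = e ; s₂ = x-y≡0⇒x≡y p
      ; s₃ = x-y≡0⇒x≡y (linear₂ (solve 3 (λ α β x → β :- con 0 := one :* (α :* x :+ β :- con 0) :+ :- x :* (α :- con 0)) α β x₁) q p) }

  record Line (x₁ y₁ x₂ y₂ l m : Carrier) : Set where
    field
      thr₁ : y₁ ≡ l * x₁ + m
      thr₂ : y₂ ≡ l * x₂ + m
      meet : Meets l m x₁ x₂ (l * l + a₁ * l - a₂ - x₁ - x₂)

  chord : ∀ {x₁ y₁ x₂ y₂} → On (just (x₁ , y₁)) → On (just (x₂ , y₂)) → x₁ ≢ x₂ →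
    Line x₁ y₁ x₂ y₂ ((y₂ - y₁) / (x₂ - x₁)) ((y₁ * x₂ - y₂ * x₁) / (x₂ - x₁))
  chord {x₁} {y₁} {x₂} {y₂} on₁ on₂ x₁≢x₂ = record { thr₁ = t₁ ; thr₂ = t₂ ; meet = meets-from α≡0 r₁ refl }
    where
    l = (y₂ - y₁) / (x₂ - x₁)
    m = (y₁ * x₂ - y₂ * x₁) / (x₂ - x₁)
    x₃ = l * l + a₁ * l - a₂ - x₁ - x₂
    nz : x₂ - x₁ ≢ 0#
    nz = x-y≢0 (λ e → x₁≢x₂ (sym e))
    t₁ : y₁ ≡ l * x₁ + m
    t₁ = *-cancelʳ nz (linear₂ (solve 6 (λ x₁ y₁ x₂ y₂ l m → y₁ :* (x₂ :- x₁) :- (l :* x₁ :+ m) :* (x₂ :- x₁)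
      := :- x₁ :* (l :* (x₂ :- x₁) :- (y₂ :- y₁)) :+ :- one :* (m :* (x₂ :- x₁) :- (y₁ :* x₂ :- y₂ :* x₁))) x₁ y₁ x₂ y₂ l m)
      (/-cancel nz _) (/-cancel nz _))
    t₂ : y₂ ≡ l * x₂ + m
    t₂ = *-cancelʳ nz (linear₂ (solve 6 (λ x₁ y₁ x₂ y₂ l m → y₂ :* (x₂ :- x₁) :- (l :* x₂ :+ m) :* (x₂ :- x₁)
      := :- x₂ :* (l :* (x₂ :- x₁) :- (y₂ :- y₁)) :+ :- one :* (m :* (x₂ :- x₁) :- (y₁ :* x₂ :- y₂ :* x₁))) x₁ y₁ x₂ y₂ l m)
      (/-cancel nz _) (/-cancel nz _))
    r₁ = line-root₁ on₁ t₁ refl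
    r₂ = line-root₂ on₂ t₂ refl
    -- The linear polynomial α T + β has the two distinct roots `x₁` and `x₂`.
    α≡0 = *≡0 (linear₂ (solve 4 (λ α β x₁ x₂ → α :* (x₁ :- x₂) :- con 0
      := one :* (α :* x₁ :+ β :- con 0) :+ :- one :* (α :* x₂ :+ β :- con 0)) _ _ x₁ x₂) r₁ r₂) (x-y≢0 x₁≢x₂)

  tangent : ∀ {x y} → On (just (x , y)) → (let d = fromℕ 2 * y + a₁ * x + a₃) → d ≢ 0# →
    Line x y x y ((fromℕ 3 * x * x + fromℕ 2 * a₂ * x + a₄ - a₁ * y) / d)
      (((- (x * x * x)) + a₄ * x + fromℕ 2 * a₆ - a₃ * y) / d)
  tangent {x} {y} on nz = record { thr₁ = t ; thr₂ = t ; meet = meets-from α≡0 (line-root₁ on t refl) refl }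
    where
    d = fromℕ 2 * y + a₁ * x + a₃
    l = (fromℕ 3 * x * x + fromℕ 2 * a₂ * x + a₄ - a₁ * y) / d
    m = ((- (x * x * x)) + a₄ * x + fromℕ 2 * a₆ - a₃ * y) / d
    x₃ = l * l + a₁ * l - a₂ - x - x
    t : y ≡ l * x + m
    t = *-cancelʳ nz (linear₃ (solve 9 (λ a₁ a₂ a₃ a₄ a₆ x y l m → let d = con 2 :* y :+ a₁ :* x :+ a₃ in
      y :* d :- (l :* x :+ m) :* d
      := :- x :* (l :* d :- (con 3 :* x :* x :+ con 2 :* a₂ :* x :+ a₄ :- a₁ :* y))
        :+ :- one :* (m :* d :- (:- (x :* x :* x) :+ a₄ :* x :+ con 2 :* a₆ :- a₃ :* y))
        :+ con 2 :* (y :* y :+ a₁ :* x :* y :+ a₃ :* y :- (x :* x :* x :+ a₂ :* x :* x :+ a₄ :* x :+ a₆)))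
      a₁ a₂ a₃ a₄ a₆ x y l m) (/-cancel nz _) (/-cancel nz _) on)
    -- Only one root is available here; the second condition is the choice of the slope, that is,
    -- the vanishing of the derivative along the line.
    α≡0 : (a₄ - a₁ * m - a₃ * l - fromℕ 2 * l * m) - (x * x + x * x₃ + x * x₃) ≡ 0#
    α≡0 = linear₂ (solve 8 (λ a₁ a₂ a₃ a₄ x y l m → let d = con 2 :* y :+ a₁ :* x :+ a₃ in let x₃ = l :* l :+ a₁ :* l :- a₂ :- x :- x in
      (a₄ :- a₁ :* m :- a₃ :* l :- con 2 :* l :* m) :- (x :* x :+ x :* x₃ :+ x :* x₃) :- con 0
      := :- one :* (l :* d :- (con 3 :* x :* x :+ con 2 :* a₂ :* x :+ a₄ :- a₁ :* y))
        :+ (a₁ :+ con 2 :* l) :* (y :- (l :* x :+ m))) a₁ a₂ a₃ a₄ x y l m) (/-cancel nz _) t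

  -- With both intersections at x, the coefficient identity `s₂` is the derivative of the equation
  -- along the line.
  tangent-slope : ∀ {x y l m} → Line x y x y l m →
    l * (fromℕ 2 * y + a₁ * x + a₃) ≡ fromℕ 3 * x * x + fromℕ 2 * a₂ * x + a₄ - a₁ * y
  tangent-slope {x} {y} {l} {m} L = linear₂ (solve 8 (λ a₁ a₂ a₃ a₄ x y l m → let x₃ = l :* l :+ a₁ :* l :- a₂ :- x :- x in
      l :* (con 2 :* y :+ a₁ :* x :+ a₃) :- (con 3 :* x :* x :+ con 2 :* a₂ :* x :+ a₄ :- a₁ :* y)
      := :- one :* (a₄ :- a₁ :* m :- a₃ :* l :- con 2 :* l :* m :- (x :* x :+ x :* x₃ :+ x :* x₃))
        :+ (a₁ :+ con 2 :* l) :* (y :- (l :* x :+ m))) a₁ a₂ a₃ a₄ x y l m) (Meets.s₂ (Line.meet L)) (Line.thr₁ L)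

  -- The graph of the addition law on the curve, so that later proofs match on geometric cases
  -- instead of repeating the tests of `add`. The last premise of `line` records whether it is a
  -- proper chord or a tangent with invertible denominator.
  data AddView : Point → Point → Point → Set where
    O+_  : ∀ Q → AddView nothing Q Q
    _+O  : ∀ p → AddView (just p) nothing (just p)
    opposite : ∀ {x y y′} → y + y′ + a₁ * x + a₃ ≡ 0# → AddView (just (x , y)) (just (x , y′)) nothing
    line : ∀ {x₁ y₁ x₂ y₂} l m → Line x₁ y₁ x₂ y₂ l m →
      x₁ ≢ x₂ ⊎ (x₁ ≡ x₂ × y₁ ≡ y₂ × fromℕ 2 * y₁ + a₁ * x₁ + a₃ ≢ 0#) →
      (let x₃ = l * l + a₁ * l - a₂ - x₁ - x₂) →
      AddView (just (x₁ , y₁)) (just (x₂ , y₂)) (just (x₃ , - ((l + a₁) * x₃) - m - a₃))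

  -- The two equations subtract to (y - y′)(y + y′ + a₁x + a₃) = 0.
  same-y : ∀ {x y y′} → On (just (x , y)) → On (just (x , y′)) → y + y′ + a₁ * x + a₃ ≢ 0# → y ≡ y′
  same-y {x} {y} {y′} on on′ h = x-y≡0⇒x≡y (*≡0 (linear₂ (solve 8 (λ a₁ a₂ a₃ a₄ a₆ x y y′ →
    let f = x :* x :* x :+ a₂ :* x :* x :+ a₄ :* x :+ a₆ in
    (y :- y′) :* (y :+ y′ :+ a₁ :* x :+ a₃) :- con 0
    := one :* (y :* y :+ a₁ :* x :* y :+ a₃ :* y :- f) :+ :- one :* (y′ :* y′ :+ a₁ :* x :* y′ :+ a₃ :* y′ :- f)) a₁ a₂ a₃ a₄ a₆ x y y′) on on′) h)

  infixl 6 _⊞_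
  _⊞_ : Point → Point → Point
  _⊞_ = add F W

  private
    addView′′ : ∀ P Q → On P → On Q → AddView P Q (P ⊞ Q)
    addView′′ nothing  Q       _ _ = O+ Q
    addView′′ (just p) nothing _ _ = p +O
    addView′′ (just (x₁ , y₁)) (just (x₂ , y₂)) on₁ on₂ with x₁ ≟ x₂
    ... | no x₁≢x₂ = line _ _ (chord on₁ on₂ x₁≢x₂) (inj₁ x₁≢x₂)
    ... | yes refl with (y₁ + y₂ + a₁ * x₁ + a₃) ≟ 0#
    ...   | yes e = opposite e
    ...   | no  e with same-y on₁ on₂ e
    ...     | refl = line _ _ (tangent on₁ d≢0) (inj₂ (refl , refl , d≢0))
      where
      d≢0 : fromℕ 2 * y₁ + a₁ * x₁ + a₃ ≢ 0#
      d≢0 h = e (trans (solve 4 (λ a₁ a₃ x y → y :+ y :+ a₁ :* x :+ a₃ := con 2 :* y :+ a₁ :* x :+ a₃) a₁ a₃ x₁ y₁) h)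

  abstract
    addView : ∀ P Q → On P → On Q → AddView P Q (P ⊞ Q)
    addView = addView′′

  private
    ⊞-on′′ : ∀ P Q → On P → On Q → On (P ⊞ Q)
    ⊞-on′′ P Q p q = go (addView P Q p q) p q
      where
      go : ∀ {P Q S} → AddView P Q S → On P → On Q → On S
      go (O+ Q) _ q = q
      go (p +O) p′ _ = p′
      go (opposite _) _ _ = tt
      go (line l m L _) _ _ = meets-on (Line.meet L)

  abstract
    ⊞-on : ∀ P Q → On P → On Q → On (P ⊞ Q)
    ⊞-on = ⊞-on′′

  ⊟_ : Point → Point
  ⊟ nothing        = nothing
  ⊟ just (x , y) = just (x , - y - a₁ * x - a₃)

  private
    ⊟-on′′ : ∀ P → On P → On (⊟ P)
    ⊟-on′′ nothing        _ = tt
    ⊟-on′′ (just (x , y)) p = trans (solve 4 (λ a₁ a₃ x y → let y′ = :- y :- a₁ :* x :- a₃ in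
      y′ :* y′ :+ a₁ :* x :* y′ :+ a₃ :* y′ := y :* y :+ a₁ :* x :* y :+ a₃ :* y) a₁ a₃ x y) p

  abstract
    ⊟-on : ∀ P → On P → On (⊟ P)
    ⊟-on = ⊟-on′′

-- Quadratic extensions of a ring.

-- S[y] / (y² + h y − f), free on 1, y.
module Quadratic (S : CommutativeRing 0ℓ 0ℓ) (h f : CommutativeRing.Carrier S) where
  open CommutativeRing S hiding (zero)
  open RingSolve S

  Quad : Set
  Quad = Carrier × Carrier

  infix 4 _≃_
  record _≃_ (z w : Quad) : Set where
    constructor _,,_
    field
      re : proj₁ z ≈ proj₁ w
      im : proj₂ z ≈ proj₂ w
  open _≃_ public

  infixl 6 _+q_
  infixl 7 _*q_
  _+q_ _*q_ : Quad → Quad → Quad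
  (a , b) +q (c , d) = a + c , b + d
  (a , b) *q (c , d) = a * c + b * d * f , a * d + b * c - b * d * h

  -- Conjugation replaces y by the other root -h - y of its equation; on the coordinate ring of the
  -- curve this is negation of points.
  -q_ conj : Quad → Quad
  -q (a , b) = - a , - b
  conj (a , b) = a - b * h , - b

  embed : Carrier → Quad
  embed s = s , 0#

  root : Quad
  root = 0# , 1#

  norm : Quad → Carrier
  norm (a , b) = a * a - a * b * h - b * b * f

  quadRing : CommutativeRing 0ℓ 0ℓ
  quadRing = record
    { Carrier = Quad ; _≈_ = _≃_ ; _+_ = _+q_ ; _*_ = _*q_ ; -_ = -q_ ; 0# = 0# , 0# ; 1# = 1# , 0#
    ; isCommutativeRing = record
      { isRing = record
        { +-isAbelianGroup = record
          { isGroup = record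
            { isMonoid = record
              { isSemigroup = record
                { isMagma = record
                  { isEquivalence = record
                    { refl = refl ,, refl
                    ; sym = λ e → sym (re e) ,, sym (im e)
                    ; trans = λ e e′ → trans (re e) (re e′) ,, trans (im e) (im e′) }
                  ; ∙-cong = λ e e′ → +-cong (re e) (re e′) ,, +-cong (im e) (im e′) }
                ; assoc = λ _ _ _ → +-assoc _ _ _ ,, +-assoc _ _ _ }
              ; identity = (λ _ → +-identityˡ _ ,, +-identityˡ _) , (λ _ → +-identityʳ _ ,, +-identityʳ _) }
            ; inverse = (λ _ → -‿inverseˡ _ ,, -‿inverseˡ _) , (λ _ → -‿inverseʳ _ ,, -‿inverseʳ _)
            ; ⁻¹-cong = λ e → -‿cong (re e) ,, -‿cong (im e) }
          ; comm = λ _ _ → +-comm _ _ ,, +-comm _ _ }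
        ; *-cong = λ e e′ → +-cong (*-cong (re e) (re e′)) (*-congʳ (*-cong (im e) (im e′)))
            ,, +-cong (+-cong (*-cong (re e) (im e′)) (*-cong (im e) (re e′))) (-‿cong (*-congʳ (*-cong (im e) (im e′))))
        ; *-assoc = λ { (a , b) (c , d) (e , g) →
            solve 8 (λ a b c d e g f h → (a :* c :+ b :* d :* f) :* e :+ (a :* d :+ b :* c :- b :* d :* h) :* g :* f
                      := a :* (c :* e :+ d :* g :* f) :+ b :* (c :* g :+ d :* e :- d :* g :* h) :* f) a b c d e g f h
            ,, solve 8 (λ a b c d e g f h →
                    (a :* c :+ b :* d :* f) :* g :+ (a :* d :+ b :* c :- b :* d :* h) :* e :- (a :* d :+ b :* c :- b :* d :* h) :* g :* h
                      := a :* (c :* g :+ d :* e :- d :* g :* h) :+ b :* (c :* e :+ d :* g :* f) :- b :* (c :* g :+ d :* e :- d :* g :* h) :* h)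
                    a b c d e g f h }
        ; *-identity = (λ { (a , b) → solve 4 (λ a b f h → one :* a :+ con 0 :* b :* f := a) a b f h
                                   ,, solve 4 (λ a b f h → one :* b :+ con 0 :* a :- con 0 :* b :* h := b) a b f h })
                     , (λ { (a , b) → solve 4 (λ a b f h → a :* one :+ b :* con 0 :* f := a) a b f h
                                   ,, solve 4 (λ a b f h → a :* con 0 :+ b :* one :- b :* con 0 :* h := b) a b f h })
        ; distrib = (λ { (a , b) (c , d) (e , g) →
                solve 7 (λ a b c d e g f → a :* (c :+ e) :+ b :* (d :+ g) :* f := (a :* c :+ b :* d :* f) :+ (a :* e :+ b :* g :* f)) a b c d e g f
                ,, solve 7 (λ a b c d e g h → a :* (d :+ g) :+ b :* (c :+ e) :- b :* (d :+ g) :* h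
                     := (a :* d :+ b :* c :- b :* d :* h) :+ (a :* g :+ b :* e :- b :* g :* h)) a b c d e g h })
            , (λ { (a , b) (c , d) (e , g) →
                solve 7 (λ a b c d e g f → (c :+ e) :* a :+ (d :+ g) :* b :* f := (c :* a :+ d :* b :* f) :+ (e :* a :+ g :* b :* f)) a b c d e g f
                ,, solve 7 (λ a b c d e g h → (c :+ e) :* b :+ (d :+ g) :* a :- (d :+ g) :* b :* h
                     := (c :* b :+ d :* a :- d :* b :* h) :+ (e :* b :+ g :* a :- g :* b :* h)) a b c d e g h }) }
      ; *-comm = λ { (a , b) (c , d) →
          solve 5 (λ a b c d f → a :* c :+ b :* d :* f := c :* a :+ d :* b :* f) a b c d f
          ,, solve 5 (λ a b c d h → a :* d :+ b :* c :- b :* d :* h := c :* b :+ d :* a :- d :* b :* h) a b c d h } } }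

  root-eq : root *q root +q embed h *q root ≃ embed f
  root-eq = solve 2 (λ f h → con 0 :* con 0 :+ one :* one :* f :+ (h :* con 0 :+ con 0 :* one :* f) := f) f h
         ,, solve 2 (λ f h → con 0 :* one :+ one :* con 0 :- one :* one :* h :+ (h :* one :+ con 0 :* con 0 :- con 0 :* one :* h) := con 0) f h

  embed-cong : ∀ {a b} → a ≈ b → embed a ≃ embed b
  embed-cong e = e ,, refl

  embed-+ : ∀ a b → embed (a + b) ≃ embed a +q embed b
  embed-+ a b = refl ,, sym (+-identityˡ _)

  embed-* : ∀ a b → embed (a * b) ≃ embed a *q embed b
  embed-* a b = solve 3 (λ a b f → a :* b := a :* b :+ con 0 :* con 0 :* f) a b f
             ,, solve 3 (λ a b h → con 0 := a :* con 0 :+ con 0 :* b :- con 0 :* con 0 :* h) a b h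

  embed-⊖ : ∀ a → embed (- a) ≃ -q embed a
  embed-⊖ a = refl ,, solve 0 (con 0 := :- con 0)

  norm-cong : ∀ {z w} → z ≃ w → norm z ≈ norm w
  norm-cong e = +-cong (+-cong (*-cong (re e) (re e)) (-‿cong (*-congʳ (*-cong (re e) (im e))))) (-‿cong (*-congʳ (*-cong (im e) (im e))))

  norm-* : ∀ z w → norm (z *q w) ≈ norm z * norm w
  norm-* (a , b) (c , d) = solve 6 (λ a b c d f h →
    let m = a :* c :+ b :* d :* f
        n = a :* d :+ b :* c :- b :* d :* h
    in m :* m :- m :* n :* h :- n :* n :* f := (a :* a :- a :* b :* h :- b :* b :* f) :* (c :* c :- c :* d :* h :- d :* d :* f)) a b c d f h

  norm-conj : ∀ z → z *q conj z ≃ embed (norm z)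
  norm-conj (a , b) =
    solve 4 (λ a b f h → a :* (a :- b :* h) :+ b :* :- b :* f := a :* a :- a :* b :* h :- b :* b :* f) a b f h
    ,, solve 4 (λ a b f h → a :* :- b :+ b :* (a :- b :* h) :- b :* :- b :* h := con 0) a b f h

  conj-* : ∀ z w → conj (z *q w) ≃ conj z *q conj w
  conj-* (a , b) (c , d) =
    solve 6 (λ a b c d f h → a :* c :+ b :* d :* f :- (a :* d :+ b :* c :- b :* d :* h) :* h
      := (a :- b :* h) :* (c :- d :* h) :+ :- b :* :- d :* f) a b c d f h
    ,, solve 6 (λ a b c d f h → :- (a :* d :+ b :* c :- b :* d :* h)
      := (a :- b :* h) :* :- d :+ :- b :* (c :- d :* h) :- :- b :* :- d :* h) a b c d f h

  open RingHom

  embedHom : Hom S quadRing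
  embedHom = record { φ = embed ; cong = embed-cong ; +-hom = embed-+ ; *-hom = embed-* ; ⊖-hom = embed-⊖
    ; 0-hom = refl ,, refl ; 1-hom = refl ,, refl }

  module _ {T : CommutativeRing 0ℓ 0ℓ} (H : Hom S T) (t : CommutativeRing.Carrier T) where
    private
      module T = CommutativeRing T
      module ST = RingSolve T
      open Hom H

    quadHom : t T.* t T.+ φ h T.* t T.≈ φ f → Hom quadRing T
    quadHom t-root = record
      { φ = λ { (a , b) → φ a T.+ φ b T.* t }
      ; cong = λ e → T.+-cong (cong (re e)) (T.*-congʳ (cong (im e)))
      ; +-hom = λ { (a , b) (c , d) → T.trans (T.+-cong (+-hom a c) (T.*-congʳ (+-hom b d)))
          (ST.solve 5 (λ a b c d t → a :+ c :+ (b :+ d) :* t := a :+ b :* t :+ (c :+ d :* t)) (φ a) (φ b) (φ c) (φ d) t) }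
      ; *-hom = λ { (a , b) (c , d) → T.trans
          (T.+-cong (push 5 (λ a b c d f → a :* c :+ b :* d :* f) a b c d f)
            (T.*-congʳ (push 5 (λ a b c d h → a :* d :+ b :* c :- b :* d :* h) a b c d h)))
          (ST.linear₁ (ST.solve 7 (λ a b c d f h t →
              a :* c :+ b :* d :* f :+ (a :* d :+ b :* c :- b :* d :* h) :* t :- (a :+ b :* t) :* (c :+ d :* t)
              := :- (b :* d) :* (t :* t :+ h :* t :- f)) (φ a) (φ b) (φ c) (φ d) (φ f) (φ h) t) t-root) }
      ; ⊖-hom = λ { (a , b) → T.trans (T.+-cong (⊖-hom a) (T.*-congʳ (⊖-hom b))) (ST.solve 3 (λ a b t → :- a :+ :- b :* t := :- (a :+ b :* t)) (φ a) (φ b) t) }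
      ; 0-hom = T.trans (T.+-cong 0-hom (T.*-congʳ 0-hom)) (ST.solve 1 (λ t → con 0 :+ con 0 :* t := con 0) t)
      ; 1-hom = T.trans (T.+-cong 1-hom (T.*-congʳ 0-hom)) (ST.solve 1 (λ t → one :+ con 0 :* t := one) t) }

  conjHom : Hom quadRing quadRing
  conjHom = record
    { φ = conj ; cong = λ e → +-cong (re e) (-‿cong (*-congʳ (im e))) ,, -‿cong (im e)
    ; +-hom = λ { (a , b) (c , d) → solve 5 (λ a b c d h → a :+ c :- (b :+ d) :* h := a :- b :* h :+ (c :- d :* h)) a b c d h
        ,, solve 2 (λ b d → :- (b :+ d) := :- b :+ :- d) b d }
    ; *-hom = conj-*
    ; ⊖-hom = λ { (a , b) → solve 3 (λ a b h → :- a :- :- b :* h := :- (a :- b :* h)) a b h ,, refl }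
    ; 0-hom = solve 1 (λ h → con 0 :- con 0 :* h := con 0) h ,, solve 0 (:- con 0 := con 0)
    ; 1-hom = solve 1 (λ h → one :- con 0 :* h := one) h ,, solve 0 (:- con 0 := con 0) }

  conj-root : conj root ≃ -q root +q -q embed h
  conj-root = solve 1 (λ h → con 0 :- one :* h := :- con 0 :+ :- h) h ,, solve 0 (:- one := :- one :+ :- con 0)

-- The affine coordinate ring and its norm to F[X].

module Coordinate (F : FiniteField) (W : Weierstrass F) where
  open FiniteField F
  open Weierstrass W
  open FieldKit F hiding (_:+_; _:*_; _:-_; :-_; _:=_; con; one)
  open FieldPoly F
  open import Data.List using ([]; _∷_)
  open import Data.Nat as ℕ using (ℕ; zero; suc; _≤_; _<_; s≤s)
  import Data.Nat.Properties as ℕ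
  open import Data.Nat.Tactic.RingSolver using (solve-∀)
  open import Relation.Binary.PropositionalEquality

  η cubic : Poly
  η     = a₃ ∷ a₁ ∷ []
  cubic = a₆ ∷ a₄ ∷ a₂ ∷ 1# ∷ []

  open RingHom
  open Quadratic polyRing η cubic public
  module PS = RingSolve polyRing
  open PS using (_:+_; _:*_; _:-_; :-_; _:=_; con; one)
  module R = CommutativeRing quadRing

  deg-η : Deg≤ η 1
  deg-η = deg≤ λ { (suc zero) (s≤s ()) ; (suc (suc m)) _ → refl }

  top-cubic : Top cubic 3
  top-cubic = top (deg≤ λ { (suc (suc (suc (suc m)))) _ → refl ; (suc zero) (s≤s ()) ; (suc (suc zero)) (s≤s (s≤s ())) ; (suc (suc (suc zero))) (s≤s (s≤s (s≤s ()))) })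
                  (λ h → 0≢1 (sym h))

  private
    -- The degree of the norm is the pole order at infinity. Its possible values 2m and 2n + 3 leave
    -- out 1, and this gap is what distinguishes the curve from a line: it makes the ideals of
    -- points nonprincipal.
    m+m≢1 : ∀ m → m ℕ.+ m ≢ 1
    m+m≢1 (suc zero)    ()
    m+m≢1 (suc (suc m)) ()

    n+n+3≢1 : ∀ n → n ℕ.+ n ℕ.+ 3 ≢ 1
    n+n+3≢1 n e with trans (sym (ℕ.+-comm (n ℕ.+ n) 3)) e
    ... | ()

  private
    2n+2 : ∀ n → suc n ℕ.+ suc n ≡ n ℕ.+ n ℕ.+ 2
    2n+2 = solve-∀

    2n+3 : ∀ n → n ℕ.+ n ℕ.+ 3 ≡ suc (suc n) ℕ.+ suc n
    2n+3 = solve-∀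

    m+n+1 : ∀ m n → m ℕ.+ n ℕ.+ 1 ≡ m ℕ.+ suc n
    m+n+1 = solve-∀

  -- a² has even degree and b² f odd degree, so the leading terms of the norm cannot cancel.
  norm-top : ∀ z → z ≃ ([] , []) ⊎ ∃ λ k → Top (norm z) k × k ≢ 1
  norm-top (a , b) with zero-or-top a | zero-or-top b
  ... | inj₁ a≋0 | inj₁ b≋0 = inj₁ (a≋0 ,, b≋0)
  ... | inj₂ (m , s) | inj₁ b≋0 = inj₂ (m ℕ.+ m , top-cong (P.sym eq) (top-⊗′ s s) , m+m≢1 m)
    where
    eq : norm (a , b) ≋ a ⊗ a
    eq = P.trans (norm-cong (P.refl ,, b≋0))
      (PS.solve 3 (λ a h f → a :* a :- a :* con 0 :* h :- con 0 :* con 0 :* f := a :* a) a η cubic)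
  ... | inj₁ a≋0 | inj₂ (n , t) = inj₂ (n ℕ.+ n ℕ.+ 3 , top-cong (P.sym eq) (top-⊖ (top-⊗′ (top-⊗′ t t) top-cubic)) , n+n+3≢1 n)
    where
    eq : norm (a , b) ≋ ⊖ (b ⊗ b ⊗ cubic)
    eq = P.trans (norm-cong (a≋0 ,, P.refl))
      (PS.solve 3 (λ b h f → con 0 :* con 0 :- con 0 :* b :* h :- b :* b :* f := :- (b :* b :* f)) b η cubic)
  ... | inj₂ (m , s) | inj₂ (n , t) with m ℕ.≤? suc n
  ...   | yes m≤1+n = inj₂ (n ℕ.+ n ℕ.+ 3 , top-cong (P.+-comm (⊖ (b ⊗ b ⊗ cubic)) (a ⊗ a ⊕ ⊖ (a ⊗ b ⊗ η)))
            (top-dominates (top-⊖ (top-⊗′ (top-⊗′ t t) top-cubic)) small (ℕ.≤-reflexive (sym (ℕ.+-suc (n ℕ.+ n) 2)))) , n+n+3≢1 n)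
    where
    le : suc n ℕ.+ suc n ≤ n ℕ.+ n ℕ.+ 2
    le = ℕ.≤-reflexive (2n+2 n)
    mid : m ℕ.+ n ℕ.+ 1 ≤ suc n ℕ.+ suc n
    mid = ℕ.≤-trans (ℕ.≤-reflexive (m+n+1 m n)) (ℕ.+-monoˡ-≤ (suc n) m≤1+n)
    small : Deg≤ (a ⊗ a ⊕ ⊖ (a ⊗ b ⊗ η)) (n ℕ.+ n ℕ.+ 2)
    small = deg-mono le (deg-⊕ (deg-mono (ℕ.+-mono-≤ m≤1+n m≤1+n) (deg-⊗ (deg s) (deg s)))
                                (deg-⊖ (deg-mono mid (deg-⊗ (deg-⊗ (deg s) (deg t)) deg-η))))
  ...   | no  m≰1+n = inj₂ (m ℕ.+ m , top-cong (P.sym (P.+-assoc (a ⊗ a) (⊖ (a ⊗ b ⊗ η)) (⊖ (b ⊗ b ⊗ cubic))))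
            (top-dominates (top-⊗′ s s) small lt) , m+m≢1 m)
    where
    1+n<m : suc n < m
    1+n<m = ℕ.≰⇒> m≰1+n
    lt : m ℕ.+ suc n < m ℕ.+ m
    lt = ℕ.+-monoʳ-< m 1+n<m
    le : n ℕ.+ n ℕ.+ 3 ≤ m ℕ.+ suc n
    le = ℕ.≤-trans (ℕ.≤-reflexive (2n+3 n)) (ℕ.+-monoˡ-≤ (suc n) 1+n<m)
    small : Deg≤ (⊖ (a ⊗ b ⊗ η) ⊕ ⊖ (b ⊗ b ⊗ cubic)) (m ℕ.+ suc n)
    small = deg-⊕ (deg-⊖ (deg-mono (ℕ.≤-reflexive (m+n+1 m n)) (deg-⊗ (deg-⊗ (deg s) (deg t)) deg-η)))
                  (deg-⊖ (deg-mono le (deg-⊗ (deg-⊗ (deg t) (deg t)) (deg top-cubic))))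

  norm-≋0 : ∀ z → norm z ≋ [] → z ≃ ([] , [])
  norm-≋0 z h with norm-top z
  ... | inj₁ z≃0 = z≃0
  ... | inj₂ (_ , t , _) = contradiction h (top-≋0 t)

  norm-0 : norm ([] , []) ≋ []
  norm-0 = PS.solve 2 (λ h f → con 0 :* con 0 :- con 0 :* con 0 :* h :- con 0 :* con 0 :* f := con 0) η cubic

  -- Zero divisors would be carried by the multiplicative norm to zero divisors of F[X].
  *q≄0 : ∀ {z w} → ¬ z ≃ ([] , []) → ¬ w ≃ ([] , []) → ¬ z *q w ≃ ([] , [])
  *q≄0 {z} {w} h k e = [ (λ z0 → h (norm-≋0 z z0)) , (λ w0 → k (norm-≋0 w w0)) ]′
    (poly-zero-product (P.trans (P.sym (norm-* z w)) (P.trans (norm-cong e) norm-0)))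

  module RS = RingSolve quadRing

  scalars : Hom fieldRing quadRing
  scalars = embedHom ∘h constHom
  open Hom scalars public using () renaming (φ to c)
  module E = Hom embedHom

  x̂ ŷ : Quad
  x̂ = embed X
  ŷ = root

  η-expand : embed η ≃ c a₁ R.* x̂ R.+ c a₃
  η-expand = R.trans (embed-cong (P.trans (horner a₃ (const a₁)) (PS.solve 3 (λ a b X → a :+ X :* b := b :* X :+ a) _ _ _)))
    (E.push 3 (λ a₁ a₃ X → a₁ :* X :+ a₃) (const a₁) (const a₃) X)

  cubic-expand : embed cubic ≃ x̂ R.* x̂ R.* x̂ R.+ c a₂ R.* x̂ R.* x̂ R.+ c a₄ R.* x̂ R.+ c a₆
  cubic-expand = R.trans (embed-cong (P.trans (horner a₆ _) (P.+-congˡ (P.*-congˡ (P.trans (horner a₄ _) (P.+-congˡ (P.*-congˡ (horner a₂ _))))))))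
    (R.trans (E.push 5 (λ a₂ a₄ a₆ X u → a₆ :+ X :* (a₄ :+ X :* (a₂ :+ X :* u))) (const a₂) (const a₄) (const a₆) X (const 1#))
      (RS.solve 4 (λ a₂ a₄ a₆ X → a₆ :+ X :* (a₄ :+ X :* (a₂ :+ X :* one)) := X :* X :* X :+ a₂ :* X :* X :+ a₄ :* X :+ a₆) (c a₂) (c a₄) (c a₆) x̂))

  curve : ŷ R.* ŷ R.+ c a₁ R.* x̂ R.* ŷ R.+ c a₃ R.* ŷ ≃ x̂ R.* x̂ R.* x̂ R.+ c a₂ R.* x̂ R.* x̂ R.+ c a₄ R.* x̂ R.+ c a₆
  curve = R.trans (RS.solve 4 (λ a₁ a₃ X Y → Y :* Y :+ a₁ :* X :* Y :+ a₃ :* Y := Y :* Y :+ (a₁ :* X :+ a₃) :* Y) (c a₁) (c a₃) x̂ ŷ)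
    (R.trans (R.+-congˡ (R.*-congʳ (R.sym η-expand))) (R.trans root-eq cubic-expand))

-- Ideals and ideal classes.

module Ideals (R : CommutativeRing 0ℓ 0ℓ) where
  open CommutativeRing R hiding (zero)
  open RingSolve R

  infixr 6 _+∈_
  infixr 7 _*∈_
  data Span (S : Carrier → Set) : Carrier → Set where
    gen  : ∀ {a} → S a → Span S a
    0∈   : Span S 0#
    _+∈_ : ∀ {a b} → Span S a → Span S b → Span S (a + b)
    _*∈_ : ∀ c {a} → Span S a → Span S (c * a)
    resp : ∀ {a b} → a ≈ b → Span S a → Span S b

  record IsIdeal (I : Carrier → Set) : Set where
    field
      0∈I  : I 0#
      +∈I  : ∀ {a b} → I a → I b → I (a + b)
      *∈I  : ∀ c {a} → I a → I (c * a)
      resI : ∀ {a b} → a ≈ b → I a → I b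
  open IsIdeal public

  span⊆ : ∀ {S I} → IsIdeal I → (∀ {z} → S z → I z) → ∀ {z} → Span S z → I z
  span⊆ i s (gen x)    = s x
  span⊆ i s 0∈         = 0∈I i
  span⊆ i s (a +∈ b)   = +∈I i (span⊆ i s a) (span⊆ i s b)
  span⊆ i s (c *∈ a)   = *∈I i c (span⊆ i s a)
  span⊆ i s (resp e a) = resI i e (span⊆ i s a)

  span-ideal : ∀ {S} → IsIdeal (Span S)
  span-ideal = record { 0∈I = 0∈ ; +∈I = _+∈_ ; *∈I = _*∈_ ; resI = resp }

  whole : Carrier → Set
  whole _ = ⊤

  whole-ideal : IsIdeal whole
  whole-ideal = record { 0∈I = tt ; +∈I = λ _ _ → tt ; *∈I = λ _ _ → tt ; resI = λ _ _ → tt }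

  infixl 7 _∙_
  _∙_ : (Carrier → Set) → (Carrier → Set) → Carrier → Set
  I ∙ J = Span λ z → ∃₂ λ a b → I a × J b × z ≈ a * b

  prod∈ : ∀ {I J a b} → I a → J b → (I ∙ J) (a * b)
  prod∈ p q = gen (_ , _ , p , q , refl)

  ∙-assoc⊆ : ∀ {I J K z} → ((I ∙ J) ∙ K) z → (I ∙ (J ∙ K)) z
  ∙-assoc⊆ {I} {J} {K} = span⊆ span-ideal λ { (u , k , pu , pk , e) → resp (sym e) (go pk pu) }
    where
    go : ∀ {k} → K k → ∀ {u} → (I ∙ J) u → (I ∙ (J ∙ K)) (u * k)
    go pk (gen (a , b , pa , pb , e)) = resp (sym (trans (*-congʳ e) (*-assoc _ _ _))) (prod∈ pa (prod∈ pb pk))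
    go pk 0∈         = resp (sym (zeroˡ _)) 0∈
    go pk (a +∈ b)   = resp (sym (distribʳ _ _ _)) (go pk a +∈ go pk b)
    go pk (c *∈ a)   = resp (sym (*-assoc _ _ _)) (c *∈ go pk a)
    go pk (resp e a) = resp (*-congʳ e) (go pk a)

  ∙-comm⊆ : ∀ {I J z} → (I ∙ J) z → (J ∙ I) z
  ∙-comm⊆ = span⊆ span-ideal λ { (a , b , p , q , e) → resp (trans (*-comm _ _) (sym e)) (prod∈ q p) }

  infix 4 _∼_
  -- g I = h J with g and h nonzero: equality of ideal classes, stated elementwise so that neither
  -- fractions nor invertible ideals are needed.
  record _∼_ (I J : Carrier → Set) : Set where
    field
      g h   : Carrier
      g≉0   : ¬ g ≈ 0#
      h≉0   : ¬ h ≈ 0#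
      to    : ∀ {z} → I z → ∃ λ w → J w × g * z ≈ h * w
      from  : ∀ {w} → J w → ∃ λ z → I z × g * z ≈ h * w

  ∼-sym : ∀ {I J} → I ∼ J → J ∼ I
  ∼-sym e = record
    { g = h ; h = g ; g≉0 = h≉0 ; h≉0 = g≉0
    ; to   = λ p → let (z , q , eq) = from p in z , q , sym eq
    ; from = λ p → let (z , q , eq) = to p in z , q , sym eq }
    where open _∼_ e

  module _ (*≉0 : ∀ {x y} → ¬ x ≈ 0# → ¬ y ≈ 0# → ¬ x * y ≈ 0#) where
    ∼-trans : ∀ {I J K} → I ∼ J → J ∼ K → I ∼ K
    ∼-trans e e′ = record
      { g = E′.g * E.g ; h = E.h * E′.h ; g≉0 = *≉0 E′.g≉0 E.g≉0 ; h≉0 = *≉0 E.h≉0 E′.h≉0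
      ; to = λ p → let (w , q , eq) = E.to p ; (v , r , eq′) = E′.to q in v , r , comb eq eq′
      ; from = λ p → let (w , q , eq′) = E′.from p ; (v , r , eq) = E.from q in v , r , comb eq eq′ }
      where
      module E = _∼_ e
      module E′ = _∼_ e′
      comb : ∀ {z w v} → E.g * z ≈ E.h * w → E′.g * w ≈ E′.h * v → E′.g * E.g * z ≈ E.h * E′.h * v
      comb {z} {w} {v} p q = linear₂ (solve 7 (λ g h g′ h′ z w v →
        g′ :* g :* z :- h :* h′ :* v := g′ :* (g :* z :- h :* w) :+ h :* (g′ :* w :- h′ :* v)) _ _ _ _ _ _ _) p q

  module _ (1≉0 : ¬ 1# ≈ 0#) where
    ≐⇒∼ : ∀ {I J} → (∀ {z} → I z → J z) → (∀ {z} → J z → I z) → I ∼ J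
    ≐⇒∼ f f′ = record { g = 1# ; h = 1# ; g≉0 = 1≉0 ; h≉0 = 1≉0
      ; to = λ p → _ , f p , refl ; from = λ p → _ , f′ p , refl }

    ∙-assoc : ∀ {I J K} → (I ∙ J) ∙ K ∼ I ∙ (J ∙ K)
    -- The reverse inclusion is the forward one with the factors in reverse order, by commutativity.
    ∙-assoc = ≐⇒∼ ∙-assoc⊆ λ p → ∙-comm⊆ (span⊆ span-ideal (λ { (a , b , pa , pb , e) → gen (a , b , pa , ∙-comm⊆ pb , e) })
      (∙-assoc⊆ (span⊆ span-ideal (λ { (a , b , pa , pb , e) → gen (a , b , ∙-comm⊆ pa , pb , e) }) (∙-comm⊆ p))))

    ∙-comm : ∀ {I J} → I ∙ J ∼ J ∙ I
    ∙-comm = ≐⇒∼ ∙-comm⊆ ∙-comm⊆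

    ∙-unitˡ : ∀ {I} → IsIdeal I → whole ∙ I ∼ I
    ∙-unitˡ i = ≐⇒∼ (span⊆ i λ { (a , b , _ , q , e) → resI i (sym e) (*∈I i a q) })
      (λ p → resp (*-identityˡ _) (prod∈ tt p))

  -- Since the elements z with g z in h J form an ideal, one half of I ∼ J can be checked on
  -- generators through `span⊆`.
  scaled : Carrier → Carrier → (Carrier → Set) → Carrier → Set
  scaled g h J z = ∃ λ w → J w × g * z ≈ h * w

  scaled-ideal : ∀ g h {J} → IsIdeal J → IsIdeal (scaled g h J)
  scaled-ideal g h i = record
    { 0∈I  = 0# , 0∈I i , trans (zeroʳ _) (sym (zeroʳ _))
    ; +∈I  = λ { (w , r , p) (v , s , q) → w + v , +∈I i r s , trans (distribˡ _ _ _) (trans (+-cong p q) (sym (distribˡ _ _ _))) }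
    ; *∈I  = λ { c (w , r , p) → c * w , *∈I i c r , trans (*-swap _ _ _) (trans (*-congˡ p) (*-swap _ _ _)) }
    ; resI = λ { e (w , r , p) → w , r , trans (*-congˡ (sym e)) p } }

  ∙-congʳ : ∀ {I I′ J} → I ∼ I′ → I ∙ J ∼ I′ ∙ J
  ∙-congʳ {I} {I′} {J} e = record { g = g ; h = h ; g≉0 = g≉0 ; h≉0 = h≉0
    ; to   = span⊆ (scaled-ideal g h span-ideal) λ { (a , b , p , q , eq) →
        let (w , r , eq′) = to p in w * b , prod∈ r q
        , trans (*-congˡ eq) (trans (sym (*-assoc _ _ _)) (trans (*-congʳ eq′) (*-assoc _ _ _))) }
    ; from = λ p → let (z , q , eq) = back p in z , q , sym eq }
    where
    open _∼_ e
    back : ∀ {w} → (I′ ∙ J) w → scaled h g (I ∙ J) w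
    back = span⊆ (scaled-ideal h g span-ideal) λ { (a , b , p , q , eq) →
      let (w , r , eq′) = from p in w * b , prod∈ r q
      , trans (*-congˡ eq) (trans (sym (*-assoc _ _ _)) (trans (*-congʳ (sym eq′)) (*-assoc _ _ _))) }

-- The ideal of a point, and products of such ideals.

module PointIdeals (F : FiniteField) (W : Weierstrass F) (nonsing : disc F W ≢ FiniteField.0# F)
  (R : CommutativeRing 0ℓ 0ℓ) (C : RingHom.Hom (FieldKit.fieldRing F) R) where
  open import Relation.Binary.PropositionalEquality using (_≡_; _≢_)
  open RingHom

  open FiniteField F using () renaming (_+_ to _+ᶠ_; _*_ to _*ᶠ_; -_ to -ᶠ_; _-_ to _-ᶠ_; 0# to 0ᶠ; 1# to 1ᶠ; _≟_ to _≟ᶠ_; fromℕ to ℕᶠ; _⁻¹ to _⁻¹ᶠ; Carrier to Kᶠ)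
  open Weierstrass W
  open Addition F W
  module FK = FieldKit F
  open CommutativeRing R hiding (zero)
  open RingSolve R
  open Ideals R
  import Relation.Binary.PropositionalEquality as ≡
  open Hom C using (transfer) renaming (φ to c)

  private
    discE : ∀ {n} → Expr n → Expr n → Expr n → Expr n → Expr n → Expr n
    discE a₁ a₂ a₃ a₄ a₆ =
      let b₂ = a₁ :* a₁ :+ con 4 :* a₂ in
      let b₄ = con 2 :* a₄ :+ a₁ :* a₃ in
      let b₆ = a₃ :* a₃ :+ con 4 :* a₆ in
      let b₈ = a₁ :* a₁ :* a₆ :+ con 4 :* a₂ :* a₆ :- a₁ :* a₃ :* a₄ :+ a₂ :* a₃ :* a₃ :- a₄ :* a₄ in
      :- (b₂ :* b₂ :* b₈) :- con 8 :* b₄ :* b₄ :* b₄ :- con 27 :* b₆ :* b₆ :+ con 9 :* b₂ :* b₄ :* b₆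

  -- Moving (x , y) to the origin does not change the discriminant, and turns a₃, a₄, −a₆
  -- into the partial derivatives and the value of the equation at (x , y).
  singular⇒disc≡0 : ∀ {x y} → On (just (x , y)) → ℕᶠ 2 *ᶠ y +ᶠ a₁ *ᶠ x +ᶠ a₃ ≡ 0ᶠ →
    ℕᶠ 3 *ᶠ x *ᶠ x +ᶠ ℕᶠ 2 *ᶠ a₂ *ᶠ x +ᶠ a₄ -ᶠ a₁ *ᶠ y ≡ 0ᶠ → disc F W ≡ 0ᶠ
  singular⇒disc≡0 {x} {y} on fy fx = ≡.trans
    (FK.solve 7 (λ a₁ a₂ a₃ a₄ a₆ x y → discE a₁ a₂ a₃ a₄ a₆ := discE a₁ (a₂ :+ con 3 :* x)
      (con 2 :* y :+ a₁ :* x :+ a₃) (con 3 :* x :* x :+ con 2 :* a₂ :* x :+ a₄ :- a₁ :* y)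
      (x :* x :* x :+ a₂ :* x :* x :+ a₄ :* x :+ a₆ :- (y :* y :+ a₁ :* x :* y :+ a₃ :* y))) a₁ a₂ a₃ a₄ a₆ x y)
    (≡.trans (≡.cong₂ (λ u v → disc F (weier a₁ (a₂ +ᶠ ℕᶠ 3 *ᶠ x) u v (x *ᶠ x *ᶠ x +ᶠ a₂ *ᶠ x *ᶠ x +ᶠ a₄ *ᶠ x +ᶠ a₆ -ᶠ (y *ᶠ y +ᶠ a₁ *ᶠ x *ᶠ y +ᶠ a₃ *ᶠ y)))) fy fx)
    (≡.trans (≡.cong (λ u → disc F (weier a₁ (a₂ +ᶠ ℕᶠ 3 *ᶠ x) 0ᶠ 0ᶠ u)) (FK.x≈y⇒x-y≈0 (≡.sym on)))
      (FK.solve 2 (λ a₁ a₂ → discE a₁ a₂ (con 0) (con 0) (con 0) := con 0) a₁ (a₂ +ᶠ ℕᶠ 3 *ᶠ x))))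

  module Classes (x̂ ŷ : Carrier)
    (curve : ŷ * ŷ + c a₁ * x̂ * ŷ + c a₃ * ŷ ≈ x̂ * x̂ * x̂ + c a₂ * x̂ * x̂ + c a₄ * x̂ + c a₆)
    (1≉0 : ¬ 1# ≈ 0#) (vertical≉0 : ∀ a → ¬ x̂ - c a ≈ 0#) (line≉0 : ∀ l m → ¬ ŷ - (c l * x̂ + c m) ≈ 0#) where

    -- The maximal ideal of an affine point. The point at infinity is invisible in the affine ring
    -- and gets the unit ideal, the neutral class.
    Id : Point → Carrier → Set
    Id nothing          = whole
    Id (just (x , y)) z = ∃₂ λ p r → z ≈ p * (x̂ - c x) + r * (ŷ - c y)

    Id-ideal : ∀ P → IsIdeal (Id P)
    Id-ideal nothing = whole-ideal
    Id-ideal (just (x , y)) = record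
      { 0∈I = 0# , 0# , solve 2 (λ u v → con 0 := con 0 :* u :+ con 0 :* v) _ _
      ; +∈I = λ { (p , r , e) (p′ , r′ , e′) → p + p′ , r + r′ , trans (+-cong e e′)
          (solve 6 (λ p r p′ r′ u v → p :* u :+ r :* v :+ (p′ :* u :+ r′ :* v) := (p :+ p′) :* u :+ (r :+ r′) :* v) _ _ _ _ _ _) }
      ; *∈I = λ { k (p , r , e) → k * p , k * r , trans (*-congˡ e)
          (solve 5 (λ k p r u v → k :* (p :* u :+ r :* v) := k :* p :* u :+ k :* r :* v) _ _ _ _ _) }
      ; resI = λ { e (p , r , e′) → p , r , trans (sym e) e′ } }

    module _ {x₁ y₁ x₂ y₂ l m : Kᶠ} (L : Line x₁ y₁ x₂ y₂ l m)
      (distinct : x₁ ≢ x₂ ⊎ (x₁ ≡ x₂ × y₁ ≡ y₂ × ℕᶠ 2 *ᶠ y₁ +ᶠ a₁ *ᶠ x₁ +ᶠ a₃ ≢ 0ᶠ)) where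
      private
        x₃ = l *ᶠ l +ᶠ a₁ *ᶠ l -ᶠ a₂ -ᶠ x₁ -ᶠ x₂
        y₃ = -ᶠ ((l +ᶠ a₁) *ᶠ x₃) -ᶠ m -ᶠ a₃
        P  = just (x₁ , y₁)
        Q  = just (x₂ , y₂)
        T  = just (x₃ , y₃)
        u₁ = x̂ - c x₁
        u₂ = x̂ - c x₂
        u₃ = x̂ - c x₃
        λ̂  = ŷ - (c l * x̂ + c m)
        λ̄  = ŷ + c a₁ * x̂ + c a₃ + c l * x̂ + c m
        open Line L
        open Meets meet

        -- `λ̄` is minus the conjugate of the line `λ̂`, so the product is minus the norm of the
        -- line: the cubic whose roots are the three abscissas.
        factor : λ̂ * λ̄ ≈ u₁ * u₂ * u₃
        factor = linear₄ (solve 12 (λ x y a₁ a₂ a₃ a₄ a₆ l m x₁ x₂ x₃ →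
            (y :- (l :* x :+ m)) :* (y :+ a₁ :* x :+ a₃ :+ l :* x :+ m) :- (x :- x₁) :* (x :- x₂) :* (x :- x₃)
            := one :* (y :* y :+ a₁ :* x :* y :+ a₃ :* y :- (x :* x :* x :+ a₂ :* x :* x :+ a₄ :* x :+ a₆))
              :+ x :* x :* (x₃ :- (l :* l :+ a₁ :* l :- a₂ :- x₁ :- x₂))
              :+ x :* (a₄ :- a₁ :* m :- a₃ :* l :- con 2 :* l :* m :- (x₁ :* x₂ :+ x₁ :* x₃ :+ x₂ :* x₃))
              :+ one :* (a₆ :- m :* a₃ :- m :* m :- :- (x₁ :* x₂ :* x₃)))
            x̂ ŷ (c a₁) (c a₂) (c a₃) (c a₄) (c a₆) (c l) (c m) (c x₁) (c x₂) (c x₃))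
          curve
          (transfer 6 (λ l a₁ a₂ x₁ x₂ x₃ → x₃ := l :* l :+ a₁ :* l :- a₂ :- x₁ :- x₂) l a₁ a₂ x₁ x₂ x₃ s₁)
          (transfer 8 (λ a₁ a₃ a₄ l m x₁ x₂ x₃ → a₄ :- a₁ :* m :- a₃ :* l :- con 2 :* l :* m := x₁ :* x₂ :+ x₁ :* x₃ :+ x₂ :* x₃)
            a₁ a₃ a₄ l m x₁ x₂ x₃ s₂)
          (transfer 6 (λ a₃ a₆ m x₁ x₂ x₃ → a₆ :- m :* a₃ :- m :* m := :- (x₁ :* x₂ :* x₃)) a₃ a₆ m x₁ x₂ x₃ s₃)

        through : ∀ {x y} → y ≡ l *ᶠ x +ᶠ m → ŷ - c y ≈ λ̂ + c l * (x̂ - c x)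
        through {x} {y} e = linear₁ (solve 6 (λ X Y x y l m →
            Y :- y :- (Y :- (l :* X :+ m) :+ l :* (X :- x)) := :- one :* (y :- (l :* x :+ m))) x̂ ŷ (c x) (c y) (c l) (c m))
          (transfer 4 (λ x y l m → y := l :* x :+ m) x y l m e)

        third : ŷ - c y₃ ≈ λ̄ - (c a₁ + c l) * u₃
        third = linear₁ (solve 8 (λ X Y x₃ y₃ a₁ a₃ l m →
            Y :- y₃ :- (Y :+ a₁ :* X :+ a₃ :+ l :* X :+ m :- (a₁ :+ l) :* (X :- x₃)) := :- one :* (y₃ :- (:- ((l :+ a₁) :* x₃) :- m :- a₃)))
            x̂ ŷ (c x₃) (c y₃) (c a₁) (c a₃) (c l) (c m))
          (transfer 6 (λ x₃ y₃ a₁ a₃ l m → y₃ := :- ((l :+ a₁) :* x₃) :- m :- a₃) x₃ y₃ a₁ a₃ l m ≡.refl)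

        reduce : ∀ {x y z p r} → y ≡ l *ᶠ x +ᶠ m → z ≈ p * (x̂ - c x) + r * (ŷ - c y) → z ≈ (p + r * c l) * (x̂ - c x) + r * λ̂
        reduce e h = trans h (trans (+-congˡ (*-congˡ (through e)))
          (solve 5 (λ p r l u L → p :* u :+ r :* (L :+ l :* u) := (p :+ r :* l) :* u :+ r :* L) _ _ _ _ _))

        λ∈ : ∀ {x y} → y ≡ l *ᶠ x +ᶠ m → Id (just (x , y)) λ̂
        λ∈ e = - c l , 1# , trans (solve 3 (λ l u L → L := :- l :* u :+ one :* (L :+ l :* u)) _ _ _) (+-congˡ (*-congˡ (sym (through e))))

        u∈ : ∀ {x y} → Id (just (x , y)) (x̂ - c x)
        u∈ = 1# , 0# , solve 2 (λ u v → u := one :* u :+ con 0 :* v) _ _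

        -- Modulo `λ̂` the two ideals are generated by `u₁` and `u₂`, and u₃ u₁ u₂ = λ̂ λ̄. Here
        -- `λ̄` lies in the ideal of T, because T is the reflection of the third intersection and so
        -- lies on the conjugate line.
        forth : ∀ {z} → (Id P ∙ Id Q) z → scaled u₃ λ̂ (Id T) z
        forth = span⊆ (scaled-ideal u₃ λ̂ (Id-ideal T)) λ { (a , b , (p , r , ea) , (p′ , r′ , eb) , e) →
          let s = p + r * c l
              s′ = p′ + r′ * c l in
          s * s′ * λ̄ + (s * r′ * u₁ + s′ * r * u₂ + r * r′ * λ̂) * u₃
          , (s * s′ * (c a₁ + c l) + (s * r′ * u₁ + s′ * r * u₂ + r * r′ * λ̂) , s * s′
            , trans (solve 5 (λ t L k u w → t :* L :+ w :* u := (t :* k :+ w) :* u :+ t :* (L :- k :* u)) _ _ (c a₁ + c l) _ _)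
                    (+-congˡ (*-congˡ (sym third))))
          , trans (*-congˡ (trans e (*-cong (reduce thr₁ ea) (reduce thr₂ eb))))
              (linear₁ (solve 9 (λ s r s′ r′ u₁ u₂ u₃ L L̄ →
                u₃ :* ((s :* u₁ :+ r :* L) :* (s′ :* u₂ :+ r′ :* L))
                  :- L :* (s :* s′ :* L̄ :+ (s :* r′ :* u₁ :+ s′ :* r :* u₂ :+ r :* r′ :* L) :* u₃)
                := :- (s :* s′) :* (L :* L̄ :- u₁ :* u₂ :* u₃)) _ _ _ _ _ _ _ _ _) factor) }

        unit : ∀ {a} → a ≢ 0ᶠ → c (a ⁻¹ᶠ) * c a ≈ 1#
        unit {a} h = trans (sym (Hom.*-hom C (a ⁻¹ᶠ) a)) (trans (Hom.cong C (FK.inverseˡ h)) (Hom.1-hom C))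

        -- A unit multiple of `λ̂` is a combination of products of generators. For a chord it is u₁
        -- λ̂ - λ̂ u₂ = (x₂ - x₁) λ̂. For a tangent, λ̂ + λ̄ equals d = 2y + a₁x + a₃ up to
        -- multiples of `λ̂` and `u₁`, so λ̂² and λ̂ λ̄ = u₁ u₂ u₃ combine to d λ̂.
        λ∈PQ : x₁ ≢ x₂ ⊎ (x₁ ≡ x₂ × y₁ ≡ y₂ × ℕᶠ 2 *ᶠ y₁ +ᶠ a₁ *ᶠ x₁ +ᶠ a₃ ≢ 0ᶠ) → (Id P ∙ Id Q) λ̂
        λ∈PQ (inj₁ x₁≢x₂) = resp
          (linear₂ (solve 6 (λ i X x₁ x₂ L d → i :* ((X :- x₁) :* L :+ :- one :* (L :* (X :- x₂))) :- L
              := (i :* L) :* (x₂ :- x₁ :- d) :+ L :* (i :* d :- one)) (c ((x₂ -ᶠ x₁) ⁻¹ᶠ)) x̂ (c x₁) (c x₂) λ̂ (c (x₂ -ᶠ x₁)))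
            (sym (trans (Hom.+-hom C _ _) (+-congˡ (Hom.⊖-hom C _)))) (unit (λ h → x₁≢x₂ (≡.sym (FK.x-y≡0⇒x≡y h)))))
          (c ((x₂ -ᶠ x₁) ⁻¹ᶠ) *∈ (prod∈ (u∈ {x₁} {y₁}) (λ∈ thr₂) +∈ (- 1# *∈ prod∈ (λ∈ thr₁) (u∈ {x₂} {y₂}))))
        λ∈PQ (inj₂ (_ , _ , d≢0)) = resp
          (linear₄ (solve 13 (λ i d X Y x y L L̄ a₁ a₃ l u₂ u₃ →
              i :* (L :* L :+ (u₃ :* ((X :- x) :* u₂) :+ (:- con 2 :* (L :* L) :+ :- (con 2 :* l :+ a₁) :* ((X :- x) :* L)))) :- L
              := (i :* L) :* (con 2 :* y :+ a₁ :* x :+ a₃ :- d) :+ L :* (i :* d :- one) :+ :- i :* (L :* L̄ :- (X :- x) :* u₂ :* u₃)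
                :+ i :* L :* (L :+ L̄ :- con 2 :* L :- (con 2 :* l :+ a₁) :* (X :- x) :- (con 2 :* y :+ a₁ :* x :+ a₃)))
              (c ((ℕᶠ 2 *ᶠ y₁ +ᶠ a₁ *ᶠ x₁ +ᶠ a₃) ⁻¹ᶠ)) (c (ℕᶠ 2 *ᶠ y₁ +ᶠ a₁ *ᶠ x₁ +ᶠ a₃)) x̂ ŷ (c x₁) (c y₁) λ̂ λ̄ (c a₁) (c a₃) (c l) u₂ u₃)
            (sym (transfer 5 (λ x y a₁ a₃ d → d := con 2 :* y :+ a₁ :* x :+ a₃) x₁ y₁ a₁ a₃ (ℕᶠ 2 *ᶠ y₁ +ᶠ a₁ *ᶠ x₁ +ᶠ a₃) ≡.refl))
            (unit d≢0) factor
            (linear₁ (solve 8 (λ X Y x y a₁ a₃ l m →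
                let L = Y :- (l :* X :+ m) in
                let L̄ = Y :+ a₁ :* X :+ a₃ :+ l :* X :+ m in
                L :+ L̄ :- con 2 :* L :- (con 2 :* l :+ a₁) :* (X :- x) :- (con 2 :* y :+ a₁ :* x :+ a₃)
                := :- con 2 :* (y :- (l :* x :+ m))) x̂ ŷ (c x₁) (c y₁) (c a₁) (c a₃) (c l) (c m))
              (transfer 4 (λ x y l m → y := l :* x :+ m) x₁ y₁ l m thr₁)))
          (c ((ℕᶠ 2 *ᶠ y₁ +ᶠ a₁ *ᶠ x₁ +ᶠ a₃) ⁻¹ᶠ) *∈ (prod∈ (λ∈ thr₁) (λ∈ thr₂) +∈ ((u₃ *∈ prod∈ (u∈ {x₁} {y₁}) (u∈ {x₂} {y₂}))
            +∈ ((- κ 2 *∈ prod∈ (λ∈ thr₁) (λ∈ thr₂)) +∈ (- (κ 2 * c l + c a₁) *∈ prod∈ (u∈ {x₁} {y₁}) (λ∈ thr₂))))))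

        back : ∀ {w} → Id T w → ∃ λ z → (Id P ∙ Id Q) z × u₃ * z ≈ λ̂ * w
        back {w} (p , r , e) = s * λ̂ + r * (u₁ * u₂) , (s *∈ λ∈PQ distinct) +∈ (r *∈ prod∈ (u∈ {x₁} {y₁}) (u∈ {x₂} {y₂}))
          , trans (linear₁ (solve 8 (λ p r k u₁ u₂ u₃ L L̄ →
                u₃ :* ((p :- r :* k) :* L :+ r :* (u₁ :* u₂)) :- L :* (p :* u₃ :+ r :* (L̄ :- k :* u₃))
                := :- r :* (L :* L̄ :- u₁ :* u₂ :* u₃)) p r (c a₁ + c l) u₁ u₂ u₃ λ̂ λ̄) factor)
              (*-congˡ (sym (trans e (+-congˡ (*-congˡ third)))))
          where s = p - r * (c a₁ + c l)

      line-class : Id P ∙ Id Q ∼ Id T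
      line-class = record { g = u₃ ; h = λ̂ ; g≉0 = vertical≉0 x₃ ; h≉0 = line≉0 l m ; to = forth ; from = back }

    module _ {x y y′ : Kᶠ} (on : On (just (x , y))) (opp : y +ᶠ y′ +ᶠ a₁ *ᶠ x +ᶠ a₃ ≡ 0ᶠ) where
      private
        u = x̂ - c x
        v = ŷ - c y
        v′ = ŷ - c y′
        P = just (x , y)
        Q = just (x , y′)
        w = x̂ * x̂ + x̂ * c x + c x * c x + c a₂ * (x̂ + c x) + c a₄ - c a₁ * ŷ
        fx fy : Kᶠ
        fx = ℕᶠ 3 *ᶠ x *ᶠ x +ᶠ ℕᶠ 2 *ᶠ a₂ *ᶠ x +ᶠ a₄ -ᶠ a₁ *ᶠ y
        fy = ℕᶠ 2 *ᶠ y +ᶠ a₁ *ᶠ x +ᶠ a₃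

        opp′ : c y + c y′ + c a₁ * c x + c a₃ ≈ 0#
        opp′ = transfer 5 (λ x y y′ a₁ a₃ → y :+ y′ :+ a₁ :* x :+ a₃ := con 0) x y y′ a₁ a₃ opp

        factor : v * v′ ≈ u * w
        factor = linear₃ (solve 10 (λ X Y x y y′ a₁ a₂ a₃ a₄ a₆ →
            (Y :- y) :* (Y :- y′) :- (X :- x) :* (X :* X :+ X :* x :+ x :* x :+ a₂ :* (X :+ x) :+ a₄ :- a₁ :* Y)
            := one :* (Y :* Y :+ a₁ :* X :* Y :+ a₃ :* Y :- (X :* X :* X :+ a₂ :* X :* X :+ a₄ :* X :+ a₆))
              :+ :- one :* (y :* y :+ a₁ :* x :* y :+ a₃ :* y :- (x :* x :* x :+ a₂ :* x :* x :+ a₄ :* x :+ a₆))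
              :+ (y :- Y) :* (y :+ y′ :+ a₁ :* x :+ a₃ :- con 0))
            x̂ ŷ (c x) (c y) (c y′) (c a₁) (c a₂) (c a₃) (c a₄) (c a₆))
          curve
          (transfer 7 (λ x y a₁ a₂ a₃ a₄ a₆ → y :* y :+ a₁ :* x :* y :+ a₃ :* y := x :* x :* x :+ a₂ :* x :* x :+ a₄ :* x :+ a₆)
            x y a₁ a₂ a₃ a₄ a₆ on)
          opp′

        u∈ : ∀ y → Id (just (x , y)) u
        u∈ y = 1# , 0# , solve 2 (λ u v → u := one :* u :+ con 0 :* v) _ _

        v∈ : ∀ y → Id (just (x , y)) (ŷ - c y)
        v∈ y = 0# , 1# , solve 2 (λ u v → v := con 0 :* u :+ one :* v) _ _

        unit : ∀ {a} → a ≢ 0ᶠ → c (a ⁻¹ᶠ) * c a ≈ 1#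
        unit {a} h = trans (sym (Hom.*-hom C (a ⁻¹ᶠ) a)) (trans (Hom.cong C (FK.inverseˡ h)) (Hom.1-hom C))

        -- Here nonsingularity enters: one partial derivative is a unit at the point. If it is `fy`,
        -- then u v′ - v u = (y - y′) u = fy u. If it is `fx`, then v v′ = u w, where `w` differs
        -- from `fx` by a combination of `u` and `v`.
        u∈PQ : (Id P ∙ Id Q) u
        u∈PQ with fy ≟ᶠ 0ᶠ | fx ≟ᶠ 0ᶠ
        ... | no fy≢0 | _ = resp
          (linear₃ (solve 9 (λ i d Y u x y y′ a₁ a₃ → i :* (u :* (Y :- y′) :+ :- one :* ((Y :- y) :* u)) :- u
              := :- (i :* u) :* (y :+ y′ :+ a₁ :* x :+ a₃ :- con 0) :+ u :* (i :* d :- one) :+ :- (i :* u) :* (d :- (con 2 :* y :+ a₁ :* x :+ a₃)))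
              (c (fy ⁻¹ᶠ)) (c fy) ŷ u (c x) (c y) (c y′) (c a₁) (c a₃))
            opp′ (unit fy≢0) (transfer 5 (λ x y a₁ a₃ d → d := con 2 :* y :+ a₁ :* x :+ a₃) x y a₁ a₃ fy ≡.refl))
          (c (fy ⁻¹ᶠ) *∈ (prod∈ (u∈ y) (v∈ y′) +∈ (- 1# *∈ prod∈ (v∈ y) (u∈ y′))))
        ... | yes _ | no fx≢0 = resp
          (linear₃ (solve 10 (λ i d X Y x y y′ a₁ a₂ a₄ →
              i :* ((Y :- y) :* (Y :- y′) :+ (:- (X :+ con 2 :* x :+ a₂) :* ((X :- x) :* (X :- x)) :+ a₁ :* ((Y :- y) :* (X :- x)))) :- (X :- x)
              := i :* ((Y :- y) :* (Y :- y′) :- (X :- x) :* (X :* X :+ X :* x :+ x :* x :+ a₂ :* (X :+ x) :+ a₄ :- a₁ :* Y))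
                :+ (X :- x) :* (i :* d :- one)
                :+ :- (i :* (X :- x)) :* (d :- (con 3 :* x :* x :+ con 2 :* a₂ :* x :+ a₄ :- a₁ :* y)))
              (c (fx ⁻¹ᶠ)) (c fx) x̂ ŷ (c x) (c y) (c y′) (c a₁) (c a₂) (c a₄))
            factor (unit fx≢0)
            (transfer 6 (λ x y a₁ a₂ a₄ d → d := con 3 :* x :* x :+ con 2 :* a₂ :* x :+ a₄ :- a₁ :* y) x y a₁ a₂ a₄ fx ≡.refl))
          (c (fx ⁻¹ᶠ) *∈ (prod∈ (v∈ y) (v∈ y′)
            +∈ ((- (x̂ + κ 2 * c x + c a₂) *∈ prod∈ (u∈ y) (u∈ y′)) +∈ (c a₁ *∈ prod∈ (v∈ y) (u∈ y′)))))
        ... | yes fy≡0 | yes fx≡0 = ⊥-elim (nonsing (singular⇒disc≡0 on fy≡0 fx≡0))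

      opposite-class : Id P ∙ Id Q ∼ whole
      opposite-class = record
        { g = 1# ; h = u ; g≉0 = 1≉0 ; h≉0 = vertical≉0 x
        ; to = span⊆ (scaled-ideal 1# u whole-ideal) λ { (a , b , (p , r , ea) , (p′ , r′ , eb) , e) →
            p * p′ * u + p * r′ * v′ + r * p′ * v + r * r′ * w , tt
            , trans (*-congˡ (trans e (*-cong ea eb)))
                (linear₁ (solve 8 (λ p r p′ r′ u v v′ w →
                  one :* ((p :* u :+ r :* v) :* (p′ :* u :+ r′ :* v′)) :- u :* (p :* p′ :* u :+ p :* r′ :* v′ :+ r :* p′ :* v :+ r :* r′ :* w)
                  := r :* r′ :* (v :* v′ :- u :* w)) p r p′ r′ u v v′ w) factor) }
        ; from = λ {z} _ → z * u , z *∈ u∈PQ , solve 2 (λ z u → one :* (z :* u) := u :* z) z u }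

    class : ∀ P Q → On P → On Q → Id P ∙ Id Q ∼ Id (P ⊞ Q)
    class P Q p q = go (addView P Q p q) p
      where
      go : ∀ {P Q S} → AddView P Q S → On P → Id P ∙ Id Q ∼ Id S
      go (O+ Q) _ = ∙-unitˡ 1≉0 (Id-ideal Q)
      go (p +O) _ = ≐⇒∼ 1≉0 (span⊆ (Id-ideal (just p)) λ { (a , b , pa , _ , e) → resI (Id-ideal (just p)) (trans (*-comm _ _) (sym e)) (*∈I (Id-ideal (just p)) b pa) })
        (λ h → resp (*-identityʳ _) (prod∈ h tt))
      go (opposite e) on = opposite-class on e
      go (line l m L d) _ = line-class L d

-- The group law, deduced from ideal classes.

module GroupLaw (F : FiniteField) (W : Weierstrass F) (nonsing : disc F W ≢ FiniteField.0# F) where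
  open import Relation.Binary.PropositionalEquality

  open FiniteField F using (_≟_; 0≢1)
  open FiniteField F using () renaming (_+_ to _+ᶠ_; _*_ to _*ᶠ_; -_ to -ᶠ_; _-_ to _-ᶠ_; 0# to 0ᶠ; 1# to 1ᶠ)
  open Weierstrass W
  open FieldKit F using (fieldRing; linear₁; linear₂)
  module FK = RingSolve fieldRing
  open FieldPoly F
  open Addition F W public
  open Coordinate F W
  open RingHom
  open RingExpr
  open import Data.List using ([])
  open import Data.Nat as ℕ using (ℕ; zero; suc; s≤s; z≤n)
  import Data.Nat.Properties as ℕ
  open CommutativeRing quadRing hiding (zero; refl; sym; trans; reflexive)

  open PointIdeals F W nonsing quadRing scalars using (module Classes)
  open Ideals quadRing

  private
    1≉0 : ¬ 1# ≃ 0#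
    1≉0 e = 0≢1 (sym (at (re e) 0))

    vertical-embed : ∀ a → x̂ - c a ≃ embed (X- a)
    vertical-embed a = R.trans (R.sym (E.push 2 (λ X a → X :- a) X (const a))) (embed-cong (P.sym
      (P.trans (horner (-ᶠ a) (const (1ᶠ))) (P.trans (P.+-cong (const-⊖ a) (P.*-identityʳ X)) (P.+-comm _ _)))))

    vertical≉0 : ∀ a → ¬ x̂ - c a ≃ 0#
    vertical≉0 a e = top-≋0 (top-X- a) (re (R.trans (R.sym (vertical-embed a)) e))

    line≉0 : ∀ l m → ¬ ŷ - (c l * x̂ + c m) ≃ 0#
    line≉0 l m e = 0≢1 (sym (at (P.trans (P.sym im-eq) (im e)) 0))
      where
      im-eq : proj₂ (ŷ - (c l * x̂ + c m)) ≋ const (1ᶠ)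
      im-eq = P.trans (P.+-congˡ (P.-‿cong (im (R.sym (E.push 3 (λ l X m → l :* X :+ m) (const l) X (const m))))))
        (PS.solve 0 (one :- con 0 := one))

  open Classes x̂ ŷ curve 1≉0 vertical≉0 line≉0

  private
    norm-vertical : ∀ a → Top (norm (x̂ - c a)) 2
    norm-vertical a = top-cong (P.sym (P.trans (norm-cong (vertical-embed a))
      (PS.solve 3 (λ v h f → v :* v :- v :* con 0 :* h :- con 0 :* con 0 :* f := v :* v) (X- a) η cubic))) (top-⊗′ (top-X- a) (top-X- a))

    norm-horizontal : ∀ b → Top (norm (ŷ - c b)) 3
    norm-horizontal b = top-cong (P.sym (PS.solve 3 (λ b h f →
        (con 0 :- b) :* (con 0 :- b) :- (con 0 :- b) :* (one :- con 0) :* h :- (one :- con 0) :* (one :- con 0) :* f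
        := :- f :+ (b :* b :+ b :* h)) (const b) η cubic))
      (top-dominates (top-⊖ top-cubic)
        (deg-⊕ (deg-mono z≤n (deg-⊗ (deg-const b) (deg-const b))) (deg-⊗ (deg-const b) deg-η)) (s≤s (s≤s z≤n)))

    2-3-gap : ∀ k l l′ → k ≢ 1 → l′ ≢ 1 → k ℕ.+ l ≡ 2 → k ℕ.+ l′ ≡ 3 → k ≡ 0
    2-3-gap zero _ _ _ _ _ _ = refl
    2-3-gap (suc zero) _ _ h _ _ _ = contradiction refl h
    2-3-gap (suc (suc zero)) _ l′ _ h _ e = contradiction (cong (ℕ.pred ∘′ ℕ.pred) e) h
      where open import Function using (_∘′_)
    2-3-gap (suc (suc (suc k))) _ _ _ _ () _

    -- The residue map of the maximal ideal of a point.
    evaluate : ∀ {x y} → On (just (x , y)) → Hom quadRing fieldRing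
    evaluate {x} {y} on = quadHom (evalHom x) y (FK.linear₁ (FK.solve 7 (λ a₁ a₂ a₃ a₄ a₆ x y →
      y :* y :+ (a₃ :+ x :* (a₁ :+ x :* con 0)) :* y :- (a₆ :+ x :* (a₄ :+ x :* (a₂ :+ x :* (one :+ x :* con 0))))
      := one :* (y :* y :+ a₁ :* x :* y :+ a₃ :* y :- (x :* x :* x :+ a₂ :* x :* x :+ a₄ :* x :+ a₆))) a₁ a₂ a₃ a₄ a₆ x y) on)

    module _ {x y} (on : On (just (x , y))) where
      open Hom (evaluate on)

      ideal-vanishes : ∀ {z} → Id (just (x , y)) z → φ z ≡ 0ᶠ
      ideal-vanishes {z} (p , r , e) = trans (Hom.cong (evaluate on) e) (trans (push 4 (λ p u r v → p :* u :+ r :* v) p (x̂ - c x) r (ŷ - c y))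
        (trans (cong₂ (λ u v → φ p *ᶠ u +ᶠ φ r *ᶠ v) u≡0 v≡0) (FK.solve 2 (λ p r → p :* con 0 :+ r :* con 0 := con 0) (φ p) (φ r))))
        where
        u≡0 : φ (x̂ - c x) ≡ 0ᶠ
        u≡0 = trans (Hom.cong (evaluate on) (vertical-embed x)) (FK.solve 2 (λ x y → :- x :+ x :* (one :+ x :* con 0) :+ con 0 :* y := con 0) x y)
        v≡0 : φ (ŷ - c y) ≡ 0ᶠ
        v≡0 = trans (push 2 (λ Y y → Y :- y) ŷ (c y)) (FK.solve 2 (λ x y → con 0 :+ (one :+ x :* con 0) :* y :- (y :+ x :* con 0 :+ con 0 :* y) := con 0) x y)

      vanishing-norm : ∀ {z} → Id (just (x , y)) z → eval x (norm z) ≡ 0ᶠ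
      vanishing-norm {z} h = trans (Hom.push (evalHom x) 4 (λ a b h f → a :* a :- a :* b :* h :- b :* b :* f) (proj₁ z) (proj₂ z) η cubic)
        (linear₂ (FK.solve 9 (λ a b a₁ a₂ a₃ a₄ a₆ x y →
            a :* a :- a :* b :* (a₃ :+ x :* (a₁ :+ x :* con 0)) :- b :* b :* (a₆ :+ x :* (a₄ :+ x :* (a₂ :+ x :* (one :+ x :* con 0)))) :- con 0
            := (a :- b :* y :- b :* (a₃ :+ x :* a₁)) :* (a :+ b :* y :- con 0)
              :+ b :* b :* (y :* y :+ a₁ :* x :* y :+ a₃ :* y :- (x :* x :* x :+ a₂ :* x :* x :+ a₄ :* x :+ a₆)))
            (eval x (proj₁ z)) (eval x (proj₂ z)) a₁ a₂ a₃ a₄ a₆ x y) (ideal-vanishes h) on)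

  *-cancel : ∀ {g z w} → ¬ g ≃ 0# → g * z ≃ g * w → z ≃ w
  *-cancel {g} {z} {w} h e with norm-top (z - w)
  ... | inj₁ z-w≃0 = RS.x-y≈0⇒x≈y z-w≃0
  ... | inj₂ (_ , t , _) = ⊥-elim (*q≄0 h (λ e′ → top-≋0 t (P.trans (norm-cong e′) norm-0))
    (R.trans (RS.solve 3 (λ g z w → g :* (z :- w) := g :* z :- g :* w) g z w) (RS.x≈y⇒x-y≈0 e)))

  -- A generator of the ideal would have norm of degree 0 or 2 dividing norms of degree 2 and 3.
  private
    nonprincipal′′ : ∀ {p} → On (just p) → ¬ Id (just p) ∼ whole
    nonprincipal′′ {x , y} on e =
      let (z , z∈ , gz≃h) = from {1#} tt
          multiple : ∀ {v} → Id (just (x , y)) v → ∃ λ w → v ≃ z * w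
          multiple v∈ = let (w , _ , eq) = to v∈ in w , *-cancel g≉0 (R.trans eq (R.trans (R.*-congʳ (R.trans (R.sym (R.*-identityʳ h)) (R.sym gz≃h))) (R.*-assoc g z w)))
          (w , eu) = multiple (R.1# , R.0# , RS.solve 2 (λ u v → u := one :* u :+ con 0 :* v) (x̂ - c x) (ŷ - c y))
          (w′ , ev) = multiple (R.0# , R.1# , RS.solve 2 (λ u v → v := con 0 :* u :+ one :* v) (x̂ - c x) (ŷ - c y))
      in conclude z w w′ (vanishing-norm on z∈) (top-cong (P.trans (norm-cong eu) (norm-* z w)) (norm-vertical x))
           (top-cong (P.trans (norm-cong ev) (norm-* z w′)) (norm-horizontal y)) (norm-top z) (norm-top w) (norm-top w′)
      where
      open _∼_ e
      zeroˡ′ : ∀ {z} w → z ≃ ([] , []) → norm z ⊗ norm w ≋ []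
      zeroˡ′ w e = P.trans (P.*-congʳ (P.trans (norm-cong e) norm-0)) (P.zeroˡ _)
      zeroʳ′ : ∀ z {w} → w ≃ ([] , []) → norm z ⊗ norm w ≋ []
      zeroʳ′ z e = P.trans (P.*-congˡ (P.trans (norm-cong e) norm-0)) (P.zeroʳ _)
      Class : Quad → Set
      Class z = z ≃ ([] , []) ⊎ ∃ λ k → Top (norm z) k × k ≢ 1
      conclude : ∀ z w w′ → eval x (norm z) ≡ 0ᶠ → Top (norm z ⊗ norm w) 2 → Top (norm z ⊗ norm w′) 3 →
        Class z → Class w → Class w′ → ⊥
      conclude z w w′ v t t′ (inj₁ z0) _ _ = top-≋0 t (zeroˡ′ w z0)
      conclude z w w′ v t t′ (inj₂ _) (inj₁ w0) _ = top-≋0 t (zeroʳ′ z w0)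
      conclude z w w′ v t t′ (inj₂ _) (inj₂ _) (inj₁ w0) = top-≋0 t′ (zeroʳ′ z w0)
      conclude z w w′ v t t′ (inj₂ (k , s , k≢1)) (inj₂ (l , s₁ , _)) (inj₂ (l′ , s₂ , l′≢1)) =
        -- Degree 2 would leave a cofactor whose norm has degree 1. So the norm of the generator is
        -- a nonzero constant, yet it vanishes at x.
        top-eval x (subst (Top (norm z)) (2-3-gap k l l′ k≢1 l′≢1 (top-unique (top-⊗′ s s₁) t) (top-unique (top-⊗′ s s₂) t′)) s) v

  abstract
    nonprincipal : ∀ {p} → On (just p) → ¬ Id (just p) ∼ whole
    nonprincipal = nonprincipal′′

  opposite-sum : ∀ {x y y′} → y +ᶠ y′ +ᶠ a₁ *ᶠ x +ᶠ a₃ ≡ 0ᶠ → just (x , y) ⊞ just (x , y′) ≡ nothing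
  opposite-sum {x} {y} {y′} e with x ≟ x
  ... | no x≢x = contradiction refl x≢x
  ... | yes _ with (y +ᶠ y′ +ᶠ a₁ *ᶠ x +ᶠ a₃) ≟ 0ᶠ
  ...   | yes _ = refl
  ...   | no h = contradiction e h

  private
    ⊞-inverse′′ : ∀ P → P ⊞ (⊟ P) ≡ nothing
    ⊞-inverse′′ nothing = refl
    ⊞-inverse′′ (just (x , y)) = opposite-sum (FK.solve 4 (λ a₁ a₃ x y → y :+ (:- y :- a₁ :* x :- a₃) :+ a₁ :* x :+ a₃ := con 0) a₁ a₃ x y)

  abstract
    ⊞-inverse : ∀ P → P ⊞ (⊟ P) ≡ nothing
    ⊞-inverse = ⊞-inverse′′

  ∼-trans′ : ∀ {I J K} → I ∼ J → J ∼ K → I ∼ K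
  ∼-trans′ = ∼-trans *q≄0

  difference-nothing : ∀ A B → On A → On B → A ⊞ (⊟ B) ≡ nothing → A ≡ B
  difference-nothing nothing nothing _ _ _ = refl
  difference-nothing (just _) nothing _ _ ()
  difference-nothing nothing (just _) _ _ ()
  difference-nothing (just (x , y)) (just (x′ , y′)) on on′ e with just (x , y) ⊞ (⊟ just (x′ , y′)) | addView (just (x , y)) (⊟ just (x′ , y′)) on (⊟-on (just (x′ , y′)) on′)
  ... | nothing | opposite h = cong (λ t → just (x , t)) (FK.linear₁ (FK.solve 5 (λ a₁ a₃ x y y′ →
      y :- y′ := one :* (y :+ (:- y′ :- a₁ :* x :- a₃) :+ a₁ :* x :+ a₃ :- con 0)) a₁ a₃ x y y′) h)

  private
    -- Both classes are multiplied by that of ⊟ B, which makes the class of A ⊞ (⊟ B) trivial. The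
    -- cancellation takes place among ideals, so of the laws of ⊞ only the inverse is used.
    Id-injective′′ : ∀ A B → On A → On B → Id A ∼ Id B → A ≡ B
    Id-injective′′ A B a b e = difference-nothing A B a b (only-nothing (A ⊞ (⊟ B)) (⊞-on A (⊟ B) a (⊟-on B b))
      (∼-trans′ (∼-sym (class A (⊟ B) a (⊟-on B b))) (∼-trans′ (∙-congʳ e)
        (subst (λ S → Id B ∙ Id (⊟ B) ∼ Id S) (⊞-inverse B) (class B (⊟ B) b (⊟-on B b))))))
      where
      only-nothing : ∀ S → On S → Id S ∼ whole → S ≡ nothing
      only-nothing nothing  _ _ = refl
      only-nothing (just p) on h = contradiction h (nonprincipal on)

  abstract
    Id-injective : ∀ A B → On A → On B → Id A ∼ Id B → A ≡ B
    Id-injective = Id-injective′′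

  private
    ⊞-comm′′ : ∀ P Q → On P → On Q → P ⊞ Q ≡ Q ⊞ P
    ⊞-comm′′ P Q p q = Id-injective _ _ (⊞-on P Q p q) (⊞-on Q P q p)
      (∼-trans′ (∼-sym (class P Q p q)) (∼-trans′ (∙-comm 1≉0) (class Q P q p)))

  abstract
    ⊞-comm : ∀ P Q → On P → On Q → P ⊞ Q ≡ Q ⊞ P
    ⊞-comm = ⊞-comm′′

  private
    ⊞-assoc′′ : ∀ P Q S → On P → On Q → On S → (P ⊞ Q) ⊞ S ≡ P ⊞ (Q ⊞ S)
    ⊞-assoc′′ P Q S p q s = Id-injective _ _ (⊞-on (P ⊞ Q) S pq s) (⊞-on P (Q ⊞ S) p qs)
      (∼-trans′ (∼-sym (class (P ⊞ Q) S pq s)) (∼-trans′ (∙-congʳ (∼-sym (class P Q p q))) (∼-trans′ (∙-assoc 1≉0)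
        (∼-trans′ (∙-comm 1≉0) (∼-trans′ (∙-congʳ (class Q S q s)) (∼-trans′ (∙-comm 1≉0) (class P (Q ⊞ S) p qs)))))))
      where
      pq = ⊞-on P Q p q
      qs = ⊞-on Q S q s

  abstract
    ⊞-assoc : ∀ P Q S → On P → On Q → On S → (P ⊞ Q) ⊞ S ≡ P ⊞ (Q ⊞ S)
    ⊞-assoc = ⊞-assoc′′

-- Powers in rings and under homomorphisms.

module Power (R : CommutativeRing 0ℓ 0ℓ) where
  open CommutativeRing R hiding (zero)
  open import Data.Nat as ℕ using (ℕ; zero; suc)
  open RingSolve R

  infixr 9 _^_
  _^_ : Carrier → ℕ → Carrier
  a ^ zero  = 1#
  a ^ suc n = a * a ^ n

  ^-cong : ∀ n {a b} → a ≈ b → a ^ n ≈ b ^ n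
  ^-cong zero    e = refl
  ^-cong (suc n) e = *-cong e (^-cong n e)

  ^-* : ∀ n a b → (a * b) ^ n ≈ a ^ n * b ^ n
  ^-* zero    a b = sym (*-identityˡ _)
  ^-* (suc n) a b = trans (*-congˡ (^-* n a b)) (solve 4 (λ a b c d → a :* b :* (c :* d) := a :* c :* (b :* d)) _ _ _ _)

  1^ : ∀ n → 1# ^ n ≈ 1#
  1^ zero    = refl
  1^ (suc n) = trans (*-identityˡ _) (1^ n)

  idempotent-^ : ∀ {s} → s * s ≈ s → ∀ n → s ^ suc n ≈ s
  idempotent-^ h zero    = *-identityʳ _
  idempotent-^ h (suc n) = trans (*-congˡ (idempotent-^ h n)) h

  nilpotent-^ : ∀ {s} → s * s ≈ 0# → ∀ n → s ^ suc (suc n) ≈ 0#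
  nilpotent-^ h n = trans (sym (*-assoc _ _ _)) (trans (*-congʳ h) (zeroˡ _))

module PowerHom {A B : CommutativeRing 0ℓ 0ℓ} (H : RingHom.Hom A B) where
  open RingHom

  open import Data.Nat using (zero; suc)
  private
    module A = Power A
    module B = Power B
    module R = CommutativeRing B
  open Hom H

  hom-^ : ∀ n x → φ (x A.^ n) R.≈ φ x B.^ n
  hom-^ zero    x = 1-hom
  hom-^ (suc n) x = R.trans (*-hom x (x A.^ n)) (R.*-congˡ (hom-^ n x))

-- Counting with duplicate-free lists.

module Lists where
  open import Data.Bool using (true; false; if_then_else_)
  open import Data.List using (List; []; _∷_; _++_; map; length; filter; concatMap; deduplicate; cartesianProduct)
  open import Data.List.Relation.Unary.Unique.Propositional.Properties using (filter⁺)
  open import Data.List.Relation.Unary.Unique.DecPropositional.Properties using (deduplicate-!)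
  open import Data.List.Relation.Binary.Permutation.Propositional using (_↭_; refl; prep; swap; trans; ↭-sym; ↭-trans)
  open import Data.List.Relation.Binary.Permutation.Propositional.Properties using (shift; ↭-length; ∈-resp-↭)
  open import Data.List.Relation.Unary.All as All using (All; []; _∷_)
  open import Data.Nat using (ℕ; suc; _+_; _*_; _≤_; z≤n; s≤s)
  open import Data.Nat.Properties
  open import Relation.Binary.PropositionalEquality as ≡ using (_≡_; _≢_; cong; sym)
  open import Relation.Unary using (Decidable)

  private variable
    A B : Set
    x : A
    xs ys : List A

  member-↭ : x ∈ xs → ∃ λ ys → xs ↭ x ∷ ys
  member-↭ {x = x} x∈ with ∈-∃++ x∈
  ... | as , bs , ≡.refl = as ++ bs , shift x as bs

  Unique-resp-↭ : xs ↭ ys → Unique xs → Unique ys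
  Unique-resp-↭ refl u = u
  Unique-resp-↭ (prep x p) (x∉ ∷ u) = All.tabulate (λ i → All.lookup x∉ (∈-resp-↭ (↭-sym p) i)) ∷ Unique-resp-↭ p u
  Unique-resp-↭ (swap x y p) ((x≢y ∷ x∉) ∷ y∉ ∷ u) =
    ((λ e → x≢y (sym e)) ∷ All.tabulate (λ i → All.lookup y∉ (∈-resp-↭ (↭-sym p) i)))
    ∷ All.tabulate (λ i → All.lookup x∉ (∈-resp-↭ (↭-sym p) i)) ∷ Unique-resp-↭ p u
  Unique-resp-↭ (trans p q) u = Unique-resp-↭ q (Unique-resp-↭ p u)

  tail-∈ : ∀ {y : A} → y ∈ x ∷ xs → x ≢ y → y ∈ xs
  tail-∈ (here e) h = contradiction (sym e) h
  tail-∈ (there i) _ = i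

  unique-length : Unique xs → (∀ {x} → x ∈ xs → x ∈ ys) → length xs ≤ length ys
  unique-length {xs = []} _ _ = z≤n
  unique-length {xs = x ∷ xs} (x∉ ∷ u) sub with member-↭ (sub (here ≡.refl))
  ... | zs , p = ≤-trans (s≤s (unique-length u (λ i → tail-∈ (∈-resp-↭ p (sub (there i))) (All.lookup x∉ i)))) (≤-reflexive (sym (↭-length p)))

  unique-↭ : Unique xs → (∀ {x} → x ∈ xs → x ∈ ys) → length ys ≤ length xs → xs ↭ ys
  unique-↭ {xs = []} {ys = []} _ _ _ = refl
  unique-↭ {xs = x ∷ xs} (x∉ ∷ u) sub l with member-↭ (sub (here ≡.refl))
  ... | zs , p = ↭-trans (prep x (unique-↭ u (λ i → tail-∈ (∈-resp-↭ p (sub (there i))) (All.lookup x∉ i))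
      (≤-pred (≤-trans (≤-reflexive (sym (↭-length p))) l)))) (↭-sym p)

  unique-map : ∀ {f : A → B} → (∀ {x y} → x ∈ xs → y ∈ xs → f x ≡ f y → x ≡ y) → Unique xs → Unique (map f xs)
  unique-map {xs = []} _ _ = []
  unique-map {xs = x ∷ xs} {f = f} inj (x∉ ∷ u) = All.tabulate distinct ∷ unique-map (λ i j → inj (there i) (there j)) u
    where
    distinct : ∀ {z} → z ∈ map f xs → f x ≢ z
    distinct z∈ e with ∈-map⁻ f z∈
    ... | y , y∈ , ≡.refl = All.lookup x∉ y∈ (inj (here ≡.refl) (there y∈) e)

  self-map-↭ : ∀ {f : A → A} → Unique xs → (∀ {x y} → x ∈ xs → y ∈ xs → f x ≡ f y → x ≡ y) →
    (∀ {x} → x ∈ xs → f x ∈ xs) → map f xs ↭ xs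
  self-map-↭ {xs = xs} {f = f} u inj into = unique-↭ (unique-map inj u) sub (≤-reflexive (sym (length-map f xs)))
    where
    sub : ∀ {z} → z ∈ map f xs → z ∈ xs
    sub z∈ with ∈-map⁻ f z∈
    ... | y , y∈ , ≡.refl = into y∈

  ∑ : (A → ℕ) → List A → ℕ
  ∑ f []       = 0
  ∑ f (x ∷ xs) = f x + ∑ f xs

  ∑-+ : ∀ (f g : A → ℕ) xs → ∑ (λ x → f x + g x) xs ≡ ∑ f xs + ∑ g xs
  ∑-+ f g [] = ≡.refl
  ∑-+ f g (x ∷ xs) = ≡.trans (cong (f x + g x +_) (∑-+ f g xs)) (interchange (f x) (g x) (∑ f xs) (∑ g xs))
    where
    open import Data.Nat.Tactic.RingSolver using (solve-∀)
    interchange : ∀ a b c d → a + b + (c + d) ≡ a + c + (b + d)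
    interchange = solve-∀

  ∑-cong : ∀ {f g : A → ℕ} xs → (∀ {x} → x ∈ xs → f x ≡ g x) → ∑ f xs ≡ ∑ g xs
  ∑-cong [] _ = ≡.refl
  ∑-cong (x ∷ xs) h = ≡.cong₂ _+_ (h (here ≡.refl)) (∑-cong xs (λ i → h (there i)))

  ∑-const : ∀ k (xs : List A) → ∑ (λ _ → k) xs ≡ length xs * k
  ∑-const k [] = ≡.refl
  ∑-const k (x ∷ xs) = cong (k +_) (∑-const k xs)

  ∑-↭ : ∀ (f : A → ℕ) → xs ↭ ys → ∑ f xs ≡ ∑ f ys
  ∑-↭ f refl = ≡.refl
  ∑-↭ f (prep x p) = cong (f x +_) (∑-↭ f p)
  ∑-↭ f (swap {xs} x y p) = ≡.trans (sym (+-assoc (f x) (f y) _)) (≡.trans (≡.cong₂ _+_ (+-comm (f x) (f y)) (∑-↭ f p)) (+-assoc (f y) (f x) _))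
  ∑-↭ f (trans p q) = ≡.trans (∑-↭ f p) (∑-↭ f q)

  ∑-map : ∀ (f : B → ℕ) (g : A → B) xs → ∑ f (map g xs) ≡ ∑ (λ x → f (g x)) xs
  ∑-map f g [] = ≡.refl
  ∑-map f g (x ∷ xs) = cong (f (g x) +_) (∑-map f g xs)

  ∑-≤ : ∀ {f : A → ℕ} {k} xs → (∀ {x} → x ∈ xs → f x ≤ k) → ∑ f xs ≤ length xs * k
  ∑-≤ [] _ = z≤n
  ∑-≤ (x ∷ xs) h = +-mono-≤ (h (here ≡.refl)) (∑-≤ xs (λ i → h (there i)))

  -- A sum that reaches the total of the termwise bounds leaves no slack in any term.
  ∑-tight : ∀ {f : A → ℕ} {k} xs → (∀ {x} → x ∈ xs → f x ≤ k) → length xs * k ≤ ∑ f xs → ∀ {x} → x ∈ xs → f x ≡ k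
  ∑-tight {f = f} {k} (x ∷ xs) h l (here ≡.refl) = ≤-antisym (h (here ≡.refl))
    (+-cancelʳ-≤ (∑ f xs) k (f x) (≤-trans (+-monoʳ-≤ k (∑-≤ xs (λ i → h (there i)))) l))
  ∑-tight {f = f} {k} (x ∷ xs) h l (there i) = ∑-tight xs (λ i → h (there i))
    (+-cancelˡ-≤ k (length xs * k) (∑ f xs) (≤-trans l (+-monoˡ-≤ (∑ f xs) (h (here ≡.refl))))) i

  module _ {A B : Set} (_≟_ : (x y : B) → Dec (x ≡ y)) (g : A → B) where
    fibre : List A → B → List A
    fibre xs c = filter (λ x → g x ≟ c) xs

    fibre-∷-≡ : ∀ x xs → length (fibre (x ∷ xs) (g x)) ≡ suc (length (fibre xs (g x)))
    fibre-∷-≡ x xs with g x ≟ g x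
    ... | yes _ = ≡.refl
    ... | no h  = contradiction ≡.refl h

    fibre-∷-≢ : ∀ x xs {c} → g x ≢ c → length (fibre (x ∷ xs) c) ≡ length (fibre xs c)
    fibre-∷-≢ x xs {c} h with g x ≟ c
    ... | yes e = contradiction e h
    ... | no _  = ≡.refl

    ∑-fibres : ∀ {cs} → Unique cs → ∀ xs → (∀ {x} → x ∈ xs → g x ∈ cs) → ∑ (λ c → length (fibre xs c)) cs ≡ length xs
    ∑-fibres {cs} u [] _ = ≡.trans (∑-const 0 cs) (*-zeroʳ (length cs))
    ∑-fibres {cs} u (x ∷ xs) h with member-↭ (h (here ≡.refl))
    ... | ds , p = ≡.trans (∑-↭ _ p) (≡.trans (≡.cong₂ _+_ (fibre-∷-≡ x xs) (∑-cong ds λ {c} c∈ → fibre-∷-≢ x xs (gx∉ c∈)))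
        (cong suc (≡.trans (sym (∑-↭ _ p)) (∑-fibres u xs (λ i → h (there i))))))
      where
      gx∉ : ∀ {c} → c ∈ ds → g x ≢ c
      gx∉ c∈ with Unique-resp-↭ p u
      ... | x∉ ∷ _ = All.lookup x∉ c∈

  module _ {A B : Set} {P : A → Set} (P? : Decidable P) (k : A → B) where
    concatMap-if : ∀ xs → concatMap (λ x → if does (P? x) then k x ∷ [] else []) xs ≡ map k (filter P? xs)
    concatMap-if [] = ≡.refl
    concatMap-if (x ∷ xs) with does (P? x)
    ... | true  = cong (k x ∷_) (concatMap-if xs)
    ... | false = concatMap-if xs

  length-concatMap : ∀ (f : A → List B) xs → length (concatMap f xs) ≡ ∑ (λ x → length (f x)) xs
  length-concatMap f [] = ≡.refl
  length-concatMap f (x ∷ xs) = ≡.trans (length-++ (f x)) (cong (length (f x) +_) (length-concatMap f xs))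

  length-filter-cong : ∀ {P Q : A → Set} (P? : Decidable P) (Q? : Decidable Q) → (∀ x → P x → Q x) → (∀ x → Q x → P x) →
    ∀ xs → length (filter P? xs) ≡ length (filter Q? xs)
  length-filter-cong P? Q? f g [] = ≡.refl
  length-filter-cong P? Q? f g (x ∷ xs) with P? x | Q? x
  ... | yes _ | yes _ = cong suc (length-filter-cong P? Q? f g xs)
  ... | no _  | no _  = length-filter-cong P? Q? f g xs
  ... | yes p | no ¬q = contradiction (f x p) ¬q
  ... | no ¬p | yes q = contradiction (g x q) ¬p

  fibre-bound : ∀ (_≟_ : (x y : B) → Dec (x ≡ y)) (f : A → B) k {xs} → Unique xs →
    (∀ {zs} → Unique zs → (∀ {z} → z ∈ zs → z ∈ xs) → (∀ {z w} → z ∈ zs → w ∈ zs → f z ≡ f w) → length zs ≤ k) →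
    length xs ≤ length (deduplicate _≟_ (map f xs)) * k
  fibre-bound _≟_ f k {xs} u h = ≤-trans
    (≤-reflexive (sym (∑-fibres _≟_ f (deduplicate-! _≟_ (map f xs)) xs (λ i → ∈-deduplicate⁺ _≟_ (∈-map⁺ f i)))))
    (∑-≤ (deduplicate _≟_ (map f xs)) (λ {c} _ → h (filter⁺ (λ x → f x ≟ c) u)
      (λ i → proj₁ (∈-filter⁻ (λ x → f x ≟ c) i))
      (λ i j → ≡.trans (proj₂ (∈-filter⁻ (λ x → f x ≟ c) {xs = xs} i)) (sym (proj₂ (∈-filter⁻ (λ x → f x ≟ c) {xs = xs} j))))))

  -- Each round removes a pair x, σ x. The number `n` is fuel: the shortened list is not a
  -- structural part of the original one.
  even-involution : ∀ (σ : A → A) n {xs} → length xs ≤ n → Unique xs → (∀ {x} → x ∈ xs → σ x ∈ xs) →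
    (∀ {x} → x ∈ xs → σ (σ x) ≡ x) → (∀ {x} → x ∈ xs → σ x ≢ x) → ∃ λ k → length xs ≡ k + k
  even-involution σ n {[]} _ _ _ _ _ = 0 , ≡.refl
  even-involution σ (suc n) {x ∷ ys} (s≤s l) (x∉ ∷ u) into inv fix with member-↭ (tail-∈ (into (here ≡.refl)) (λ e → fix (here ≡.refl) (sym e)))
  ... | zs , p with Unique-resp-↭ p u
  ...   | σx∉ ∷ u′ with even-involution σ n (≤-trans (≤-trans (n≤1+n _) (≤-reflexive (sym (↭-length p)))) l) u′ into′ (λ i → inv (back i)) (λ i → fix (back i))
    where
    back : ∀ {z} → z ∈ zs → z ∈ x ∷ ys
    back i = there (∈-resp-↭ (↭-sym p) (there i))
    into′ : ∀ {z} → z ∈ zs → σ z ∈ zs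
    into′ {z} i = tail-∈ (∈-resp-↭ p (tail-∈ (into (back i)) σz≢x)) σz≢σx
      where
      σz≢x : x ≢ σ z
      σz≢x e = All.lookup σx∉ i (≡.trans (cong σ e) (inv (back i)))
      σz≢σx : σ x ≢ σ z
      σz≢σx e = All.lookup x∉ (∈-resp-↭ (↭-sym p) (there i)) (≡.trans (sym (inv (here ≡.refl))) (≡.trans (cong σ e) (inv (back i))))
  ...     | k , e = suc k , ≡.trans (cong suc (≡.trans (↭-length p) (cong suc e))) (cong suc (sym (+-suc k k)))

  length-cartesianProduct : ∀ (xs : List A) (ys : List B) → length (cartesianProduct xs ys) ≡ length xs * length ys
  length-cartesianProduct []       ys = ≡.refl
  length-cartesianProduct (x ∷ xs) ys = ≡.trans (length-++ (map (x ,_) ys)) (≡.cong₂ _+_ (length-map (x ,_) ys) (length-cartesianProduct xs ys))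

-- Finite abelian groups carved out by a predicate.

module FiniteAbelian {A : Set} (P : A → Set) (_∙_ : A → A → A) (ε : A)
  (closed : ∀ x y → P x → P y → P (x ∙ y)) (ε∈ : P ε)
  (assoc : ∀ x y z → P x → P y → P z → (x ∙ y) ∙ z ≡ x ∙ (y ∙ z))
  (comm : ∀ x y → P x → P y → x ∙ y ≡ y ∙ x)
  (identityˡ : ∀ x → ε ∙ x ≡ x)
  (inv : A → A) (inv∈ : ∀ x → P x → P (inv x)) (inverseʳ : ∀ x → P x → x ∙ inv x ≡ ε) where
  open import Relation.Binary.PropositionalEquality as ≡ hiding (trans)

  open import Data.List using (List; []; _∷_; map; foldr; length)
  open import Data.List.Relation.Binary.Permutation.Propositional using (_↭_; refl; prep; swap; trans; ↭-sym)
  open import Data.List.Relation.Binary.Permutation.Propositional.Properties using (∈-resp-↭)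
  open import Data.Nat as ℕ using (ℕ; zero; suc; _<_; s≤s; z≤n)
  import Data.Nat.Properties as ℕ
  open import Data.Nat.Divisibility using (_∣_; divides)
  open import Data.Nat.DivMod using (_/_; _%_; m≡m%n+[m/n]*n; m%n<n)
  open Lists using (self-map-↭)
  open ≡-Reasoning

  pow : ℕ → A → A
  pow zero    a = ε
  pow (suc n) a = a ∙ pow n a

  identityʳ : ∀ x → P x → x ∙ ε ≡ x
  identityʳ x p = ≡.trans (comm x ε p ε∈) (identityˡ x)

  pow∈ : ∀ n {a} → P a → P (pow n a)
  pow∈ zero    p = ε∈
  pow∈ (suc n) p = closed _ _ p (pow∈ n p)

  cancelˡ : ∀ x y z → P x → P y → P z → x ∙ y ≡ x ∙ z → y ≡ z
  cancelˡ x y z px py pz e = begin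
    y                 ≡⟨ sym (identityˡ y) ⟩
    ε ∙ y             ≡⟨ cong (_∙ y) (sym left) ⟩
    (inv x ∙ x) ∙ y   ≡⟨ assoc _ _ _ (inv∈ x px) px py ⟩
    inv x ∙ (x ∙ y)   ≡⟨ cong (inv x ∙_) e ⟩
    inv x ∙ (x ∙ z)   ≡⟨ sym (assoc _ _ _ (inv∈ x px) px pz) ⟩
    (inv x ∙ x) ∙ z   ≡⟨ cong (_∙ z) left ⟩
    ε ∙ z             ≡⟨ identityˡ z ⟩
    z                 ∎
    where
    left : inv x ∙ x ≡ ε
    left = ≡.trans (comm _ _ (inv∈ x px) px) (inverseʳ x px)

  pow-+ : ∀ m n {a} → P a → pow (m ℕ.+ n) a ≡ pow m a ∙ pow n a
  pow-+ zero    n p = sym (identityˡ _)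
  pow-+ (suc m) n p = ≡.trans (cong (_ ∙_) (pow-+ m n p)) (sym (assoc _ _ _ p (pow∈ m p) (pow∈ n p)))

  pow-ε : ∀ n → pow n ε ≡ ε
  pow-ε zero    = refl
  pow-ε (suc n) = ≡.trans (identityˡ _) (pow-ε n)

  pow-* : ∀ m n {a} → P a → pow (m ℕ.* n) a ≡ pow m (pow n a)
  pow-* zero    n p = refl
  pow-* (suc m) n p = ≡.trans (pow-+ n (m ℕ.* n) p) (cong (pow n _ ∙_) (pow-* m n p))

  interchange : ∀ a b c d → P a → P b → P c → P d → (a ∙ b) ∙ (c ∙ d) ≡ (a ∙ c) ∙ (b ∙ d)
  interchange a b c d pa pb pc pd = begin
    (a ∙ b) ∙ (c ∙ d) ≡⟨ assoc a b _ pa pb (closed _ _ pc pd) ⟩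
    a ∙ (b ∙ (c ∙ d)) ≡⟨ cong (a ∙_) (sym (assoc b c d pb pc pd)) ⟩
    a ∙ ((b ∙ c) ∙ d) ≡⟨ cong (λ t → a ∙ (t ∙ d)) (comm b c pb pc) ⟩
    a ∙ ((c ∙ b) ∙ d) ≡⟨ cong (a ∙_) (assoc c b d pc pb pd) ⟩
    a ∙ (c ∙ (b ∙ d)) ≡⟨ sym (assoc a c _ pa pc (closed _ _ pb pd)) ⟩
    (a ∙ c) ∙ (b ∙ d) ∎

  pow-∙ : ∀ n a b → P a → P b → pow n (a ∙ b) ≡ pow n a ∙ pow n b
  pow-∙ zero    a b p q = sym (identityˡ ε)
  pow-∙ (suc n) a b p q = ≡.trans (cong ((a ∙ b) ∙_) (pow-∙ n a b p q)) (interchange a b _ _ p q (pow∈ n p) (pow∈ n q))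

  product : List A → A
  product = foldr _∙_ ε

  product∈ : ∀ {xs} → (∀ {x} → x ∈ xs → P x) → P (product xs)
  product∈ {[]}     h = ε∈
  product∈ {x ∷ xs} h = closed _ _ (h (here refl)) (product∈ (λ i → h (there i)))

  product-↭ : ∀ {xs ys} → xs ↭ ys → (∀ {x} → x ∈ xs → P x) → product xs ≡ product ys
  product-↭ refl h = refl
  product-↭ (prep x p) h = cong (x ∙_) (product-↭ p (λ i → h (there i)))
  product-↭ (swap {xs} {ys} x y p) h = begin
    x ∙ (y ∙ product xs) ≡⟨ sym (assoc _ _ _ px py pxs) ⟩
    (x ∙ y) ∙ product xs ≡⟨ cong₂ _∙_ (comm _ _ px py) (product-↭ p (λ i → h (there (there i)))) ⟩
    (y ∙ x) ∙ product ys ≡⟨ assoc _ _ _ py px (product∈ (λ i → h (there (there (∈-resp-↭ (↭-sym p) i))))) ⟩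
    y ∙ (x ∙ product ys) ∎
    where
    px = h (here refl)
    py = h (there (here refl))
    pxs = product∈ (λ i → h (there (there i)))
  product-↭ (trans p q) h = ≡.trans (product-↭ p h) (product-↭ q (λ i → h (∈-resp-↭ (↭-sym p) i)))

  product-map : ∀ a xs → P a → (∀ {x} → x ∈ xs → P x) → product (map (a ∙_) xs) ≡ pow (length xs) a ∙ product xs
  product-map a []       p h = sym (identityˡ ε)
  product-map a (x ∷ xs) p h = ≡.trans (cong ((a ∙ x) ∙_) (product-map a xs p (λ i → h (there i))))
    (interchange a x _ _ p (h (here refl)) (pow∈ (length xs) p) (product∈ (λ i → h (there i))))

  -- Translation by a permutes the group, so a^{#G} times the product of all elements is that product.
  lagrange : ∀ {xs} → Unique xs → (∀ {x} → x ∈ xs → P x) → (∀ {x} → P x → x ∈ xs) → ∀ {a} → P a → pow (length xs) a ≡ ε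
  lagrange {xs} u sound complete {a} p = cancelˡ (product xs) _ _ pxs (pow∈ (length xs) p) ε∈ (begin
    product xs ∙ pow (length xs) a   ≡⟨ comm _ _ pxs (pow∈ (length xs) p) ⟩
    pow (length xs) a ∙ product xs   ≡⟨ sym (product-map a xs p sound) ⟩
    product (map (a ∙_) xs)          ≡⟨ sym (product-↭ (↭-sym perm) sound) ⟩
    product xs                       ≡⟨ sym (identityʳ _ pxs) ⟩
    product xs ∙ ε                   ∎)
    where
    pxs = product∈ sound
    perm : map (a ∙_) xs ↭ xs
    perm = self-map-↭ u (λ i j e → cancelˡ a _ _ p (sound i) (sound j) e) (λ i → complete (closed _ _ p (sound i)))

  pow-∣ : ∀ {m n a} → P a → m ∣ n → pow m a ≡ ε → pow n a ≡ ε
  pow-∣ {m} p (divides k refl) e = ≡.trans (pow-* k m p) (≡.trans (cong (pow k) e) (pow-ε k))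

  minimal-∣ : ∀ {o n a} → P a → 0 < o → pow o a ≡ ε → (∀ m → 0 < m → m < o → pow m a ≢ ε) → pow n a ≡ ε → o ∣ n
  minimal-∣ {suc o} {n} {a} p _ e least h with n % suc o in eq
  ... | zero  = divides (n / suc o) (≡.trans (m≡m%n+[m/n]*n n (suc o)) (cong (ℕ._+ n / suc o ℕ.* suc o) eq))
  ... | suc r = contradiction (begin
      pow (suc r) a ≡⟨ sym (identityʳ _ (pow∈ (suc r) p)) ⟩
      pow (suc r) a ∙ ε ≡⟨ cong (pow (suc r) a ∙_) (sym (pow-∣ p (divides (n / suc o) refl) e)) ⟩
      pow (suc r) a ∙ pow (n / suc o ℕ.* suc o) a ≡⟨ sym (pow-+ (suc r) _ p) ⟩
      pow (suc r ℕ.+ n / suc o ℕ.* suc o) a ≡⟨ cong (λ k → pow (k ℕ.+ n / suc o ℕ.* suc o) a) (sym eq) ⟩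
      pow (n % suc o ℕ.+ n / suc o ℕ.* suc o) a ≡⟨ cong (λ k → pow k a) (sym (m≡m%n+[m/n]*n n (suc o))) ⟩
      pow n a ≡⟨ h ⟩
      ε ∎) (least (suc r) (s≤s z≤n) (subst (_< suc o) eq (m%n<n n (suc o))))

-- Finite fields: Fermat's theorem, the factors of X^q - X, and Frobenius.

module FieldFinite (F : FiniteField) where
  open FiniteField F renaming (size to q)
  open FieldKit F
  open FieldPoly F
  open Power fieldRing using () renaming (_^_ to _^ᶠ_; ^-cong to ^ᶠ-cong)
  open RingHom
  open Lists
  open import Data.List using (List; []; _∷_; allFin; length)
  open import Data.List.Relation.Unary.All as All using (All; []; _∷_)
  open import Data.List.Relation.Unary.Unique.Propositional.Properties using (allFin⁺)
  open import Data.List.Relation.Binary.Permutation.Propositional using (_↭_)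
  open import Data.List.Relation.Binary.Permutation.Propositional.Properties using (∈-resp-↭; ↭-length)
  open import Data.Nat as ℕ using (ℕ; zero; suc; _≤_; _<_; z≤n; s≤s)
  import Data.Nat.Properties as ℕ
  open import Function.Bundles using (Inverse)
  open import Relation.Binary.PropositionalEquality
  module PS = RingSolve polyRing
  module PP = Power polyRing

  module En = Inverse enum

  length-elements : length elements ≡ q
  length-elements = trans (length-map En.from (allFin q)) (length-tabulate {n = q} (λ i → i))

  ∈-elements : ∀ c → c ∈ elements
  ∈-elements c = subst (_∈ elements) (En.strictlyInverseʳ c) (∈-map⁺ En.from (∈-allFin (En.to c)))

  unique-elements : Unique elements
  unique-elements = unique-map (λ {x} {y} _ _ e → trans (sym (En.strictlyInverseˡ x)) (trans (cong En.to e) (En.strictlyInverseˡ y))) (allFin⁺ q)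

  private
    split-zero : ∃ λ rest → elements ↭ 0# ∷ rest
    split-zero = member-↭ (∈-elements 0#)
    nonzeros = proj₁ split-zero
    perm = proj₂ split-zero

    q≡ : q ≡ suc (length nonzeros)
    q≡ = trans (sym length-elements) (↭-length perm)

    unique-0∷ : Unique (0# ∷ nonzeros)
    unique-0∷ = Unique-resp-↭ perm unique-elements

    unique-tail : ∀ {x : Carrier} {xs} → Unique (x ∷ xs) → Unique xs
    unique-tail (_ ∷ u) = u

    sound : ∀ {x} → x ∈ nonzeros → x ≢ 0#
    sound i e with unique-0∷
    ... | h ∷ _ = All.lookup h i (sym e)

    complete : ∀ {x} → x ≢ 0# → x ∈ nonzeros
    complete {x} h = tail-∈ (∈-resp-↭ perm (∈-elements x)) (λ e → h (sym e))

    module Units = FiniteAbelian (_≢ 0#) _*_ 1# (λ _ _ → *≢0) (λ e → 0≢1 (sym e)) (λ x y z _ _ _ → *-assoc x y z)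
      (λ x y _ _ → *-comm x y) *-identityˡ _⁻¹ (λ _ → ⁻¹≢0) inverseʳ

    pow-^ : ∀ n a → Units.pow n a ≡ a ^ᶠ n
    pow-^ zero    a = refl
    pow-^ (suc n) a = cong (a *_) (pow-^ n a)

  fermat : ∀ c → c ^ᶠ q ≡ c
  fermat c = subst (λ n → c ^ᶠ n ≡ c) (sym q≡) (go (c ≟ 0#))
    where
    go : _ → c ^ᶠ suc (length nonzeros) ≡ c
    go (yes c≡0) = trans (cong (_* c ^ᶠ length nonzeros) c≡0) (trans (zeroˡ _) (sym c≡0))
    go (no c≢0) = trans (cong (c *_) (trans (sym (pow-^ (length nonzeros) c)) (Units.lagrange (unique-tail unique-0∷) sound complete c≢0))) (*-identityʳ c)

  1<q : 1 < q
  1<q = subst (1 <_) (sym q≡) (s≤s (nonempty (complete (λ e → 0≢1 (sym e)))))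
    where
    nonempty : ∀ {x : Carrier} {xs} → x ∈ xs → 0 < length xs
    nonempty (here _)  = s≤s z≤n
    nonempty (there _) = s≤s z≤n

  ∏X- : List Carrier → Poly
  ∏X- []       = const 1#
  ∏X- (a ∷ as) = (X- a) ⊗ ∏X- as

  deg-∏X- : ∀ as → Deg≤ (∏X- as) (length as)
  deg-∏X- []       = deg-const 1#
  deg-∏X- (a ∷ as) = deg-⊗ (deg-X- a) (deg-∏X- as)

  monic-∏X- : ∀ as → coeff (∏X- as) (length as) ≡ 1#
  monic-∏X- []       = refl
  monic-∏X- (a ∷ as) = trans (top-⊗ 1 (length as) (deg-X- a) (deg-∏X- as)) (trans (cong (1# *_) (monic-∏X- as)) (*-identityˡ 1#))

  eval-∏X-≢0 : ∀ {a} as → (∀ {b} → b ∈ as → a ≢ b) → eval a (∏X- as) ≢ 0#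
  eval-∏X-≢0 {a} []       h e = 0≢1 (sym (trans (sym (eval-const a 1#)) e))
  eval-∏X-≢0 {a} (b ∷ as) h e = *≢0 (x-y≢0 (h (here refl))) (eval-∏X-≢0 as (λ i → h (there i)))
    (trans (cong (_* eval a (∏X- as)) (sym (eval-X- a b))) (trans (sym (eval-⊗ a (X- b) (∏X- as))) e))

  root-factor : ∀ {a p} → eval a p ≡ 0# → p ≋ (X- a) ⊗ quot a p
  root-factor {a} {p} e = P.trans (remainder a p) (P.trans (P.+-congˡ (P.trans (const-cong e) const-0)) (P.+-identityʳ _))

  roots-factor : ∀ {p} as → Unique as → (∀ {a} → a ∈ as → eval a p ≡ 0#) → ∃ λ g → p ≋ ∏X- as ⊗ g
  roots-factor {p} [] _ _ = p , P.sym (P.*-identityˡ p)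
  roots-factor {p} (a ∷ as) (a∉ ∷ u) h with roots-factor as u (λ i → h (there i))
  ... | g , e = quot a g , P.trans e (P.trans (P.*-congˡ (root-factor g-root))
      (PS.solve 3 (λ x y z → x :* (y :* z) := y :* x :* z) (∏X- as) (X- a) (quot a g)))
    where
    g-root : eval a g ≡ 0#
    g-root = *≡0 (trans (*-comm _ _) (trans (sym (eval-⊗ a (∏X- as) g)) (trans (sym (eval-cong a e)) (h (here refl)))))
      (eval-∏X-≢0 as (All.lookup a∉))

  few-roots : ∀ {p n as} → Top p n → Unique as → (∀ {a} → a ∈ as → eval a p ≡ 0#) → length as ≤ n
  few-roots {p} {n} {as} t u h with roots-factor as u h
  ... | g , e with zero-or-top g
  ...   | inj₁ g≋0 = contradiction (P.trans e (P.trans (P.*-congˡ g≋0) (P.zeroʳ _))) (top-≋0 t)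
  ...   | inj₂ (k , s) = ℕ.≤-trans (ℕ.m≤m+n (length as) k) (ℕ.≤-reflexive (top-unique (top-cong (P.sym e)
      (top-⊗′ (top (deg-∏X- as) (λ z → 0≢1 (trans (sym z) (monic-∏X- as)))) s)) t))

  vanishing : ∀ {p m} → Deg≤ p m → m < q → (∀ c → eval c p ≡ 0#) → p ≋ []
  vanishing {p} {m} d m<q h with zero-or-top p
  ... | inj₁ z = z
  ... | inj₂ (n , t) = contradiction (ℕ.≤-trans (ℕ.≤-reflexive (sym length-elements)) (ℕ.≤-trans (few-roots t unique-elements (λ {a} _ → h a)) (top≤ d t)))
      (ℕ.<⇒≱ m<q)

  coeff-X^-n : ∀ n → coeff (X PP.^ n) n ≡ 1#
  coeff-X^-n zero    = refl
  coeff-X^-n (suc n) = trans (coeff-X⊗ (X PP.^ n) (suc n)) (coeff-X^-n n)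

  deg-X^ : ∀ n → Deg≤ (X PP.^ n) n
  deg-X^ zero    = deg-const 1#
  deg-X^ (suc n) = deg-⊗ deg-X (deg-X^ n)

  eval-^ : ∀ c p n → eval c (p PP.^ n) ≡ eval c p ^ᶠ n
  eval-^ c p zero    = eval-const c 1#
  eval-^ c p (suc n) = trans (eval-⊗ c p (p PP.^ n)) (cong (eval c p *_) (eval-^ c p n))

  top-X^q-X : Top (X PP.^ q ⊕ ⊖ X) q
  top-X^q-X = top-dominates (top (deg-X^ q) (λ e → 0≢1 (trans (sym e) (coeff-X^-n q)))) (deg-⊖ deg-X) 1<q

  eval-X^q-X : ∀ c → eval c (X PP.^ q ⊕ ⊖ X) ≡ 0#
  eval-X^q-X c = trans (eval-⊕ c (X PP.^ q) (⊖ X)) (trans (cong₂ _+_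
    (trans (eval-^ c X q) (trans (^ᶠ-cong q (eval-X c)) (fermat c))) (trans (eval-⊖ c X) (cong -_ (eval-X c)))) (-‿inverseʳ c))

  deg-drop : ∀ {p m} → Deg≤ p (suc m) → coeff p (suc m) ≡ 0# → Deg≤ p m
  deg-drop {p} {m} d e = deg≤ λ k m<k → case k m<k (k ℕ.≟ suc m)
    where
    case : ∀ k → m < k → Dec (k ≡ suc m) → coeff p k ≡ 0#
    case k m<k (yes refl) = e
    case k m<k (no h) = vanish d k (ℕ.≤∧≢⇒< m<k (λ e → h (sym e)))

  q-2 : ∃ λ m → q ≡ suc (suc m)
  q-2 = go q 1<q
    where
    go : ∀ n → 1 < n → ∃ λ m → n ≡ suc (suc m)
    go (suc (suc m)) _ = m , refl
    go (suc zero) (s≤s ())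

  -- The leading terms cancel, and a difference of degree below q cannot have q zeros unless it is
  -- zero.
  vanishing-monic : ∀ {p p′} → Deg≤ p q → Deg≤ p′ q → coeff p q ≡ coeff p′ q → (∀ c → eval c p ≡ eval c p′) → p ≋ p′
  vanishing-monic {p} {p′} d d′ e h = PS.x-y≈0⇒x≈y (go q-2)
    where
    eval-diff : ∀ c → eval c (p ⊕ ⊖ p′) ≡ 0#
    eval-diff c = trans (eval-⊕ c p (⊖ p′)) (trans (cong₂ _+_ (h c) (eval-⊖ c p′)) (-‿inverseʳ _))
    coeff-diff : coeff (p ⊕ ⊖ p′) q ≡ 0#
    coeff-diff = trans (coeff-⊕ p (⊖ p′) q) (trans (cong₂ _+_ e (coeff-⊖ p′ q)) (-‿inverseʳ _))
    go : (∃ λ m → q ≡ suc (suc m)) → p ⊕ ⊖ p′ ≋ []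
    go (m , eq) = vanishing (deg-drop (subst (Deg≤ _) eq (deg-⊕ d (deg-⊖ d′))) (subst (λ n → coeff (p ⊕ ⊖ p′) n ≡ 0#) eq coeff-diff))
      (ℕ.≤-reflexive (sym eq)) eval-diff

  X^q-X : X PP.^ q ⊕ ⊖ X ≋ ∏X- elements
  X^q-X = vanishing-monic (deg top-X^q-X) (subst (Deg≤ (∏X- elements)) length-elements (deg-∏X- elements))
    (trans leading (sym (subst (λ n → coeff (∏X- elements) n ≡ 1#) length-elements (monic-∏X- elements))))
    (λ c → trans (eval-X^q-X c) (sym (eval-∏≡0 (∈-elements c))))
    where
    leading : coeff (X PP.^ q ⊕ ⊖ X) q ≡ 1#
    leading = trans (coeff-⊕ (X PP.^ q) (⊖ X) q) (trans (cong₂ _+_ (coeff-X^-n q) (vanish (deg-⊖ deg-X) q 1<q)) (+-identityʳ 1#))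
    eval-∏≡0 : ∀ {c as} → c ∈ as → eval c (∏X- as) ≡ 0#
    eval-∏≡0 {c} {a ∷ as} (here refl) = trans (eval-⊗ c (X- c) (∏X- as)) (trans (cong (_* eval c (∏X- as)) (trans (eval-X- c c) (-‿inverseʳ c))) (zeroˡ _))
    eval-∏≡0 {c} {a ∷ as} (there i) = trans (eval-⊗ c (X- a) (∏X- as)) (trans (cong (eval c (X- a) *_) (eval-∏≡0 i)) (zeroʳ _))

  -- Pascal's triangle computed inside F, where the vanishing of its q-th row can be stated without
  -- naming the characteristic.
  binomial : ℕ → ℕ → Carrier
  binomial zero    zero    = 1#
  binomial zero    (suc k) = 0#
  binomial (suc n) zero    = binomial n zero
  binomial (suc n) (suc k) = binomial n (suc k) + binomial n k

  private
    binomial-0 : ∀ n → binomial n 0 ≡ 1#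
    binomial-0 zero    = refl
    binomial-0 (suc n) = binomial-0 n

    binomial-> : ∀ n k → n < k → binomial n k ≡ 0#
    binomial-> zero    (suc k) _       = refl
    binomial-> (suc n) (suc k) (s≤s l) = trans (cong₂ _+_ (binomial-> n (suc k) (ℕ.m<n⇒m<1+n l)) (binomial-> n k l)) (+-identityˡ 0#)

    binomial-n : ∀ n → binomial n n ≡ 1#
    binomial-n zero    = refl
    binomial-n (suc n) = trans (cong₂ _+_ (binomial-> n (suc n) ℕ.≤-refl) (binomial-n n)) (+-identityˡ 1#)

    1+X : Poly
    1+X = const 1# ⊕ X

    coeff-[1+X]^ : ∀ n k → coeff (1+X PP.^ n) k ≡ binomial n k
    coeff-[1+X]^ zero zero    = refl
    coeff-[1+X]^ zero (suc k) = refl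
    coeff-[1+X]^ (suc n) k = trans (at (PS.solve 2 (λ x p → (one :+ x) :* p := p :+ x :* p) X (1+X PP.^ n)) k)
      (trans (coeff-⊕ (1+X PP.^ n) _ k) (trans (cong₂ _+_ (coeff-[1+X]^ n k) (coeff-X⊗ (1+X PP.^ n) k)) (go k)))
      where
      go : ∀ k → binomial n k + coeff (0# ∷ 1+X PP.^ n) k ≡ binomial (suc n) k
      go zero    = +-identityʳ _
      go (suc k) = cong (binomial n (suc k) +_) (coeff-[1+X]^ n k)

    -- Both sides are monic of degree q and by `fermat` define the same function c ↦ c + 1.
    -- Comparing coefficients then kills the inner binomials, without ever showing that q is a power
    -- of the characteristic.
    [1+X]^q : 1+X PP.^ q ≋ X PP.^ q ⊕ const 1#
    [1+X]^q = vanishing-monic (deg≤ λ k l → trans (coeff-[1+X]^ q k) (binomial-> q k l))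
      (deg-⊕ (deg-X^ q) (deg-mono z≤n (deg-const 1#)))
      (trans (coeff-[1+X]^ q q) (trans (binomial-n q) (sym (trans (coeff-⊕ (X PP.^ q) (const 1#) q)
        (trans (cong₂ _+_ (coeff-X^-n q) (vanish (deg-const 1#) q (ℕ.<⇒≤ 1<q))) (+-identityʳ 1#))))))
      (λ c → trans (eval-^ c 1+X q) (trans (fermat _) (trans (eval-⊕ c (const 1#) X) (trans (+-comm _ _)
        (sym (trans (eval-⊕ c (X PP.^ q) (const 1#)) (cong (_+ eval c (const 1#)) (trans (eval-^ c X q) (fermat _)))))))))

    binomial-q : ∀ k → k ≢ 0 → k ≢ q → binomial q k ≡ 0#
    binomial-q k k≢0 k≢q = trans (sym (coeff-[1+X]^ q k)) (trans (at [1+X]^q k) (trans (coeff-⊕ (X PP.^ q) (const 1#) k)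
      (trans (cong₂ _+_ (coeff-X^-≢ q k k≢q) (const-≢ k k≢0)) (+-identityʳ 0#))))
      where
      const-≢ : ∀ k → k ≢ 0 → coeff (const 1#) k ≡ 0#
      const-≢ zero    h = contradiction refl h
      const-≢ (suc k) h = refl
      coeff-X^-≢ : ∀ n k → k ≢ n → coeff (X PP.^ n) k ≡ 0#
      coeff-X^-≢ zero    zero    h = contradiction refl h
      coeff-X^-≢ zero    (suc k) h = refl
      coeff-X^-≢ (suc n) zero    h = coeff-X⊗ (X PP.^ n) 0
      coeff-X^-≢ (suc n) (suc k) h = trans (coeff-X⊗ (X PP.^ n) (suc k)) (coeff-X^-≢ n k (λ e → h (cong suc e)))

  module Frobenius (R : CommutativeRing 0ℓ 0ℓ) (H : Hom fieldRing R) where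
    private
      module R = CommutativeRing R
      module RS = RingSolve R
      open Hom H
    open Power R public

    private
      module _ (a b : R.Carrier) where
        -- The sum of f(k) a^k b^(n-k) over k ≤ n, arranged by Horner's scheme in `a`.
        homogenise : ℕ → (ℕ → Carrier) → R.Carrier
        homogenise zero    f = φ (f 0)
        homogenise (suc n) f = φ (f 0) R.* b ^ suc n R.+ a R.* homogenise n (λ k → f (suc k))

        homogenise-cong : ∀ n {f g} → (∀ k → k ≤ n → f k ≡ g k) → homogenise n f R.≈ homogenise n g
        homogenise-cong zero    h = Hom.cong H (h 0 z≤n)
        homogenise-cong (suc n) h = R.+-cong (R.*-congʳ (Hom.cong H (h 0 z≤n))) (R.*-congˡ (homogenise-cong n (λ k l → h (suc k) (s≤s l))))

        homogenise-+ : ∀ n f g → homogenise n (λ k → f k + g k) R.≈ homogenise n f R.+ homogenise n g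
        homogenise-+ zero    f g = +-hom _ _
        homogenise-+ (suc n) f g = R.trans (R.+-cong (R.*-congʳ (+-hom _ _)) (R.*-congˡ (homogenise-+ n _ _)))
          (RS.solve 6 (λ x y t a u v → (x :+ y) :* t :+ a :* (u :+ v) := x :* t :+ a :* u :+ (y :* t :+ a :* v)) _ _ _ _ _ _)

        homogenise-raise : ∀ n f → f (suc n) ≡ 0# → homogenise (suc n) f R.≈ b R.* homogenise n f
        homogenise-raise zero f h = R.trans (R.+-congˡ (R.*-congˡ (R.trans (Hom.cong H h) 0-hom)))
          (RS.solve 3 (λ x a b → x :* (b :* one) :+ a :* con 0 := b :* x) _ a b)
        homogenise-raise (suc n) f h = R.trans (R.+-congˡ (R.*-congˡ (homogenise-raise n (λ k → f (suc k)) h)))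
          (RS.solve 5 (λ x a b t u → x :* (b :* t) :+ a :* (b :* u) := b :* (x :* t :+ a :* u)) _ a b _ _)

        binomial-theorem : ∀ n → (a R.+ b) ^ n R.≈ homogenise n (binomial n)
        binomial-theorem zero    = R.sym 1-hom
        binomial-theorem (suc n) = R.trans (R.*-congˡ (binomial-theorem n)) (R.trans
          (RS.solve 3 (λ a b h → (a :+ b) :* h := b :* h :+ a :* h) a b _)
          (R.trans (R.+-congʳ (R.sym (homogenise-raise n (binomial n) (binomial-> n (suc n) ℕ.≤-refl))))
          (R.trans (R.+-assoc _ _ _) (R.+-congˡ (R.trans (R.sym (R.distribˡ a _ _))
            (R.*-congˡ (R.sym (homogenise-+ n (λ k → binomial n (suc k)) (binomial n)))))))))

        homogenise-top : ∀ n f → (∀ k → k < n → f k ≡ 0#) → homogenise n f R.≈ φ (f n) R.* a ^ n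
        homogenise-top zero    f h = R.sym (R.*-identityʳ _)
        homogenise-top (suc n) f h = R.trans (R.+-cong (R.*-congʳ (R.trans (Hom.cong H (h 0 (s≤s z≤n))) 0-hom))
          (R.*-congˡ (homogenise-top n (λ k → f (suc k)) (λ k l → h (suc k) (s≤s l)))))
          (RS.solve 4 (λ t a x u → con 0 :* t :+ a :* (x :* u) := x :* (a :* u)) _ a _ _)

    frobenius-+ : ∀ a b → (a R.+ b) ^ q R.≈ a ^ q R.+ b ^ q
    frobenius-+ a b = R.trans (binomial-theorem a b q) (go q q-2 binomial-q (binomial-n q) (binomial-0 q))
      where
      go : ∀ n {f} → (∃ λ m → n ≡ suc (suc m)) → (∀ k → k ≢ 0 → k ≢ n → f k ≡ 0#) → f n ≡ 1# → f 0 ≡ 1# → homogenise a b n f R.≈ a ^ n R.+ b ^ n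
      go (suc n) {f} _ h e e₀ = R.trans (R.+-cong (R.*-congʳ (R.trans (Hom.cong H e₀) 1-hom))
        (R.*-congˡ (R.trans (homogenise-top a b n (λ k → f (suc k)) (λ k l → h (suc k) (λ ()) (λ e → ℕ.<⇒≢ l (ℕ.suc-injective e))))
          (R.*-congʳ (R.trans (Hom.cong H e) 1-hom)))))
        (RS.solve 3 (λ t a u → one :* t :+ a :* (one :* u) := a :* u :+ t) _ a _)

    frobenius-scalar : ∀ c → φ c ^ q R.≈ φ c
    frobenius-scalar c = R.trans (R.sym (PowerHom.hom-^ H q c)) (Hom.cong H (fermat c))

    frobenius : Hom R R
    frobenius = record
      { φ = _^ q ; cong = ^-cong q ; +-hom = frobenius-+ ; *-hom = ^-* q
      -- (-a)^q + a^q = (-a + a)^q = 0 serves odd and even q alike.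
      ; ⊖-hom = λ a → RS.x-y≈0⇒x≈y (R.trans (RS.solve 2 (λ s t → s :- :- t := s :+ t) ((R.- a) ^ q) (a ^ q))
          (R.trans (R.sym (frobenius-+ (R.- a) a)) (R.trans (^-cong q (R.-‿inverseˡ a)) 0^q)))
      ; 0-hom = 0^q ; 1-hom = 1^ q }
      where
      0^q : R.0# ^ q R.≈ R.0#
      0^q = R.trans (^-cong q (R.sym 0-hom)) (R.trans (frobenius-scalar 0#) 0-hom)

-- Frobenius on F[y]/(y² + h y - f) in the split, double and inert cases.

module QuadraticRoots (F : FiniteField) (h f : FiniteField.Carrier F) where
  open FiniteField F renaming (size to q)
  open FieldKit F
  open FieldPoly F using (X; X-_; module EvalIn)
  open FieldFinite F
  open Quadratic fieldRing h f
  open Lists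
  open RingHom
  open import Data.List using (List; []; _∷_; length)
  open import Data.List.Relation.Unary.All as All using ([]; _∷_)
  open import Data.List.Relation.Unary.Unique.Propositional.Properties using (filter⁺)
  open import Data.Nat as ℕ using (ℕ; suc; z≤n; s≤s)
  import Data.Nat.Properties as ℕ
  open import Relation.Binary.PropositionalEquality
  private
    module Q = CommutativeRing quadRing
    module QS = RingSolve quadRing
  open Frobenius quadRing embedHom

  roots : List Carrier
  roots = fibre _≟_ (λ y → y * y + h * y) elements f

  -- Indexed by the number of roots. The quotient ring is F × F, a ring of dual numbers or a field
  -- accordingly, and Frobenius acts differently on each.
  data Roots : ℕ → Set where
    split  : ∀ y₁ y₂ → y₁ ≢ y₂ → y₁ + y₂ ≡ - h → y₁ * y₂ ≡ - f → Roots 2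
    double : ∀ y₀ → y₀ + y₀ ≡ - h → y₀ * y₀ ≡ - f → Roots 1
    inert  : (∀ y → y * y + h * y ≢ f) → Roots 0

  classify : Roots (length roots)
  classify = go roots (filter⁺ (λ y → (y * y + h * y) ≟ f) unique-elements)
    (λ i → proj₂ (∈-filter⁻ (λ y → (y * y + h * y) ≟ f) {xs = elements} i))
    (λ {y} e → ∈-filter⁺ (λ y → (y * y + h * y) ≟ f) (∈-elements y) e)
    where
    go : ∀ L → Unique L → (∀ {y} → y ∈ L → y * y + h * y ≡ f) → (∀ {y} → y * y + h * y ≡ f → y ∈ L) → Roots (length L)
    go [] _ _ complete = inert λ y e → absurd (complete e)
      where
      absurd : ∀ {y : Carrier} → y ∈ [] → ⊥
      absurd ()
    go (y ∷ ys) u sound complete = decide (y ≟ y′)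
      where
      y′ = - h - y
      sum : y + y′ ≡ - h
      sum = solve 2 (λ h y → y :+ (:- h :- y) := :- h) h y
      product : y * y′ ≡ - f
      product = linear₁ (solve 3 (λ h f y → y :* (:- h :- y) :- :- f := :- one :* (y :* y :+ h :* y :- f)) h f y) (sound (here refl))
      y′-root : y′ * y′ + h * y′ ≡ f
      y′-root = linear₁ (solve 3 (λ h f y → (:- h :- y) :* (:- h :- y) :+ h :* (:- h :- y) :- f := one :* (y :* y :+ h :* y :- f)) h f y) (sound (here refl))
      only : ∀ {z} → z * z + h * z ≡ f → z ≡ y ⊎ z ≡ y′
      only {z} e = [ (λ p → inj₁ (x-y≡0⇒x≡y p)) , (λ p → inj₂ (x-y≡0⇒x≡y p)) ]′ (zero-product {z - y} {z - y′}
        (linear₂ (solve 4 (λ h f y z → (z :- y) :* (z :- (:- h :- y)) :- con 0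
          := one :* (z :* z :+ h :* z :- f) :+ :- one :* (y :* y :+ h :* y :- f)) h f y z) e (sound (here refl))))
      decide : Dec (y ≡ y′) → Roots (length (y ∷ ys))
      decide (yes e) = subst Roots (sym (ℕ.≤-antisym (unique-length u into) (s≤s z≤n)))
        (double y (trans (cong (y +_) e) sum) (trans (cong (y *_) e) product))
        where
        into : ∀ {z} → z ∈ y ∷ ys → z ∈ y ∷ []
        into i with only (sound i)
        ... | inj₁ p = here p
        ... | inj₂ p = here (trans p (sym e))
      decide (no ne) = subst Roots (ℕ.≤-antisym (unique-length ((ne ∷ []) ∷ [] ∷ []) both) (unique-length u into))
        (split y y′ ne sum product)
        where
        into : ∀ {z} → z ∈ y ∷ ys → z ∈ y ∷ y′ ∷ []
        into i with only (sound i)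
        ... | inj₁ p = here p
        ... | inj₂ p = there (here p)
        both : ∀ {z} → z ∈ y ∷ y′ ∷ [] → z ∈ y ∷ ys
        both (here refl) = here refl
        both (there (here refl)) = complete y′-root

  scalar^ : ∀ c → embed c ^ q ≃ embed c
  scalar^ = frobenius-scalar

  private
    product-form : ∀ y₁ y₂ → y₁ + y₂ ≡ - h → y₁ * y₂ ≡ - f → (root Q.- embed y₁) Q.* (root Q.- embed y₂) ≃ Q.0#
    product-form y₁ y₂ s p = QS.linear₃ (QS.solve 5 (λ r y₁ y₂ h f →
        (r :- y₁) :* (r :- y₂) :- con 0 := one :* (r :* r :+ h :* r :- f) :+ :- r :* (y₁ :+ y₂ :- :- h) :+ one :* (y₁ :* y₂ :- :- f))
        root (embed y₁) (embed y₂) (embed h) (embed f))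
      root-eq (Hom.transfer embedHom 3 (λ y₁ y₂ h → y₁ :+ y₂ := :- h) y₁ y₂ h s) (Hom.transfer embedHom 3 (λ y₁ y₂ f → y₁ :* y₂ := :- f) y₁ y₂ f p)

  -- (y - y₁)/(y₂ - y₁) is idempotent, so the q-th power fixes it, and it generates the ring over F.
  frobenius-split : ∀ y₁ y₂ → y₁ ≢ y₂ → y₁ + y₂ ≡ - h → y₁ * y₂ ≡ - f → root ^ q ≃ root
  frobenius-split y₁ y₂ ne s p = QS.linear₂
    (QS.solve 6 (λ r t y₁ y₂ i δ → t :- r := δ :* (i :* (t :- y₁) :- i :* (r :- y₁)) :+ (r :- t) :* (i :* δ :- one))
      root (root ^ q) (embed y₁) (embed y₂) i δ) frob unit
    where
    i = embed ((y₂ - y₁) ⁻¹)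
    δ = embed (y₂ - y₁)
    unit : i Q.* δ ≃ Q.1#
    unit = Q.trans (Q.sym (embed-* _ _)) (embed-cong (inverseˡ (x-y≢0 (λ e → ne (sym e)))))
    idempotent : (i Q.* (root Q.- embed y₁)) Q.* (i Q.* (root Q.- embed y₁)) ≃ i Q.* (root Q.- embed y₁)
    idempotent = QS.linear₃ (QS.solve 5 (λ r y₁ y₂ i δ → i :* (r :- y₁) :* (i :* (r :- y₁)) :- i :* (r :- y₁)
        := i :* i :* ((r :- y₁) :* (r :- y₂) :- con 0) :+ i :* (r :- y₁) :* (i :* δ :- one) :+ :- (i :* i :* (r :- y₁)) :* (δ :- (y₂ :- y₁)))
        root (embed y₁) (embed y₂) i δ) (product-form y₁ y₂ s p) unit
      (Hom.push embedHom 2 (λ y₁ y₂ → y₂ :- y₁) y₁ y₂)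
    frob : i Q.* (root ^ q Q.- embed y₁) ≃ i Q.* (root Q.- embed y₁)
    frob = Q.trans (Q.*-cong (Q.sym (scalar^ _)) (Q.trans (Q.+-congˡ (Q.-‿cong (Q.sym (scalar^ y₁)))) (Q.sym (Hom.push frobenius 2 (λ r y → r :- y) root (embed y₁)))))
      (Q.trans (Q.sym (^-* q i (root Q.- embed y₁))) (idem^q (q-2)))
      where
      idem^q : (∃ λ m → q ≡ suc (suc m)) → (i Q.* (root Q.- embed y₁)) ^ q ≃ i Q.* (root Q.- embed y₁)
      idem^q (m , e) = subst (λ n → (i Q.* (root Q.- embed y₁)) ^ n ≃ i Q.* (root Q.- embed y₁)) (sym e) (idempotent-^ idempotent (suc m))

  -- The difference y - y₀ has square zero, and q ≥ 2.
  frobenius-double : ∀ y₀ → y₀ + y₀ ≡ - h → y₀ * y₀ ≡ - f → root ^ q ≃ embed y₀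
  frobenius-double y₀ s p = QS.x-y≈0⇒x≈y (Q.trans (Q.+-congˡ (Q.-‿cong (Q.sym (scalar^ y₀))))
    (Q.trans (Q.sym (Hom.push frobenius 2 (λ r y → r :- y) root (embed y₀))) (nil^q q-2)))
    where
    nil^q : (∃ λ m → q ≡ suc (suc m)) → (root Q.- embed y₀) ^ q ≃ Q.0#
    nil^q (m , e) = subst (λ n → (root Q.- embed y₀) ^ n ≃ Q.0#) (sym e) (nilpotent-^ (product-form y₀ y₀ s p) m)

  double-nilpotent : ∀ y₀ → y₀ + y₀ ≡ - h → y₀ * y₀ ≡ - f → (root Q.- embed y₀) Q.* (root Q.- embed y₀) ≃ Q.0#
  double-nilpotent y₀ = product-form y₀ y₀

  module Inert (irreducible : ∀ y → y * y + h * y ≢ f) where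
    norm≢0 : ∀ z → ¬ z ≃ Q.0# → norm z ≢ 0#
    norm≢0 (a , b) z≄0 e with b ≟ 0#
    ... | no b≢0 = irreducible y (*-cancelʳ (*≢0 b≢0 b≢0) (linear₂ (solve 5 (λ a b h f y → (y :* y :+ h :* y) :* (b :* b) :- f :* (b :* b)
        := (y :* b :- a :+ h :* b) :* (y :* b :- :- a) :+ one :* (a :* a :- a :* b :* h :- b :* b :* f :- con 0)) a b h f y)
        (/-cancel b≢0 (- a)) e))
      where y = (- a) / b
    ... | yes b≡0 = z≄0 (a≡0 ,, b≡0)
      where
      a≡0 : a ≡ 0#
      a≡0 with zero-product {a} {a} (linear₂ (solve 4 (λ a b h f → a :* a :- con 0 := one :* (a :* a :- a :* b :* h :- b :* b :* f :- con 0) :+ (a :* h :+ b :* f) :* (b :- con 0)) a b h f) e b≡0)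
      ... | inj₁ p = p
      ... | inj₂ p = p

    private
      module Ev = EvalIn embedHom root
      module EvH = Hom Ev.evalInHom

      product≢0 : ∀ as → norm (EvH.φ (∏X- as)) ≢ 0#
      product≢0 [] e = norm≢0 Q.1# (λ e → 0≢1 (sym (re e))) (trans (sym (norm-cong EvH.1-hom)) e)
      product≢0 (a ∷ as) e = *≢0 (norm≢0 _ linear≄0) (product≢0 as) (trans (sym (norm-* _ _)) (trans (sym (norm-cong (EvH.*-hom (X- a) (∏X- as)))) e))
        where
        linear≄0 : ¬ EvH.φ (X- a) ≃ Q.0#
        linear≄0 e = 0≢1 (trans (sym (im e)) (trans (im (QS.solve 2 (λ m r → m :+ r :* (one :+ r :* con 0) := m :+ r) (embed (- a)) root))
          (+-identityˡ 1#)))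

    -- Otherwise the product of y - a over all a in F, which is y^q - y, would be zero; but none of
    -- its factors is, and the ring is a field.
    root^q≄root : ¬ root ^ q ≃ root
    root^q≄root e = product≢0 elements (trans (norm-cong (Q.trans (EvH.cong (P.sym X^q-X)) (Q.trans
        (Q.trans (EvH.+-hom _ _) (Q.+-cong (Q.trans (PowerHom.hom-^ Ev.evalInHom q X) (^-cong q Ev.evalIn-X)) (Q.trans (EvH.⊖-hom X) (Q.-‿cong Ev.evalIn-X))))
        (QS.x≈y⇒x-y≈0 e)))) (solve 2 (λ h f → con 0 :* con 0 :- con 0 :* con 0 :* h :- con 0 :* con 0 :* f := con 0) h f))
      where
      open FieldPoly F using (module P)

    -- t = y^q satisfies the same quadratic equation as y, so (t - y)(t + y + h) = 0, and the first
    -- factor was excluded.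
    frobenius-inert : root ^ q Q.+ root Q.+ embed h ≃ Q.0#
    frobenius-inert = decide (norm (root ^ q Q.+ root Q.+ embed h) ≟ 0#)
      where
      t-root : root ^ q Q.* root ^ q Q.+ embed h Q.* root ^ q ≃ embed f
      t-root = QS.linear₃ (QS.solve 5 (λ t h′ h f′ f → t :* t :+ h :* t :- f := one :* (t :* t :+ h′ :* t :- f′) :+ :- t :* (h′ :- h) :+ one :* (f′ :- f))
        (root ^ q) (embed h ^ q) (embed h) (embed f ^ q) (embed f))
        (Hom.transfer frobenius 3 (λ r h f → r :* r :+ h :* r := f) root (embed h) (embed f) root-eq) (scalar^ h) (scalar^ f)
      product : (root ^ q Q.- root) Q.* (root ^ q Q.+ root Q.+ embed h) ≃ Q.0#
      product = QS.linear₂ (QS.solve 4 (λ t r h f → (t :- r) :* (t :+ r :+ h) :- con 0 := one :* (t :* t :+ h :* t :- f) :+ :- one :* (r :* r :+ h :* r :- f))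
        (root ^ q) root (embed h) (embed f)) t-root root-eq
      norm-0 : norm Q.0# ≡ 0#
      norm-0 = solve 2 (λ h f → con 0 :* con 0 :- con 0 :* con 0 :* h :- con 0 :* con 0 :* f := con 0) h f
      ≃0? : ∀ z → norm z ≡ 0# → z ≃ Q.0#
      ≃0? (a , b) e with a ≟ 0# | b ≟ 0#
      ... | yes a≡0 | yes b≡0 = a≡0 ,, b≡0
      ... | yes _ | no b≢0 = contradiction e (norm≢0 (a , b) (λ z → b≢0 (im z)))
      ... | no a≢0 | _ = contradiction e (norm≢0 (a , b) (λ z → a≢0 (re z)))
      decide : Dec (norm (root ^ q Q.+ root Q.+ embed h) ≡ 0#) → root ^ q Q.+ root Q.+ embed h ≃ Q.0#
      decide (yes e) = ≃0? _ e
      decide (no ne) = contradiction (QS.x-y≈0⇒x≈y (≃0? _ (*≡0 (trans (sym (norm-* _ _)) (trans (norm-cong product) norm-0)) ne))) root^q≄root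

-- The list of points, arranged by fibres over x.

module Points (F : FiniteField) (W : Weierstrass F) where
  open FiniteField F
  open Weierstrass W
  open FieldKit F
  open FieldFinite F using (∈-elements; unique-elements)
  open FieldPoly F using (eval)
  open Coordinate F W using (η; cubic)
  open Addition F W
  open Lists
  open import Data.List using (List; []; _∷_; map; filter; concatMap; length)
  open import Data.List.Relation.Unary.All as All using (All; []; _∷_)
  open import Data.List.Relation.Unary.All.Properties using () renaming (map⁺ to All-map⁺)
  open import Data.List.Relation.Unary.AllPairs as AllPairs using (AllPairs; []; _∷_)
  open import Data.List.Relation.Unary.AllPairs.Properties using () renaming (map⁺ to AllPairs-map⁺)
  open import Data.List.Relation.Unary.Unique.Propositional.Properties using (filter⁺; concat⁺)
  open import Data.Nat using (ℕ; suc)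
  open import Relation.Binary.PropositionalEquality

  on? : ∀ x y → Dec (On (just (x , y)))
  on? x y = (y * y + a₁ * x * y + a₃ * y) ≟ (x * x * x + a₂ * x * x + a₄ * x + a₆)

  row : Carrier → List Point
  row x = map (λ y → just (x , y)) (filter (on? x) elements)

  points-rows : points F W ≡ nothing ∷ concatMap row elements
  points-rows = cong (nothing ∷_) (go elements)
    where
    open import Data.List using (_++_)
    open import Data.Bool using (if_then_else_)
    go : ∀ xs → concatMap (λ x → concatMap (λ y → if onCurve F W x y then just (x , y) ∷ [] else []) elements) xs ≡ concatMap row xs
    go []       = refl
    go (x ∷ xs) = cong₂ _++_ (concatMap-if (on? x) (λ y → just (x , y)) elements) (go xs)

  row-sound : ∀ {x P} → P ∈ row x → ∃ λ y → P ≡ just (x , y) × On (just (x , y))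
  row-sound {x} i with ∈-map⁻ (λ y → just (x , y)) i
  ... | y , y∈ , refl = y , refl , proj₂ (∈-filter⁻ (on? x) {xs = elements} y∈)

  points-sound : ∀ {P} → P ∈ points F W → On P
  points-sound {P} i with subst (P ∈_) points-rows i
  ... | here refl = tt
  ... | there j with ∈-concat⁻′ (map row elements) j
  ...   | xs , P∈ , xs∈ with ∈-map⁻ row xs∈
  ...     | x , _ , refl with row-sound P∈
  ...       | y , refl , on = on

  points-complete : ∀ {P} → On P → P ∈ points F W
  points-complete {nothing} _ = subst (nothing ∈_) (sym points-rows) (here refl)
  points-complete {just (x , y)} on = subst (just (x , y) ∈_) (sym points-rows)
    (there (∈-concat⁺′ (∈-map⁺ (λ y → just (x , y)) (∈-filter⁺ (on? x) (∈-elements y) on)) (∈-map⁺ row (∈-elements x))))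

  private
    y-of x-of : Point → Carrier
    y-of nothing        = 0#
    y-of (just (_ , y)) = y
    x-of nothing        = 0#
    x-of (just (x , _)) = x

    row-unique : ∀ x → Unique (row x)
    row-unique x = unique-map (λ _ _ e → cong y-of e) (filter⁺ (on? x) unique-elements)

  points-unique : Unique (points F W)
  points-unique = subst Unique (sym points-rows) (All.tabulate not-nothing
    ∷ concat⁺ (All-map⁺ (All.tabulate λ {x} _ → row-unique x)) (AllPairs-map⁺ (AllPairs.map disjoint unique-elements)))
    where
    not-nothing : ∀ {P} → P ∈ concatMap row elements → nothing ≢ P
    not-nothing j refl with ∈-concat⁻′ (map row elements) j
    ... | xs , P∈ , xs∈ with ∈-map⁻ row xs∈
    ...   | x , _ , refl with row-sound P∈
    ...     | _ , () , _
    disjoint : ∀ {x x′} → x ≢ x′ → ∀ {P} → P ∈ row x × P ∈ row x′ → ⊥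
    disjoint h (i , j) with row-sound i | row-sound j
    ... | _ , refl , _ | _ , e , _ = h (cong x-of e)

  count : Carrier → ℕ
  count a = length (QuadraticRoots.roots F (eval a η) (eval a cubic))

  length-points : length (points F W) ≡ suc (∑ count elements)
  length-points = trans (cong length points-rows) (cong suc (trans (length-concatMap row elements)
    (∑-cong elements λ {x} _ → trans (length-map _ (filter (on? x) elements))
      (length-filter-cong (on? x) (λ y → (y * y + eval x η * y) ≟ eval x cubic)
        (λ y e → linear₁ (solve 7 (λ a₁ a₂ a₃ a₄ a₆ x y →
            y :* y :+ (a₃ :+ x :* (a₁ :+ x :* con 0)) :* y :- (a₆ :+ x :* (a₄ :+ x :* (a₂ :+ x :* (one :+ x :* con 0))))
            := one :* (y :* y :+ a₁ :* x :* y :+ a₃ :* y :- (x :* x :* x :+ a₂ :* x :* x :+ a₄ :* x :+ a₆))) a₁ a₂ a₃ a₄ a₆ x y) e)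
        (λ y e → linear₁ (solve 7 (λ a₁ a₂ a₃ a₄ a₆ x y →
            y :* y :+ a₁ :* x :* y :+ a₃ :* y :- (x :* x :* x :+ a₂ :* x :* x :+ a₄ :* x :+ a₆)
            := one :* (y :* y :+ (a₃ :+ x :* (a₁ :+ x :* con 0)) :* y :- (a₆ :+ x :* (a₄ :+ x :* (a₂ :+ x :* (one :+ x :* con 0)))))) a₁ a₂ a₃ a₄ a₆ x y) e)
        elements)))) 

-- Orders of points and the exponent of the group.

module Exponent (F : FiniteField) (W : Weierstrass F) (nonsing : disc F W ≢ FiniteField.0# F) where
  open import Relation.Binary.PropositionalEquality

  open GroupLaw F W nonsing using (Point; On; _⊞_; ⊟_; ⊞-on; ⊟-on; ⊞-assoc; ⊞-comm; ⊞-inverse)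
  open Points F W
  open import Data.Bool using (true; false)
  open import Data.List using ([]; _∷_; map; foldr; length; applyUpTo)
  open import Data.Nat as ℕ using (ℕ; zero; suc; _<_; _≤_; z≤n; s≤s; _+_)
  import Data.Nat.Properties as ℕ
  open import Data.Nat.Divisibility using (_∣_; ∣-trans; 1∣_)
  open import Data.Nat.LCM using (lcm; m∣lcm[m,n]; n∣lcm[m,n]; lcm-least)

  module G = FiniteAbelian On _⊞_ nothing ⊞-on tt ⊞-assoc ⊞-comm (λ _ → refl) ⊟_ ⊟-on (λ P _ → ⊞-inverse P)
  open G using (pow)

  N λE : ℕ
  N  = length (points F W)
  λE = foldr lcm 1 (map (order F W) (points F W))

  pow-N : ∀ {P} → On P → pow N P ≡ nothing
  pow-N = G.lagrange points-unique points-sound points-complete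

  smul-pow : ∀ n P → smul F W n P ≡ pow n P
  smul-pow zero    P = refl
  smul-pow (suc n) P = cong (P ⊞_) (smul-pow n P)

  private
    isO-false : ∀ {Q} → isO F Q ≡ false → Q ≢ nothing
    isO-false () refl

    isO-true : ∀ {Q} → isO F Q ≡ true → Q ≡ nothing
    isO-true {nothing} _ = refl

    IsOrder : Point → ℕ → Set
    IsOrder P r = 0 < r × pow r P ≡ nothing × (∀ m → 0 < m → m < r → pow m P ≢ nothing)

    -- `upTo` unfolds by shifting a function, so the induction carries the offset `k`: multiples up
    -- to `k` have been excluded and the remaining candidates are k + 1, ..., k + m. Lagrange's
    -- theorem later guarantees a success.
    search : ∀ P (f : ℕ → ℕ) m k → (∀ i → f i ≡ k + i) → (∀ j → 0 < j → j ≤ k → pow j P ≢ nothing) →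
      (∃ λ n → k < n × n ≤ k + m × pow n P ≡ nothing) → IsOrder P (orderSearch F W P (map suc (applyUpTo f m)))
    search P f zero    k _ _ (n , k<n , n≤k , _) = ⊥-elim (ℕ.<⇒≱ k<n (ℕ.≤-trans n≤k (ℕ.≤-reflexive (ℕ.+-identityʳ k))))
    search P f (suc m) k f≡ none (n , k<n , n≤ , e) with isO F (smul F W (suc (f 0)) P) in eq
    ... | true  = s≤s z≤n , trans (sym (smul-pow (suc (f 0)) P)) (isO-true eq)
      , λ { j 0<j (s≤s j≤) → none j 0<j (ℕ.≤-trans j≤ (ℕ.≤-reflexive (trans (f≡ 0) (ℕ.+-identityʳ k)))) }
    ... | false = search P (λ i → f (suc i)) m (suc k) (λ i → trans (f≡ (suc i)) (ℕ.+-suc k i)) none′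
        (n , ℕ.≤∧≢⇒< k<n (λ { refl → ¬suc-k e }) , ℕ.≤-trans n≤ (ℕ.≤-reflexive (ℕ.+-suc k m)) , e)
      where
      ¬suc-k : pow (suc k) P ≢ nothing
      ¬suc-k h = isO-false eq (trans (smul-pow (suc (f 0)) P) (trans (cong (λ i → pow (suc i) P) (trans (f≡ 0) (ℕ.+-identityʳ k))) h))
      none′ : ∀ j → 0 < j → j ≤ suc k → pow j P ≢ nothing
      none′ j 0<j j≤ with ℕ.m≤n⇒m<n∨m≡n j≤
      ... | inj₁ (s≤s j≤k) = none j 0<j j≤k
      ... | inj₂ refl = ¬suc-k

    0<N : 0 < N
    0<N = go (points-complete {nothing} tt)
      where
      go : ∀ {P : Point} {xs} → P ∈ xs → 0 < length xs
      go (here _)  = s≤s z≤n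
      go (there _) = s≤s z≤n

    order-spec : ∀ {P} → On P → IsOrder P (order F W P)
    order-spec {P} p = search P (λ i → i) N 0 (λ _ → refl) (λ { (suc j) _ () }) (N , 0<N , ℕ.≤-refl , pow-N p)

    order∣N : ∀ {P} → On P → order F W P ∣ N
    order∣N p = let (0<o , e , least) = order-spec p in G.minimal-∣ p 0<o e least (pow-N p)

    lcm-multiple : ∀ {P} xs → P ∈ xs → order F W P ∣ foldr lcm 1 (map (order F W) xs)
    lcm-multiple (x ∷ xs) (here refl) = m∣lcm[m,n] _ _
    lcm-multiple (x ∷ xs) (there i) = ∣-trans (lcm-multiple xs i) (n∣lcm[m,n] (order F W x) _)

    lcm-divides : ∀ xs {n} → (∀ {P} → P ∈ xs → order F W P ∣ n) → foldr lcm 1 (map (order F W) xs) ∣ n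
    lcm-divides []       h = 1∣ _
    lcm-divides (x ∷ xs) h = lcm-least (h (here refl)) (lcm-divides xs (λ i → h (there i)))

  exponent-kills : ∀ {P} → On P → pow λE P ≡ nothing
  exponent-kills {P} p = let (_ , e , _) = order-spec p in G.pow-∣ p (lcm-multiple (points F W) (points-complete p)) e

  exponent∣N : λE ∣ N
  exponent∣N = lcm-divides (points F W) (λ i → order∣N (points-sound i))

-- Multiplicities of roots of polynomials.

module RootPowers (F : FiniteField) where
  open FiniteField F
  open FieldKit F
  open FieldPoly F
  open FieldFinite F
  open Lists
  open import Data.List using (List; []; _∷_)
  open import Data.List.Relation.Unary.All as All using (All; []; _∷_)
  open import Data.Nat as ℕ using (ℕ; zero; suc)
  import Data.Nat.Properties as ℕ
  open import Relation.Binary.PropositionalEquality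

  ∏X-^ : (Carrier → ℕ) → List Carrier → Poly
  ∏X-^ m []       = const 1#
  ∏X-^ m (a ∷ as) = (X- a) PP.^ m a ⊗ ∏X-^ m as

  top-^ : ∀ a k → Top ((X- a) PP.^ k) k
  top-^ a zero    = top (deg-const 1#) (λ e → 0≢1 (sym e))
  top-^ a (suc k) = top-⊗′ (top-X- a) (top-^ a k)

  top-∏X-^ : ∀ m as → Top (∏X-^ m as) (∑ m as)
  top-∏X-^ m []       = top (deg-const 1#) (λ e → 0≢1 (sym e))
  top-∏X-^ m (a ∷ as) = top-⊗′ (top-^ a (m a)) (top-∏X-^ m as)

  eval-^≢0 : ∀ {a b} k → a ≢ b → eval a ((X- b) PP.^ k) ≢ 0#
  eval-^≢0 {a} zero    h e = 0≢1 (sym (trans (sym (eval-const a 1#)) e))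
  eval-^≢0 {a} {b} (suc k) h e = *≢0 (λ z → h (x-y≈0⇒x≈y (trans (sym (eval-X- a b)) z))) (eval-^≢0 k h) (trans (sym (eval-⊗ a (X- b) _)) e)

  eval-∏X-^≢0 : ∀ {a} m as → (∀ {b} → b ∈ as → a ≢ b) → eval a (∏X-^ m as) ≢ 0#
  eval-∏X-^≢0 {a} m []       h e = 0≢1 (sym (trans (sym (eval-const a 1#)) e))
  eval-∏X-^≢0 {a} m (b ∷ as) h e = *≢0 (eval-^≢0 (m b) (h (here refl))) (eval-∏X-^≢0 m as (λ i → h (there i))) (trans (sym (eval-⊗ a ((X- b) PP.^ m b) _)) e)

  ⊗-cancelˡ : ∀ {p u v} → ¬ p ≋ [] → p ⊗ u ≋ p ⊗ v → u ≋ v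
  ⊗-cancelˡ {p} {u} {v} h e with poly-zero-product {p} {u ⊕ ⊖ v} (P.trans (PS.solve 3 (λ p u v → p :* (u :- v) := p :* u :- p :* v) p u v) (PS.x≈y⇒x-y≈0 e))
  ... | inj₁ z = contradiction z h
  ... | inj₂ z = PS.x-y≈0⇒x≈y z

  -- X - a is prime and does not divide `Q`, so its factors pass to `g` one at a time.
  power-divides : ∀ {a Q g w} k → eval a Q ≢ 0# → (X- a) PP.^ k ⊗ w ≋ Q ⊗ g → ∃ λ v → g ≋ (X- a) PP.^ k ⊗ v
  power-divides {g = g} zero _ _ = g , P.sym (P.*-identityˡ g)
  power-divides {a} {Q} {g} {w} (suc k) h e =
    let (v , ev) = power-divides k h (⊗-cancelˡ (top-≋0 (top-X- a)) (P.trans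
          (PS.solve 3 (λ l p w → l :* (p :* w) := l :* p :* w) (X- a) ((X- a) PP.^ k) w)
          (P.trans e (P.trans (P.*-congˡ g≋) (PS.solve 3 (λ Q l g → Q :* (l :* g) := l :* (Q :* g)) Q (X- a) (quot a g))))))
    in v , P.trans g≋ (P.trans (P.*-congˡ ev) (P.sym (P.*-assoc _ _ _)))
    where
    g≋ : g ≋ (X- a) ⊗ quot a g
    g≋ = root-factor (*≡0 (trans (*-comm _ _) (trans (sym (eval-⊗ a Q g)) (trans (sym (eval-cong a e))
      (trans (eval-⊗ a ((X- a) PP.^ suc k) w) (trans (cong (_* eval a w) (trans (eval-⊗ a (X- a) _) (trans (cong (_* eval a ((X- a) PP.^ k)) (trans (eval-X- a a) (-‿inverseʳ a)))
        (zeroˡ _)))) (zeroˡ _)))))) h)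

  ∏X-^-divides : ∀ m {n} as → Unique as → (∀ {a} → a ∈ as → ∃ λ g → n ≋ (X- a) PP.^ m a ⊗ g) → ∃ λ g → n ≋ ∏X-^ m as ⊗ g
  ∏X-^-divides m {n} [] _ _ = n , P.sym (P.*-identityˡ n)
  ∏X-^-divides m {n} (a ∷ as) (a∉ ∷ u) h =
    let (g , e) = ∏X-^-divides m as u (λ i → h (there i))
        (w , ew) = h (here refl)
        (v , ev) = power-divides (m a) (eval-∏X-^≢0 m as (All.lookup a∉)) (P.trans (P.sym ew) e)
    in v , P.trans e (P.trans (P.*-congˡ ev) (PS.solve 3 (λ p l v → p :* (l :* v) := l :* p :* v) (∏X-^ m as) ((X- a) PP.^ m a) v))

  ^-+ : ∀ p m n → p PP.^ m ⊗ p PP.^ n ≋ p PP.^ (m ℕ.+ n)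
  ^-+ p zero    n = P.*-identityˡ _
  ^-+ p (suc m) n = P.trans (P.*-assoc p _ _) (P.*-congˡ (^-+ p m n))

  factor-out : ∀ {p n} a → Top p n → ∃₂ λ k g → p ≋ (X- a) PP.^ k ⊗ g × eval a g ≢ 0#
  factor-out {p} {n} a t = go (eval a p ≟ 0#) n t
    where
    go : ∀ {p} → Dec (eval a p ≡ 0#) → ∀ n → Top p n → ∃₂ λ k g → p ≋ (X- a) PP.^ k ⊗ g × eval a g ≢ 0#
    go {p} (no h) n t = 0 , p , P.sym (P.*-identityˡ p) , h
    go {p} (yes e) zero t = contradiction e (top-eval a t)
    go {p} (yes e) (suc n) t with zero-or-top (quot a p)
    ... | inj₁ z = contradiction (P.trans (root-factor e) (P.trans (P.*-congˡ z) (P.zeroʳ _))) (top-≋0 t)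
    ... | inj₂ (m , s) with ℕ.suc-injective (top-unique (top-⊗′ (top-X- a) s) (top-cong (root-factor e) t))
    ...   | refl with go (eval a (quot a p) ≟ 0#) m s
    ...     | k , g , eq , h = suc k , g , P.trans (root-factor e) (P.trans (P.*-congˡ eq) (P.sym (P.*-assoc _ _ _))) , h

  multiplicity-unique : ∀ {a g h} m n → eval a g ≢ 0# → eval a h ≢ 0# → (X- a) PP.^ m ⊗ g ≋ (X- a) PP.^ n ⊗ h → m ≡ n
  multiplicity-unique zero zero _ _ _ = refl
  multiplicity-unique {a} {g} {h} zero (suc n) g≢0 _ e = contradiction (trans (eval-cong a (P.trans (P.sym (P.*-identityˡ g)) e)) (eval-suc-power n h)) g≢0
    where
    eval-suc-power : ∀ n h → eval a ((X- a) PP.^ suc n ⊗ h) ≡ 0#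
    eval-suc-power n h = trans (eval-⊗ a ((X- a) PP.^ suc n) h) (trans (cong (_* eval a h) (trans (eval-⊗ a (X- a) _) (trans (cong (_* eval a ((X- a) PP.^ n)) (trans (eval-X- a a) (-‿inverseʳ a))) (zeroˡ _)))) (zeroˡ _))
  multiplicity-unique {a} {g} {h} (suc m) zero g≢0 h≢0 e = sym (multiplicity-unique zero (suc m) h≢0 g≢0 (P.sym e))
  multiplicity-unique {a} {g} {h} (suc m) (suc n) g≢0 h≢0 e = cong suc (multiplicity-unique m n g≢0 h≢0
    (⊗-cancelˡ (top-≋0 (top-X- a)) (P.trans (P.sym (P.*-assoc _ _ _)) (P.trans e (P.*-assoc _ _ _)))))

  -- Even order of vanishing at a, order zero included.
  Even : Carrier → Poly → Set
  Even a p = ∃₂ λ k g → p ≋ (X- a) PP.^ (k ℕ.+ k) ⊗ g × eval a g ≢ 0#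

  -- Orders of vanishing add up, and a square has even order everywhere.
  even-quotient : ∀ {a p r s} → Even a p → p ⊗ r ≋ s ⊗ s → ¬ r ≋ [] → ¬ s ≋ [] → Even a r
  even-quotient {a} {p} {r} {s} (k , g , ep , g≢0) e r≢0 s≢0 =
    let (i , g′ , er , g′≢0) = factor-out a (proj₂ (nonzero-top r≢0))
        (j , h , es , h≢0)   = factor-out a (proj₂ (nonzero-top s≢0))
        powers = multiplicity-unique (k ℕ.+ k ℕ.+ i) (j ℕ.+ j) (nonzero g≢0 g′≢0) (nonzero h≢0 h≢0)
          (P.trans (gather (k ℕ.+ k) i g g′) (P.trans (P.*-cong (P.sym ep) (P.sym er)) (P.trans e (P.trans (P.*-cong es es) (P.sym (gather j j h h))))))
    in j ℕ.∸ k , g′ , P.trans er (P.*-congʳ (P.reflexive (cong ((X- a) PP.^_) (even-part k i j powers)))) , g′≢0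
    where
    nonzero : ∀ {u v} → eval a u ≢ 0# → eval a v ≢ 0# → eval a (u ⊗ v) ≢ 0#
    nonzero {u} {v} hu hv z = *≢0 hu hv (trans (sym (eval-⊗ a u v)) z)
    gather : ∀ m n u v → (X- a) PP.^ (m ℕ.+ n) ⊗ (u ⊗ v) ≋ (X- a) PP.^ m ⊗ u ⊗ ((X- a) PP.^ n ⊗ v)
    gather m n u v = P.trans (P.*-congʳ (P.sym (^-+ (X- a) m n))) (PS.solve 4 (λ x y u v → x :* y :* (u :* v) := x :* u :* (y :* v)) ((X- a) PP.^ m) ((X- a) PP.^ n) u v)
    even-part : ∀ k i j → k ℕ.+ k ℕ.+ i ≡ j ℕ.+ j → i ≡ (j ℕ.∸ k) ℕ.+ (j ℕ.∸ k)
    even-part zero i j e = e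
    even-part (suc k) i (suc j) e = even-part k i j (ℕ.suc-injective (trans (cong (ℕ._+ i) (sym (ℕ.+-suc k k))) (trans (ℕ.suc-injective e) (ℕ.+-suc j j))))

-- The quadratic form attached to the sum and the difference of two points.

-- For points P, Q with x-coordinates X : Z and x : 1, the pair x(P + Q), x(P − Q)
-- is the pair of roots of the binary form A T² − B T S + C S².
module Kummer (R : CommutativeRing 0ℓ 0ℓ) (b₂ b₄ b₆ b₈ : CommutativeRing.Carrier R) where
  open CommutativeRing R hiding (zero)
  open RingSolve R

  module _ (x X Z : Carrier) where
    formA formB formC : Carrier
    formA = (X - x * Z) * (X - x * Z)
    formB = κ 2 * ((x * X) * (X + x * Z)) + b₂ * ((x * X) * Z) + b₄ * ((X + x * Z) * Z) + b₆ * (Z * Z)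
    formC = (x * X) * (x * X) - b₄ * ((x * X) * Z) - b₆ * ((X + x * Z) * Z) - b₈ * (Z * Z)

  module _ (x : Carrier) where
    -- The duplication formula is x(2P) = φ₂ / ψ², with ψ² = (2y + a₁x + a₃)² on the curve.
    ψ² φ₂ : Carrier
    ψ² = κ 4 * x * x * x + b₂ * x * x + κ 2 * b₄ * x + b₆
    φ₂ = x * x * x * x - b₄ * x * x - κ 2 * b₆ * x - b₈

  -- The cofactors u and v express the discriminant as u φ₂ + v ψ².
  module _ (x : Carrier) where
    cofactorφ cofactorψ : Carrier
    cofactorφ = b₂ * b₂ - κ 48 * x * x - κ 8 * b₂ * x - κ 32 * b₄
    cofactorψ = κ 12 * x * x * x - b₂ * x * x - κ 10 * b₄ * x - κ 27 * b₆ + b₂ * b₄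

  Coprime : Carrier → Carrier → Set
  Coprime X Z = ∃₂ λ α β → α * X + β * Z ≈ 1#

  -- T : S is a root of the form, so it is the x-coordinate of the sum or of the difference; the
  -- form cannot tell which.
  Related : (x X Z T S : Carrier) → Set
  Related x X Z T S = formA x X Z * (T * T) - formB x X Z * (T * S) + formC x X Z * (S * S) ≈ 0#

  private
    A B : ∀ {n} → Expr n → Expr n → Expr n → Expr n → Expr n → Expr n → Expr n
    A b₂ b₄ b₆ x X Z = (X :- x :* Z) :* (X :- x :* Z)
    B b₂ b₄ b₆ x X Z = con 2 :* ((x :* X) :* (X :+ x :* Z)) :+ b₂ :* ((x :* X) :* Z) :+ b₄ :* ((X :+ x :* Z) :* Z) :+ b₆ :* (Z :* Z)
    C : ∀ {n} → Expr n → Expr n → Expr n → Expr n → Expr n → Expr n → Expr n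
    C b₄ b₆ b₈ x X Z = (x :* X) :* (x :* X) :- b₄ :* ((x :* X) :* Z) :- b₆ :* ((X :+ x :* Z) :* Z) :- b₈ :* (Z :* Z)

  -- The relation says that three points add up to zero for suitable signs, a condition symmetric in
  -- the three.
  related-sym : ∀ x X Z T S → Related x X Z T S → Related x T S X Z
  related-sym x X Z T S h = trans (solve 9 (λ b₂ b₄ b₆ b₈ x X Z T S →
      A b₂ b₄ b₆ x T S :* (X :* X) :- B b₂ b₄ b₆ x T S :* (X :* Z) :+ C b₄ b₆ b₈ x T S :* (Z :* Z)
      := A b₂ b₄ b₆ x X Z :* (T :* T) :- B b₂ b₄ b₆ x X Z :* (T :* S) :+ C b₄ b₆ b₈ x X Z :* (S :* S)) b₂ b₄ b₆ b₈ x X Z T S) h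

  -- A unit times the discriminant lies in the ideal of the form's coefficients: modulo
  -- e = X − x Z they become 0, Z² ψ²(x), Z² φ₂(x), and e² = A.
  private
    unimodular′′ : ∀ {i x X Z} → i * (cofactorφ x * φ₂ x + cofactorψ x * ψ² x) ≈ 1# → Coprime X Z →
      ∃ λ r → ∃₂ λ s t → r * formA x X Z + s * formB x X Z + t * formC x X Z ≈ 1#
    unimodular′′ {i} {x} {X} {Z} key (α , β , bez) =
      H * H , (1# + e * H) * (γ * γ) * (i * v) , (1# + e * H) * (γ * γ) * (i * u) , proof
      where
      u = cofactorφ x
      v = cofactorψ x
      e = X - x * Z
      γ = α * x + β
      B₁ = κ 2 * x * (κ 3 * x * Z + e) + b₂ * x * Z + b₄ * Z
      C₁ = x * x * (κ 2 * x * Z + e) - b₄ * x * Z - b₆ * Z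
      D = i * (u * C₁ + v * B₁)
      -- Since γ Z = 1 - α e, multiplying i v B + i u C by γ² gives (1 - α e)² + e γ² D = 1 - e H.
      -- The witnesses then express (1 + e H)(1 - e H) + H² e² = 1, where e² is `formA`.
      H = κ 2 * α - α * α * e - γ * γ * D
      γZ : γ * Z ≈ 1# - α * e
      γZ = linear₁ (solve 5 (λ α β x X Z → (α :* x :+ β) :* Z :- (one :- α :* (X :- x :* Z)) := one :* (α :* X :+ β :* Z :- one)) α β x X Z) bez
      formB-mod : formB x X Z ≈ Z * Z * ψ² x + e * B₁
      formB-mod = solve 6 (λ b₂ b₄ b₆ x X Z → B b₂ b₄ b₆ x X Z
        := Z :* Z :* (con 4 :* x :* x :* x :+ b₂ :* x :* x :+ con 2 :* b₄ :* x :+ b₆)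
          :+ (X :- x :* Z) :* (con 2 :* x :* (con 3 :* x :* Z :+ (X :- x :* Z)) :+ b₂ :* x :* Z :+ b₄ :* Z)) b₂ b₄ b₆ x X Z
      formC-mod : formC x X Z ≈ Z * Z * φ₂ x + e * C₁
      formC-mod = solve 6 (λ b₄ b₆ b₈ x X Z → C b₄ b₆ b₈ x X Z
        := Z :* Z :* (x :* x :* x :* x :- b₄ :* x :* x :- con 2 :* b₆ :* x :- b₈)
          :+ (X :- x :* Z) :* (x :* x :* (con 2 :* x :* Z :+ (X :- x :* Z)) :- b₄ :* x :* Z :- b₆ :* Z)) b₄ b₆ b₈ x X Z
      proof : H * H * formA x X Z + (1# + e * H) * (γ * γ) * (i * v) * formB x X Z + (1# + e * H) * (γ * γ) * (i * u) * formC x X Z ≈ 1#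
      proof = linear₄ (solve 14 (λ α γ Z e i u v ψ φ B₁ C₁ A B C →
          let H = con 2 :* α :- α :* α :* e :- γ :* γ :* (i :* (u :* C₁ :+ v :* B₁)) in
          H :* H :* (e :* e) :+ (one :+ e :* H) :* (γ :* γ) :* (i :* v) :* B :+ (one :+ e :* H) :* (γ :* γ) :* (i :* u) :* C :- one
          := (one :+ e :* H) :* (γ :* γ) :* (i :* v) :* (B :- (Z :* Z :* ψ :+ e :* B₁))
            :+ (one :+ e :* H) :* (γ :* γ) :* (i :* u) :* (C :- (Z :* Z :* φ :+ e :* C₁))
            :+ (one :+ e :* H) :* (γ :* Z) :* (γ :* Z) :* (i :* (u :* φ :+ v :* ψ) :- one)
            :+ (one :+ e :* H) :* (γ :* Z :+ one :- α :* e) :* (γ :* Z :- (one :- α :* e)))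
          α γ Z e i u v (ψ² x) (φ₂ x) B₁ C₁ (formA x X Z) (formB x X Z) (formC x X Z)) formB-mod formC-mod key γZ

  abstract
    unimodular : ∀ {i x X Z} → i * (cofactorφ x * φ₂ x + cofactorψ x * ψ² x) ≈ 1# → Coprime X Z →
      ∃ λ r → ∃₂ λ s t → r * formA x X Z + s * formB x X Z + t * formC x X Z ≈ 1#
    unimodular = unimodular′′

  -- The factorisation A T² - B T S + C S² = (Z₋ T - X₋ S)(Z₊ T - X₊ S).
  record Splits (A B C X₋ Z₋ X₊ Z₊ : Carrier) : Set where
    constructor splits
    field
      A≈ : A ≈ Z₋ * Z₊
      B≈ : B ≈ X₋ * Z₊ + X₊ * Z₋
      C≈ : C ≈ X₋ * X₊

  private
    split′′ : ∀ {A B C X₋ Z₋} → Coprime X₋ Z₋ → A * (X₋ * X₋) - B * (X₋ * Z₋) + C * (Z₋ * Z₋) ≈ 0# →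
      ∃₂ λ X₊ Z₊ → Splits A B C X₋ Z₋ X₊ Z₊
    split′′ {A} {B} {C} {X} {Z} (α , β , bez) root =
      -- By the Bezout identity (X, Z) and (-β, α) form a basis. The form vanishes on the first
      -- vector, takes the value r on the second, and has mixed term p; in these coordinates it is
      -- (X S - Z T)(p (α T + β S) + r (X S - Z T)), whose second factor is the wanted one.
      p * β + r * X , r * Z - p * α , splits
      (linear₂ (solve 7 (λ A B C X Z α β →
          let p = con 2 :* C :* Z :* α :- con 2 :* A :* X :* β :- B :* (X :* α :- β :* Z) in
          let r = A :* β :* β :+ B :* α :* β :+ C :* α :* α in
          A :- Z :* (r :* Z :- p :* α)
          := :- ((α :* X :+ β :* Z :+ one) :* A) :* (α :* X :+ β :* Z :- one)
            :+ α :* α :* (A :* (X :* X) :- B :* (X :* Z) :+ C :* (Z :* Z) :- con 0)) A B C X Z α β) bez root)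
      (linear₂ (solve 7 (λ A B C X Z α β →
          let p = con 2 :* C :* Z :* α :- con 2 :* A :* X :* β :- B :* (X :* α :- β :* Z) in
          let r = A :* β :* β :+ B :* α :* β :+ C :* α :* α in
          B :- (X :* (r :* Z :- p :* α) :+ (p :* β :+ r :* X) :* Z)
          := :- ((α :* X :+ β :* Z :+ one) :* B) :* (α :* X :+ β :* Z :- one)
            :+ :- (con 2 :* α :* β) :* (A :* (X :* X) :- B :* (X :* Z) :+ C :* (Z :* Z) :- con 0)) A B C X Z α β) bez root)
      (linear₂ (solve 7 (λ A B C X Z α β →
          let p = con 2 :* C :* Z :* α :- con 2 :* A :* X :* β :- B :* (X :* α :- β :* Z) in
          let r = A :* β :* β :+ B :* α :* β :+ C :* α :* α in
          C :- X :* (p :* β :+ r :* X)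
          := :- ((α :* X :+ β :* Z :+ one) :* C) :* (α :* X :+ β :* Z :- one)
            :+ β :* β :* (A :* (X :* X) :- B :* (X :* Z) :+ C :* (Z :* Z) :- con 0)) A B C X Z α β) bez root)
      where
      p = κ 2 * C * Z * α - κ 2 * A * X * β - B * (X * α - β * Z)
      r = A * β * β + B * α * β + C * α * α

  abstract
    split : ∀ {A B C X₋ Z₋} → Coprime X₋ Z₋ → A * (X₋ * X₋) - B * (X₋ * Z₋) + C * (Z₋ * Z₋) ≈ 0# →
      ∃₂ λ X₊ Z₊ → Splits A B C X₋ Z₋ X₊ Z₊
    split = split′′

  private
    -- A primitive form has primitive factors: each of A, B, C is a combination of X₊ and Z₊, so a
    -- combination equal to 1 turns into a Bezout identity.
    splits-coprime′′ : ∀ {A B C X₋ Z₋ X₊ Z₊} → (∃ λ r → ∃₂ λ s t → r * A + s * B + t * C ≈ 1#) →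
      Splits A B C X₋ Z₋ X₊ Z₊ → Coprime X₊ Z₊
    splits-coprime′′ {A} {B} {C} {X₋} {Z₋} {X₊} {Z₊} (r , s , t , e) (splits ea eb ec) = s * Z₋ + t * X₋ , r * Z₋ + s * X₋ ,
      linear₄ (solve 10 (λ r s t A B C X₋ Z₋ X₊ Z₊ → (s :* Z₋ :+ t :* X₋) :* X₊ :+ (r :* Z₋ :+ s :* X₋) :* Z₊ :- one
        := one :* (r :* A :+ s :* B :+ t :* C :- one) :+ :- r :* (A :- Z₋ :* Z₊) :+ :- s :* (B :- (X₋ :* Z₊ :+ X₊ :* Z₋)) :+ :- t :* (C :- X₋ :* X₊))
        r s t A B C X₋ Z₋ X₊ Z₊) e ea eb ec

  abstract
    splits-coprime : ∀ {A B C X₋ Z₋ X₊ Z₊} → (∃ λ r → ∃₂ λ s t → r * A + s * B + t * C ≈ 1#) →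
      Splits A B C X₋ Z₋ X₊ Z₊ → Coprime X₊ Z₊
    splits-coprime = splits-coprime′′

  splits-swap : ∀ {A B C X₋ Z₋ X₊ Z₊} → Splits A B C X₋ Z₋ X₊ Z₊ → Splits A B C X₊ Z₊ X₋ Z₋
  splits-swap (splits ea eb ec) = splits (trans ea (*-comm _ _)) (trans eb (+-comm _ _)) (trans ec (*-comm _ _))

  private
    splits-related′′ : ∀ {x X Z X₋ Z₋ X₊ Z₊} → Splits (formA x X Z) (formB x X Z) (formC x X Z) X₋ Z₋ X₊ Z₊ → Related x X Z X₊ Z₊
    splits-related′′ {x} {X} {Z} {X₋} {Z₋} {X₊} {Z₊} (splits ea eb ec) =
      linear₃ (solve 7 (λ A B C X₋ Z₋ X₊ Z₊ → A :* (X₊ :* X₊) :- B :* (X₊ :* Z₊) :+ C :* (Z₊ :* Z₊) :- con 0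
        := X₊ :* X₊ :* (A :- Z₋ :* Z₊) :+ :- (X₊ :* Z₊) :* (B :- (X₋ :* Z₊ :+ X₊ :* Z₋)) :+ Z₊ :* Z₊ :* (C :- X₋ :* X₊))
        (formA x X Z) (formB x X Z) (formC x X Z) X₋ Z₋ X₊ Z₊) ea eb ec

  abstract
    splits-related : ∀ {x X Z X₋ Z₋ X₊ Z₊} → Splits (formA x X Z) (formB x X Z) (formC x X Z) X₋ Z₋ X₊ Z₊ → Related x X Z X₊ Z₊
    splits-related = splits-related′′

  private
    discriminant′′ : κ 4 * b₈ ≈ b₂ * b₆ - b₄ * b₄ → ∀ x → cofactorφ x * φ₂ x + cofactorψ x * ψ² x
      ≈ (- (b₂ * b₂ * b₈)) - κ 8 * b₄ * b₄ * b₄ - κ 27 * b₆ * b₆ + κ 9 * b₂ * b₄ * b₆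
    discriminant′′ e x = linear₁ (solve 5 (λ b₂ b₄ b₆ b₈ x →
      (b₂ :* b₂ :- con 48 :* x :* x :- con 8 :* b₂ :* x :- con 32 :* b₄) :* (x :* x :* x :* x :- b₄ :* x :* x :- con 2 :* b₆ :* x :- b₈)
        :+ (con 12 :* x :* x :* x :- b₂ :* x :* x :- con 10 :* b₄ :* x :- con 27 :* b₆ :+ b₂ :* b₄)
          :* (con 4 :* x :* x :* x :+ b₂ :* x :* x :+ con 2 :* b₄ :* x :+ b₆)
        :- (:- (b₂ :* b₂ :* b₈) :- con 8 :* b₄ :* b₄ :* b₄ :- con 27 :* b₆ :* b₆ :+ con 9 :* b₂ :* b₄ :* b₆)
      := (con 12 :* x :* x :+ con 2 :* b₂ :* x :+ con 8 :* b₄) :* (con 4 :* b₈ :- (b₂ :* b₆ :- b₄ :* b₄))) b₂ b₄ b₆ b₈ x) e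

  abstract
    discriminant : κ 4 * b₈ ≈ b₂ * b₆ - b₄ * b₄ → ∀ x → cofactorφ x * φ₂ x + cofactorψ x * ψ² x
      ≈ (- (b₂ * b₂ * b₈)) - κ 8 * b₄ * b₄ * b₄ - κ 27 * b₆ * b₆ + κ 9 * b₂ * b₄ * b₆
    discriminant = discriminant′′

-- Degrees of x-coordinates, and the Hasse inequality.

module Heights (F : FiniteField) (W : Weierstrass F) (nonsing : disc F W ≢ FiniteField.0# F) where
  open import Relation.Binary.PropositionalEquality

  open FiniteField F
  open Weierstrass W
  open FieldKit F
  open FieldPoly F
  open RingHom
  open import Data.List using ([]; _∷_)
  open import Data.Nat as ℕ using (ℕ; zero; suc; _≤_; z≤n; s≤s)
  import Data.Nat.Properties as ℕ
  open import Data.Nat.Tactic.RingSolver using (solve-∀)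
  module PS = RingSolve polyRing

  b₂ b₄ b₆ b₈ : Carrier
  b₂ = a₁ * a₁ + fromℕ 4 * a₂
  b₄ = fromℕ 2 * a₄ + a₁ * a₃
  b₆ = a₃ * a₃ + fromℕ 4 * a₆
  b₈ = a₁ * a₁ * a₆ + fromℕ 4 * a₂ * a₆ - a₁ * a₃ * a₄ + a₂ * a₃ * a₃ - a₄ * a₄

  private
    b₈-relation′′ : fromℕ 4 * b₈ ≡ b₂ * b₆ - b₄ * b₄
    b₈-relation′′ = solve 5 (λ a₁ a₂ a₃ a₄ a₆ →
      con 4 :* (a₁ :* a₁ :* a₆ :+ con 4 :* a₂ :* a₆ :- a₁ :* a₃ :* a₄ :+ a₂ :* a₃ :* a₃ :- a₄ :* a₄)
      := (a₁ :* a₁ :+ con 4 :* a₂) :* (a₃ :* a₃ :+ con 4 :* a₆) :- (con 2 :* a₄ :+ a₁ :* a₃) :* (con 2 :* a₄ :+ a₁ :* a₃)) a₁ a₂ a₃ a₄ a₆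

  abstract
    b₈-relation : fromℕ 4 * b₈ ≡ b₂ * b₆ - b₄ * b₄
    b₈-relation = b₈-relation′′

  module KF = Kummer fieldRing b₂ b₄ b₆ b₈
  module KP = Kummer polyRing (const b₂) (const b₄) (const b₆) (const b₈)
  open KP using (module Splits)
  module CH = Hom constHom

  disc⁻¹ : Carrier
  disc⁻¹ = disc F W ⁻¹

  private
    key-F′′ : ∀ x → disc⁻¹ * (KF.cofactorφ x * KF.φ₂ x + KF.cofactorψ x * KF.ψ² x) ≡ 1#
    key-F′′ x = trans (cong (disc⁻¹ *_) (KF.discriminant b₈-relation x)) (inverseˡ nonsing)

  abstract
    key-F : ∀ x → disc⁻¹ * (KF.cofactorφ x * KF.φ₂ x + KF.cofactorψ x * KF.ψ² x) ≡ 1#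
    key-F = key-F′′

  private
    key-P′′ : const disc⁻¹ ⊗ (KP.cofactorφ X ⊗ KP.φ₂ X ⊕ KP.cofactorψ X ⊗ KP.ψ² X) ≋ const 1#
    key-P′′ = P.trans (P.*-congˡ (P.trans (KP.discriminant (CH.transfer 4 (λ b₂ b₄ b₆ b₈ → con 4 :* b₈ := b₂ :* b₆ :- b₄ :* b₄) b₂ b₄ b₆ b₈ b₈-relation) X)
        (P.sym (CH.push 4 (λ b₂ b₄ b₆ b₈ → (:- (b₂ :* b₂ :* b₈)) :- con 8 :* b₄ :* b₄ :* b₄ :- con 27 :* b₆ :* b₆ :+ con 9 :* b₂ :* b₄ :* b₆) b₂ b₄ b₆ b₈))))
      (P.trans (P.sym (const-* disc⁻¹ (disc F W))) (const-cong (inverseˡ nonsing)))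

  abstract
    key-P : const disc⁻¹ ⊗ (KP.cofactorφ X ⊗ KP.φ₂ X ⊕ KP.cofactorψ X ⊗ KP.ψ² X) ≋ const 1#
    key-P = key-P′′

  -- The maximum of the two degrees; for a coprime pair it is the degree of U / V as a map to the
  -- projective line.
  record Size (U V : Poly) (d : ℕ) : Set where
    constructor sized
    field
      degU : Deg≤ U d
      degV : Deg≤ V d
      lead≢0 : ¬ (coeff U d ≡ 0# × coeff V d ≡ 0#)

  record Size₃ (A B C : Poly) (d : ℕ) : Set where
    constructor sized₃
    field
      degA : Deg≤ A d
      degB : Deg≤ B d
      degC : Deg≤ C d
      lead≢0 : ¬ (coeff A d ≡ 0# × coeff B d ≡ 0# × coeff C d ≡ 0#)

  size₃-unique : ∀ {A B C m n} → Size₃ A B C m → Size₃ A B C n → m ≡ n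
  size₃-unique {m = m} {n} (sized₃ a b c l) (sized₃ a′ b′ c′ l′) with ℕ.<-cmp m n
  ... | tri≈ _ e _ = e
  ... | tri< m<n _ _ = contradiction (vanish a n m<n , vanish b n m<n , vanish c n m<n) l′
  ... | tri> _ _ n<m = contradiction (vanish a′ m n<m , vanish b′ m n<m , vanish c′ m n<m) l

  size₃-cong : ∀ {A B C A′ B′ C′ m} → A ≋ A′ → B ≋ B′ → C ≋ C′ → Size₃ A B C m → Size₃ A′ B′ C′ m
  size₃-cong {m = m} a b c (sized₃ da db dc l) = sized₃ (deg-cong a da) (deg-cong b db) (deg-cong c dc)
    λ { (ea , eb , ec) → l (trans (at a m) ea , trans (at b m) eb , trans (at c m) ec) }

  private
    coprime-size′′ : ∀ {U V} → KP.Coprime U V → ∃ (Size U V)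
    coprime-size′′ {U} {V} (α , β , e) with zero-or-top U | zero-or-top V
    ... | inj₁ u | inj₁ v = ⊥-elim (0≢1 (sym (at (P.trans (P.sym e) (P.trans (P.+-cong (P.*-congˡ u) (P.*-congˡ v)) (PS.solve 2 (λ a b → a :* con 0 :+ b :* con 0 := con 0) α β))) 0)))
    ... | inj₁ u | inj₂ (n , t) = n , sized (deg≤ λ m _ → at u m) (deg t) λ { (_ , z) → lead t z }
    ... | inj₂ (m , s) | inj₁ v = m , sized (deg s) (deg≤ λ m _ → at v m) λ { (z , _) → lead s z }
    ... | inj₂ (m , s) | inj₂ (n , t) with ℕ.≤-total m n
    ...   | inj₁ m≤n = n , sized (deg-mono m≤n (deg s)) (deg t) λ { (_ , z) → lead t z }
    ...   | inj₂ n≤m = m , sized (deg s) (deg-mono n≤m (deg t)) λ { (z , _) → lead s z }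

  abstract
    coprime-size : ∀ {U V} → KP.Coprime U V → ∃ (Size U V)
    coprime-size = coprime-size′′

  -- Gauss's lemma at infinity: the top coefficients are those of a product of two nonzero binary
  -- linear forms over a field.
  product-size : ∀ {U V U′ V′ m n} → Size U V m → Size U′ V′ n → Size₃ (V ⊗ V′) (U ⊗ V′ ⊕ U′ ⊗ V) (U ⊗ U′) (m ℕ.+ n)
  product-size {U} {V} {U′} {V′} {m} {n} (sized du dv l) (sized du′ dv′ l′) =
    sized₃ (deg-⊗ dv dv′) (deg-⊕ (deg-⊗ du dv′) (subst (Deg≤ (U′ ⊗ V)) (ℕ.+-comm n m) (deg-⊗ du′ dv))) (deg-⊗ du du′)
    λ { (ea , eb , ec) → nonzero (trans (sym (top-⊗ m n dv dv′)) ea)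
          (trans (sym (trans (coeff-⊕ (U ⊗ V′) (U′ ⊗ V) (m ℕ.+ n)) (cong₂ _+_ (top-⊗ m n du dv′)
            (trans (cong (coeff (U′ ⊗ V)) (ℕ.+-comm m n)) (top-⊗ n m du′ dv))))) eb)
          (trans (sym (top-⊗ m n du du′)) ec) }
    where
    nonzero : coeff V m * coeff V′ n ≡ 0# → coeff U m * coeff V′ n + coeff U′ n * coeff V m ≡ 0# → coeff U m * coeff U′ n ≡ 0# → ⊥
    nonzero vv uv uu with coeff V m ≟ 0#
    ... | no v≢0 = l′ (*≡0 u′v≡0 v≢0 , v′≡0)
      where
      v′≡0 : coeff V′ n ≡ 0#
      v′≡0 = *≡0 (trans (*-comm _ _) vv) v≢0
      u′v≡0 : coeff U′ n * coeff V m ≡ 0#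
      u′v≡0 = trans (sym (trans (cong (λ z → coeff U m * z + coeff U′ n * coeff V m) v′≡0) (solve 2 (λ u t → u :* con 0 :+ t := t) _ _))) uv
    ... | yes v≡0 = l′ (u′≡0 , *≡0 (trans (*-comm _ _) (trans (sym (trans (cong (λ z → coeff U m * coeff V′ n + z * coeff V m) u′≡0) (solve 2 (λ t v → t :+ con 0 :* v := t) _ _))) uv)) u≢0)
      where
      u≢0 : coeff U m ≢ 0#
      u≢0 u≡0 = l (u≡0 , v≡0)
      u′≡0 : coeff U′ n ≡ 0#
      u′≡0 = *≡0 (trans (*-comm _ _) uu) u≢0

  coeff-shift : ∀ p n → coeff (X ⊗ p) (suc n) ≡ coeff p n
  coeff-shift p n = coeff-X⊗ p (suc n)

  deg-shift : ∀ {p n} → Deg≤ p n → Deg≤ (X ⊗ p) (suc n)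
  deg-shift d = deg-⊗ deg-X d

  deg-κ : ∀ n → Deg≤ (PS.κ n) 0
  deg-κ n = deg-cong (CH.κ-hom n) (deg-const _)

  private
    -- With u and v the coefficients of U and V in degree d, the coefficient in degree 2(d + 1) is
    -- v² for the form A and u² for the form C.
    forms-size′′ : ∀ {U V d} → Size U V d → Size₃ (KP.formA X U V) (KP.formB X U V) (KP.formC X U V) (suc d ℕ.+ suc d)
    forms-size′′ {U} {V} {d} (sized du dv l) = sized₃ degA degB degC λ { (ea , _ , ec) → l
        ( square (trans (sym leadC) ec)
        , square (trans (solve 1 (λ v → v :* v := :- v :* :- v) _) (trans (sym (trans (top-⊗ (suc d) (suc d) dE dE) (cong₂ _*_ leadE leadE))) ea))) }
      where
      square : ∀ {z} → z * z ≡ 0# → z ≡ 0#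
      square e with zero-product e
      ... | inj₁ h = h
      ... | inj₂ h = h
      dxU : Deg≤ (X ⊗ U) (suc d)
      dxU = deg-shift du
      dS : Deg≤ (U ⊕ X ⊗ V) (suc d)
      dS = deg-⊕ (deg-mono (ℕ.n≤1+n d) du) (deg-shift dv)
      dE : Deg≤ (U ⊕ ⊖ (X ⊗ V)) (suc d)
      dE = deg-⊕ (deg-mono (ℕ.n≤1+n d) du) (deg-⊖ (deg-shift dv))
      leadE : coeff (U ⊕ ⊖ (X ⊗ V)) (suc d) ≡ - coeff V d
      leadE = trans (coeff-⊕ U _ (suc d)) (trans (cong₂ _+_ (vanish du (suc d) ℕ.≤-refl) (trans (coeff-⊖ (X ⊗ V) (suc d)) (cong -_ (coeff-shift V d)))) (+-identityˡ _))
      low : d ℕ.+ suc d ≤ suc d ℕ.+ d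
      low = ℕ.≤-reflexive (ℕ.+-comm d (suc d))
      D : suc d ℕ.+ d ≤ suc d ℕ.+ suc d
      D = ℕ.+-monoʳ-≤ (suc d) (ℕ.n≤1+n d)
      dVV : Deg≤ (V ⊗ V) (suc d ℕ.+ d)
      dVV = deg-mono (ℕ.+-monoˡ-≤ d (ℕ.n≤1+n d)) (deg-⊗ dv dv)
      scaled : ∀ {c p n} → Deg≤ p n → Deg≤ (const c ⊗ p) n
      scaled = deg-⊗ (deg-const _)
      degA : Deg≤ (KP.formA X U V) (suc d ℕ.+ suc d)
      degA = deg-⊗ dE dE
      degB : Deg≤ (KP.formB X U V) (suc d ℕ.+ suc d)
      degB = deg-⊕ (deg-⊕ (deg-⊕ (deg-⊗ (deg-κ 2) (deg-⊗ dxU dS)) (deg-mono D (scaled (deg-⊗ dxU dv))))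
        (deg-mono D (scaled (deg-⊗ dS dv)))) (deg-mono D (scaled dVV))
      rest : Poly
      rest = (⊖ (const b₄ ⊗ (X ⊗ U ⊗ V)) ⊕ ⊖ (const b₆ ⊗ ((U ⊕ X ⊗ V) ⊗ V))) ⊕ ⊖ (const b₈ ⊗ (V ⊗ V))
      deg-rest : Deg≤ rest (suc d ℕ.+ d)
      deg-rest = deg-⊕ (deg-⊕ (deg-⊖ (scaled (deg-⊗ dxU dv))) (deg-⊖ (scaled (deg-⊗ dS dv)))) (deg-⊖ (scaled dVV))
      C≋ : (X ⊗ U) ⊗ (X ⊗ U) ⊕ rest ≋ KP.formC X U V
      C≋ = PS.solve 4 (λ a b c d → a :+ (:- b :+ :- c :+ :- d) := a :- b :- c :- d) _ _ _ _
      degC : Deg≤ (KP.formC X U V) (suc d ℕ.+ suc d)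
      degC = deg-cong C≋ (deg-⊕ (deg-⊗ dxU dxU) (deg-mono D deg-rest))
      leadC : coeff (KP.formC X U V) (suc d ℕ.+ suc d) ≡ coeff U d * coeff U d
      leadC = trans (sym (at C≋ _)) (trans (coeff-⊕ _ rest _) (trans (cong₂ _+_
        (trans (top-⊗ (suc d) (suc d) dxU dxU) (cong₂ _*_ (coeff-shift U d) (coeff-shift U d)))
        (vanish deg-rest _ (ℕ.+-monoʳ-< (suc d) ℕ.≤-refl))) (+-identityʳ _)))

  abstract
    forms-size : ∀ {U V d} → Size U V d → Size₃ (KP.formA X U V) (KP.formB X U V) (KP.formC X U V) (suc d ℕ.+ suc d)
    forms-size = forms-size′′

  -- The same triple of forms is measured once from its factors and once from U : V. This is the
  -- parallelogram law for degrees, the source of the second difference 2.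
  step-size : ∀ {U V U₋ V₋ U₊ V₊ d d₋ d₊} → KP.Splits (KP.formA X U V) (KP.formB X U V) (KP.formC X U V) U₋ V₋ U₊ V₊ →
    Size U V d → Size U₋ V₋ d₋ → Size U₊ V₊ d₊ → d₋ ℕ.+ d₊ ≡ suc d ℕ.+ suc d
  step-size sp s s₋ s₊ = size₃-unique (size₃-cong (P.sym A≈) (P.sym B≈) (P.sym C≈) (product-size s₋ s₊)) (forms-size s)
    where open Splits sp

  private
    unimodular-P′′ : ∀ {U V} → KP.Coprime U V → ∃ λ r → ∃₂ λ s t → r ⊗ KP.formA X U V ⊕ s ⊗ KP.formB X U V ⊕ t ⊗ KP.formC X U V ≋ const 1#
    unimodular-P′′ = KP.unimodular key-P

  abstract
    unimodular-P : ∀ {U V} → KP.Coprime U V → ∃ λ r → ∃₂ λ s t → r ⊗ KP.formA X U V ⊕ s ⊗ KP.formB X U V ⊕ t ⊗ KP.formC X U V ≋ const 1#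
    unimodular-P = unimodular-P′′

  -- Two constants cannot be adjacent: read as a polynomial in x, the relation has as
  -- coefficients the three forms of a pair of points over F, which have no common zero.
  private
    constants-unrelated′′ : ∀ {U V T S} → Size U V 0 → Size T S 0 → ¬ KP.Related X U V T S
    constants-unrelated′′ {U} {V} {T} {S} (sized du dv l) (sized dt ds l′) rel = conclude (s ≟ 0#)
      where
      u = coeff U 0
      v = coeff V 0
      t = coeff T 0
      s = coeff S 0
      constant : ∀ {p} → Deg≤ p 0 → p ≋ const (coeff p 0)
      constant d = coeffwise λ { zero → refl ; (suc n) → vanish d (suc n) (s≤s z≤n) }
      K₂ K₁ K₀ : Carrier
      K₂ = (v * t - u * s) * (v * t - u * s)
      K₁ = - (fromℕ 2 * (u * v) * (t * t)) - (fromℕ 2 * (u * u) + b₂ * (u * v) + b₄ * (v * v)) * (t * s) - (b₄ * (u * v) + b₆ * (v * v)) * (s * s)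
      K₀ = u * u * (t * t) - (b₄ * (u * v) + b₆ * (v * v)) * (t * s) - (b₆ * (u * v) + b₈ * (v * v)) * (s * s)
      A′ B′ C′ : ∀ {n} → Expr n → Expr n → Expr n → Expr n → Expr n → Expr n → Expr n
      A′ b₂ b₄ b₆ x X Z = (X :- x :* Z) :* (X :- x :* Z)
      B′ b₂ b₄ b₆ x X Z = con 2 :* ((x :* X) :* (X :+ x :* Z)) :+ b₂ :* ((x :* X) :* Z) :+ b₄ :* ((X :+ x :* Z) :* Z) :+ b₆ :* (Z :* Z)
      C′ b₄ b₆ b₈ x X Z = (x :* X) :* (x :* X) :- b₄ :* ((x :* X) :* Z) :- b₆ :* ((X :+ x :* Z) :* Z) :- b₈ :* (Z :* Z)
      poly≋0 : (K₀ ∷ K₁ ∷ K₂ ∷ []) ≋ []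
      poly≋0 = P.trans (horner K₀ _) (P.trans (P.+-congˡ (P.*-congˡ (horner K₁ (const K₂))))
        (P.trans (P.+-cong (CH.push 7 (λ b₄ b₆ b₈ u v t s → u :* u :* (t :* t) :- (b₄ :* (u :* v) :+ b₆ :* (v :* v)) :* (t :* s) :- (b₆ :* (u :* v) :+ b₈ :* (v :* v)) :* (s :* s)) b₄ b₆ b₈ u v t s)
          (P.*-congˡ (P.+-cong (CH.push 7 (λ b₂ b₄ b₆ u v t s → :- (con 2 :* (u :* v) :* (t :* t)) :- (con 2 :* (u :* u) :+ b₂ :* (u :* v) :+ b₄ :* (v :* v)) :* (t :* s) :- (b₄ :* (u :* v) :+ b₆ :* (v :* v)) :* (s :* s)) b₂ b₄ b₆ u v t s)
            (P.*-congˡ (CH.push 4 (λ u v t s → (v :* t :- u :* s) :* (v :* t :- u :* s)) u v t s)))))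
        (P.trans (PS.linear₄ (PS.solve 13 (λ b₂ b₄ b₆ b₈ x U V T S u v t s →
            (u :* u :* (t :* t) :- (b₄ :* (u :* v) :+ b₆ :* (v :* v)) :* (t :* s) :- (b₆ :* (u :* v) :+ b₈ :* (v :* v)) :* (s :* s))
            :+ x :* ((:- (con 2 :* (u :* v) :* (t :* t)) :- (con 2 :* (u :* u) :+ b₂ :* (u :* v) :+ b₄ :* (v :* v)) :* (t :* s) :- (b₄ :* (u :* v) :+ b₆ :* (v :* v)) :* (s :* s))
              :+ x :* ((v :* t :- u :* s) :* (v :* t :- u :* s)))
            :- (A′ b₂ b₄ b₆ x u v :* (t :* t) :- B′ b₂ b₄ b₆ x u v :* (t :* s) :+ C′ b₄ b₆ b₈ x u v :* (s :* s))
            := con 0 :* (U :- u) :+ con 0 :* (V :- v) :+ con 0 :* (T :- t) :+ con 0 :* (S :- s))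
            (const b₂) (const b₄) (const b₆) (const b₈) X U V T S (const u) (const v) (const t) (const s))
            (constant du) (constant dv) (constant dt) (constant ds))
          (P.trans (P.sym (related-cong (constant du) (constant dv) (constant dt) (constant ds))) rel))))
        where
        related-cong : ∀ {U U′ V V′ T T′ S S′} → U ≋ U′ → V ≋ V′ → T ≋ T′ → S ≋ S′ →
          (KP.formA X U V ⊗ (T ⊗ T) ⊕ ⊖ (KP.formB X U V ⊗ (T ⊗ S))) ⊕ KP.formC X U V ⊗ (S ⊗ S)
          ≋ (KP.formA X U′ V′ ⊗ (T′ ⊗ T′) ⊕ ⊖ (KP.formB X U′ V′ ⊗ (T′ ⊗ S′))) ⊕ KP.formC X U′ V′ ⊗ (S′ ⊗ S′)
        related-cong {U} {U′} {V} {V′} eu ev et es = P.+-cong (P.+-cong (P.*-cong A≋ (P.*-cong et et)) (P.-‿cong (P.*-cong B≋ (P.*-cong et es)))) (P.*-cong C≋ (P.*-cong es es))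
          where
          xU = P.*-congˡ {X} eu
          xV = P.*-congˡ {X} ev
          VV = P.*-cong ev ev
          A≋ : KP.formA X U V ≋ KP.formA X U′ V′
          A≋ = P.*-cong (P.+-cong eu (P.-‿cong xV)) (P.+-cong eu (P.-‿cong xV))
          B≋ : KP.formB X U V ≋ KP.formB X U′ V′
          B≋ = P.+-cong (P.+-cong (P.+-cong (P.*-congˡ (P.*-cong xU (P.+-cong eu xV))) (P.*-congˡ (P.*-cong xU ev)))
            (P.*-congˡ (P.*-cong (P.+-cong eu xV) ev))) (P.*-congˡ VV)
          C≋ : KP.formC X U V ≋ KP.formC X U′ V′
          C≋ = P.+-cong (P.+-cong (P.+-cong (P.*-cong xU xU) (P.-‿cong (P.*-congˡ (P.*-cong xU ev))))
            (P.-‿cong (P.*-congˡ (P.*-cong (P.+-cong eu xV) ev)))) (P.-‿cong (P.*-congˡ VV))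
      k₀ : K₀ ≡ 0#
      k₀ = at poly≋0 0
      k₁ : K₁ ≡ 0#
      k₁ = at poly≋0 1
      k₂ : K₂ ≡ 0#
      k₂ = at poly≋0 2
      square : ∀ {z} → z * z ≡ 0# → z ≡ 0#
      square e with zero-product e
      ... | inj₁ h = h
      ... | inj₂ h = h
      coprime-uv : KF.Coprime u v
      coprime-uv with u ≟ 0#
      ... | no u≢0 = u ⁻¹ , 0# , trans (cong (_+ 0# * v) (inverseˡ u≢0)) (solve 1 (λ v → one :+ con 0 :* v := one) v)
      ... | yes u≡0 = 0# , v ⁻¹ , trans (cong (0# * u +_) (inverseˡ (λ v≡0 → l (u≡0 , v≡0)))) (solve 1 (λ u → con 0 :* u :+ one := one) u)
      conclude : _ → ⊥
      conclude (yes s≡0) = l (u≡0 , v≡0)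
        where
        t≢0 : t ≢ 0#
        t≢0 t≡0 = l′ (t≡0 , s≡0)
        v≡0 : v ≡ 0#
        v≡0 = *≡0 (square (trans (solve 4 (λ u v t s → v :* t :* (v :* t) := (v :* t :- u :* con 0) :* (v :* t :- u :* con 0)) u v t s)
          (trans (cong (λ s → (v * t - u * s) * (v * t - u * s)) (sym s≡0)) k₂))) t≢0
        u≡0 : u ≡ 0#
        u≡0 = square (*≡0 (linear₃ (solve 7 (λ b₄ b₆ b₈ u v t s → u :* u :* (t :* t) :- con 0
            := one :* ((u :* u :* (t :* t) :- (b₄ :* (u :* v) :+ b₆ :* (v :* v)) :* (t :* s) :- (b₆ :* (u :* v) :+ b₈ :* (v :* v)) :* (s :* s)) :- con 0)
              :+ ((b₄ :* (u :* v) :+ b₆ :* (v :* v)) :* t :+ (b₆ :* (u :* v) :+ b₈ :* (v :* v)) :* s) :* (s :- con 0) :+ con 0 :* (v :- con 0)) b₄ b₆ b₈ u v t s) k₀ s≡0 v≡0) (*≢0 t≢0 t≢0))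
      conclude (no s≢0) = 0≢1 (sym (trans (sym eq) (trans (cong₂ (λ a b → r * a + r′ * b + r″ * C) A≡0 B≡0)
          (trans (cong (λ z → r * 0# + r′ * 0# + r″ * z) C≡0) (solve 3 (λ a b c → a :* con 0 :+ b :* con 0 :+ c :* con 0 := con 0) r r′ r″)))))
        where
        -- By the symmetry of the relation, K₂, -K₁ and K₀ are s² times the three forms of u : v
        -- taken at this abscissa, where they cannot all vanish.
        x = t / s
        t≡ : x * s ≡ t
        t≡ = /-cancel s≢0 t
        A = KF.formA x u v
        B = KF.formB x u v
        C = KF.formC x u v
        uni = KF.unimodular (key-F x) coprime-uv
        r = proj₁ uni
        r′ = proj₁ (proj₂ uni)
        r″ = proj₁ (proj₂ (proj₂ uni))
        eq : r * A + r′ * B + r″ * C ≡ 1#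
        eq = proj₂ (proj₂ (proj₂ uni))
        A≡0 : A ≡ 0#
        A≡0 = *≡0 (linear₂ (solve 5 (λ x u v t s → (u :- x :* v) :* (u :- x :* v) :* (s :* s) :- con 0
            := one :* ((v :* t :- u :* s) :* (v :* t :- u :* s) :- con 0) :+ v :* (v :* t :+ v :* x :* s :- con 2 :* u :* s) :* (x :* s :- t)) x u v t s) k₂ t≡) (*≢0 s≢0 s≢0)
        B≡0 : B ≡ 0#
        B≡0 = *≡0 (linear₂ (solve 8 (λ b₂ b₄ b₆ x u v t s → B′ b₂ b₄ b₆ x u v :* (s :* s) :- con 0
            := :- one :* ((:- (con 2 :* (u :* v) :* (t :* t)) :- (con 2 :* (u :* u) :+ b₂ :* (u :* v) :+ b₄ :* (v :* v)) :* (t :* s) :- (b₄ :* (u :* v) :+ b₆ :* (v :* v)) :* (s :* s)) :- con 0)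
              :+ (con 2 :* (u :* v) :* (x :* s :+ t) :+ (con 2 :* (u :* u) :+ b₂ :* (u :* v) :+ b₄ :* (v :* v)) :* s) :* (x :* s :- t)) b₂ b₄ b₆ x u v t s) k₁ t≡) (*≢0 s≢0 s≢0)
        C≡0 : C ≡ 0#
        C≡0 = *≡0 (linear₂ (solve 8 (λ b₄ b₆ b₈ x u v t s → C′ b₄ b₆ b₈ x u v :* (s :* s) :- con 0
            := one :* ((u :* u :* (t :* t) :- (b₄ :* (u :* v) :+ b₆ :* (v :* v)) :* (t :* s) :- (b₆ :* (u :* v) :+ b₈ :* (v :* v)) :* (s :* s)) :- con 0)
              :+ (u :* u :* (x :* s :+ t) :- (b₄ :* (u :* v) :+ b₆ :* (v :* v)) :* s) :* (x :* s :- t)) b₄ b₆ b₈ x u v t s) k₀ t≡) (*≢0 s≢0 s≢0)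

  abstract
    constants-unrelated : ∀ {U V T S} → Size U V 0 → Size T S 0 → ¬ KP.Related X U V T S
    constants-unrelated = constants-unrelated′′

  -- U : V and U′ : V′ are the x-coordinates of two points over F(E) that differ by the generic point (X , Y),
  -- as functions of X, of degrees m and n.
  record Adjacent (m n : ℕ) : Set where
    constructor adjacent
    field
      U V U′ V′ : Poly
      coprime   : KP.Coprime U V
      coprime′  : KP.Coprime U′ V′
      sizeU     : Size U V m
      sizeU′    : Size U′ V′ n
      related   : KP.Related X U′ V′ U V

  private
    next′′ : ∀ {m n} → Adjacent m n → ∃ λ k → Adjacent n k × m ℕ.+ k ≡ suc n ℕ.+ suc n
    next′′ (adjacent U V U′ V′ c c′ s s′ rel) =
      let (U″ , V″ , sp) = KP.split c rel
          c″ = KP.splits-coprime (unimodular-P c′) sp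
          (k , s″) = coprime-size c″
      in k , adjacent U′ V′ U″ V″ c′ c″ s′ s″ (KP.related-sym X U′ V′ U″ V″ (KP.splits-related sp)) , step-size sp s′ s s″

  abstract
    next : ∀ {m n} → Adjacent m n → ∃ λ k → Adjacent n k × m ℕ.+ k ≡ suc n ℕ.+ suc n
    next = next′′

  -- The degree of x(ΦP - nP) is n² - τ n + q, written without subtraction. Two consecutive values
  -- are carried along, as the recursion is of second order.
  parabola : ∀ {q p τ} → Adjacent q p → p ℕ.+ τ ≡ suc q → ∀ n →
    ∃₂ λ a b → Adjacent a b × a ℕ.+ τ ℕ.* n ≡ n ℕ.* n ℕ.+ q × b ℕ.+ τ ℕ.* suc n ≡ suc n ℕ.* suc n ℕ.+ q
  parabola {q} {p} {τ} adj e zero = q , p , adj , trans (cong (q ℕ.+_) (ℕ.*-zeroʳ τ)) (ℕ.+-identityʳ q) , trans (cong (p ℕ.+_) (ℕ.*-identityʳ τ)) e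
  parabola {q} {p} {τ} adj e (suc n) with parabola adj e n
  ... | a , b , ab , ea , eb with next ab
  ...   | c , bc , ec = b , c , bc , eb , ℕ.+-cancelʳ-≡ (a ℕ.+ τ ℕ.* n) _ _ (begin
      (c ℕ.+ τ ℕ.* suc (suc n)) ℕ.+ (a ℕ.+ τ ℕ.* n)   ≡⟨ lhs a c τ n ⟩
      (a ℕ.+ c) ℕ.+ 2 ℕ.* (τ ℕ.* suc n)                ≡⟨ cong (ℕ._+ 2 ℕ.* (τ ℕ.* suc n)) ec ⟩
      (suc b ℕ.+ suc b) ℕ.+ 2 ℕ.* (τ ℕ.* suc n)        ≡⟨ mid b (τ ℕ.* suc n) ⟩
      2 ℕ.+ 2 ℕ.* (b ℕ.+ τ ℕ.* suc n)                  ≡⟨ cong (λ z → 2 ℕ.+ 2 ℕ.* z) eb ⟩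
      2 ℕ.+ 2 ℕ.* (suc n ℕ.* suc n ℕ.+ q)              ≡⟨ rhs n q ⟩
      (suc (suc n) ℕ.* suc (suc n) ℕ.+ q) ℕ.+ (n ℕ.* n ℕ.+ q) ≡⟨ cong ((suc (suc n) ℕ.* suc (suc n) ℕ.+ q) ℕ.+_) (sym ea) ⟩
      (suc (suc n) ℕ.* suc (suc n) ℕ.+ q) ℕ.+ (a ℕ.+ τ ℕ.* n) ∎)
    where
    open ≡-Reasoning
    lhs : ∀ a c τ n → (c ℕ.+ τ ℕ.* suc (suc n)) ℕ.+ (a ℕ.+ τ ℕ.* n) ≡ (a ℕ.+ c) ℕ.+ 2 ℕ.* (τ ℕ.* suc n)
    lhs = solve-∀
    mid : ∀ b k → (suc b ℕ.+ suc b) ℕ.+ 2 ℕ.* k ≡ 2 ℕ.+ 2 ℕ.* (b ℕ.+ k)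
    mid = solve-∀
    rhs : ∀ n q → 2 ℕ.+ 2 ℕ.* (suc n ℕ.* suc n ℕ.+ q) ≡ (suc (suc n) ℕ.* suc (suc n) ℕ.+ q) ℕ.+ (n ℕ.* n ℕ.+ q)
    rhs = solve-∀

  half : ∀ n → ∃ λ k → n ≡ k ℕ.+ k ⊎ n ≡ suc (k ℕ.+ k)
  half zero = 0 , inj₁ refl
  half (suc n) with half n
  ... | k , inj₁ e = k , inj₂ (cong suc e)
  ... | k , inj₂ e = suc k , inj₁ (trans (cong suc e) (cong suc (sym (ℕ.+-suc k k))))

  -- The parabola is evaluated next to its vertex. For τ = 2k the value q - k² at k is enough. For τ
  -- = 2k + 1 the values at k and k + 1 both equal q - k² - k, and nonnegativity alone only yields
  -- τ² ≤ 4q + 1; a positive value gives the missing unit through τ² + 3 = 4(k² + k + 1).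
  hasse : ∀ {q p τ} → Adjacent q p → p ℕ.+ τ ≡ suc q → τ ℕ.* τ ≤ 4 ℕ.* q
  hasse {q} {p} {τ} adj e with half τ
  ... | k , inj₁ refl = even (parabola adj e k)
    where
    sq : ∀ k → (k ℕ.+ k) ℕ.* (k ℕ.+ k) ≡ 4 ℕ.* (k ℕ.* k)
    sq = solve-∀
    dbl : ∀ a k → a ℕ.+ (k ℕ.+ k) ℕ.* k ≡ k ℕ.* k ℕ.+ (a ℕ.+ k ℕ.* k)
    dbl = solve-∀
    even : (∃₂ λ a b → Adjacent a b × a ℕ.+ τ ℕ.* k ≡ k ℕ.* k ℕ.+ q × b ℕ.+ τ ℕ.* suc k ≡ suc k ℕ.* suc k ℕ.+ q) → τ ℕ.* τ ≤ 4 ℕ.* q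
    even (a , _ , _ , ea , _) = ℕ.≤-trans (ℕ.≤-reflexive (sq k)) (ℕ.*-monoʳ-≤ 4
      (ℕ.≤-trans (ℕ.m≤n+m (k ℕ.* k) a) (ℕ.≤-reflexive (ℕ.+-cancelˡ-≡ (k ℕ.* k) _ _ (trans (sym (dbl a k)) ea)))))
  ... | k , inj₂ refl = odd (parabola adj e k)
    where
    sq : ∀ k → suc (k ℕ.+ k) ℕ.* suc (k ℕ.+ k) ℕ.+ 3 ≡ 4 ℕ.* suc (k ℕ.* k ℕ.+ k)
    sq = solve-∀
    at-k : ∀ a k → a ℕ.+ suc (k ℕ.+ k) ℕ.* k ≡ k ℕ.* k ℕ.+ (a ℕ.+ (k ℕ.* k ℕ.+ k))
    at-k = solve-∀
    at-suc-k : ∀ b k → b ℕ.+ suc (k ℕ.+ k) ℕ.* suc k ≡ suc k ℕ.* suc k ℕ.+ (b ℕ.+ (k ℕ.* k ℕ.+ k))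
    at-suc-k = solve-∀
    odd : (∃₂ λ a b → Adjacent a b × a ℕ.+ τ ℕ.* k ≡ k ℕ.* k ℕ.+ q × b ℕ.+ τ ℕ.* suc k ≡ suc k ℕ.* suc k ℕ.+ q) → τ ℕ.* τ ≤ 4 ℕ.* q
    odd (suc a , _ , _ , ea , _) = ℕ.≤-trans (ℕ.m≤m+n (τ ℕ.* τ) 3) (ℕ.≤-trans (ℕ.≤-reflexive (sq k)) (ℕ.*-monoʳ-≤ 4
      (ℕ.≤-trans (s≤s (ℕ.m≤n+m (k ℕ.* k ℕ.+ k) a)) (ℕ.≤-reflexive (ℕ.+-cancelˡ-≡ (k ℕ.* k) _ _ (trans (sym (at-k (suc a) k)) ea))))))
    -- Value 0 at k forces value 0 at k + 1, that is, two adjacent constant x-coordinates.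
    odd (zero , b , adj′ , ea , eb) = ⊥-elim (constants-unrelated (Adjacent.sizeU′ adj₀) (Adjacent.sizeU adj₀) (Adjacent.related adj₀))
      where
      b≡0 : b ≡ 0
      b≡0 = ℕ.+-cancelʳ-≡ (k ℕ.* k ℕ.+ k) _ _ (trans (ℕ.+-cancelˡ-≡ (suc k ℕ.* suc k) _ _ (trans (sym (at-suc-k b k)) eb))
        (sym (ℕ.+-cancelˡ-≡ (k ℕ.* k) _ _ (trans (sym (at-k 0 k)) ea))))
      adj₀ : Adjacent 0 0
      adj₀ = subst (Adjacent 0) b≡0 adj′

-- The quadratic form computed from chords.

module ChordForms (R : CommutativeRing 0ℓ 0ℓ) (a₁ a₂ a₃ a₄ a₆ : CommutativeRing.Carrier R) where
  open CommutativeRing R hiding (zero)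
  open RingSolve R

  b₂ b₄ b₆ b₈ : Carrier
  b₂ = a₁ * a₁ + κ 4 * a₂
  b₄ = κ 2 * a₄ + a₁ * a₃
  b₆ = a₃ * a₃ + κ 4 * a₆
  b₈ = a₁ * a₁ * a₆ + κ 4 * a₂ * a₆ - a₁ * a₃ * a₄ + a₂ * a₃ * a₃ - a₄ * a₄

  open Kummer R b₂ b₄ b₆ b₈

  Curve : Carrier → Carrier → Set
  Curve x y = y * y + a₁ * x * y + a₃ * y ≈ x * x * x + a₂ * x * x + a₄ * x + a₆

  -- (x₁ − x₂)² times the x-coordinate of the third point on a line of slope w / (x₁ − x₂).
  numerator : Carrier → Carrier → Carrier → Carrier
  numerator x₁ x₂ w = w * w + a₁ * w * (x₁ - x₂) - (a₂ + x₁ + x₂) * ((x₁ - x₂) * (x₁ - x₂))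

  private
    N : ∀ {n} → Expr n → Expr n → Expr n → Expr n → Expr n → Expr n
    N a₁ a₂ x₁ x₂ w = w :* w :+ a₁ :* w :* (x₁ :- x₂) :- (a₂ :+ x₁ :+ x₂) :* ((x₁ :- x₂) :* (x₁ :- x₂))
    On : ∀ {n} → Expr n → Expr n → Expr n → Expr n → Expr n → Expr n → Expr n → Expr n
    On a₁ a₂ a₃ a₄ a₆ x y = y :* y :+ a₁ :* x :* y :+ a₃ :* y :- (x :* x :* x :+ a₂ :* x :* x :+ a₄ :* x :+ a₆)

  module _ {x₁ y₁ x₂ y₂ : Carrier} (on₁ : Curve x₁ y₁) (on₂ : Curve x₂ y₂) where
    -- The second argument y₁ + y₂ + a₁x₂ + a₃ is the ordinate difference for the negative of the
    -- second point. The numerators are thus formA times the abscissas of the sum and of the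
    -- difference, and these are the roots of the form.
    numerator-sum : numerator x₁ x₂ (y₁ - y₂) + numerator x₁ x₂ (y₁ + y₂ + a₁ * x₂ + a₃) ≈ formB x₂ x₁ 1#
    numerator-sum = linear₂ (solve 9 (λ a₁ a₂ a₃ a₄ a₆ x₁ y₁ x₂ y₂ →
      N a₁ a₂ x₁ x₂ (y₁ :- y₂) :+ N a₁ a₂ x₁ x₂ (y₁ :+ y₂ :+ a₁ :* x₂ :+ a₃)
        :- (con 2 :* ((x₂ :* x₁) :* (x₁ :+ x₂ :* one)) :+ (a₁ :* a₁ :+ con 4 :* a₂) :* ((x₂ :* x₁) :* one)
            :+ (con 2 :* a₄ :+ a₁ :* a₃) :* ((x₁ :+ x₂ :* one) :* one) :+ (a₃ :* a₃ :+ con 4 :* a₆) :* (one :* one))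
      := con 2 :* On a₁ a₂ a₃ a₄ a₆ x₁ y₁ :+ con 2 :* On a₁ a₂ a₃ a₄ a₆ x₂ y₂) a₁ a₂ a₃ a₄ a₆ x₁ y₁ x₂ y₂) on₁ on₂

    numerator-product : numerator x₁ x₂ (y₁ - y₂) * numerator x₁ x₂ (y₁ + y₂ + a₁ * x₂ + a₃) ≈ formA x₂ x₁ 1# * formC x₂ x₁ 1#
    numerator-product = linear₂ (solve 9 (λ a₁ a₂ a₃ a₄ a₆ x₁ y₁ x₂ y₂ →
      N a₁ a₂ x₁ x₂ (y₁ :- y₂) :* N a₁ a₂ x₁ x₂ (y₁ :+ y₂ :+ a₁ :* x₂ :+ a₃)
        :- (x₁ :- x₂ :* one) :* (x₁ :- x₂ :* one)
          :* ((x₂ :* x₁) :* (x₂ :* x₁) :- (con 2 :* a₄ :+ a₁ :* a₃) :* ((x₂ :* x₁) :* one) :- (a₃ :* a₃ :+ con 4 :* a₆) :* ((x₁ :+ x₂ :* one) :* one)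
            :- (a₁ :* a₁ :* a₆ :+ con 4 :* a₂ :* a₆ :- a₁ :* a₃ :* a₄ :+ a₂ :* a₃ :* a₃ :- a₄ :* a₄) :* (one :* one))
      := (a₁ :* a₃ :* x₁ :+ a₁ :* x₁ :* y₁ :+ a₁ :* a₁ :* x₁ :* x₂ :+ con 4 :* a₂ :* x₁ :* x₂ :+ a₃ :* y₁ :+ a₄ :* x₁ :+ a₆ :+ con 2 :* x₁ :* x₂ :* x₂ :+ con 2 :* x₁ :* x₁ :* x₂ :+ y₁ :* y₁ :- a₁ :* a₃ :* x₂ :- con 2 :* a₁ :* x₂ :* y₂ :- a₁ :* a₁ :* x₂ :* x₂ :- a₂ :* x₁ :* x₁ :- con 2 :* a₂ :* x₂ :* x₂ :- con 2 :* a₃ :* y₂ :- x₁ :* x₁ :* x₁ :- con 2 :* x₂ :* x₂ :* x₂ :- con 2 :* y₂ :* y₂)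
          :* On a₁ a₂ a₃ a₄ a₆ x₁ y₁
        :+ (a₁ :* a₃ :* x₂ :+ a₁ :* x₂ :* y₂ :+ a₁ :* a₁ :* x₁ :* x₂ :+ con 4 :* a₂ :* x₁ :* x₂ :+ a₃ :* y₂ :+ a₄ :* x₂ :+ con 2 :* x₁ :* x₂ :* x₂ :+ con 2 :* x₁ :* x₁ :* x₂ :+ y₂ :* y₂ :- a₁ :* a₃ :* x₁ :- a₁ :* a₁ :* x₁ :* x₁ :- con 4 :* a₂ :* x₁ :* x₁ :- a₂ :* x₂ :* x₂ :- con 2 :* a₄ :* x₁ :- a₆ :- con 4 :* x₁ :* x₁ :* x₁ :- x₂ :* x₂ :* x₂)
          :* On a₁ a₂ a₃ a₄ a₆ x₂ y₂) a₁ a₂ a₃ a₄ a₆ x₁ y₁ x₂ y₂) on₁ on₂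

-- Base change of a quadratic extension.

module QuadraticMap {S T : CommutativeRing 0ℓ 0ℓ} (H : RingHom.Hom S T) (h f : CommutativeRing.Carrier S) where
  open RingHom

  open RingExpr
  open Hom H
  module QS = Quadratic S h f
  module QT = Quadratic T (φ h) (φ f)

  mapHom : Hom QS.quadRing QT.quadRing
  mapHom = record
    { φ = λ { (a , b) → φ a , φ b }
    ; cong = λ e → cong (QS.re e) QT.,, cong (QS.im e)
    ; +-hom = λ { (a , b) (c , d) → +-hom a c QT.,, +-hom b d }
    ; *-hom = λ { (a , b) (c , d) → push 5 (λ a b c d f → a :* c :+ b :* d :* f) a b c d f
        QT.,, push 5 (λ a b c d h → a :* d :+ b :* c :- b :* d :* h) a b c d h }
    ; ⊖-hom = λ { (a , b) → ⊖-hom a QT.,, ⊖-hom b }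
    ; 0-hom = 0-hom QT.,, 0-hom
    ; 1-hom = 1-hom QT.,, 0-hom }

-- The degrees of x(ΦP - P) and x(ΦP + P) for the generic point P.

module Hasse (F : FiniteField) (W : Weierstrass F) (nonsing : disc F W ≢ FiniteField.0# F) where
  open import Relation.Binary.PropositionalEquality

  open FiniteField F using (Carrier; elements; 0#; 1#; 0≢1) renaming (size to q; _+_ to _+ᶠ_; _*_ to _*ᶠ_; -_ to -ᶠ_; _-_ to _-ᶠ_)
  open Weierstrass W
  open FieldKit F using (fieldRing)

  open FieldPoly F
  open FieldFinite F hiding (module PS)
  open RootPowers F
  open Coordinate F W
  open Heights F W nonsing hiding (module PS)
  open Lists
  open RingHom
  open RingExpr
  open import Data.List using ([]; _∷_; length)
  open import Data.List.Relation.Unary.All as All using ([]; _∷_)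
  open import Data.Nat as ℕ using (ℕ; suc; _≤_; _<_; _∸_; z≤n; s≤s)
  import Data.Nat.Properties as ℕ
  open import Data.Nat.Tactic.RingSolver using (solve-∀)
  module FS = RingSolve fieldRing

  open Frobenius quadRing scalars using (_^_; frobenius; frobenius-scalar; ^-cong)

  Xq δ : Poly
  Xq = X PP.^ q
  δ  = Xq ⊕ ⊖ X

  -- The ordinate of ΦP as an element α + β y of the coordinate ring. Its abscissa is `Xq`, already
  -- a polynomial in X.
  π : Quad
  π = ŷ ^ q

  private
    α β : Poly
    α = proj₁ π
    β = proj₂ π

    x̂q : embed Xq ≃ x̂ ^ q
    x̂q = PowerHom.hom-^ embedHom q X

    s t ηq : Poly
    s  = const a₁ ⊗ δ
    t  = (const a₂ ⊕ Xq ⊕ X) ⊗ (δ ⊗ δ)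
    ηq = const a₁ ⊗ Xq ⊕ const a₃

    η≋ : η ≋ const a₁ ⊗ X ⊕ const a₃
    η≋ = P.trans (horner a₃ (const a₁)) (PS.solve 3 (λ a b X → a :+ X :* b := b :* X :+ a) (const a₃) (const a₁) X)

    ηq-η : ηq ≋ η ⊕ s
    ηq-η = PS.linear₁ (PS.solve 5 (λ a₁ a₃ X Xq η → a₁ :* Xq :+ a₃ :- (η :+ a₁ :* (Xq :- X)) := :- one :* (η :- (a₁ :* X :+ a₃)))
      (const a₁) (const a₃) X Xq η) η≋

    η^q : embed η ^ q ≃ embed ηq
    η^q = R.trans (^-cong q η-expand) (R.trans (Hom.push frobenius 3 (λ a₁ X a₃ → a₁ :* X :+ a₃) (c a₁) x̂ (c a₃))
      (R.trans (R.+-cong (R.*-cong (frobenius-scalar a₁) (R.sym x̂q)) (frobenius-scalar a₃))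
        (R.sym (E.push 3 (λ a₁ X a₃ → a₁ :* X :+ a₃) (const a₁) Xq (const a₃)))))

    -- Conjugation is a ring homomorphism and so commutes with q-th powers: Φ(-P) = -ΦP.
    conj-π : conj π ≃ R.- π R.+ R.- embed ηq
    conj-π = R.trans (PowerHom.hom-^ conjHom q ŷ) (R.trans (^-cong q conj-root)
      (R.trans (Hom.push frobenius 2 (λ y e → :- y :+ :- e) ŷ (embed η)) (R.+-congˡ (R.-‿cong η^q))))

    trace-π : α ⊕ ⊖ (β ⊗ η) ≋ ⊖ α ⊕ ⊖ ηq
    trace-π = re conj-π

    -- The coefficient of y in w² + s w - t, the numerator for the slope w / δ. When it vanishes the
    -- numerator lies in F[X] and equals `reduced w`; for the slopes below this expresses that x(ΦP
    -- ± P) is invariant under P ↦ -P.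
    conjugate-condition : Poly → Poly → Poly
    conjugate-condition a b = a ⊗ b ⊕ b ⊗ a ⊕ ⊖ (b ⊗ b ⊗ η) ⊕ s ⊗ b

    reduced : Quad → Poly
    reduced (a , b) = a ⊗ a ⊕ b ⊗ b ⊗ cubic ⊕ s ⊗ a ⊕ ⊖ t

    module CR = ChordForms quadRing (c a₁) (c a₂) (c a₃) (c a₄) (c a₆)
    module KR = Kummer quadRing (c b₂) (c b₄) (c b₆) (c b₈)
    module KC = Kummer quadRing CR.b₂ CR.b₄ CR.b₆ CR.b₈

    numerator-reduced : ∀ w → conjugate-condition (proj₁ w) (proj₂ w) ≋ [] → CR.numerator (x̂ ^ q) x̂ w ≃ embed (reduced w)
    numerator-reduced w@(a , b) cond = R.trans (RS.linear₃ (RS.solve 7 (λ w S T xq x a₁ a₂ →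
        w :* w :+ a₁ :* w :* (xq :- x) :- (a₂ :+ xq :+ x) :* ((xq :- x) :* (xq :- x)) :- (w :* w :+ S :* w :- T)
        := :- w :* (S :- a₁ :* (xq :- x)) :+ one :* (T :- (a₂ :+ xq :+ x) :* ((xq :- x) :* (xq :- x))) :+ con 0 :* (w :- w))
        w (embed s) (embed t) (x̂ ^ q) x̂ (c a₁) (c a₂))
      (R.trans (E.push 3 (λ a₁ xq x → a₁ :* (xq :- x)) (const a₁) Xq X) (R.*-congˡ (R.+-congʳ x̂q)))
      (R.trans (E.push 3 (λ a₂ xq x → (a₂ :+ xq :+ x) :* ((xq :- x) :* (xq :- x))) (const a₂) Xq X)
        (R.*-cong (R.+-congʳ (R.+-congˡ x̂q)) (R.*-cong (R.+-congʳ x̂q) (R.+-congʳ x̂q)))) R.refl)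
      (PS.solve 5 (λ a b f s t → a :* a :+ b :* b :* f :+ (s :* a :+ con 0 :* b :* f) :- t := a :* a :+ b :* b :* f :+ s :* a :- t) a b cubic s t
      ,, P.trans (PS.solve 4 (λ a b h s → a :* b :+ b :* a :- b :* b :* h :+ (s :* b :+ con 0 :* a :- con 0 :* b :* h) :- con 0
          := a :* b :+ b :* a :- b :* b :* h :+ s :* b) a b η s) cond)

    -- Ordinate differences of ΦP with P and with -P. Hence `n₊` is δ² x(ΦP + P) and `n₋` is δ² x(ΦP
    -- - P).
    w₊ w₋ : Quad
    w₊ = π R.- ŷ
    w₋ = π R.+ ŷ R.+ embed η

    cond₊ : conjugate-condition (proj₁ w₊) (proj₂ w₊) ≋ []
    cond₊ = PS.linear₂ (PS.solve 5 (λ a b h hq s → let a′ = a :- con 0 in let b′ = b :- one in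
      a′ :* b′ :+ b′ :* a′ :- b′ :* b′ :* h :+ s :* b′ :- con 0
      := (b :- one) :* (a :- b :* h :- (:- a :- hq)) :+ :- (b :- one) :* (hq :- (h :+ s))) α β η ηq s) trace-π ηq-η

    cond₋ : conjugate-condition (proj₁ w₋) (proj₂ w₋) ≋ []
    cond₋ = PS.linear₂ (PS.solve 5 (λ a b h hq s → let a′ = a :+ con 0 :+ h in let b′ = b :+ one :+ con 0 in
      a′ :* b′ :+ b′ :* a′ :- b′ :* b′ :* h :+ s :* b′ :- con 0
      := (b :+ one) :* (a :- b :* h :- (:- a :- hq)) :+ :- (b :+ one) :* (hq :- (h :+ s))) α β η ηq s) trace-π ηq-η

    n₊ n₋ : Poly
    n₊ = reduced w₊
    n₋ = reduced w₋

    curve-q : CR.Curve (x̂ ^ q) π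
    curve-q = R.trans (R.+-cong (R.+-congˡ (R.*-congʳ (R.*-congʳ (R.sym (frobenius-scalar a₁))))) (R.*-congʳ (R.sym (frobenius-scalar a₃))))
      (R.trans (Hom.transfer frobenius 7 (λ x y a₁ a₂ a₃ a₄ a₆ → y :* y :+ a₁ :* x :* y :+ a₃ :* y := x :* x :* x :+ a₂ :* x :* x :+ a₄ :* x :+ a₆)
        x̂ ŷ (c a₁) (c a₂) (c a₃) (c a₄) (c a₆) curve)
      (R.+-cong (R.+-cong (R.+-congˡ (R.*-congʳ (R.*-congʳ (frobenius-scalar a₂)))) (R.*-congʳ (frobenius-scalar a₄))) (frobenius-scalar a₆)))

    numerator-cong : ∀ {w w′} → w ≃ w′ → CR.numerator (x̂ ^ q) x̂ w ≃ CR.numerator (x̂ ^ q) x̂ w′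
    numerator-cong e = R.+-congʳ (R.+-cong (R.*-cong e e) (R.*-congʳ (R.*-congˡ e)))

    N₊ : CR.numerator (x̂ ^ q) x̂ (π R.- ŷ) ≃ embed n₊
    N₊ = numerator-reduced w₊ cond₊

    N₋ : CR.numerator (x̂ ^ q) x̂ (π R.+ ŷ R.+ c a₁ R.* x̂ R.+ c a₃) ≃ embed n₋
    N₋ = R.trans (numerator-cong (R.trans (R.+-assoc _ _ _) (R.+-congˡ (R.sym η-expand)))) (numerator-reduced w₋ cond₋)

    b₂-expand : c b₂ ≃ CR.b₂
    b₂-expand = Hom.push scalars 2 (λ a₁ a₂ → a₁ :* a₁ :+ con 4 :* a₂) a₁ a₂
    b₄-expand : c b₄ ≃ CR.b₄
    b₄-expand = Hom.push scalars 3 (λ a₁ a₃ a₄ → con 2 :* a₄ :+ a₁ :* a₃) a₁ a₃ a₄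
    b₆-expand : c b₆ ≃ CR.b₆
    b₆-expand = Hom.push scalars 2 (λ a₃ a₆ → a₃ :* a₃ :+ con 4 :* a₆) a₃ a₆
    b₈-expand : c b₈ ≃ CR.b₈
    b₈-expand = Hom.push scalars 5 (λ a₁ a₂ a₃ a₄ a₆ → a₁ :* a₁ :* a₆ :+ con 4 :* a₂ :* a₆ :- a₁ :* a₃ :* a₄ :+ a₂ :* a₃ :* a₃ :- a₄ :* a₄) a₁ a₂ a₃ a₄ a₆

    embed-formB : embed (KP.formB X Xq (const 1#)) ≃ KC.formB x̂ (x̂ ^ q) R.1#
    embed-formB = R.trans (E.push 6 (λ b₂ b₄ b₆ x X Z →
        con 2 :* ((x :* X) :* (X :+ x :* Z)) :+ b₂ :* ((x :* X) :* Z) :+ b₄ :* ((X :+ x :* Z) :* Z) :+ b₆ :* (Z :* Z))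
        (const b₂) (const b₄) (const b₆) X Xq (const 1#))
      (R.+-cong (R.+-cong (R.+-cong (R.*-congˡ (R.*-cong (R.*-congˡ x̂q) (R.+-congʳ x̂q))) (R.*-cong b₂-expand (R.*-congʳ (R.*-congˡ x̂q))))
        (R.*-cong b₄-expand (R.*-congʳ (R.+-congʳ x̂q)))) (R.*-congʳ b₆-expand))

    embed-formA : embed (KP.formA X Xq (const 1#)) ≃ KC.formA x̂ (x̂ ^ q) R.1#
    embed-formA = R.trans (E.push 3 (λ x X Z → (X :- x :* Z) :* (X :- x :* Z)) X Xq (const 1#)) (R.*-cong (R.+-congʳ x̂q) (R.+-congʳ x̂q))

    embed-formC : embed (KP.formC X Xq (const 1#)) ≃ KC.formC x̂ (x̂ ^ q) R.1#
    embed-formC = R.trans (E.push 6 (λ b₄ b₆ b₈ x X Z →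
        (x :* X) :* (x :* X) :- b₄ :* ((x :* X) :* Z) :- b₆ :* ((X :+ x :* Z) :* Z) :- b₈ :* (Z :* Z))
        (const b₄) (const b₆) (const b₈) X Xq (const 1#))
      (R.+-cong (R.+-cong (R.+-cong (R.*-cong (R.*-congˡ x̂q) (R.*-congˡ x̂q)) (R.-‿cong (R.*-cong b₄-expand (R.*-congʳ (R.*-congˡ x̂q)))))
        (R.-‿cong (R.*-cong b₆-expand (R.*-congʳ (R.+-congʳ x̂q))))) (R.-‿cong (R.*-congʳ b₈-expand)))

    A B C : Poly
    A = KP.formA X Xq (const 1#)
    B = KP.formB X Xq (const 1#)
    C = KP.formC X Xq (const 1#)

    sum : n₊ ⊕ n₋ ≋ B
    sum = re (R.trans (E.+-hom n₊ n₋) (R.trans (R.+-cong (R.sym N₊) (R.sym N₋)) (R.trans (CR.numerator-sum curve-q curve) (R.sym embed-formB))))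

    product : n₊ ⊗ n₋ ≋ A ⊗ C
    product = re (R.trans (E.*-hom n₊ n₋) (R.trans (R.*-cong (R.sym N₊) (R.sym N₋)) (R.trans (CR.numerator-product curve-q curve)
      (R.trans (R.*-cong (R.sym embed-formA) (R.sym embed-formC)) (R.sym (E.*-hom A C))))))

  private
    module _ (a : Carrier) where
      open QuadraticMap (evalHom a) η cubic using (mapHom)
      module QR = QuadraticRoots F (eval a η) (eval a cubic)
      module Q = Quadratic fieldRing (eval a η) (eval a cubic)
      module QC = CommutativeRing Q.quadRing
      module QS = RingSolve Q.quadRing
      module FQ = Frobenius Q.quadRing Q.embedHom
      module M = Hom mapHom

      map-ŷ : M.φ ŷ Q.≃ Q.root
      map-ŷ = refl Q.,, eval-const a 1#

      map-π : M.φ π Q.≃ Q.root FQ.^ q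
      map-π = QC.trans (PowerHom.hom-^ mapHom q ŷ) (FQ.^-cong q map-ŷ)

      linear-divides : ∀ {p} → eval a p ≡ 0# → ∃ λ g → p ≋ (X- a) ⊗ g
      linear-divides {p} e = quot a p , root-factor e

      δ-divides : ∃ λ g → δ ≋ (X- a) ⊗ g
      δ-divides = linear-divides (eval-X^q-X a)

      -- `reduced w` is a quadratic form in δ and the two coordinates of w, and X - a divides all
      -- three of them.
      square-divides : ∀ w → M.φ w Q.≃ QC.0# → ∃ λ g → reduced w ≋ (X- a) PP.^ 2 ⊗ g
      square-divides (u , v) e =
        let (u′ , eu) = linear-divides (Q.re e)
            (v′ , ev) = linear-divides (Q.im e)
            (d , ed)  = δ-divides
        in u′ ⊗ u′ ⊕ v′ ⊗ v′ ⊗ cubic ⊕ const a₁ ⊗ d ⊗ u′ ⊕ ⊖ ((const a₂ ⊕ Xq ⊕ X) ⊗ (d ⊗ d))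
        , PS.linear₃ (PS.solve 10 (λ u v D l u′ v′ d f a₁ k →
            u :* u :+ v :* v :* f :+ a₁ :* D :* u :- k :* (D :* D)
              :- l :* (l :* one) :* (u′ :* u′ :+ v′ :* v′ :* f :+ a₁ :* d :* u′ :- k :* (d :* d))
            := (u :+ l :* u′ :+ a₁ :* D) :* (u :- l :* u′) :+ (v :+ l :* v′) :* f :* (v :- l :* v′)
              :+ (a₁ :* (l :* u′) :- k :* (D :+ l :* d)) :* (D :- l :* d)) u v δ (X- a) u′ v′ d cubic (const a₁) (const a₂ ⊕ Xq ⊕ X)) eu ev ed

      divides-once : ∀ w → M.φ w QC.* M.φ w Q.≃ QC.0# → ∃ λ g → reduced w ≋ (X- a) PP.^ 1 ⊗ g
      divides-once (u , v) e = let (g , eq) = linear-divides vanishes in g , P.trans eq (P.*-congʳ (P.sym (P.*-identityʳ (X- a))))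
        where
        δ≡0 : eval a δ ≡ 0#
        δ≡0 = eval-X^q-X a
        vanishes : eval a (reduced (u , v)) ≡ 0#
        vanishes = trans (Hom.push (evalHom a) 6 (λ u v d f a₁ k → u :* u :+ v :* v :* f :+ a₁ :* d :* u :- k :* (d :* d)) u v δ cubic (const a₁) (const a₂ ⊕ Xq ⊕ X))
          (FS.linear₂ (FS.solve 6 (λ u v d f a₁ k → u :* u :+ v :* v :* f :+ a₁ :* d :* u :- k :* (d :* d) :- con 0
            := one :* (u :* u :+ v :* v :* f :- con 0) :+ (a₁ :* u :- k :* d) :* (d :- con 0)) (eval a u) (eval a v) (eval a δ) (eval a cubic) (eval a (const a₁)) (eval a (const a₂ ⊕ Xq ⊕ X)))
            (Q.re e) δ≡0)

      divides-zero : ∀ p → ∃ λ g → p ≋ (X- a) PP.^ 0 ⊗ g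
      divides-zero p = p , P.sym (P.*-identityˡ p)

      map-w₊ : M.φ w₊ Q.≃ Q.root FQ.^ q QC.- Q.root
      map-w₊ = QC.trans (Hom.push mapHom 2 (λ p y → p :- y) π ŷ) (QC.+-cong map-π (QC.-‿cong map-ŷ))

      map-w₋ : M.φ w₋ Q.≃ Q.root FQ.^ q QC.+ Q.root QC.+ Q.embed (eval a η)
      map-w₋ = QC.trans (Hom.push mapHom 3 (λ p y h → p :+ y :+ h) π ŷ (embed η)) (QC.+-congʳ (QC.+-cong map-π map-ŷ))

      -- In the fibre over a, with r the class of y, w₊ becomes r^q - r and w₋ becomes r^q + r + h.
      -- The first is zero in the split case and the second in the inert case; in the double case
      -- both are multiples of a nilpotent element, which costs one factor each.
      divides : ∀ {k} → QR.Roots k → (∃ λ g → n₊ ≋ (X- a) PP.^ k ⊗ g) × (∃ λ g → n₋ ≋ (X- a) PP.^ (2 ∸ k) ⊗ g)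
      divides (QR.split y₁ y₂ ne es ep) =
        square-divides w₊ (QC.trans map-w₊ (QS.x≈y⇒x-y≈0 (QR.frobenius-split y₁ y₂ ne es ep))) , divides-zero n₋
      divides (QR.inert irr) = divides-zero n₊ , square-divides w₋ (QC.trans map-w₋ (QR.Inert.frobenius-inert irr))
      divides (QR.double y₀ es ep) = divides-once w₊ (squared {w₊} e₊) , divides-once w₋ (squared {w₋} e₋)
        where
        nil : (Q.root QC.- Q.embed y₀) QC.* (Q.root QC.- Q.embed y₀) Q.≃ QC.0#
        nil = QR.double-nilpotent y₀ es ep
        e₊ : M.φ w₊ Q.≃ QC.- QC.1# QC.* (Q.root QC.- Q.embed y₀)
        e₊ = QC.trans map-w₊ (QS.linear₁ (QS.solve 3 (λ t r y → t :- r :- :- one :* (r :- y) := one :* (t :- y)) (Q.root FQ.^ q) Q.root (Q.embed y₀))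
          (QR.frobenius-double y₀ es ep))
        e₋ : M.φ w₋ Q.≃ QC.1# QC.* (Q.root QC.- Q.embed y₀)
        e₋ = QC.trans map-w₋ (QS.linear₂ (QS.solve 4 (λ t r y h → t :+ r :+ h :- one :* (r :- y) := one :* (t :- y) :+ one :* (y :+ y :- :- h))
            (Q.root FQ.^ q) Q.root (Q.embed y₀) (Q.embed (eval a η)))
          (QR.frobenius-double y₀ es ep) (Hom.transfer Q.embedHom 2 (λ y h → y :+ y := :- h) y₀ (eval a η) es))
        squared : ∀ {w k} → M.φ w Q.≃ k QC.* (Q.root QC.- Q.embed y₀) → M.φ w QC.* M.φ w Q.≃ QC.0#
        squared {w} {k} e = QC.trans (QC.*-cong e e) (QS.linear₁ (QS.solve 2 (λ k z → k :* z :* (k :* z) :- con 0 := k :* k :* (z :* z :- con 0)) k _) nil)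

  count : Carrier → ℕ
  count a = length (QuadraticRoots.roots F (eval a η) (eval a cubic))

  count≤2 : ∀ a → count a ≤ 2
  count≤2 a with count a | QuadraticRoots.classify F (eval a η) (eval a cubic)
  ... | _ | QuadraticRoots.split _ _ _ _ _ = ℕ.≤-refl
  ... | _ | QuadraticRoots.double _ _ _    = s≤s z≤n
  ... | _ | QuadraticRoots.inert _         = z≤n

  private
    complementary : ∀ m m′ as → (∀ a → m a ℕ.+ m′ a ≡ 2) → ∏X-^ m as ⊗ ∏X-^ m′ as ≋ ∏X- as ⊗ ∏X- as
    complementary m m′ [] h = P.refl
    complementary m m′ (a ∷ as) h = P.trans (PS.solve 4 (λ x y z w → x :* y :* (z :* w) := x :* z :* (y :* w)) _ _ _ _)
      (P.trans (P.*-cong (P.trans (^-+ (X- a) (m a) (m′ a)) (P.trans (P.reflexive (cong ((X- a) PP.^_) (h a))) (P.*-congˡ (P.*-identityʳ _)))) (complementary m m′ as h))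
        (PS.solve 2 (λ l p → l :* l :* (p :* p) := l :* p :* (l :* p)) _ _))

    count′ : Carrier → ℕ
    count′ a = 2 ∸ count a

    count+count′ : ∀ a → count a ℕ.+ count′ a ≡ 2
    count+count′ a = ℕ.m+[n∸m]≡n (count≤2 a)

    Z Z′ : Poly
    Z  = ∏X-^ count elements
    Z′ = ∏X-^ count′ elements

    k k′ : ℕ
    k  = ∑ count elements
    k′ = ∑ count′ elements

    k+k′ : k ℕ.+ k′ ≡ q ℕ.+ q
    k+k′ = trans (sym (∑-+ count count′ elements)) (trans (∑-cong elements (λ {a} _ → count+count′ a)) (trans (∑-const 2 elements)
      (trans (cong (ℕ._* 2) length-elements) (trans (ℕ.*-comm q 2) (cong (q ℕ.+_) (ℕ.+-identityʳ q))))))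

    factor₊ : ∃ λ U → n₊ ≋ Z ⊗ U
    factor₊ = ∏X-^-divides count elements unique-elements (λ {a} _ → proj₁ (divides a (QuadraticRoots.classify F (eval a η) (eval a cubic))))

    factor₋ : ∃ λ U → n₋ ≋ Z′ ⊗ U
    factor₋ = ∏X-^-divides count′ elements unique-elements (λ {a} _ → proj₂ (divides a (QuadraticRoots.classify F (eval a η) (eval a cubic))))

    U₊ U₋ : Poly
    U₊ = proj₁ factor₊
    U₋ = proj₁ factor₋

    δ≋ : Xq ⊕ ⊖ (X ⊗ const 1#) ≋ δ
    δ≋ = P.+-congˡ (P.-‿cong (P.*-identityʳ X))

    A≋ : A ≋ Z ⊗ Z′
    A≋ = P.trans (P.*-cong δ≋ δ≋) (P.trans (P.*-cong X^q-X X^q-X) (P.sym (complementary count count′ elements count+count′)))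

    top-A : Top A (q ℕ.+ q)
    top-A = top-cong (P.sym (P.*-cong δ≋ δ≋)) (top-⊗′ top-X^q-X top-X^q-X)

    frobenius-splits : KP.Splits A B C U₋ Z U₊ Z′
    frobenius-splits = Kummer.splits A≋
      (P.trans (P.sym sum) (P.trans (P.+-cong (proj₂ factor₊) (proj₂ factor₋)) (PS.solve 4 (λ Z u Z′ v → Z :* u :+ Z′ :* v := v :* Z′ :+ u :* Z) Z U₊ Z′ U₋)))
      -- n₊ n₋ equals A C on the one hand and Z Z′ U₋ U₊ = A U₋ U₊ on the other.
      (⊗-cancelˡ (top-≋0 top-A) (P.trans (P.sym product) (P.trans (P.*-cong (proj₂ factor₊) (proj₂ factor₋))
        (P.trans (PS.solve 4 (λ Z u Z′ v → Z :* u :* (Z′ :* v) := Z :* Z′ :* (v :* u)) Z U₊ Z′ U₋) (P.*-congʳ (P.sym A≋))))))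

    coprime-q : KP.Coprime Xq (const 1#)
    coprime-q = [] , const 1# , PS.solve 1 (λ x → con 0 :* x :+ one :* one := one) Xq

    size-q : Size Xq (const 1#) q
    size-q = sized (deg-X^ q) (deg-mono z≤n (deg-const 1#)) λ { (e , _) → 0≢1 (trans (sym e) (coeff-X^-n q)) }

    coprime₋ : KP.Coprime U₋ Z
    coprime₋ = KP.splits-coprime (unimodular-P coprime-q) (KP.splits-swap frobenius-splits)

    coprime₊ : KP.Coprime U₊ Z′
    coprime₊ = KP.splits-coprime (unimodular-P coprime-q) frobenius-splits

    -- Strictly below the degree 2(q + 1) of the triple, because the denominator of x(ΦP) is 1. With
    -- deg A = 2q this leaves C alone to attain it.
    deg-B : Deg≤ B (suc q ℕ.+ q)
    deg-B = deg-⊕ (deg-⊕ (deg-⊕ (deg-⊗ (deg-κ 2) (deg-⊗ (deg-⊗ deg-X (deg-X^ q)) deg-sum))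
        (low (deg-⊗ (deg-const b₂) (deg-⊗ (deg-⊗ deg-X (deg-X^ q)) (deg-const 1#)))))
        (low′ (deg-⊗ (deg-const b₄) (deg-⊗ deg-sum (deg-const 1#)))))
      (deg-mono z≤n (deg-⊗ (deg-const b₆) (deg-⊗ (deg-const 1#) (deg-const 1#))))
      where
      deg-sum : Deg≤ (Xq ⊕ X ⊗ const 1#) q
      deg-sum = deg-⊕ (deg-X^ q) (deg-cong (P.sym (P.*-identityʳ X)) (deg-mono (ℕ.<⇒≤ 1<q) deg-X))
      low : ∀ {p} → Deg≤ p (suc q ℕ.+ 0) → Deg≤ p (suc q ℕ.+ q)
      low = deg-mono (ℕ.+-monoʳ-≤ (suc q) z≤n)
      low′ : ∀ {p} → Deg≤ p (q ℕ.+ 0) → Deg≤ p (suc q ℕ.+ q)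
      low′ = deg-mono (ℕ.≤-trans (ℕ.+-monoʳ-≤ q z≤n) (ℕ.n≤1+n (q ℕ.+ q)))

    top-C : Top C (suc q ℕ.+ suc q)
    top-C = top degC λ e → lead≢0 (vanish (deg top-A) _ q+q< , vanish deg-B _ (ℕ.+-monoʳ-< (suc q) ℕ.≤-refl) , e)
      where
      open Size₃ (forms-size size-q)
      q+q< : q ℕ.+ q < suc q ℕ.+ suc q
      q+q< = s≤s (ℕ.+-monoʳ-≤ q (ℕ.n≤1+n q))

    -- n₊ n₋ has degree 4 q + 2 and n₊ + n₋ has degree at most 2 q + 1.
    balanced : ∀ {m m′ n} → m ℕ.+ m′ ≡ n ℕ.+ n → (m < m′ → m′ ≤ n) → (m′ < m → m ≤ n) → m ≡ n × m′ ≡ n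
    balanced {m} {m′} {n} e l r with ℕ.<-cmp m m′
    ... | tri< m<m′ _ _ = contradiction (ℕ.+-mono-<-≤ (ℕ.<-≤-trans m<m′ (l m<m′)) (l m<m′)) (λ h → ℕ.<⇒≢ h e)
    ... | tri> _ _ m′<m = contradiction (ℕ.+-mono-≤-< (r m′<m) (ℕ.<-≤-trans m′<m (r m′<m))) (λ h → ℕ.<⇒≢ h e)
    ... | tri≈ _ refl _ = same , same
      where
      same : m ≡ n
      same with ℕ.<-cmp m n
      ... | tri< h _ _ = contradiction e (ℕ.<⇒≢ (ℕ.+-mono-< h h))
      ... | tri≈ _ h _ = h
      ... | tri> _ _ h = contradiction (sym e) (ℕ.<⇒≢ (ℕ.+-mono-< h h))

    top-n : Top n₊ (suc q ℕ.+ q) × Top n₋ (suc q ℕ.+ q)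
    top-n = go (zero-or-top n₊) (zero-or-top n₋)
      where
      arith : ∀ q → (q ℕ.+ q) ℕ.+ (suc q ℕ.+ suc q) ≡ (suc q ℕ.+ q) ℕ.+ (suc q ℕ.+ q)
      arith = solve-∀
      top-product : Top (n₊ ⊗ n₋) ((q ℕ.+ q) ℕ.+ (suc q ℕ.+ suc q))
      top-product = top-cong (P.sym product) (top-⊗′ top-A top-C)
      go : n₊ ≋ [] ⊎ ∃ (Top n₊) → n₋ ≋ [] ⊎ ∃ (Top n₋) → Top n₊ (suc q ℕ.+ q) × Top n₋ (suc q ℕ.+ q)
      go (inj₁ z) _ = contradiction (P.trans (P.*-congʳ z) (P.zeroˡ _)) (top-≋0 top-product)
      go (inj₂ _) (inj₁ z) = contradiction (P.trans (P.*-congˡ z) (P.zeroʳ _)) (top-≋0 top-product)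
      go (inj₂ (m , s)) (inj₂ (m′ , s′)) = subst (Top n₊) (proj₁ same) s , subst (Top n₋) (proj₂ same) s′
        where
        same : m ≡ suc q ℕ.+ q × m′ ≡ suc q ℕ.+ q
        same = balanced (trans (top-unique (top-⊗′ s s′) top-product) (arith q))
          (λ h → top≤ deg-B (top-cong sum (top-cong (P.+-comm n₋ n₊) (top-dominates s′ (deg s) h))))
          (λ h → top≤ deg-B (top-cong sum (top-dominates s (deg s′) h)))

    -- 2q + 1 = deg Z′ + deg U and deg Z + deg Z′ = 2q give deg U = deg Z + 1, so the numerator
    -- dominates. As deg Z counts affine points of E or of the twist, the extra 1 is the point at
    -- infinity.
    size-factor : ∀ {n Z′ U Z j j′} → Top n (suc q ℕ.+ q) → Top Z′ j′ → Top Z j → n ≋ Z′ ⊗ U → j ℕ.+ j′ ≡ q ℕ.+ q → Size U Z (suc j)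
    size-factor {n} {Z′} {U} {Z} {j} {j′} t t′ t″ e jj with zero-or-top U
    ... | inj₁ z = contradiction (P.trans e (P.trans (P.*-congˡ z) (P.zeroʳ _))) (top-≋0 t)
    ... | inj₂ (u , s) = sized (subst (Deg≤ U) u≡ (deg s)) (deg-mono (ℕ.n≤1+n j) (deg t″)) λ { (z , _) → lead s (subst (λ i → coeff U i ≡ 0#) (sym u≡) z) }
      where
      u≡ : u ≡ suc j
      u≡ = ℕ.+-cancelˡ-≡ j′ _ _ (trans (top-unique (top-⊗′ t′ s) (top-cong e t)) (trans (cong suc (trans (sym jj) (ℕ.+-comm j j′))) (sym (ℕ.+-suc j′ j))))

  private
    related₋ : KP.Related X U₋ Z Xq (const 1#)
    related₋ = KP.related-sym X Xq (const 1#) U₋ Z (KP.splits-related {X} {Xq} {const 1#} {U₊} {Z′} {U₋} {Z} (KP.splits-swap frobenius-splits))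

    related₊ : KP.Related X U₊ Z′ Xq (const 1#)
    related₊ = KP.related-sym X Xq (const 1#) U₊ Z′ (KP.splits-related {X} {Xq} {const 1#} {U₋} {Z} {U₊} {Z′} frobenius-splits)

    size₋ : Size U₋ Z (suc k)
    size₋ = size-factor (proj₂ top-n) (top-∏X-^ count′ elements) (top-∏X-^ count elements) (proj₂ factor₋) k+k′

    size₊ : Size U₊ Z′ (suc k′)
    size₊ = size-factor (proj₁ top-n) (top-∏X-^ count elements) (top-∏X-^ count′ elements) (proj₂ factor₊) (trans (ℕ.+-comm k′ k) k+k′)

  abstract
    adjacent-minus : Adjacent q (suc (∑ count elements))
    adjacent-minus = adjacent Xq (const 1#) U₋ Z coprime-q coprime₋ size-q size₋ related₋

    adjacent-plus : Adjacent q (suc (∑ (λ a → 2 ∸ count a) elements))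
    adjacent-plus = adjacent Xq (const 1#) U₊ Z′ coprime-q coprime₊ size-q size₊ related₊

-- Counting the points of the quadratic twist.

module TwistCount (F : FiniteField) (W : Weierstrass F) (D : FiniteField.Carrier F) (param : TwistParam F D) where
  open import Relation.Binary.PropositionalEquality

  open FiniteField F renaming (size to q)
  open Weierstrass W
  open FieldKit F
  open FieldPoly F using (eval)
  open FieldFinite F using (∈-elements; unique-elements; length-elements)
  open QuadraticRoots F using (roots; Roots; classify; split; double; inert)
  open Lists
  open import Data.List using ([]; _∷_; length; map)
  open import Data.List.Relation.Unary.Unique.Propositional.Properties using (filter⁺)
  open import Data.Nat as ℕ using (ℕ; suc; _≤_; z≤n; s≤s; _∸_)
  import Data.Nat.Properties as ℕ
  open import Data.Nat.Tactic.RingSolver using (solve-∀)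

  u i : Carrier
  u = 1# - fromℕ 4 * D
  i = u ⁻¹

  -- If 4D = 1, then -1/2 is a root of X² + X + D; and if 2 = 0, then u = 1.
  u≢0 : u ≢ 0#
  u≢0 e with fromℕ 2 ≟ 0#
  ... | yes 2≡0 = 0≢1 (sym (linear₂ (solve 1 (λ D → one :- con 0 := one :* (one :- con 4 :* D :- con 0) :+ con 2 :* D :* (con 2 :- con 0)) D) e 2≡0))
  ... | no 2≢0 = param x (*≡0 {z = fromℕ 2 * fromℕ 2} (linear₂ (solve 2 (λ x D → (x :* x :+ x :+ D) :* (con 2 :* con 2) :- con 0
        := (x :* con 2 :+ one) :* (x :* con 2 :- :- one) :+ :- one :* (one :- con 4 :* D :- con 0)) x D) (/-cancel 2≢0 (- 1#)) e) (*≢0 2≢0 2≢0))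
    where x = (- 1#) / fromℕ 2

  iu : i * u ≡ 1#
  iu = inverseˡ u≢0

  root-∈ : ∀ {h c y} → y * y + h * y ≡ c → y ∈ roots h c
  root-∈ {h} {c} {y} e = ∈-filter⁺ (λ y → (y * y + h * y) ≟ c) (∈-elements y) e

  ∈-root : ∀ {h c y} → y ∈ roots h c → y * y + h * y ≡ c
  ∈-root {h} {c} y∈ = proj₂ (∈-filter⁻ (λ y → (y * y + h * y) ≟ c) {xs = elements} y∈)

  unique-roots : ∀ h c → Unique (roots h c)
  unique-roots h c = filter⁺ (λ y → (y * y + h * y) ≟ c) unique-elements

  module _ (h : Carrier) where
    twisted : Carrier → Carrier
    twisted c = u * c - D * h * h

    private
      -- A root z of the twisted equation would make (z - y₁)/(y₁ - y₂) a root of X² + X + D.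
      none : ∀ {c} y₁ y₂ → y₁ ≢ y₂ → y₁ + y₂ ≡ - h → y₁ * y₂ ≡ - c → ∀ {z} → z ∈ roots h (twisted c) → ⊥
      none {c} y₁ y₂ ne es ep {z} z∈ = param x (*≡0 {z = (y₁ - y₂) * (y₁ - y₂)}
        (linear₄ (solve 7 (λ D h c y₁ y₂ z x → (x :* x :+ x :+ D) :* ((y₁ :- y₂) :* (y₁ :- y₂)) :- con 0
          := (x :* (y₁ :- y₂) :+ z :- y₂) :* (x :* (y₁ :- y₂) :- (z :- y₁))
            :+ one :* (z :* z :+ h :* z :- ((one :- con 4 :* D) :* c :- D :* h :* h))
            :+ (D :* (y₁ :+ y₂ :- h) :- z) :* (y₁ :+ y₂ :- :- h)
            :+ (one :- con 4 :* D) :* (y₁ :* y₂ :- :- c)) D h c y₁ y₂ z x)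
          (/-cancel (x-y≢0 ne) (z - y₁)) (∈-root z∈) es ep) (*≢0 (x-y≢0 ne) (x-y≢0 ne)))
        where x = (z - y₁) / (y₁ - y₂)

      only : ∀ {c} y₀ → y₀ + y₀ ≡ - h → y₀ * y₀ ≡ - c → ∀ {z} → z ∈ roots h (twisted c) → z ∈ y₀ ∷ []
      only {c} y₀ es ep {z} z∈ = here (x-y≡0⇒x≡y (square (linear₃ (solve 5 (λ D h c y z → (z :- y) :* (z :- y) :- con 0
          := one :* (z :* z :+ h :* z :- ((one :- con 4 :* D) :* c :- D :* h :* h))
            :+ (D :* (y :+ y :- h) :- z) :* (y :+ y :- :- h) :+ (one :- con 4 :* D) :* (y :* y :- :- c)) D h c y₀ z) (∈-root z∈) es ep)))
        where
        square : ∀ {z} → z * z ≡ 0# → z ≡ 0#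
        square e with zero-product e
        ... | inj₁ h = h
        ... | inj₂ h = h

      Roots≤2 : ∀ {h c k} → Roots h c k → k ≤ 2
      Roots≤2 (split _ _ _ _ _) = ℕ.≤-refl
      Roots≤2 (double _ _ _)    = s≤s z≤n
      Roots≤2 (inert _)         = z≤n

      -- An upper bound is all that is shown case by case; averaging over c makes it an equality, so
      -- no root of the twisted equation has to be constructed.
      at-most : ∀ {c k} → Roots h c k → k ℕ.+ length (roots h (twisted c)) ≤ 2
      at-most {c} (split y₁ y₂ ne es ep) = s≤s (s≤s (unique-length {ys = []} (unique-roots h (twisted c)) (λ z∈ → ⊥-elim (none y₁ y₂ ne es ep z∈))))
      at-most {c} (double y₀ es ep) = s≤s (unique-length (unique-roots h (twisted c)) (only y₀ es ep))
      at-most {c} (inert _) = Roots≤2 (classify h (twisted c))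

      -- The one right-hand side c for which y solves the twisted equation.
      g : Carrier → Carrier
      g y = (y * y + h * y + D * h * h) * i

      fibre-g : ∀ c → length (roots h (twisted c)) ≡ length (fibre _≟_ g elements c)
      fibre-g c = length-filter-cong (λ y → (y * y + h * y) ≟ twisted c) (λ y → g y ≟ c)
        (λ y e → linear₂ (solve 6 (λ D h c i u y → (y :* y :+ h :* y :+ D :* h :* h) :* i :- c
          := i :* (y :* y :+ h :* y :- (u :* c :- D :* h :* h)) :+ c :* (i :* u :- one)) D h c i u y) e iu)
        (λ y e → linear₂ (solve 6 (λ D h c i u y → y :* y :+ h :* y :- (u :* c :- D :* h :* h)
          := u :* ((y :* y :+ h :* y :+ D :* h :* h) :* i :- c) :+ :- (y :* y :+ h :* y :+ D :* h :* h) :* (i :* u :- one)) D h c i u y) e iu)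
        elements

    -- Each y is a root of exactly one equation of either kind, so on average, hence always, there are two roots.
    two-roots : ∀ c → length (roots h c) ℕ.+ length (roots h (twisted c)) ≡ 2
    two-roots c = ∑-tight elements (λ {c} _ → at-most (classify h c)) (ℕ.≤-reflexive (sym total)) (∈-elements c)
      where
      total : ∑ (λ c → length (roots h c) ℕ.+ length (roots h (twisted c))) elements ≡ length elements ℕ.* 2
      total = trans (∑-+ (λ c → length (roots h c)) (λ c → length (roots h (twisted c))) elements)
        (trans (cong₂ ℕ._+_ (∑-fibres _≟_ (λ y → y * y + h * y) unique-elements elements (λ {y} _ → ∈-elements _))
          (trans (∑-cong elements (λ {c} _ → fibre-g c)) (∑-fibres _≟_ g unique-elements elements (λ {y} _ → ∈-elements _))))
        (dbl (length elements)))
        where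
        dbl : ∀ n → n ℕ.+ n ≡ n ℕ.* 2
        dbl = solve-∀

  scale-≤ : ∀ {w} h c → w ≢ 0# → length (roots h c) ≤ length (roots (w * h) (w * w * c))
  scale-≤ {w} h c w≢0 = ℕ.≤-trans (ℕ.≤-reflexive (sym (length-map (w *_) (roots h c))))
    (unique-length (unique-map (λ {x} {y} _ _ e → *-cancelʳ w≢0 (trans (*-comm x w) (trans e (*-comm w y)))) (unique-roots h c)) into)
    where
    into : ∀ {z} → z ∈ map (w *_) (roots h c) → z ∈ roots (w * h) (w * w * c)
    into z∈ with ∈-map⁻ (w *_) z∈
    ... | y , y∈ , refl = root-∈ (linear₁ (solve 4 (λ w h c y → w :* y :* (w :* y) :+ w :* h :* (w :* y) :- w :* w :* c := w :* w :* (y :* y :+ h :* y :- c)) w h c y) (∈-root y∈))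

  scale-roots : ∀ {w} h c → w ≢ 0# → length (roots (w * h) (w * w * c)) ≡ length (roots h c)
  scale-roots {w} h c w≢0 = ℕ.≤-antisym (ℕ.≤-trans (scale-≤ (w * h) (w * w * c) (⁻¹≢0 w≢0))
      (ℕ.≤-reflexive (cong₂ (λ h c → length (roots h c))
        (linear₁ (solve 3 (λ w v h → v :* (w :* h) :- h := h :* (v :* w :- one)) w (w ⁻¹) h) (inverseˡ w≢0))
        (linear₁ (solve 3 (λ w v c → v :* v :* (w :* w :* c) :- c := c :* (v :* w :+ one) :* (v :* w :- one)) w (w ⁻¹) c) (inverseˡ w≢0)))))
    (scale-≤ h c w≢0)

  W′ : Weierstrass F
  W′ = twistEqn F D W

  inverse-unique : ∀ {a b} → b * a ≡ 1# → a ⁻¹ ≡ b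
  inverse-unique {a} {b} e = *-cancelʳ a≢0 (trans (inverseˡ a≢0) (sym e))
    where
    a≢0 : a ≢ 0#
    a≢0 z = 0≢1 (trans (sym (zeroʳ b)) (trans (cong (b *_) (sym z)) e))

  -- With powers of `i` in place of inverses of powers of `u`, the coefficients become polynomial
  -- and accessible to the solver.
  twist-coefficients : W′ ≡ weier (a₁ * i) (a₂ * i - D * a₁ * a₁ * (i * i)) (a₃ * (i * i))
    (a₄ * (i * i) - fromℕ 2 * D * a₁ * a₃ * (i * i * i)) (a₆ * (i * i * i) - D * a₃ * a₃ * (i * i * i * i))
  twist-coefficients = trans (cong (λ j → weier (a₁ * i) (a₂ * i - D * a₁ * a₁ * j) (a₃ * j) (a₄ * j - fromℕ 2 * D * a₁ * a₃ * (u * u * u) ⁻¹) (a₆ * (u * u * u) ⁻¹ - D * a₃ * a₃ * (u * u * (u * u)) ⁻¹)) j₂)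
    (cong₂ (λ j k → weier (a₁ * i) (a₂ * i - D * a₁ * a₁ * (i * i)) (a₃ * (i * i)) (a₄ * (i * i) - fromℕ 2 * D * a₁ * a₃ * j) (a₆ * j - D * a₃ * a₃ * k)) j₃ j₄)
    where
    j₂ : (u * u) ⁻¹ ≡ i * i
    j₂ = inverse-unique (linear₁ (solve 2 (λ i u → i :* i :* (u :* u) :- one := (i :* u :+ one) :* (i :* u :- one)) i u) iu)
    j₃ : (u * u * u) ⁻¹ ≡ i * i * i
    j₃ = inverse-unique (linear₁ (solve 2 (λ i u → i :* i :* i :* (u :* u :* u) :- one := (i :* u :* (i :* u) :+ i :* u :+ one) :* (i :* u :- one)) i u) iu)
    j₄ : (u * u * (u * u)) ⁻¹ ≡ i * i * i * i
    j₄ = inverse-unique (linear₁ (solve 2 (λ i u → i :* i :* i :* i :* (u :* u :* (u :* u)) :- one := (i :* u :* (i :* u) :+ one) :* (i :* u :+ one) :* (i :* u :- one)) i u) iu)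

  private
    module C = Coordinate F W
    count-at : Weierstrass F → Carrier → ℕ
    count-at W a = length (roots (eval a (Coordinate.η F W)) (eval a (Coordinate.cubic F W)))

    twist-count : ∀ a → count-at W a ℕ.+ count-at W′ (i * a) ≡ 2
    twist-count a = trans (cong (count-at W a ℕ.+_) (trans (cong (λ W → count-at W (i * a)) twist-coefficients) (trans
        (cong₂ (λ h c → length (roots h c)) h-eq c-eq) (scale-roots h (twisted h (eval a C.cubic)) (*≢0 i≢0 i≢0))))) (two-roots h (eval a C.cubic))
      where
      h = eval a C.η
      i≢0 : i ≢ 0#
      i≢0 = ⁻¹≢0 u≢0
      h-eq : a₃ * (i * i) + i * a * (a₁ * i + i * a * 0#) ≡ i * i * h
      h-eq = solve 4 (λ a₁ a₃ a i → a₃ :* (i :* i) :+ i :* a :* (a₁ :* i :+ i :* a :* con 0) := i :* i :* (a₃ :+ a :* (a₁ :+ a :* con 0))) a₁ a₃ a i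
      c-eq : (a₆ * (i * i * i) - D * a₃ * a₃ * (i * i * i * i)) + i * a * ((a₄ * (i * i) - fromℕ 2 * D * a₁ * a₃ * (i * i * i)) + i * a * ((a₂ * i - D * a₁ * a₁ * (i * i)) + i * a * (1# + i * a * 0#)))
        ≡ i * i * (i * i) * twisted h (eval a C.cubic)
      c-eq = linear₁ (solve 9 (λ a₁ a₂ a₃ a₄ a₆ D i u a →
          let h = a₃ :+ a :* (a₁ :+ a :* con 0) in let f = a₆ :+ a :* (a₄ :+ a :* (a₂ :+ a :* (one :+ a :* con 0))) in
          (a₆ :* (i :* i :* i) :- D :* a₃ :* a₃ :* (i :* i :* i :* i)) :+ i :* a :* ((a₄ :* (i :* i) :- con 2 :* D :* a₁ :* a₃ :* (i :* i :* i)) :+ i :* a :* ((a₂ :* i :- D :* a₁ :* a₁ :* (i :* i)) :+ i :* a :* (one :+ i :* a :* con 0)))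
            :- i :* i :* (i :* i) :* (u :* f :- D :* h :* h)
          := :- (i :* i :* i :* f) :* (i :* u :- one)) a₁ a₂ a₃ a₄ a₆ D i u a) iu

  length-points-twist : length (points F W′) ≡ suc (∑ (λ a → 2 ∸ Points.count F W a) elements)
  length-points-twist = trans (Points.length-points F W′) (cong suc (trans (sym (∑-↭ (Points.count F W′) perm))
    (trans (∑-map (Points.count F W′) (i *_) elements) (∑-cong elements λ {a} _ → sym (trans (cong (_∸ count-at W a) (sym (twist-count a))) (ℕ.m+n∸m≡n (count-at W a) _))))))
    where
    perm = self-map-↭ unique-elements (λ {x} {y} _ _ e → *-cancelʳ (⁻¹≢0 u≢0) (trans (*-comm x i) (trans e (*-comm i y)))) (λ {x} _ → ∈-elements (i * x))

  points-sum : length (points F W) ℕ.+ length (points F W′) ≡ q ℕ.+ 1 ℕ.+ (q ℕ.+ 1)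
  points-sum = trans (cong₂ ℕ._+_ (Points.length-points F W) length-points-twist) (trans (arith _ _)
    (trans (cong (2 ℕ.+_) (trans (sym (∑-+ (Points.count F W) (λ a → 2 ∸ Points.count F W a) elements))
      (trans (∑-cong elements (λ {a} _ → ℕ.m+[n∸m]≡n (ℕ.≤-trans (ℕ.m≤m+n (count-at W a) _) (ℕ.≤-reflexive (twist-count a))))) (trans (∑-const 2 elements) (cong (ℕ._* 2) length-elements))))) (arith′ q)))
    where
    arith : ∀ a b → suc a ℕ.+ suc b ≡ 2 ℕ.+ (a ℕ.+ b)
    arith = solve-∀
    arith′ : ∀ q → 2 ℕ.+ q ℕ.* 2 ≡ q ℕ.+ 1 ℕ.+ (q ℕ.+ 1)
    arith′ = solve-∀

-- The arithmetic of the orders and the finite check.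

module Numerics where
  open import Data.List using (List; []; _∷_)
  open import Data.List.Membership.DecPropositional using (_∈?_)
  open import Data.Nat
  open import Data.Nat.Divisibility using (_∣_; _∣?_; ∣⇒≤)
  open import Data.Nat.DivMod using (_%_)
  open import Data.Nat.Properties
  open import Data.Nat.Tactic.RingSolver using (solve-∀)
  open import Relation.Binary.PropositionalEquality

  exceptional : List ℕ
  exceptional = 3 ∷ 4 ∷ 5 ∷ 7 ∷ 9 ∷ 11 ∷ 16 ∷ 17 ∷ 23 ∷ 25 ∷ 29 ∷ 49 ∷ []

  distance : ℕ → ℕ → ℕ
  distance m n = (m ∸ n) + (n ∸ m)

  Leftover : (A B M N : ℕ) → Set
  Leftover A B M N = (A ≡ 12 × B ≡ 16 × M ≡ 4 × N ≡ 8) ⊎ (A ≡ 16 × B ≡ 24 × M ≡ 4 × N ∣ 12)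

  -- Parities under which the bound 4L² on the product of the orders improves to L².
  Small : (q M N : ℕ) → Set
  Small q M N = M % 2 ≡ 1 ⊎ N % 2 ≡ 1 ⊎ q % 2 ≡ 0

  -- A = q + 1 − x and B = q + 1 + x are the group orders, M = 1 + m and N = 1 + n the exponents,
  -- L = 1 + l their least common multiple, and 1 + d a multiple of L such that q + 1 − x ± (1 + d)
  -- is in the Hasse interval.
  private
    With-n With-m With-l : (q A B l m : ℕ) → ℕ → Set
    With-n q A B l m n = suc n ∣ suc l → suc n ∣ B → B ≤ suc n * suc n →
      (Small q (suc m) (suc n) → A * B ≤ suc l * suc l) → (∀ {c} → c < l → ¬ (suc m ∣ suc c × suc n ∣ suc c)) → Leftover A B (suc m) (suc n)
    With-m q A B l _ m = suc m ∣ suc l → suc m ∣ A → A ≤ suc m * suc m → ∀ {n} → n < 33 → With-n q A B l m n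
    With-l q A B d _ l = suc l ∣ suc d → A * B ≤ suc l * suc l * 4 → ∀ {m} → m < 33 → With-m q A B l 0 m

    In-interval : (q A d : ℕ) → Set
    In-interval q A d = distance (A + suc d) (suc q) * distance (A + suc d) (suc q) ≤ 4 * q
      ⊎ distance (A ∸ suc d) (suc q) * distance (A ∸ suc d) (suc q) ≤ 4 * q

    With-d : (q A B d : ℕ) → Set
    With-d q A B d = A * B ≤ suc d * suc d * 4 → In-interval q A d → ∀ {l} → l < 33 → With-l q A B d 0 l

    With-x : (q x : ℕ) → Set
    With-x q x = x * x ≤ 4 * q → ∀ {d} → d < 33 → With-d q (suc q ∸ x) (suc q + x) d

    With-q : ℕ → Set
    With-q q = 1 < q → q ∉ exceptional → ∀ {x} → x < 17 → With-x q x

    small? : ∀ q M N → Dec (Small q M N)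
    small? q M N = (M % 2 ≟ 1) ⊎-dec (N % 2 ≟ 1) ⊎-dec (q % 2 ≟ 0)

    leftover? : ∀ A B M N → Dec (Leftover A B M N)
    leftover? A B M N = ((A ≟ 12) ×-dec (B ≟ 16) ×-dec (M ≟ 4) ×-dec (N ≟ 8)) ⊎-dec ((A ≟ 16) ×-dec (B ≟ 24) ×-dec (M ≟ 4) ×-dec (N ∣? 12))

    with-n? : ∀ q A B l m n → Dec (With-n q A B l m n)
    with-n? q A B l m n = (suc n ∣? suc l) →-dec (suc n ∣? B) →-dec (B ≤? suc n * suc n) →-dec
      (small? q (suc m) (suc n) →-dec (A * B ≤? suc l * suc l)) →-dec
      allUpTo? (λ c → ¬? ((suc m ∣? suc c) ×-dec (suc n ∣? suc c))) l →-dec leftover? A B (suc m) (suc n)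

    with-m? : ∀ q A B l m → Dec (With-m q A B l 0 m)
    with-m? q A B l m = (suc m ∣? suc l) →-dec (suc m ∣? A) →-dec (A ≤? suc m * suc m) →-dec allUpTo? (with-n? q A B l m) 33

    with-l? : ∀ q A B d l → Dec (With-l q A B d 0 l)
    with-l? q A B d l = (suc l ∣? suc d) →-dec (A * B ≤? suc l * suc l * 4) →-dec allUpTo? (with-m? q A B l) 33

    with-d? : ∀ q A B d → Dec (With-d q A B d)
    with-d? q A B d = (A * B ≤? suc d * suc d * 4) →-dec ((_ ≤? _) ⊎-dec (_ ≤? _)) →-dec allUpTo? (with-l? q A B d) 33

    with-x? : ∀ q x → Dec (With-x q x)
    with-x? q x = (x * x ≤? 4 * q) →-dec allUpTo? (with-d? q (suc q ∸ x) (suc q + x)) 33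

    with-q? : ∀ q → Dec (With-q q)
    with-q? q = (1 <? q) →-dec ¬? (_∈?_ _≟_ q exceptional) →-dec allUpTo? (with-x? q) 17

  abstract
    -- The cheap conditions on each parameter stand before the quantifier over the next one, so the
    -- decision procedure prunes the search as it descends.
    finite-check : ∀ {q} → q < 66 → With-q q
    finite-check = toWitness {a? = allUpTo? with-q? 66} _

  private
    bounded : ∀ {m k n} → m * m ≤ n → n < k * k → m < k
    bounded {m} {k} h l = ≰⇒> λ k≤m → <⇒≱ l (≤-trans (*-mono-≤ k≤m k≤m) h)

    m≤n+distance : ∀ m n → m ≤ n + distance m n
    m≤n+distance m n = ≤-trans (m≤n+m∸n m n) (+-monoʳ-≤ n (m≤m+n (m ∸ n) (n ∸ m)))

    n≤m+distance : ∀ m n → n ≤ m + distance m n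
    n≤m+distance m n = ≤-trans (m≤n+m∸n n m) (+-monoʳ-≤ m (m≤n+m (n ∸ m) (m ∸ n)))

    square-sum : ∀ {k x y} → x * x ≤ 4 * k → y * y ≤ 4 * k → (x + y) * (x + y) ≤ 16 * k
    square-sum {k} {x} {y} hx hy with ≤-total x y
    ... | inj₁ x≤y = ≤-trans (*-mono-≤ (+-monoˡ-≤ y x≤y) (+-monoˡ-≤ y x≤y)) (≤-trans (≤-reflexive (double y)) (≤-trans (*-monoʳ-≤ 4 hy) (≤-reflexive (sym (*-assoc 4 4 k)))))
      where
      double : ∀ y → (y + y) * (y + y) ≡ 4 * (y * y)
      double = solve-∀
    ... | inj₂ y≤x = ≤-trans (*-mono-≤ (+-monoʳ-≤ x y≤x) (+-monoʳ-≤ x y≤x)) (≤-trans (≤-reflexive (double x)) (≤-trans (*-monoʳ-≤ 4 hx) (≤-reflexive (sym (*-assoc 4 4 k)))))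
      where
      double : ∀ y → (y + y) * (y + y) ≡ 4 * (y * y)
      double = solve-∀

  -- With D = 1 + d, the inequalities AB ≤ 4L² ≤ 4D², D² ≤ 16q and AB + x² = (q + 1)² give
  -- (q + 1)² ≤ 68q, so that only q < 66 is left to the finite check.
  sieve : ∀ {q x A A′ B d l m n} → 1 < q → q ∉ exceptional → A + x ≡ suc q → B ≡ suc q + x → x * x ≤ 4 * q →
    distance A′ (suc q) * distance A′ (suc q) ≤ 4 * q → A′ ≡ A + suc d ⊎ A ≡ A′ + suc d →
    suc l ∣ suc d → suc m ∣ suc l → suc n ∣ suc l → (∀ {c} → suc m ∣ suc c → suc n ∣ suc c → l ≤ c) →
    suc m ∣ A → suc n ∣ B → A ≤ suc m * suc m → B ≤ suc n * suc n →
    A * B ≤ suc l * suc l * 4 → (Small q (suc m) (suc n) → A * B ≤ suc l * suc l) → Leftover A B (suc m) (suc n)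
  sieve {q} {x} {A} {A′} {B} {d} {l} {m} {n} 1<q q∉ A+x refl x² y² shift L∣D M∣L N∣L least M∣A N∣B A≤M² B≤N² AB≤ small =
    subst (λ A → Leftover A B (suc m) (suc n)) (sym A≡)
      (finite-check q<66 1<q q∉ x<17 x² d<33 (subst (λ A → A * B ≤ _) A≡ AB≤D²) interval l<33 L∣D (subst (λ A → A * B ≤ _) A≡ AB≤) (below M∣L) M∣L
        (subst (suc m ∣_) A≡ M∣A) (subst (_≤ _) A≡ A≤M²) (below N∣L) N∣L N∣B B≤N² (λ h → subst (λ A → A * B ≤ _) A≡ (small h))
        λ { c<l (Mc , Nc) → <⇒≱ c<l (least Mc Nc) })
    where
    y : ℕ
    y = distance A′ (suc q)
    A≡ : A ≡ suc q ∸ x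
    A≡ = trans (sym (m+n∸n≡m A x)) (cong (_∸ x) A+x)
    D≤ : A′ ≡ A + suc d ⊎ A ≡ A′ + suc d → suc d ≤ x + y
    D≤ (inj₁ e) = +-cancelˡ-≤ A (suc d) (x + y) (≤-trans (≤-reflexive (sym e)) (≤-trans (m≤n+distance A′ (suc q))
      (≤-reflexive (trans (cong (_+ y) (sym A+x)) (+-assoc A x y)))))
    D≤ (inj₂ e) = ≤-trans (+-cancelˡ-≤ A′ (suc d) y (≤-trans (≤-reflexive (sym e)) (≤-trans (≤-trans (m≤m+n A x) (≤-reflexive A+x)) (n≤m+distance A′ (suc q))))) (m≤n+m y x)
    D² : suc d * suc d ≤ 16 * q
    D² = ≤-trans (*-mono-≤ (D≤ shift) (D≤ shift)) (square-sum {q} {x} {y} x² y²)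
    L≤D : suc l ≤ suc d
    L≤D = ∣⇒≤ L∣D
    AB≤D² : A * B ≤ suc d * suc d * 4
    AB≤D² = ≤-trans AB≤ (*-monoˡ-≤ 4 (*-mono-≤ L≤D L≤D))
    product : A * B + x * x ≡ suc q * suc q
    product = trans (cong (λ s → A * (s + x) + x * x) (sym A+x)) (trans (identity A x) (cong₂ _*_ A+x A+x))
      where
      identity : ∀ A x → A * (A + x + x) + x * x ≡ (A + x) * (A + x)
      identity = solve-∀
    bound : suc q * suc q ≤ 68 * q
    bound = ≤-trans (≤-reflexive (sym product)) (≤-trans (+-mono-≤ (≤-trans AB≤D² (≤-trans (*-monoˡ-≤ 4 D²) (≤-reflexive (*-comm (16 * q) 4)))) x²)
      (≤-reflexive (arith q)))
      where
      arith : ∀ q → 4 * (16 * q) + 4 * q ≡ 68 * q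
      arith = solve-∀
    q<66 : q < 66
    -- For q ≥ 66, (q + 1)² = 1 + 2q + q² ≥ 1 + 68q.
    q<66 = ≰⇒> λ 66≤q → <⇒≱ (≤-refl {suc (68 * q)}) (≤-trans (≤-trans (≤-reflexive (arith q)) (s≤s (+-monoʳ-≤ (2 * q) (*-monoˡ-≤ q 66≤q))))
        (≤-trans (≤-reflexive (square q)) bound))
      where
      arith : ∀ q → suc (68 * q) ≡ suc (2 * q + 66 * q)
      arith = solve-∀
      square : ∀ q → suc (2 * q + q * q) ≡ suc q * suc q
      square = solve-∀
    q≤65 : q ≤ 65
    q≤65 = ≤-pred q<66
    x<17 : x < 17
    -- 4 · 65 = 260 < 17².
    x<17 = bounded (≤-trans x² (*-monoʳ-≤ 4 q≤65)) (m≤m+n 261 28)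
    d<33 : d < 33
    -- 16 · 65 = 1040 < 33².
    d<33 = ≤-trans (n≤1+n (suc d)) (bounded (≤-trans D² (*-monoʳ-≤ 16 q≤65)) (m≤m+n 1041 48))
    l<33 : l < 33
    l<33 = ≤-trans L≤D d<33
    below : ∀ {k} → suc k ∣ suc l → k < 33
    below k∣ = ≤-trans (∣⇒≤ k∣) l<33
    interval : In-interval q (suc q ∸ x) d
    interval = subst (λ A → In-interval q A d) A≡ (go shift)
      where
      go : A′ ≡ A + suc d ⊎ A ≡ A′ + suc d → In-interval q A d
      go (inj₁ e) = inj₁ (subst (λ A′ → distance A′ (suc q) * distance A′ (suc q) ≤ 4 * q) e y²)
      go (inj₂ e) = inj₂ (subst (λ A′ → distance A′ (suc q) * distance A′ (suc q) ≤ 4 * q) (sym (trans (cong (_∸ suc d) e) (m+n∸n≡m A′ (suc d)))) y²)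

-- Uniqueness of the pair of orders, from numerical constraints.

module Compatible where
  open Numerics
  open import Data.Nat
  open import Data.Nat.Divisibility using (_∣_; ∣⇒≤; m∣m*n; n∣m*n; ∣m+n∣m⇒∣n; 0∣⇒≡0)
  open import Data.Nat.LCM using (lcm; m∣lcm[m,n]; n∣lcm[m,n]; lcm-least)
  open import Data.Nat.Properties
  open import Relation.Binary.PropositionalEquality

  -- Everything the uniqueness argument needs to know about the two groups. The bounds are stated
  -- for every positive common multiple of M and N, so that the least one can be chosen later.
  record Compatible (q A B M N : ℕ) : Set where
    field
      first   : A ≤ M * M
      second  : B ≤ N * N
      product : ∀ {l} → M ∣ suc l → N ∣ suc l → A * B ≤ suc l * suc l * 4
      small   : ∀ {l} → M ∣ suc l → N ∣ suc l → Small q M N → A * B ≤ suc l * suc l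
      ¬leftover : ¬ Leftover A B M N

  positive-divisor : ∀ {k m} → k ∣ suc m → ∃ λ l → k ≡ suc l
  positive-divisor {zero}  h = contradiction (0∣⇒≡0 h) λ ()
  positive-divisor {suc l} _ = l , refl

  private
    difference : ∀ {m n} → m ≢ n → ∃ λ d → m ≡ n + suc d ⊎ n ≡ m + suc d
    difference {m} {n} ne with <-cmp m n
    ... | tri< m<n _ _ = _ , inj₂ (sym (trans (+-suc m _) (m+[n∸m]≡n m<n)))
    ... | tri≈ _ e _ = contradiction e ne
    ... | tri> _ _ n<m = _ , inj₁ (sym (trans (+-suc n _) (m+[n∸m]≡n n<m)))

    ∣-difference : ∀ {k m n d} → k ∣ m → k ∣ n → m ≡ n + d → k ∣ d
    ∣-difference km kn refl = ∣m+n∣m⇒∣n km kn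

    shifted : ∀ {A B A′ B′ s d} → A + B ≡ s → A′ + B′ ≡ s → A′ ≡ A + d → B ≡ B′ + d
    shifted {A} {B} {A′} {B′} {s} {d} e e′ refl = +-cancelˡ-≡ A B (B′ + d) (trans e (trans (sym e′) (trans (+-assoc A d B′) (cong (A +_) (+-comm d B′)))))

    positive-lcm : ∀ m n → ∃ λ l → lcm (suc m) (suc n) ≡ suc l
    positive-lcm m n = positive-divisor (lcm-least {suc m} {suc n} {suc m * suc n} (m∣m*n (suc n)) (n∣m*n (suc m)))

  -- The sums A + B and A′ + B′ agree, so A′ - A and B - B′ coincide; M divides the first and N the
  -- second, hence their least common multiple divides the common difference, and `sieve` applies.
  -- The roles are fixed by A being the order that is at most q + 1.
  order-unique : ∀ {q x A B A′ B′ m n} → 1 < q → q ∉ exceptional → Compatible q A B (suc m) (suc n) →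
    A + x ≡ suc q → x * x ≤ 4 * q → A + B ≡ suc q + suc q → A′ + B′ ≡ suc q + suc q → distance A′ (suc q) * distance A′ (suc q) ≤ 4 * q →
    suc m ∣ A → suc n ∣ B → suc m ∣ A′ → suc n ∣ B′ → A′ ≡ A
  order-unique {q} {x} {A} {B} {A′} {B′} {m} {n} 1<q q∉ C A+x x² AB A′B′ y² MA NB MA′ NB′ =
    decidable-stable (A′ ≟ A) λ ne → let (d , shift) = difference ne ; (l , L≡) = positive-lcm m n in ¬leftover
      (sieve 1<q q∉ A+x B≡ x² y² shift (subst (_∣ suc d) L≡ (lcm-least (proj-M shift) (proj-N shift))) (M∣L L≡) (N∣L L≡)
        (λ {c} Mc Nc → ≤-pred (∣⇒≤ (subst (_∣ suc c) L≡ (lcm-least Mc Nc)))) MA NB first second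
        (product (M∣L L≡) (N∣L L≡)) (small (M∣L L≡) (N∣L L≡)))
    where
    open Compatible C
    B≡ : B ≡ suc q + x
    B≡ = +-cancelˡ-≡ A B (suc q + x) (trans AB (trans (cong (suc q +_) (sym A+x)) (trans (sym (+-assoc (suc q) A x)) (trans (cong (_+ x) (+-comm (suc q) A)) (+-assoc A (suc q) x)))))
    M∣L : ∀ {l} → lcm (suc m) (suc n) ≡ suc l → suc m ∣ suc l
    M∣L L≡ = subst (suc m ∣_) L≡ (m∣lcm[m,n] (suc m) (suc n))
    N∣L : ∀ {l} → lcm (suc m) (suc n) ≡ suc l → suc n ∣ suc l
    N∣L L≡ = subst (suc n ∣_) L≡ (n∣lcm[m,n] (suc m) (suc n))
    proj-M : ∀ {d} → A′ ≡ A + suc d ⊎ A ≡ A′ + suc d → suc m ∣ suc d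
    proj-M (inj₁ e) = ∣-difference MA′ MA e
    proj-M (inj₂ e) = ∣-difference MA MA′ e
    proj-N : ∀ {d} → A′ ≡ A + suc d ⊎ A ≡ A′ + suc d → suc n ∣ suc d
    proj-N (inj₁ e) = ∣-difference NB NB′ (shifted AB A′B′ e)
    proj-N (inj₂ e) = ∣-difference NB′ NB (shifted A′B′ AB e)

-- Between integral traces and pairs of natural numbers.

module Traces (q : ℕ) where
  open import Data.Nat using (ℕ; suc)

  open Numerics using (distance)
  open import Data.Integer using (ℤ; +_; -[1+_]; _+_; _-_; _*_; -_; _≤_; +≤+)
  import Data.Integer.Properties as ℤ
  import Data.Integer.Tactic.RingSolver as ℤ
  import Data.Nat as ℕ
  import Data.Nat.Properties as ℕ
  open import Data.Nat.Tactic.RingSolver using (solve-∀)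
  open import Relation.Binary.PropositionalEquality

  record Trace (t : ℤ) (A B : ℕ) : Set where
    field
      first  : + q + + 1 - t ≡ + A
      second : + q + + 1 + t ≡ + B

    sum : A ℕ.+ B ≡ suc q ℕ.+ suc q
    sum = ℤ.+-injective (trans (cong₂ _+_ (sym first) (sym second)) (trans (cancel (+ q) t) (cong +_ (twice q))))
      where
      cancel : ∀ q t → q + + 1 - t + (q + + 1 + t) ≡ q + + 1 + (q + + 1)
      cancel = ℤ.solve-∀
      twice : ∀ q → q ℕ.+ 1 ℕ.+ (q ℕ.+ 1) ≡ suc q ℕ.+ suc q
      twice = solve-∀

    determined : t ≡ + q + + 1 - + A
    determined = trans (cancel (+ q) t) (cong (λ a → + q + + 1 - a) first)
      where
      cancel : ∀ q t → t ≡ q + + 1 - (q + + 1 - t)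
      cancel = ℤ.solve-∀

  private
    minus : ∀ {a k} → a ℕ.+ k ≡ suc q → + q + + 1 - + k ≡ + a
    minus {a} {k} e = trans (cong (λ n → + n - + k) (trans (ℕ.+-comm q 1) (sym e))) (cancel (+ a) (+ k))
      where
      cancel : ∀ a k → a + k - k ≡ a
      cancel = ℤ.solve-∀

    plus : ∀ k → + q + + 1 + + k ≡ + (suc q ℕ.+ k)
    plus k = cong (λ n → + (n ℕ.+ k)) (ℕ.+-comm q 1)

  trace⁺ : ∀ {a k} → a ℕ.+ k ≡ suc q → Trace (+ k) a (suc q ℕ.+ k)
  trace⁺ {k = k} e = record { first = minus e ; second = plus k }

  trace⁻ : ∀ {a k} → a ℕ.+ k ≡ suc q → Trace (- (+ k)) (suc q ℕ.+ k) a
  trace⁻ {k = k} e = record { first = trans (cong (λ z → + q + + 1 + z) (ℤ.neg-involutive (+ k))) (plus k) ; second = minus e }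

  square⁺ : ∀ {k n} → k ℕ.* k ℕ.≤ n → + k * + k ≤ + n
  square⁺ {k} h = subst (_≤ _) (ℤ.pos-* k k) (+≤+ h)

  square⁻ : ∀ {k n} → k ℕ.* k ℕ.≤ n → - (+ k) * - (+ k) ≤ + n
  square⁻ {k} h = subst (_≤ _) (square (+ k)) (square⁺ {k} h)
    where
    square : ∀ k → k * k ≡ - k * - k
    square = ℤ.solve-∀

  private
    absolute : ∀ s → ∃ λ k → s ≡ + k ⊎ s ≡ - (+ k)
    absolute (+ k)    = k , inj₁ refl
    absolute -[1+ k ] = suc k , inj₂ refl

    -- Otherwise k ≥ q + 2, and (q + 2)² exceeds 4q.
    complement : ∀ k → k ℕ.* k ℕ.≤ 4 ℕ.* q → ∃ λ a → a ℕ.+ k ≡ suc q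
    complement k h = suc q ℕ.∸ k , ℕ.m∸n+n≡m {suc q} {k} (ℕ.≮⇒≥ {suc q} {k} λ q<k → ℕ.<⇒≱ (ℕ.s≤s (bound q)) (ℕ.≤-trans (ℕ.*-mono-≤ q<k q<k) h))
      where
      bound : ∀ q → 4 ℕ.* q ℕ.≤ suc q ℕ.+ suc q ℕ.* suc (suc q)
      bound 0       = ℕ.z≤n
      bound (suc q) = ℕ.≤-trans (ℕ.m≤m+n _ (4 ℕ.+ q ℕ.* q ℕ.+ 2 ℕ.* q)) (ℕ.≤-reflexive (expand q))
        where
        expand : ∀ q → 4 ℕ.* suc q ℕ.+ (4 ℕ.+ q ℕ.* q ℕ.+ 2 ℕ.* q) ≡ suc (suc q) ℕ.+ suc (suc q) ℕ.* suc (suc (suc q))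
        expand = solve-∀

    distance-below : ∀ a {k n} → a ℕ.+ k ≡ n → distance a n ≡ k
    distance-below a {k} refl = cong₂ ℕ._+_ (ℕ.m≤n⇒m∸n≡0 (ℕ.m≤m+n a k)) (ℕ.m+n∸m≡n a k)

    distance-above : ∀ n k → distance (n ℕ.+ k) n ≡ k
    distance-above n k = trans (cong₂ ℕ._+_ (ℕ.m+n∸m≡n n k) (ℕ.m≤n⇒m∸n≡0 (ℕ.m≤m+n n k))) (ℕ.+-identityʳ k)

    square-bound : ∀ {k n} d → d ≡ k → k ℕ.* k ℕ.≤ n → d ℕ.* d ℕ.≤ n
    square-bound _ refl h = h

  orders : ∀ {s} → s * s ≤ + 4 * + q → ∃₂ λ A B → Trace s A B
    × distance A (suc q) ℕ.* distance A (suc q) ℕ.≤ 4 ℕ.* q × distance B (suc q) ℕ.* distance B (suc q) ℕ.≤ 4 ℕ.* q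
  orders {s} h with absolute s
  ... | k , inj₁ refl = go (ℤ.drop‿+≤+ (subst₂ _≤_ (sym (ℤ.pos-* k k)) (sym (ℤ.pos-* 4 q)) h))
    where
    go : k ℕ.* k ℕ.≤ 4 ℕ.* q → _
    go k² = let (a , e) = complement k k² in a , suc q ℕ.+ k , trace⁺ {a} {k} e
      , square-bound {k} (distance a (suc q)) (distance-below a e) k² , square-bound {k} (distance (suc q ℕ.+ k) (suc q)) (distance-above (suc q) k) k²
  ... | k , inj₂ refl = go (ℤ.drop‿+≤+ (subst₂ _≤_ (trans (square (+ k)) (sym (ℤ.pos-* k k))) (sym (ℤ.pos-* 4 q)) h))
    where
    square : ∀ k → - k * - k ≡ k * k
    square = ℤ.solve-∀
    go : k ℕ.* k ℕ.≤ 4 ℕ.* q → _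
    go k² = let (a , e) = complement k k² in suc q ℕ.+ k , a , trace⁻ {a} {k} e
      , square-bound {k} (distance (suc q ℕ.+ k) (suc q)) (distance-above (suc q) k) k² , square-bound {k} (distance a (suc q)) (distance-below a e) k²

-- Fields with an even number of elements.

module EvenSize (F : FiniteField) where
  open import Relation.Binary.PropositionalEquality

  open FiniteField F renaming (size to q)
  open FieldKit F
  open FieldFinite F using (∈-elements; unique-elements; length-elements)
  open Lists
  open import Data.List using (length; []; _∷_)
  open import Data.List.Relation.Binary.Permutation.Propositional.Properties using (↭-length; ∈-resp-↭)
  open import Data.List.Relation.Unary.All as All using ([]; _∷_)
  open import Data.Nat as ℕ using (ℕ; suc; _<_)
  open import Data.Nat.DivMod using (_%_; [m+kn]%n≡m%n)
  import Data.Nat.Properties as ℕ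
  open import Data.Nat.Tactic.RingSolver using (solve-∀)

  -- Negation is an involution of the nonzero elements, without fixed points unless 2 = 0.
  private
    odd-size : fromℕ 2 ≢ 0# → q % 2 ≡ 1
    odd-size 2≢0 with member-↭ (∈-elements 0#)
    ... | zs , p with Unique-resp-↭ p unique-elements
    ...   | 0∉ ∷ u = conclude (even-involution (-_) (length zs) ℕ.≤-refl u into (λ {x} _ → solve 1 (λ x → :- (:- x) := x) x) fixed)
      where
      nonzero : ∀ {x} → x ∈ zs → x ≢ 0#
      nonzero i e = All.lookup 0∉ i (sym e)
      into : ∀ {x} → x ∈ zs → - x ∈ zs
      into {x} i = tail-∈ (∈-resp-↭ p (∈-elements (- x))) (λ e → -≢0 (nonzero i) (sym e))
      fixed : ∀ {x} → x ∈ zs → - x ≢ x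
      fixed {x} i e = nonzero i (*≡0 (linear₁ (solve 1 (λ x → x :* con 2 :- con 0 := (:- one) :* (:- x :- x)) x) e) 2≢0)
      conclude : (∃ λ k → length zs ≡ k ℕ.+ k) → q % 2 ≡ 1
      conclude (k , e) = trans (cong (_% 2) (trans (sym length-elements) (trans (↭-length p) (trans (cong suc e) (arith k))))) ([m+kn]%n≡m%n 1 k 2)
        where
        arith : ∀ k → suc (k ℕ.+ k) ≡ 1 ℕ.+ k ℕ.* 2
        arith = solve-∀

  even⇒2≡0 : q % 2 ≡ 0 → fromℕ 2 ≡ 0#
  even⇒2≡0 e = decidable-stable (fromℕ 2 ≟ 0#) λ 2≢0 → contradiction (trans (sym e) (odd-size 2≢0)) λ ()

  1<size : 1 < q
  1<size = subst (1 <_) length-elements (unique-length {xs = 0# ∷ 1# ∷ []} ((0≢1 ∷ []) ∷ [] ∷ []) (λ {x} _ → ∈-elements x))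

-- 2-torsion in characteristic two.

module CharTwo (F : FiniteField) (W : Weierstrass F) (nonsing : disc F W ≢ FiniteField.0# F) (2≡0 : FiniteField.fromℕ F 2 ≡ FiniteField.0# F) where
  open import Relation.Binary.PropositionalEquality

  open FiniteField F
  open Weierstrass W
  open FieldKit F
  open GroupLaw F W nonsing using (Point; On; ⊞-inverse; ⊟_; ⊟-on)
  open Exponent F W nonsing using (module G)
  open G using (pow)
  open import Data.List using ([]; _∷_; length)
  open import Data.List.Relation.Unary.All using ([]; _∷_)
  open import Data.Nat as ℕ using (_≤_; z≤n; s≤s)

  private
    coefficients : a₁ ≡ 0# → a₃ ≡ 0# → disc F W ≡ 0#
    coefficients e₁ e₃ = linear₃ (solve 5 (λ a₁ a₂ a₃ a₄ a₆ →
        let b₂ = a₁ :* a₁ :+ con 4 :* a₂ in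
        let b₄ = con 2 :* a₄ :+ a₁ :* a₃ in
        let b₆ = a₃ :* a₃ :+ con 4 :* a₆ in
        let b₈ = a₁ :* a₁ :* a₆ :+ con 4 :* a₂ :* a₆ :- a₁ :* a₃ :* a₄ :+ a₂ :* a₃ :* a₃ :- a₄ :* a₄ in
        (:- (b₂ :* b₂ :* b₈)) :- con 8 :* b₄ :* b₄ :* b₄ :- con 27 :* b₆ :* b₆ :+ con 9 :* b₂ :* b₄ :* b₆ :- con 0
        := ((:- (b₂ :* b₈)) :+ con 9 :* b₄ :* b₆) :* a₁ :* (a₁ :- con 0) :+ (:- (con 27 :* b₆ :* a₃)) :* (a₃ :- con 0)
          :+ (con 2 :* a₂ :* ((:- (b₂ :* b₈)) :+ con 9 :* b₄ :* b₆) :- con 4 :* b₄ :* b₄ :* b₄ :- con 54 :* b₆ :* a₆) :* (con 2 :- con 0))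
        a₁ a₂ a₃ a₄ a₆) e₁ e₃ 2≡0

    slope : ∀ {x y} → On (just (x , y)) → pow 2 (just (x , y)) ≡ nothing → a₁ * x + a₃ ≡ 0#
    slope {x} {y} on e = linear₂ (solve 4 (λ a₁ a₃ x y → a₁ :* x :+ a₃ :- con 0 := one :* (y :- (:- y :- a₁ :* x :- a₃)) :+ (:- y) :* (con 2 :- con 0)) a₁ a₃ x y)
      (cong y-of (G.cancelˡ (just (x , y)) (just (x , y)) (⊟ just (x , y)) on on (⊟-on (just (x , y)) on) (trans e (sym (⊞-inverse (just (x , y))))))) 2≡0
      where
      y-of : Point → Carrier
      y-of nothing        = 0#
      y-of (just (_ , y)) = y

    a₁≢0 : ∀ {x} → a₁ * x + a₃ ≡ 0# → a₁ ≢ 0#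
    a₁≢0 {x} s e = nonsing (coefficients e (linear₂ (solve 3 (λ a₁ a₃ x → a₃ :- con 0 := one :* (a₁ :* x :+ a₃ :- con 0) :+ (:- x) :* (a₁ :- con 0)) a₁ a₃ x) s e))

    same-x : ∀ {x x′} → a₁ * x + a₃ ≡ 0# → a₁ * x′ + a₃ ≡ 0# → x ≡ x′
    same-x {x} {x′} s s′ = *-cancelʳ (a₁≢0 s) (linear₂ (solve 4 (λ a₁ a₃ x x′ →
      x :* a₁ :- x′ :* a₁ := one :* (a₁ :* x :+ a₃ :- con 0) :+ (:- one) :* (a₁ :* x′ :+ a₃ :- con 0)) a₁ a₃ x x′) s s′)

    same-y : ∀ {x y y′} → a₁ * x + a₃ ≡ 0# → On (just (x , y)) → On (just (x , y′)) → y ≡ y′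
    same-y {x} {y} {y′} s on on′ = x-y≡0⇒x≡y ([ (λ e → e) , (λ e → e) ]′ (zero-product (linear₄ (solve 8 (λ a₁ a₂ a₃ a₄ a₆ x y y′ →
        let f = x :* x :* x :+ a₂ :* x :* x :+ a₄ :* x :+ a₆ in
        (y :- y′) :* (y :- y′) :- con 0 := one :* (y :* y :+ a₁ :* x :* y :+ a₃ :* y :- f) :+ (:- one) :* (y′ :* y′ :+ a₁ :* x :* y′ :+ a₃ :* y′ :- f)
          :+ (y′ :- y) :* (a₁ :* x :+ a₃ :- con 0) :+ (y′ :* y′ :- y :* y′) :* (con 2 :- con 0)) a₁ a₂ a₃ a₄ a₆ x y y′) on on′ s 2≡0)))

    nontrivial-unique : ∀ P Q → On P → On Q → pow 2 P ≡ nothing → pow 2 Q ≡ nothing → P ≡ Q ⊎ P ≡ nothing ⊎ Q ≡ nothing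
    nontrivial-unique nothing  _        _ _ _ _ = inj₂ (inj₁ refl)
    nontrivial-unique (just _) nothing  _ _ _ _ = inj₂ (inj₂ refl)
    nontrivial-unique (just (x , y)) (just (x′ , y′)) on on′ e e′ = inj₁ (go (same-x (slope on e) (slope on′ e′)) on′)
      where
      go : x ≡ x′ → On (just (x′ , y′)) → just (x , y) ≡ just (x′ , y′)
      go refl on′ = cong (λ y → just (x , y)) (same-y (slope on e) on on′)

  -- When 2 = 0, a point of order two satisfies a₁x + a₃ = 0. Here a₁ ≠ 0, since otherwise a₃ = 0 as
  -- well and the discriminant vanishes; so x is determined, and y is a double root of its equation.
  two-torsion≤2 : ∀ {zs} → Unique zs → (∀ {z} → z ∈ zs → On z × pow 2 z ≡ nothing) → length zs ≤ 2
  two-torsion≤2 {[]}         _ _ = z≤n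
  two-torsion≤2 {_ ∷ []}     _ _ = s≤s z≤n
  two-torsion≤2 {_ ∷ _ ∷ []} _ _ = s≤s (s≤s z≤n)
  two-torsion≤2 {P ∷ Q ∷ R ∷ _} ((P≢Q ∷ P≢R ∷ _) ∷ (Q≢R ∷ _) ∷ _) h = ⊥-elim (distinct (compare (here refl) (there (here refl)))
      (compare (here refl) (there (there (here refl)))) (compare (there (here refl)) (there (there (here refl)))))
    where
    compare : ∀ {X Y} → X ∈ P ∷ Q ∷ R ∷ _ → Y ∈ P ∷ Q ∷ R ∷ _ → X ≡ Y ⊎ X ≡ nothing ⊎ Y ≡ nothing
    compare {X} {Y} i j = let (on , e) = h i ; (on′ , e′) = h j in nontrivial-unique X Y on on′ e e′
    distinct : P ≡ Q ⊎ P ≡ nothing ⊎ Q ≡ nothing → P ≡ R ⊎ P ≡ nothing ⊎ R ≡ nothing → ¬ (Q ≡ R ⊎ Q ≡ nothing ⊎ R ≡ nothing)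
    distinct (inj₁ e) _ _ = P≢Q e
    distinct _ (inj₁ e) _ = P≢R e
    distinct _ _ (inj₁ e) = Q≢R e
    distinct (inj₂ (inj₁ p)) _ (inj₂ (inj₁ q)) = P≢Q (trans p (sym q))
    distinct (inj₂ (inj₁ p)) _ (inj₂ (inj₂ r)) = P≢R (trans p (sym r))
    distinct (inj₂ (inj₂ q)) (inj₂ (inj₁ p)) _ = P≢Q (trans p (sym q))
    distinct (inj₂ (inj₂ q)) (inj₂ (inj₂ r)) _ = Q≢R (trans q (sym r))

-- Pairs of subgroups of a group with bounded torsion.

module Subgroups {A : Set} (P : A → Set) (_∙_ : A → A → A) (ε : A)
  (closed : ∀ x y → P x → P y → P (x ∙ y)) (ε∈ : P ε)
  (assoc : ∀ x y z → P x → P y → P z → (x ∙ y) ∙ z ≡ x ∙ (y ∙ z))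
  (comm : ∀ x y → P x → P y → x ∙ y ≡ y ∙ x)
  (identityˡ : ∀ x → ε ∙ x ≡ x)
  (inv : A → A) (inv∈ : ∀ x → P x → P (inv x)) (inverseʳ : ∀ x → P x → x ∙ inv x ≡ ε)
  (_≟_ : DecidableEquality A) where
  open import Relation.Binary.PropositionalEquality
  open import Data.List using (List; []; _∷_; _++_; map; length; filter; deduplicate; cartesianProduct)
  open import Data.Nat as ℕ using (ℕ; zero; suc; _*_; _+_; _≤_; _<_; z≤n; s≤s)

  open FiniteAbelian P _∙_ ε closed ε∈ assoc comm identityˡ inv inv∈ inverseʳ public
  open import Data.List.Membership.DecPropositional _≟_ using (_∈?_)
  open import Data.List.Relation.Unary.All as All using (All)
  open import Data.List.Relation.Unary.Unique.Propositional.Properties using (++⁺; cartesianProduct⁺; filter⁺)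
  open import Data.List.Relation.Unary.Unique.DecPropositional.Properties using (deduplicate-!)
  import Data.Nat.Properties as ℕ
  open import Data.Nat.Divisibility using (_∣_)
  open Lists

  Kills : ℕ → A → Set
  Kills n x = P x × pow n x ≡ ε

  kills-∣ : ∀ {m n x} → m ∣ n → Kills m x → Kills n x
  kills-∣ d (p , e) = p , pow-∣ p d e

  kills-∙ : ∀ n {x y} → Kills n x → Kills n y → Kills n (x ∙ y)
  kills-∙ n {x} {y} (p , e) (q , f) = closed x y p q , trans (pow-∙ n x y p q) (trans (cong₂ _∙_ e f) (identityˡ ε))

  pow-inv : ∀ n x → P x → pow n (inv x) ≡ inv (pow n x)
  pow-inv n x p = cancelˡ (pow n x) _ _ (pow∈ n p) (pow∈ n (inv∈ x p)) (inv∈ _ (pow∈ n p))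
    (trans (sym (pow-∙ n x (inv x) p (inv∈ x p))) (trans (cong (pow n) (inverseʳ x p)) (trans (pow-ε n) (sym (inverseʳ _ (pow∈ n p))))))

  inv-ε : inv ε ≡ ε
  inv-ε = trans (sym (identityˡ (inv ε))) (inverseʳ ε ε∈)

  kills-inv : ∀ n {x} → Kills n x → Kills n (inv x)
  kills-inv n {x} (p , e) = inv∈ x p , trans (pow-inv n x p) (trans (cong inv e) inv-ε)

  inv-involutive : ∀ x → P x → inv (inv x) ≡ x
  inv-involutive x p = cancelˡ (inv x) _ _ (inv∈ x p) (inv∈ _ (inv∈ x p)) p
    (trans (inverseʳ (inv x) (inv∈ x p)) (sym (trans (comm _ _ (inv∈ x p) p) (inverseʳ x p))))

  quotient-eq : ∀ {a b c d} → P a → P b → P c → P d → a ∙ b ≡ c ∙ d → a ∙ inv c ≡ d ∙ inv b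
  quotient-eq {a} {b} {c} {d} pa pb pc pd e = cancelˡ c _ _ pc (closed _ _ pa (inv∈ c pc)) (closed _ _ pd (inv∈ b pb)) (begin
    c ∙ (a ∙ inv c)   ≡⟨ cong (c ∙_) (comm a (inv c) pa (inv∈ c pc)) ⟩
    c ∙ (inv c ∙ a)   ≡⟨ sym (assoc c (inv c) a pc (inv∈ c pc) pa) ⟩
    (c ∙ inv c) ∙ a   ≡⟨ cong (_∙ a) (inverseʳ c pc) ⟩
    ε ∙ a             ≡⟨ identityˡ a ⟩
    a                 ≡⟨ sym (identityʳ a pa) ⟩
    a ∙ ε             ≡⟨ cong (a ∙_) (sym (inverseʳ b pb)) ⟩
    a ∙ (b ∙ inv b)   ≡⟨ sym (assoc a b (inv b) pa pb (inv∈ b pb)) ⟩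
    (a ∙ b) ∙ inv b   ≡⟨ cong (_∙ inv b) e ⟩
    (c ∙ d) ∙ inv b   ≡⟨ assoc c d (inv b) pc pd (inv∈ b pb) ⟩
    c ∙ (d ∙ inv b)   ∎)
    where open ≡-Reasoning

  divide-injective : ∀ {a b c} → P a → P b → P c → a ∙ inv c ≡ b ∙ inv c → a ≡ b
  divide-injective {a} {b} {c} pa pb pc e = cancelˡ (inv c) a b (inv∈ c pc) pa pb (trans (comm _ _ (inv∈ c pc) pa) (trans e (comm _ _ pb (inv∈ c pc))))

  record Subgroup (H : List A) : Set where
    field
      unique : Unique H
      sound  : ∀ {x} → x ∈ H → P x
      ∙∈     : ∀ {x y} → x ∈ H → y ∈ H → x ∙ y ∈ H
      inv∈H  : ∀ {x} → x ∈ H → inv x ∈ H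
      ε∈H    : ε ∈ H

    pow∈H : ∀ n {x} → x ∈ H → pow n x ∈ H
    pow∈H zero    i = ε∈H
    pow∈H (suc n) i = ∙∈ i (pow∈H n i)

  -- Taken as a hypothesis: what follows is pure group theory, and this bound is what it asks of the
  -- geometry of the curve.
  TorsionBound : Set
  TorsionBound = ∀ n {xs} → Unique xs → (∀ {x} → x ∈ xs → Kills (suc n) x) → length xs ≤ suc n * suc n

  module _ (bound : TorsionBound) where
    -- Two cosets of H in the n-torsion would exceed the torsion bound.
    saturated : ∀ {H n} → Subgroup H → (∀ {x} → x ∈ H → Kills (suc n) x) → suc n * suc n < length H + length H → ∀ {x} → Kills (suc n) x → x ∈ H
    saturated {H} {n} S kills big {x} k with x ∈? H
    ... | yes i = i
    ... | no x∉ = contradiction (ℕ.≤-trans (ℕ.≤-reflexive (sym len)) (bound n union all)) (ℕ.<⇒≱ big)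
      where
      open Subgroup S
      coset : List A
      coset = map (x ∙_) H
      len : length (H ++ coset) ≡ length H + length H
      len = trans (length-++ H) (cong (length H +_) (length-map (x ∙_) H))
      disjoint : ∀ {z} → z ∈ H × z ∈ coset → ⊥
      disjoint (i , j) with ∈-map⁻ (x ∙_) j
      ... | h , h∈ , refl = x∉ (subst (_∈ H) (trans (assoc x h (inv h) (proj₁ k) (sound h∈) (inv∈ h (sound h∈)))
          (trans (cong (x ∙_) (inverseʳ h (sound h∈))) (identityʳ x (proj₁ k)))) (∙∈ i (inv∈H h∈)))
      union : Unique (H ++ coset)
      union = ++⁺ unique (unique-map (λ i j → cancelˡ x _ _ (proj₁ k) (sound i) (sound j)) unique) disjoint
      all : ∀ {z} → z ∈ H ++ coset → Kills (suc n) z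
      all i with ∈-++⁻ H i
      ... | inj₁ j = kills j
      ... | inj₂ j with ∈-map⁻ (x ∙_) j
      ...   | h , h∈ , refl = kills-∙ (suc n) k (kills h∈)

    module Pair {H H′ : List A} (S : Subgroup H) (S′ : Subgroup H′) (common : ∀ {x} → x ∈ H → x ∈ H′ → Kills 2 x)
      {M N : ℕ} (killsM : ∀ {x} → x ∈ H → Kills M x) (killsN : ∀ {x} → x ∈ H′ → Kills N x) where
      private
        module S = Subgroup S
        module S′ = Subgroup S′

        pairs : List (A × A)
        pairs = cartesianProduct H H′

        multiply : A × A → A
        multiply (x , y) = x ∙ y

        unique-pairs : Unique pairs
        unique-pairs = cartesianProduct⁺ S.unique S′.unique

        products : List A
        products = deduplicate _≟_ (map multiply pairs)

        product-factors : ∀ {z} → z ∈ products → ∃ λ p → z ≡ multiply p × proj₁ p ∈ H × proj₂ p ∈ H′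
        product-factors i with ∈-map⁻ multiply (∈-deduplicate⁻ _≟_ (map multiply pairs) i)
        ... | (x , y) , p∈ , e with ∈-cartesianProduct⁻ H H′ p∈
        ...   | x∈ , y∈ = (x , y) , e , x∈ , y∈

        -- Pairs with equal products differ by an element of the intersection.
        fibre-≤ : ∀ {k} → (∀ {zs} → Unique zs → (∀ {z} → z ∈ zs → Kills 2 z × Kills M z × Kills N z) → length zs ≤ k) →
          length pairs ≤ length products * k
        fibre-≤ {k} small = fibre-bound _≟_ multiply k unique-pairs λ {zs} → go zs
          where
          go : ∀ zs → Unique zs → (∀ {z} → z ∈ zs → z ∈ pairs) → (∀ {z w} → z ∈ zs → w ∈ zs → multiply z ≡ multiply w) → length zs ≤ k
          go [] _ _ _ = z≤n
          go zs@((x₀ , y₀) ∷ _) u sub same = ℕ.≤-trans (ℕ.≤-reflexive (sym (length-map shift zs))) (small (unique-map injective u) in-common)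
            where
            shift : A × A → A
            shift (x , _) = x ∙ inv x₀
            mem : ∀ {x y} → (x , y) ∈ zs → x ∈ H × y ∈ H′
            mem i = ∈-cartesianProduct⁻ H H′ (sub i)
            x₀∈ : x₀ ∈ H
            x₀∈ = proj₁ (mem (here refl))
            y₀∈ : y₀ ∈ H′
            y₀∈ = proj₂ (mem (here refl))
            injective : ∀ {p q} → p ∈ zs → q ∈ zs → shift p ≡ shift q → p ≡ q
            injective {x , y} {x′ , y′} i j e with divide-injective (S.sound (proj₁ (mem i))) (S.sound (proj₁ (mem j))) (S.sound x₀∈) e
            ... | refl = cong (x ,_) (cancelˡ x y y′ (S.sound (proj₁ (mem i))) (S′.sound (proj₂ (mem i))) (S′.sound (proj₂ (mem j))) (same i j))
            in-common : ∀ {z} → z ∈ map shift zs → Kills 2 z × Kills M z × Kills N z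
            in-common i with ∈-map⁻ shift i
            ... | (x , y) , p∈ , refl = common inH inH′ , killsM inH , killsN inH′
              where
              inH : x ∙ inv x₀ ∈ H
              inH = S.∙∈ (proj₁ (mem p∈)) (S.inv∈H x₀∈)
              inH′ : x ∙ inv x₀ ∈ H′
              inH′ = subst (_∈ H′) (sym (quotient-eq (S.sound (proj₁ (mem p∈))) (S′.sound (proj₂ (mem p∈))) (S.sound x₀∈) (S′.sound y₀∈) (same p∈ (here refl))))
                (S′.∙∈ y₀∈ (S′.inv∈H (proj₂ (mem p∈))))

        length-pairs : length pairs ≡ length H * length H′
        length-pairs = length-cartesianProduct H H′

      -- |H| |H′| is at most the number of sums times the size of the intersection. The sums are
      -- killed by L = l + 1 and the intersection by g + 1, so each factor is a torsion bound.
      order-bound : ∀ {g l} → (∀ {z} → Kills 2 z → Kills M z → Kills N z → Kills (suc g) z) → M ∣ suc l → N ∣ suc l →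
        length H * length H′ ≤ suc l * suc l * (suc g * suc g)
      order-bound {g} {l} kg ML NL = ℕ.≤-trans (ℕ.≤-reflexive (sym length-pairs)) (ℕ.≤-trans
        (fibre-≤ (λ {zs} u h → bound g u (λ i → let (a , b , c) = h i in kg a b c)))
        (ℕ.*-monoˡ-≤ (suc g * suc g) (bound l (deduplicate-! _≟_ (map multiply pairs)) λ i →
          let ((x , y) , e , x∈ , y∈) = product-factors i in subst (Kills (suc l)) (sym e) (kills-∙ (suc l) (kills-∣ ML (killsM x∈)) (kills-∣ NL (killsN y∈))))))

      -- Here l + 1 is L/2. Doubling maps the sums into the L/2-torsion with fibres of size at most
      -- 2, so there are at most 2 (L/2)² of them; with at most 2 common elements the product is
      -- bounded by 4 (L/2)² = L².
      order-bound₂ : ∀ {l} → (∀ {zs} → Unique zs → (∀ {z} → z ∈ zs → Kills 2 z) → length zs ≤ 2) → M ∣ suc l + suc l → N ∣ suc l + suc l →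
        length H * length H′ ≤ suc l * suc l * 2 * 2
      order-bound₂ {l} two ML NL = ℕ.≤-trans (ℕ.≤-reflexive (sym length-pairs)) (ℕ.≤-trans
        (fibre-≤ (λ u h → two u (λ i → proj₁ (h i))))
        (ℕ.*-monoˡ-≤ 2 (ℕ.≤-trans (fibre-bound _≟_ double 2 (deduplicate-! _≟_ (map multiply pairs)) λ {zs} → halves zs)
          (ℕ.*-monoˡ-≤ 2 (bound l (deduplicate-! _≟_ (map double products)) killed)))))
        where
        double : A → A
        double x = x ∙ x
        product-on : ∀ {z} → z ∈ products → Kills (suc l + suc l) z
        product-on i = let ((x , y) , e , x∈ , y∈) = product-factors i in
          subst (Kills (suc l + suc l)) (sym e) (kills-∙ (suc l + suc l) (kills-∣ ML (killsM x∈)) (kills-∣ NL (killsN y∈)))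
        killed : ∀ {z} → z ∈ deduplicate _≟_ (map double products) → Kills (suc l) z
        killed i with ∈-map⁻ double (∈-deduplicate⁻ _≟_ (map double products) i)
        ... | x , x∈ , refl = let (p , e) = product-on x∈ in closed x x p p , trans (pow-∙ (suc l) x x p p) (trans (sym (pow-+ (suc l) (suc l) p)) e)
        halves : ∀ zs → Unique zs → (∀ {z} → z ∈ zs → z ∈ products) → (∀ {z w} → z ∈ zs → w ∈ zs → double z ≡ double w) → length zs ≤ 2
        halves [] _ _ _ = z≤n
        halves zs@(x₀ ∷ _) u sub same = ℕ.≤-trans (ℕ.≤-reflexive (sym (length-map (_∙ inv x₀) zs)))
          (two (unique-map (λ i j → divide-injective (on i) (on j) (on (here refl))) u) in-two)
          where
          on : ∀ {z} → z ∈ zs → P z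
          on i = proj₁ (product-on (sub i))
          in-two : ∀ {z} → z ∈ map (_∙ inv x₀) zs → Kills 2 z
          in-two i with ∈-map⁻ (_∙ inv x₀) i
          ... | x , x∈ , refl = closed _ _ px (inv∈ x₀ p₀) , trans (pow-∙ 2 x (inv x₀) px (inv∈ x₀ p₀))
              (trans (cong₂ _∙_ (cong (x ∙_) (identityʳ x px)) (trans (pow-inv 2 x₀ p₀) (cong inv (cong (x₀ ∙_) (identityʳ x₀ p₀)))))
                (trans (cong (_∙ inv (x₀ ∙ x₀)) (same x∈ (here refl))) (inverseʳ _ (closed x₀ x₀ p₀ p₀))))
            where
            px = on x∈
            p₀ = on (here refl)

      private
        squareʳ : ∀ m n {x} → P x → pow (m * n) x ≡ ε → pow m (pow n x) ≡ ε
        squareʳ m n p e = trans (sym (pow-* m n p)) e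

      -- As 12 + 12 > 4², H contains the whole 4-torsion. For x in H′ the element 2x is killed by 4,
      -- so it is common and killed by 2; then x itself is killed by 4, is common and is killed by
      -- 2. But 16 elements do not fit into the 2-torsion.
      no-12-16 : length H ≡ 12 → length H′ ≡ 16 → M ≡ 4 → N ≡ 8 → ⊥
      no-12-16 h h′ refl refl = ℕ.<⇒≱ {4} {16} (s≤s (s≤s (s≤s (s≤s (s≤s z≤n))))) (subst (_≤ 4) h′ (bound 1 S′.unique killed₂))
        where
        full : ∀ {x} → Kills 4 x → x ∈ H
        full = saturated {n = 3} S killsM (subst (λ n → 16 < n + n) (sym h) (s≤s (ℕ.m≤m+n 16 7)))
        killed₄ : ∀ {x} → x ∈ H′ → Kills 4 x
        killed₄ {x} i = let (p , e) = killsN i in p , trans (pow-* 2 2 p) (proj₂ (common (full (pow∈ 2 p , squareʳ 4 2 p e)) (S′.pow∈H 2 i)))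
        killed₂ : ∀ {x} → x ∈ H′ → Kills 2 x
        killed₂ i = common (full (killed₄ i)) i

      -- H is again the whole 4-torsion, so 3x is common for every x in H′ and 6 kills H′. Then H′
      -- is the product of its 2-torsion, of size at most 4, and its 3-torsion, of odd size; but 24
      -- has the factor 8.
      no-16-24 : length H ≡ 16 → length H′ ≡ 24 → M ≡ 4 → N ∣ 12 → ⊥
      no-16-24 h h′ refl N∣12 = conclude (length Tw) refl e≤4
        where
        full : ∀ {x} → Kills 4 x → x ∈ H
        full = saturated {n = 3} S killsM (subst (λ n → 16 < n + n) (sym h) (s≤s (ℕ.m≤m+n 16 15)))
        killed₆ : ∀ {x} → x ∈ H′ → pow 2 (pow 3 x) ≡ ε
        killed₆ {x} i = let (p , e) = kills-∣ N∣12 (killsN i) in proj₂ (common (full (pow∈ 3 p , squareʳ 4 3 p e)) (S′.pow∈H 3 i))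
        Tw Th : List A
        Tw = filter (λ x → pow 2 x ≟ ε) H′
        Th = filter (λ x → pow 3 x ≟ ε) H′
        Tw-sound : ∀ {x} → x ∈ Tw → x ∈ H′ × pow 2 x ≡ ε
        Tw-sound = ∈-filter⁻ (λ x → pow 2 x ≟ ε)
        Th-sound : ∀ {x} → x ∈ Th → x ∈ H′ × pow 3 x ≡ ε
        Th-sound = ∈-filter⁻ (λ x → pow 3 x ≟ ε)
        unique-Tw : Unique Tw
        unique-Tw = filter⁺ (λ x → pow 2 x ≟ ε) S′.unique
        unique-Th : Unique Th
        unique-Th = filter⁺ (λ x → pow 3 x ≟ ε) S′.unique
        e≤4 : length Tw ≤ 4
        e≤4 = bound 1 unique-Tw (λ i → S′.sound (proj₁ (Tw-sound i)) , proj₂ (Tw-sound i))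
        two-three : ∀ {x} → P x → pow 2 x ≡ ε → pow 3 x ≡ ε → x ≡ ε
        two-three {x} p e f = trans (sym (identityʳ x p)) (trans (cong (x ∙_) (sym e)) f)
        below : length Tw * length Th ≤ 24
        below = ℕ.≤-trans (ℕ.≤-reflexive (trans (sym (length-cartesianProduct Tw Th)) (sym (length-map multiply (cartesianProduct Tw Th)))))
          (subst (length (map multiply (cartesianProduct Tw Th)) ≤_) h′ (unique-length (unique-map injective (cartesianProduct⁺ unique-Tw unique-Th)) into))
          where
          into : ∀ {z} → z ∈ map multiply (cartesianProduct Tw Th) → z ∈ H′
          into i with ∈-map⁻ multiply i
          ... | (x , y) , p∈ , refl with ∈-cartesianProduct⁻ Tw Th p∈
          ...   | x∈ , y∈ = S′.∙∈ (proj₁ (Tw-sound x∈)) (proj₁ (Th-sound y∈))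
          injective : ∀ {p q} → p ∈ cartesianProduct Tw Th → q ∈ cartesianProduct Tw Th → multiply p ≡ multiply q → p ≡ q
          injective {x , y} {x′ , y′} i j e with ∈-cartesianProduct⁻ Tw Th i | ∈-cartesianProduct⁻ Tw Th j
          ... | x∈ , y∈ | x′∈ , y′∈ with Tw-sound x∈ | Th-sound y∈ | Tw-sound x′∈ | Th-sound y′∈
          ...   | xH , x2 | yH , y3 | x′H , x′2 | y′H , y′3 = cong₂ _,_ x≡x′ y≡y′
            where
            px = S′.sound xH
            px′ = S′.sound x′H
            py = S′.sound yH
            py′ = S′.sound y′H
            quotient : x ∙ inv x′ ≡ y′ ∙ inv y
            quotient = quotient-eq px py px′ py′ e
            trivial : x ∙ inv x′ ≡ ε
            trivial = two-three (closed _ _ px (inv∈ x′ px′)) (proj₂ (kills-∙ 2 (px , x2) (kills-inv 2 (px′ , x′2))))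
              (trans (cong (pow 3) quotient) (proj₂ (kills-∙ 3 (py′ , y′3) (kills-inv 3 (py , y3)))))
            x≡x′ : x ≡ x′
            x≡x′ = divide-injective px px′ px′ (trans trivial (sym (inverseʳ x′ px′)))
            y≡y′ : y ≡ y′
            y≡y′ = divide-injective py py′ py (trans (inverseʳ y py) (trans (sym trivial) quotient))
        above : 24 ≤ length Tw * length Th
        above = ℕ.≤-trans (ℕ.≤-reflexive (trans (sym h′) (sym (length-map parts H′)))) (ℕ.≤-trans (unique-length (unique-map injective S′.unique) into)
          (ℕ.≤-reflexive (length-cartesianProduct Tw Th)))
          where
          parts : A → A × A
          parts x = pow 3 x , pow 2 x
          -- x is recovered as 3x - 2x.
          injective : ∀ {x y} → x ∈ H′ → y ∈ H′ → parts x ≡ parts y → x ≡ y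
          injective {x} {y} i j e = divide-injective (S′.sound i) (S′.sound j) (inv∈ _ (pow∈ 2 (S′.sound i)))
            (trans (cong (x ∙_) (inv-involutive _ (pow∈ 2 (S′.sound i)))) (trans (cong proj₁ e)
              (cong (y ∙_) (trans (sym (cong proj₂ e)) (sym (inv-involutive _ (pow∈ 2 (S′.sound i))))))))
          into : ∀ {z} → z ∈ map parts H′ → z ∈ cartesianProduct Tw Th
          into i with ∈-map⁻ parts i
          ... | x , x∈ , refl = ∈-cartesianProduct⁺ (∈-filter⁺ (λ x → pow 2 x ≟ ε) (S′.pow∈H 3 x∈) (killed₆ x∈))
            (∈-filter⁺ (λ x → pow 3 x ≟ ε) (S′.pow∈H 2 x∈)
              (trans (sym (pow-* 3 2 (S′.sound x∈))) (trans (pow-* 2 3 (S′.sound x∈)) (killed₆ x∈))))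
        odd : ∃ λ k → length Th ≡ suc (k + k)
        odd with member-↭ (∈-filter⁺ (λ x → pow 3 x ≟ ε) S′.ε∈H (pow-ε 3))
        ... | zs , p with Unique-resp-↭ p unique-Th
        ...   | ε∉ ∷ u = let (k , e) = even-involution inv (length zs) ℕ.≤-refl u into (λ i → inv-involutive _ (on i)) fixed in
            k , trans (↭-length p) (cong suc e)
          where
          open import Data.List.Relation.Binary.Permutation.Propositional using (↭-sym)
          open import Data.List.Relation.Binary.Permutation.Propositional.Properties using (↭-length; ∈-resp-↭)
          back : ∀ {z} → z ∈ zs → z ∈ Th
          back i = ∈-resp-↭ (↭-sym p) (there i)
          on : ∀ {z} → z ∈ zs → P z
          on i = S′.sound (proj₁ (Th-sound (back i)))
          fixed : ∀ {z} → z ∈ zs → inv z ≢ z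
          fixed {z} i e = All.lookup ε∉ i (sym (two-three (on i) (trans (cong (z ∙_) (identityʳ z (on i))) (trans (cong (z ∙_) (sym e)) (inverseʳ z (on i)))) (proj₂ (Th-sound (back i)))))
          into : ∀ {z} → z ∈ zs → inv z ∈ zs
          into {z} i = tail-∈ (∈-resp-↭ p (∈-filter⁺ (λ x → pow 3 x ≟ ε) (S′.inv∈H (proj₁ (Th-sound (back i))))
              (proj₂ (kills-inv 3 (on i , proj₂ (Th-sound (back i)))))))
            (λ e → All.lookup ε∉ i (trans (sym inv-ε) (trans (cong inv e) (inv-involutive z (on i)))))
        parity : ∀ k j → k + k ≡ suc (j + j) → ⊥
        parity (suc k) zero e with trans (sym (ℕ.+-suc k k)) (ℕ.suc-injective e)
        ... | ()
        parity (suc k) (suc j) e = parity k j (ℕ.suc-injective (trans (sym (ℕ.+-suc k k)) (trans (ℕ.suc-injective e) (cong suc (ℕ.+-suc j j)))))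
        conclude : ∀ e → length Tw ≡ e → e ≤ 4 → ⊥
        conclude e eq l with odd
        ... | k , o = go e l (trans (cong₂ _*_ (sym eq) (sym o)) (ℕ.≤-antisym below above))
          where
          go : ∀ e → e ≤ 4 → e * suc (k + k) ≡ 24 → ⊥
          go 1 _ r = parity k 11 (ℕ.suc-injective (trans (sym (ℕ.*-identityˡ (suc (k + k)))) r))
          go 2 _ r = parity k 5 (ℕ.suc-injective (ℕ.*-cancelˡ-≡ (suc (k + k)) 12 2 r))
          go 3 _ r = parity k 3 (ℕ.suc-injective (ℕ.*-cancelˡ-≡ (suc (k + k)) 8 3 r))
          go 4 _ r = parity k 2 (ℕ.suc-injective (ℕ.*-cancelˡ-≡ (suc (k + k)) 6 4 r))
          go (suc (suc (suc (suc (suc _))))) (s≤s (s≤s (s≤s (s≤s ())))) _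

-- From two subgroups to the numerical constraints.

module PairCompatible {A : Set} (P : A → Set) (_∙_ : A → A → A) (ε : A)
  (closed : ∀ x y → P x → P y → P (x ∙ y)) (ε∈ : P ε)
  (assoc : ∀ x y z → P x → P y → P z → (x ∙ y) ∙ z ≡ x ∙ (y ∙ z))
  (comm : ∀ x y → P x → P y → x ∙ y ≡ y ∙ x)
  (identityˡ : ∀ x → ε ∙ x ≡ x)
  (inv : A → A) (inv∈ : ∀ x → P x → P (inv x)) (inverseʳ : ∀ x → P x → x ∙ inv x ≡ ε)
  (_≟_ : DecidableEquality A) where
  open import Relation.Binary.PropositionalEquality
  open import Data.List using (List; length)
  open import Data.Nat using (ℕ; zero; suc; _*_; _+_; _≤_; s≤s)

  open Subgroups P _∙_ ε closed ε∈ assoc comm identityˡ inv inv∈ inverseʳ _≟_ public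
  open Compatible
  open Numerics using (Small)
  open import Data.Nat.Divisibility using (_∣_; divides)
  open import Data.Nat.DivMod using (_/_; _%_; m≡m%n+[m/n]*n; m%n<n)
  import Data.Nat.Properties as ℕ
  open import Data.Nat.Tactic.RingSolver using (solve-∀)

  private
    parity : ∀ m → m % 2 ≡ 1 ⊎ m % 2 ≡ 0
    parity m with m % 2 | m%n<n m 2
    ... | zero        | _ = inj₂ refl
    ... | suc zero    | _ = inj₁ refl
    ... | suc (suc _) | s≤s (s≤s ())

    halve : ∀ l → suc l % 2 ≡ 0 → ∃ λ k → suc l ≡ suc k + suc k
    halve l e = go (suc l / 2) (trans (m≡m%n+[m/n]*n (suc l) 2) (cong (_+ suc l / 2 * 2) e))
      where
      go : ∀ k → suc l ≡ k * 2 → ∃ λ k → suc l ≡ suc k + suc k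
      go (suc k) h = k , trans h (double k)
        where
        double : ∀ k → suc k * 2 ≡ suc k + suc k
        double = solve-∀

  -- With m = 2j + 1, x = m x - j (2x).
  odd-kills : ∀ {m x} → m % 2 ≡ 1 → Kills 2 x → Kills m x → Kills 1 x
  odd-kills {m} {x} odd (p , e) (_ , e′) = p , (begin
    pow 1 x                                ≡⟨ cong (x ∙_) (sym (pow-∣ {2} {m / 2 * 2} p (divides (m / 2) refl) e)) ⟩
    pow (1 + m / 2 * 2) x                  ≡⟨ cong (λ r → pow (r + m / 2 * 2) x) (sym odd) ⟩
    pow (m % 2 + m / 2 * 2) x              ≡⟨ cong (λ n → pow n x) (sym (m≡m%n+[m/n]*n m 2)) ⟩
    pow m x                                ≡⟨ e′ ⟩
    ε                                      ∎)
    where open ≡-Reasoning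

  module _ (bound : TorsionBound) {H H′ : List A} (S : Subgroup H) (S′ : Subgroup H′) (common : ∀ {x} → x ∈ H → x ∈ H′ → Kills 2 x)
    {m n : ℕ} (killsM : ∀ {x} → x ∈ H → Kills (suc m) x) (killsN : ∀ {x} → x ∈ H′ → Kills (suc n) x) where
    private
      module B = Pair bound S S′ common {suc m} {suc n} killsM killsN

      square : ∀ k → k * (1 * 1) ≡ k
      square = solve-∀

      trivial-bound : ∀ {l} → (∀ {z} → Kills 2 z → Kills (suc m) z → Kills (suc n) z → Kills 1 z) → suc m ∣ suc l → suc n ∣ suc l → length H * length H′ ≤ suc l * suc l
      trivial-bound {l} h ML NL = ℕ.≤-trans (B.order-bound {0} {l} h ML NL) (ℕ.≤-reflexive (square (suc l * suc l)))

    compatible : ∀ {q} → (q % 2 ≡ 0 → ∀ {zs} → Unique zs → (∀ {z} → z ∈ zs → Kills 2 z) → length zs ≤ 2) →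
      Compatible q (length H) (length H′) (suc m) (suc n)
    compatible {q} two = record
      { first     = bound m (Subgroup.unique S) killsM
      ; second    = bound n (Subgroup.unique S′) killsN
      ; product   = λ {l} ML NL → B.order-bound {1} {l} (λ k _ _ → k) ML NL
      ; small     = small
      ; ¬leftover = λ
        { (inj₁ (h , h′ , m≡ , n≡)) → B.no-12-16 h h′ m≡ n≡
        ; (inj₂ (h , h′ , m≡ , n∣)) → B.no-16-24 h h′ m≡ n∣ } }
      where
      even : ∀ {l} → q % 2 ≡ 0 → (∃ λ k → suc l ≡ suc k + suc k) → suc m ∣ suc l → suc n ∣ suc l → length H * length H′ ≤ suc l * suc l
      even {l} e (k , l≡) ML NL = ℕ.≤-trans (B.order-bound₂ {k} (two e) (subst (suc m ∣_) l≡ ML) (subst (suc n ∣_) l≡ NL))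
        (ℕ.≤-reflexive (trans (arith (suc k)) (cong₂ _*_ (sym l≡) (sym l≡))))
        where
        arith : ∀ k → k * k * 2 * 2 ≡ (k + k) * (k + k)
        arith = solve-∀
      small : ∀ {l} → suc m ∣ suc l → suc n ∣ suc l → Small q (suc m) (suc n) → length H * length H′ ≤ suc l * suc l
      small {l} ML NL (inj₁ odd) = trivial-bound {l} (λ k kM _ → odd-kills {suc m} odd k kM) ML NL
      small {l} ML NL (inj₂ (inj₁ odd)) = trivial-bound {l} (λ k _ kN → odd-kills {suc n} odd k kN) ML NL
      -- For even q the parity of L decides: if L is odd the common elements are trivial, and if L
      -- is even the bound by halving applies.
      small {l} ML NL (inj₂ (inj₂ q-even)) with parity (suc l)
      ... | inj₁ odd = trivial-bound {l} (λ k kM _ → odd-kills {suc l} odd k (kills-∣ {suc m} {suc l} ML kM)) ML NL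
      ... | inj₂ l-even = even {l} q-even (halve l l-even) ML NL

-- The quadratic form at actual points of the curve.

module KummerPoints (F : FiniteField) (W : Weierstrass F) (nonsing : disc F W ≢ FiniteField.0# F) where
  open import Relation.Binary.PropositionalEquality

  open FiniteField F
  open Weierstrass W
  open FieldKit F
  open GroupLaw F W nonsing
  open Heights F W nonsing using (b₂; b₄; b₆; b₈; key-F; module KF)
  module CF = ChordForms fieldRing a₁ a₂ a₃ a₄ a₆

  -- The homogeneous x-coordinate, with O at 1 : 0.
  κ₁ κ₂ : Point → Carrier
  κ₁ nothing        = 1#
  κ₁ (just (x , _)) = x
  κ₂ nothing        = 0#
  κ₂ (just _)       = 1#

  -- The forms at the x-coordinate of Q are proportional to the symmetric functions of the
  -- x-coordinates of Q + P and Q − P.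
  record Proportional (x : Carrier) (Q S D : Point) : Set where
    field
      k     : Carrier
      k≢0   : k ≢ 0#
      propA : KF.formA x (κ₁ Q) (κ₂ Q) ≡ k * (κ₂ S * κ₂ D)
      propB : KF.formB x (κ₁ Q) (κ₂ Q) ≡ k * (κ₁ S * κ₂ D + κ₁ D * κ₂ S)
      propC : KF.formC x (κ₁ Q) (κ₂ Q) ≡ k * (κ₁ S * κ₁ D)

  swap : ∀ {x Q S D} → Proportional x Q S D → Proportional x Q D S
  swap p = record { k = k ; k≢0 = k≢0 ; propA = trans propA (cong (k *_) (*-comm _ _)) ; propB = trans propB (cong (k *_) (+-comm _ _))
    ; propC = trans propC (cong (k *_) (*-comm _ _)) }
    where open Proportional p

  chord-x : ∀ {x₁ y₁ x₂ y₂ l m} → Line x₁ y₁ x₂ y₂ l m →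
    (l * l + a₁ * l - a₂ - x₁ - x₂) * ((x₁ - x₂) * (x₁ - x₂)) ≡ CF.numerator x₁ x₂ (y₁ - y₂)
  chord-x {x₁} {y₁} {x₂} {y₂} {l} {m} L = linear₂ (solve 8 (λ a₁ a₂ x₁ y₁ x₂ y₂ l m →
      (l :* l :+ a₁ :* l :- a₂ :- x₁ :- x₂) :* ((x₁ :- x₂) :* (x₁ :- x₂))
        :- ((y₁ :- y₂) :* (y₁ :- y₂) :+ a₁ :* (y₁ :- y₂) :* (x₁ :- x₂) :- (a₂ :+ x₁ :+ x₂) :* ((x₁ :- x₂) :* (x₁ :- x₂)))
      := :- (l :* (x₁ :- x₂) :+ (y₁ :- y₂) :+ a₁ :* (x₁ :- x₂)) :* (y₁ :- (l :* x₁ :+ m))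
        :+ (l :* (x₁ :- x₂) :+ (y₁ :- y₂) :+ a₁ :* (x₁ :- x₂)) :* (y₂ :- (l :* x₂ :+ m))) a₁ a₂ x₁ y₁ x₂ y₂ l m) (Line.thr₁ L) (Line.thr₂ L)

  tangent-x : ∀ {x y l m} → On (just (x , y)) → Line x y x y l m → (let d = fromℕ 2 * y + a₁ * x + a₃) →
    (l * l + a₁ * l - a₂ - x - x) * (d * d) ≡ KF.formC x x 1#
  tangent-x {x} {y} {l} {m} on L = linear₂ (solve 8 (λ a₁ a₂ a₃ a₄ a₆ x y l →
      let d = con 2 :* y :+ a₁ :* x :+ a₃ in let s = con 3 :* x :* x :+ con 2 :* a₂ :* x :+ a₄ :- a₁ :* y in
      (l :* l :+ a₁ :* l :- a₂ :- x :- x) :* (d :* d)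
        :- ((x :* x) :* (x :* x) :- (con 2 :* a₄ :+ a₁ :* a₃) :* ((x :* x) :* one) :- (a₃ :* a₃ :+ con 4 :* a₆) :* ((x :+ x :* one) :* one)
          :- (a₁ :* a₁ :* a₆ :+ con 4 :* a₂ :* a₆ :- a₁ :* a₃ :* a₄ :+ a₂ :* a₃ :* a₃ :- a₄ :* a₄) :* (one :* one))
      := (l :* d :+ s :+ a₁ :* d) :* (l :* d :- s)
        :+ (:- (a₁ :* a₁ :+ con 4 :* a₂ :+ con 8 :* x)) :* (y :* y :+ a₁ :* x :* y :+ a₃ :* y :- (x :* x :* x :+ a₂ :* x :* x :+ a₄ :* x :+ a₆)))
      a₁ a₂ a₃ a₄ a₆ x y l) (tangent-slope L) on

  formB-double : ∀ {x y} → On (just (x , y)) → (let d = fromℕ 2 * y + a₁ * x + a₃) → KF.formB x x 1# ≡ d * d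
  formB-double {x} {y} on = linear₁ (solve 7 (λ a₁ a₂ a₃ a₄ a₆ x y → let d = con 2 :* y :+ a₁ :* x :+ a₃ in
      con 2 :* ((x :* x) :* (x :+ x :* one)) :+ (a₁ :* a₁ :+ con 4 :* a₂) :* ((x :* x) :* one)
        :+ (con 2 :* a₄ :+ a₁ :* a₃) :* ((x :+ x :* one) :* one) :+ (a₃ :* a₃ :+ con 4 :* a₆) :* (one :* one) :- d :* d
      := :- con 4 :* (y :* y :+ a₁ :* x :* y :+ a₃ :* y :- (x :* x :* x :+ a₂ :* x :* x :+ a₄ :* x :+ a₆))) a₁ a₂ a₃ a₄ a₆ x y) on

  formA-double : ∀ x → KF.formA x x 1# ≡ 0#
  formA-double x = solve 1 (λ x → (x :- x :* one) :* (x :- x :* one) := con 0) x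

  private
    -- The three forms have no common zero, and formA vanishes when the abscissas coincide.
    formC-double≢0′′ : ∀ {x} → KF.formB x x 1# ≡ 0# → KF.formC x x 1# ≢ 0#
    formC-double≢0′′ {x} b c = 0≢1 (sym (trans (sym (proj₂ (proj₂ (proj₂ uni)))) (trans
        (cong₂ (λ u v → proj₁ uni * u + proj₁ (proj₂ uni) * v + proj₁ (proj₂ (proj₂ uni)) * KF.formC x x 1#) (formA-double x) b)
        (trans (cong (λ w → proj₁ uni * 0# + proj₁ (proj₂ uni) * 0# + proj₁ (proj₂ (proj₂ uni)) * w) c)
          (solve 3 (λ r s t → r :* con 0 :+ s :* con 0 :+ t :* con 0 := con 0) _ _ _)))))
      where
      uni = KF.unimodular {disc F W ⁻¹} {x} {x} {1#} (key-F x) (0# , 1# , solve 1 (λ x → con 0 :* x :+ one :* one := one) x)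

  abstract
    formC-double≢0 : ∀ {x} → KF.formB x x 1# ≡ 0# → KF.formC x x 1# ≢ 0#
    formC-double≢0 = formC-double≢0′′

  private
    -- Sum T = 2P and difference O. The ordinate y′ is left free, since the forms see only the
    -- abscissa.
    double′′ : ∀ {x y T} → On (just (x , y)) → AddView (just (x , y)) (just (x , y)) T → ∀ {y′} → Proportional x (just (x , y′)) T nothing
    double′′ {x} {y} on (opposite e) = record { k = KF.formC x x 1# ; k≢0 = formC-double≢0 (trans (formB-double on) (trans (cong₂ _*_ d≡0 d≡0) (zeroˡ _)))
      ; propA = trans (formA-double x) (solve 1 (λ k → con 0 := k :* (con 0 :* con 0)) _)
      ; propB = trans (formB-double on) (trans (cong₂ _*_ d≡0 d≡0) (solve 1 (λ k → con 0 :* con 0 := k :* (one :* con 0 :+ one :* con 0)) _))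
      ; propC = solve 1 (λ k → k := k :* (one :* one)) _ }
      where
      d≡0 : fromℕ 2 * y + a₁ * x + a₃ ≡ 0#
      d≡0 = trans (solve 4 (λ a₁ a₃ x y → con 2 :* y :+ a₁ :* x :+ a₃ := y :+ y :+ a₁ :* x :+ a₃) a₁ a₃ x y) e
    double′′ {x} {y} on (line l m L (inj₁ ne)) = contradiction refl ne
    double′′ {x} {y} on (line l m L (inj₂ (_ , _ , d≢0))) = record { k = d * d ; k≢0 = *≢0 d≢0 d≢0
      ; propA = trans (formA-double x) (solve 1 (λ k → con 0 := k :* (one :* con 0)) _)
      ; propB = trans (formB-double on) (solve 2 (λ k z → k := k :* (z :* con 0 :+ one :* one)) _ _)
      ; propC = trans (sym (tangent-x on L)) (solve 2 (λ z k → z :* k := k :* (z :* one)) _ _) }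
      where d = fromℕ 2 * y + a₁ * x + a₃

  abstract
    double : ∀ {x y T} → On (just (x , y)) → AddView (just (x , y)) (just (x , y)) T → ∀ {y′} → Proportional x (just (x , y′)) T nothing
    double = double′′

  private
    generic′′ : ∀ {x₁ y₁ x y S D} → On (just (x₁ , y₁)) → On (just (x , y)) → x₁ ≢ x →
      AddView (just (x₁ , y₁)) (just (x , y)) S → AddView (just (x₁ , y₁)) (just (x , - y - a₁ * x - a₃)) D → Proportional x (just (x₁ , y₁)) S D
    generic′′ _ _ ne (opposite _) _ = contradiction refl ne
    generic′′ _ _ ne (line _ _ _ _) (opposite _) = contradiction refl ne
    generic′′ {x₁} {y₁} {x} {y} on₁ on ne (line l m L _) (line l′ m′ L′ _) = record { k = A ; k≢0 = A≢0
      ; propA = trans (solve 2 (λ x₁ x → (x₁ :- x :* one) :* (x₁ :- x :* one) := (x₁ :- x) :* (x₁ :- x)) x₁ x) (solve 1 (λ k → k := k :* (one :* one)) _)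
      ; propB = trans (sym (CF.numerator-sum on₁ on)) (trans (cong₂ _+_ (sym nS) (sym nD)) (solve 3 (λ s d k → s :* k :+ d :* k := k :* (s :* one :+ d :* one)) xS xD A))
      ; propC = *-cancelʳ A≢0 (trans (solve 3 (λ x₁ x z → z :* ((x₁ :- x) :* (x₁ :- x)) := (x₁ :- x :* one) :* (x₁ :- x :* one) :* z) x₁ x _) (trans (sym (CF.numerator-product on₁ on))
          (trans (cong₂ _*_ (sym nS) (sym nD)) (solve 3 (λ s d k → s :* k :* (d :* k) := k :* (s :* d) :* k) xS xD A)))) }
      where
      A = (x₁ - x) * (x₁ - x)
      A≢0 : A ≢ 0#
      A≢0 = *≢0 (x-y≢0 ne) (x-y≢0 ne)
      xS = l * l + a₁ * l - a₂ - x₁ - x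
      xD = l′ * l′ + a₁ * l′ - a₂ - x₁ - x
      nS : xS * A ≡ CF.numerator x₁ x (y₁ - y)
      nS = chord-x L
      nD : xD * A ≡ CF.numerator x₁ x (y₁ + y + a₁ * x + a₃)
      nD = trans (chord-x L′) (cong (CF.numerator x₁ x) (solve 5 (λ a₁ a₃ x y y₁ → y₁ :- (:- y :- a₁ :* x :- a₃) := y₁ :+ y :+ a₁ :* x :+ a₃) a₁ a₃ x y y₁))

  abstract
    generic : ∀ {x₁ y₁ x y S D} → On (just (x₁ , y₁)) → On (just (x , y)) → x₁ ≢ x →
      AddView (just (x₁ , y₁)) (just (x , y)) S → AddView (just (x₁ , y₁)) (just (x , - y - a₁ * x - a₃)) D → Proportional x (just (x₁ , y₁)) S D
    generic = generic′′

  infinity : ∀ {x y y′} → Proportional x nothing (just (x , y)) (just (x , y′))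
  infinity {x} = record { k = 1# ; k≢0 = λ e → 0≢1 (sym e)
    ; propA = solve 1 (λ x → (one :- x :* con 0) :* (one :- x :* con 0) := one :* (one :* one)) x
    ; propB = solve 4 (λ b₂ b₄ b₆ x → con 2 :* ((x :* one) :* (one :+ x :* con 0)) :+ b₂ :* ((x :* one) :* con 0) :+ b₄ :* ((one :+ x :* con 0) :* con 0) :+ b₆ :* (con 0 :* con 0)
        := one :* (x :* one :+ x :* one)) b₂ b₄ b₆ x
    ; propC = solve 4 (λ b₄ b₆ b₈ x → (x :* one) :* (x :* one) :- b₄ :* ((x :* one) :* con 0) :- b₆ :* ((one :+ x :* con 0) :* con 0) :- b₈ :* (con 0 :* con 0)
        := one :* (x :* x)) b₄ b₆ b₈ x }

  private
    kummer′′ : ∀ Q x y → On Q → On (just (x , y)) → Proportional x Q (Q ⊞ just (x , y)) (Q ⊞ (⊟ just (x , y)))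
    kummer′′ nothing x y _ on = infinity
    kummer′′ (just (x₁ , y₁)) x y on₁ on = go (x₁ ≟ x)
      where
      P = just (x , y)
      go : Dec (x₁ ≡ x) → Proportional x (just (x₁ , y₁)) (just (x₁ , y₁) ⊞ P) (just (x₁ , y₁) ⊞ (⊟ P))
      go (no ne) = generic on₁ on ne (addView (just (x₁ , y₁)) P on₁ on) (addView (just (x₁ , y₁)) (⊟ P) on₁ (⊟-on P on))
      go (yes refl) = same ((y₁ + y + a₁ * x + a₃) ≟ 0#)
        where
        same : Dec (y₁ + y + a₁ * x + a₃ ≡ 0#) → Proportional x (just (x , y₁)) (just (x , y₁) ⊞ P) (just (x , y₁) ⊞ (⊟ P))
        same (no h) with same-y on₁ on h
        ... | refl = subst (Proportional x P (P ⊞ P)) (sym (⊞-inverse P)) (double on (addView P P on on))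
        -- Here Q = -P: the doubling case for ⊟ P, with sum and difference exchanged.
        same (yes e) = subst (λ y₁ → Proportional x (just (x , y₁)) (just (x , y₁) ⊞ P) (just (x , y₁) ⊞ (⊟ P))) (sym y₁≡)
            (subst (λ S → Proportional x (⊟ P) S ((⊟ P) ⊞ (⊟ P))) (sym inverseˡ′) (swap (double (⊟-on P on) (addView (⊟ P) (⊟ P) (⊟-on P on) (⊟-on P on)))))
          where
          y₁≡ : y₁ ≡ - y - a₁ * x - a₃
          y₁≡ = linear₁ (solve 5 (λ a₁ a₃ x y y₁ → y₁ :- (:- y :- a₁ :* x :- a₃) := one :* (y₁ :+ y :+ a₁ :* x :+ a₃ :- con 0)) a₁ a₃ x y y₁) e
          inverseˡ′ : (⊟ P) ⊞ P ≡ nothing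
          inverseˡ′ = trans (⊞-comm (⊟ P) P (⊟-on P on) on) (⊞-inverse P)

  abstract
    kummer : ∀ Q x y → On Q → On (just (x , y)) → Proportional x Q (Q ⊞ just (x , y)) (Q ⊞ (⊟ just (x , y)))
    kummer = kummer′′

-- The bound n² on the n-torsion.

module Torsion (F : FiniteField) (W : Weierstrass F) (nonsing : disc F W ≢ FiniteField.0# F) where
  open import Relation.Binary.PropositionalEquality

  open FiniteField F
  open Weierstrass W
  open FieldKit F
  open FieldPoly F
  open FieldFinite F hiding (module PS)
  open RootPowers F
  open GroupLaw F W nonsing
  open Exponent F W nonsing using (module G)
  open G using (pow; pow∈)
  open Heights F W nonsing
  open KummerPoints F W nonsing
  open Lists
  open RingHom
  open import Data.List using (List; []; _∷_; length; filter)
  open import Data.List.Relation.Unary.All as All using ([]; _∷_)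
  open import Data.List.Relation.Unary.Unique.Propositional.Properties using (filter⁺)
  open import Data.Nat as ℕ using (ℕ; zero; suc; _≤_; _<_; z≤n; s≤s)
  import Data.Nat.Properties as ℕ
  open import Data.Nat.Tactic.RingSolver using (solve-∀)

  -- The polynomials U, V describe the x-coordinate of Q over x = a.
  Describes : Poly → Poly → Carrier → Point → Set
  Describes U V a Q = ∃ λ k → k ≢ 0# × eval a U ≡ k * κ₁ Q × eval a V ≡ k * κ₂ Q

  -- U : V and U′ : V′ are x(nP) and x((n + 1)P) for the generic point P, so V plays the part of the
  -- squared division polynomial. It has degree below n², and even order at every a that is not the
  -- abscissa of a 2-torsion point (there formB a a 1 = ψ²(a) is nonzero). At n = 0 the denominator
  -- is zero and has no order, whence the alternative in `even`.
  record Stage (n : ℕ) : Set where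
    field
      U V U′ V′  : Poly
      coprime    : KP.Coprime U V
      coprime′   : KP.Coprime U′ V′
      size₁      : Size U V (n ℕ.* n)
      size₂      : Size U′ V′ (suc n ℕ.* suc n)
      related    : KP.Related X U′ V′ U V
      low        : coeff V (n ℕ.* n) ≡ 0#
      low′       : coeff V′ (suc n ℕ.* suc n) ≡ 0#
      describes  : ∀ {a y} → On (just (a , y)) → Describes U V a (pow n (just (a , y)))
      describes′ : ∀ {a y} → On (just (a , y)) → Describes U′ V′ a (pow (suc n) (just (a , y)))
      even       : ∀ {a} → KF.formB a a 1# ≢ 0# → (U ≋ const 1# × V ≋ [] × U′ ≋ X × V′ ≋ const 1#) ⊎ Even a V
      even′      : ∀ {a} → KF.formB a a 1# ≢ 0# → Even a V′

  private
    even-nonroot : ∀ {a p} → eval a p ≢ 0# → Even a p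
    even-nonroot {a} {p} h = 0 , p , P.sym (P.*-identityˡ p) , h

    stage-0 : Stage 0
    stage-0 = record
      { U = const 1# ; V = [] ; U′ = X ; V′ = const 1#
      ; coprime  = const 1# , [] , PS.solve 0 (one :* one :+ con 0 :* con 0 := one)
      ; coprime′ = [] , const 1# , PS.solve 1 (λ x → con 0 :* x :+ one :* one := one) X
      ; size₁ = sized (deg-const 1#) (deg≤ λ _ _ → refl) λ { (e , _) → 0≢1 (sym e) }
      ; size₂ = sized deg-X (deg-mono z≤n (deg-const 1#)) λ { (e , _) → 0≢1 (sym e) }
      ; related = PS.solve 5 (λ b₂ b₄ b₆ b₈ x → let A = (x :- x :* one) :* (x :- x :* one) in
          let B = con 2 :* ((x :* x) :* (x :+ x :* one)) :+ b₂ :* ((x :* x) :* one) :+ b₄ :* ((x :+ x :* one) :* one) :+ b₆ :* (one :* one) in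
          let C = (x :* x) :* (x :* x) :- b₄ :* ((x :* x) :* one) :- b₆ :* ((x :+ x :* one) :* one) :- b₈ :* (one :* one) in
          A :* (one :* one) :- B :* (one :* con 0) :+ C :* (con 0 :* con 0) := con 0) (const b₂) (const b₄) (const b₆) (const b₈) X
      ; low = refl ; low′ = refl
      ; describes = λ {a} _ → 1# , (λ e → 0≢1 (sym e)) , trans (eval-const a 1#) (sym (*-identityˡ 1#)) , sym (zeroʳ 1#)
      ; describes′ = λ {a} _ → 1# , (λ e → 0≢1 (sym e)) , trans (eval-X a) (sym (*-identityˡ a)) , trans (eval-const a 1#) (sym (*-identityˡ 1#))
      ; even = λ _ → inj₁ (P.refl , P.refl , P.refl , P.refl)
      ; even′ = λ {a} _ → even-nonroot (λ e → 0≢1 (sym (trans (sym (eval-const a 1#)) e))) }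

    module _ (a : Carrier) (U V : Poly) where
      eval-formA : eval a (KP.formA X U V) ≡ KF.formA a (eval a U) (eval a V)
      eval-formA = trans (Hom.push (evalHom a) 3 (λ x X Z → (X :- x :* Z) :* (X :- x :* Z)) X U V) (cong (λ t → KF.formA t (eval a U) (eval a V)) (eval-X a))

      eval-formB : eval a (KP.formB X U V) ≡ KF.formB a (eval a U) (eval a V)
      eval-formB = trans (Hom.push (evalHom a) 6 (λ b₂ b₄ b₆ x X Z →
          con 2 :* ((x :* X) :* (X :+ x :* Z)) :+ b₂ :* ((x :* X) :* Z) :+ b₄ :* ((X :+ x :* Z) :* Z) :+ b₆ :* (Z :* Z)) (const b₂) (const b₄) (const b₆) X U V)
        (trans (cong (λ s → FB s (eval a (const b₄)) (eval a (const b₆)) (eval a X)) (eval-const a b₂))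
          (trans (cong₂ (λ s t → FB b₂ s t (eval a X)) (eval-const a b₄) (eval-const a b₆)) (cong (FB b₂ b₄ b₆) (eval-X a))))
        where
        FB : (b₂ b₄ b₆ x : Carrier) → Carrier
        FB b₂ b₄ b₆ x = Kummer.formB fieldRing b₂ b₄ b₆ b₈ x (eval a U) (eval a V)

      eval-formC : eval a (KP.formC X U V) ≡ KF.formC a (eval a U) (eval a V)
      eval-formC = trans (Hom.push (evalHom a) 6 (λ b₄ b₆ b₈ x X Z →
          (x :* X) :* (x :* X) :- b₄ :* ((x :* X) :* Z) :- b₆ :* ((X :+ x :* Z) :* Z) :- b₈ :* (Z :* Z)) (const b₄) (const b₆) (const b₈) X U V)
        (trans (cong (λ s → FC s (eval a (const b₆)) (eval a (const b₈)) (eval a X)) (eval-const a b₄))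
          (trans (cong₂ (λ s t → FC b₄ s t (eval a X)) (eval-const a b₆) (eval-const a b₈)) (cong (FC b₄ b₆ b₈) (eval-X a))))
        where
        FC : (b₄ b₆ b₈ x : Carrier) → Carrier
        FC b₄ b₆ b₈ x = Kummer.formC fieldRing b₂ b₄ b₆ b₈ x (eval a U) (eval a V)

    -- Evaluated at a, the factored form is proportional to the form of Q, whose roots are S and D;
    -- once one factor is known to describe D, the other must describe S. The scalar is c² k / c′.
    describes-next : ∀ {a U V U₋ V₋ U₊ V₊ Q S D} → KP.Splits (KP.formA X U V) (KP.formB X U V) (KP.formC X U V) U₋ V₋ U₊ V₊ →
      Describes U V a Q → Describes U₋ V₋ a D → Proportional a Q S D → Describes U₊ V₊ a S
    describes-next {a} {U} {V} {U₋} {V₋} {U₊} {V₊} {Q} {S} {D} (Kummer.splits sa sb sc) (c , c≢0 , cu , cv) (c′ , c′≢0 , du , dv) pr =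
      e , *≢0 (*≢0 (*≢0 c≢0 c≢0) k≢0) (⁻¹≢0 c′≢0) , solveU D refl , solveV D refl
      where
      open Proportional pr
      e = (c * c * k) / c′
      e* : e * c′ ≡ c * c * k
      e* = /-cancel c′≢0 (c * c * k)
      A′ : eval a V₋ * eval a V₊ ≡ c * c * k * (κ₂ S * κ₂ D)
      A′ = trans (sym (trans (eval-cong a sa) (eval-⊗ a V₋ V₊))) (trans (eval-formA a U V) (trans (cong₂ (KF.formA a) cu cv)
        (trans (solve 4 (λ x c u v → (c :* u :- x :* (c :* v)) :* (c :* u :- x :* (c :* v)) := c :* c :* ((u :- x :* v) :* (u :- x :* v))) a c (κ₁ Q) (κ₂ Q))
          (trans (cong (c * c *_) propA) (sym (*-assoc _ _ _))))))
      B′ : eval a U₋ * eval a V₊ + eval a U₊ * eval a V₋ ≡ c * c * k * (κ₁ S * κ₂ D + κ₁ D * κ₂ S)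
      B′ = trans (sym (trans (eval-cong a sb) (trans (eval-⊕ a (U₋ ⊗ V₊) (U₊ ⊗ V₋)) (cong₂ _+_ (eval-⊗ a U₋ V₊) (eval-⊗ a U₊ V₋)))))
        (trans (eval-formB a U V) (trans (cong₂ (KF.formB a) cu cv)
        (trans (solve 7 (λ b₂ b₄ b₆ x c u v →
            con 2 :* ((x :* (c :* u)) :* (c :* u :+ x :* (c :* v))) :+ b₂ :* ((x :* (c :* u)) :* (c :* v)) :+ b₄ :* ((c :* u :+ x :* (c :* v)) :* (c :* v)) :+ b₆ :* (c :* v :* (c :* v))
            := c :* c :* (con 2 :* ((x :* u) :* (u :+ x :* v)) :+ b₂ :* ((x :* u) :* v) :+ b₄ :* ((u :+ x :* v) :* v) :+ b₆ :* (v :* v))) b₂ b₄ b₆ a c (κ₁ Q) (κ₂ Q))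
          (trans (cong (c * c *_) propB) (sym (*-assoc _ _ _))))))
      C′ : eval a U₋ * eval a U₊ ≡ c * c * k * (κ₁ S * κ₁ D)
      C′ = trans (sym (trans (eval-cong a sc) (eval-⊗ a U₋ U₊))) (trans (eval-formC a U V) (trans (cong₂ (KF.formC a) cu cv)
        (trans (solve 7 (λ b₄ b₆ b₈ x c u v →
            (x :* (c :* u)) :* (x :* (c :* u)) :- b₄ :* ((x :* (c :* u)) :* (c :* v)) :- b₆ :* ((c :* u :+ x :* (c :* v)) :* (c :* v)) :- b₈ :* (c :* v :* (c :* v))
            := c :* c :* ((x :* u) :* (x :* u) :- b₄ :* ((x :* u) :* v) :- b₆ :* ((u :+ x :* v) :* v) :- b₈ :* (v :* v))) b₄ b₆ b₈ a c (κ₁ Q) (κ₂ Q))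
          (trans (cong (c * c *_) propC) (sym (*-assoc _ _ _))))))
      solveV : ∀ D′ → D ≡ D′ → eval a V₊ ≡ e * κ₂ S
      -- If D = O then V₋ vanishes at a, and V₊ has to be found from the middle coefficient instead
      -- of A.
      solveV nothing refl = *-cancelʳ c′≢0 (linear₄ (solve 9 (λ c′ e K um vm up vp s₁ s₂ → vp :* c′ :- e :* s₂ :* c′
          := one :* (um :* vp :+ up :* vm :- K :* (s₁ :* con 0 :+ one :* s₂)) :+ :- vp :* (um :- c′ :* one) :+ :- up :* (vm :- c′ :* con 0) :+ :- s₂ :* (e :* c′ :- K))
          c′ e (c * c * k) (eval a U₋) (eval a V₋) (eval a U₊) (eval a V₊) (κ₁ S) (κ₂ S)) B′ du dv e*)
      solveV (just (d , _)) refl = *-cancelʳ c′≢0 (linear₃ (solve 6 (λ c′ e K vm vp s₂ → vp :* c′ :- e :* s₂ :* c′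
          := one :* (vm :* vp :- K :* (s₂ :* one)) :+ :- vp :* (vm :- c′ :* one) :+ :- s₂ :* (e :* c′ :- K))
          c′ e (c * c * k) (eval a V₋) (eval a V₊) (κ₂ S)) A′ dv e*)
      solveU : ∀ D′ → D ≡ D′ → eval a U₊ ≡ e * κ₁ S
      solveU nothing refl = *-cancelʳ c′≢0 (linear₃ (solve 6 (λ c′ e K um up s₁ → up :* c′ :- e :* s₁ :* c′
          := one :* (um :* up :- K :* (s₁ :* one)) :+ :- up :* (um :- c′ :* one) :+ :- s₁ :* (e :* c′ :- K))
          c′ e (c * c * k) (eval a U₋) (eval a U₊) (κ₁ S)) C′ du e*)
      solveU (just (d , y)) refl = *-cancelʳ c′≢0 (trans (linear₃ (solve 10 (λ d c′ e K um vm up vp s₁ s₂ → up :* c′ :- (e :* s₁ :* c′ :+ d :* c′ :* (e :* s₂ :- vp) :- (d :* s₂ :+ s₁) :* (e :* c′ :- K))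
          := one :* (um :* vp :+ up :* vm :- K :* (s₁ :* one :+ d :* s₂)) :+ :- vp :* (um :- c′ :* d) :+ :- up :* (vm :- c′ :* one))
          d c′ e (c * c * k) (eval a U₋) (eval a V₋) (eval a U₊) (eval a V₊) (κ₁ S) (κ₂ S)) B′ du dv)
        (linear₂ (solve 7 (λ d c′ e K vp s₁ s₂ → e :* s₁ :* c′ :+ d :* c′ :* (e :* s₂ :- vp) :- (d :* s₂ :+ s₁) :* (e :* c′ :- K) :- e :* s₁ :* c′
          := :- (d :* c′) :* (vp :- e :* s₂) :+ :- (d :* s₂ :+ s₁) :* (e :* c′ :- K)) d c′ e (c * c * k) (eval a V₊) (κ₁ S) (κ₂ S)) (solveV (just (d , y)) refl) e*))

    -- The only term of full degree is 2 (X U)(U + X V), and the top coefficient of U + X V is that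
    -- of V.
    formB-low : ∀ {U V d} → Size U V d → coeff V d ≡ 0# → coeff (KP.formB X U V) (suc d ℕ.+ suc d) ≡ 0#
    formB-low {U} {V} {d} (sized du dv _) v≡0 = begin
      coeff (KP.formB X U V) D                      ≡⟨ coeff-⊕ _ t₄ D ⟩
      coeff (t₁ ⊕ t₂ ⊕ t₃) D + coeff t₄ D           ≡⟨ cong₂ _+_ (trans (coeff-⊕ (t₁ ⊕ t₂) t₃ D) (cong₂ _+_ (coeff-⊕ t₁ t₂ D) (small d₃))) (small d₄) ⟩
      coeff t₁ D + coeff t₂ D + 0# + 0#             ≡⟨ cong₂ (λ x y → x + y + 0# + 0#) leading (small d₂) ⟩
      0# + 0# + 0# + 0#                             ≡⟨ solve 0 (con 0 :+ con 0 :+ con 0 :+ con 0 := con 0) ⟩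
      0#                                            ∎
      where
      open ≡-Reasoning
      D = suc d ℕ.+ suc d
      S = U ⊕ X ⊗ V
      t₁ = PS.κ 2 ⊗ ((X ⊗ U) ⊗ S)
      t₂ = const b₂ ⊗ ((X ⊗ U) ⊗ V)
      t₃ = const b₄ ⊗ (S ⊗ V)
      t₄ = const b₆ ⊗ (V ⊗ V)
      dU : Deg≤ (X ⊗ U) (suc d)
      dU = deg-shift du
      dS : Deg≤ S (suc d)
      dS = deg-⊕ (deg-mono (ℕ.n≤1+n d) du) (deg-shift dv)
      d₂ : Deg≤ t₂ (suc d ℕ.+ d)
      d₂ = deg-⊗ (deg-const _) (deg-⊗ dU dv)
      d₃ : Deg≤ t₃ (suc d ℕ.+ d)
      d₃ = deg-⊗ (deg-const _) (deg-⊗ dS dv)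
      d₄ : Deg≤ t₄ (suc d ℕ.+ d)
      d₄ = deg-mono (ℕ.+-monoˡ-≤ d (ℕ.n≤1+n d)) (deg-⊗ (deg-const _) (deg-⊗ dv dv))
      small : ∀ {p} → Deg≤ p (suc d ℕ.+ d) → coeff p D ≡ 0#
      small h = vanish h D (ℕ.+-monoʳ-< (suc d) ℕ.≤-refl)
      S-low : coeff S (suc d) ≡ 0#
      S-low = trans (coeff-⊕ U (X ⊗ V) (suc d)) (trans (cong₂ _+_ (vanish du (suc d) ℕ.≤-refl) (trans (coeff-shift V d) v≡0)) (+-identityˡ 0#))
      leading : coeff t₁ D ≡ 0#
      leading = trans (top-⊗ 0 D (deg-κ 2) (deg-⊗ dU dS)) (trans (cong (coeff (PS.κ 2) 0 *_) (trans (top-⊗ (suc d) (suc d) dU dS)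
        (trans (cong (coeff (X ⊗ U) (suc d) *_) S-low) (zeroʳ _)))) (zeroʳ _))

    -- Were V zero, the Bezout identity would make U a unit; but U has degree d > 0.
    low-nonzero : ∀ {U V d} → KP.Coprime U V → Size U V d → coeff V d ≡ 0# → 0 < d → ¬ V ≋ []
    low-nonzero {U} {V} {d} (α , β , e) (sized du _ l) v≡0 0<d V≋0 = go (zero-or-top α)
      where
      αU : α ⊗ U ≋ const 1#
      αU = P.trans (P.trans (P.sym (P.+-identityʳ _)) (P.+-congˡ (P.sym (P.trans (P.*-congˡ V≋0) (P.zeroʳ β))))) e
      1≢0 : ¬ const 1# ≋ []
      1≢0 h = 0≢1 (sym (at h 0))
      go : α ≋ [] ⊎ ∃ (Top α) → ⊥
      go (inj₁ z) = 1≢0 (P.trans (P.sym αU) (P.trans (P.*-congʳ z) (P.zeroˡ U)))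
      go (inj₂ (j , t)) = ℕ.<⇒≢ (ℕ.<-≤-trans 0<d (ℕ.m≤n+m d j)) (sym (top-unique (top-cong αU (top-⊗′ t (top du (λ u≡0 → l (u≡0 , v≡0))))) (top (deg-const 1#) (λ e → 0≢1 (sym e)))))

    squares : ∀ {n d} → n ℕ.* n ℕ.+ d ≡ suc (suc n ℕ.* suc n) ℕ.+ suc (suc n ℕ.* suc n) → d ≡ suc (suc n) ℕ.* suc (suc n)
    squares {n} {d} e = ℕ.+-cancelˡ-≡ (n ℕ.* n) _ _ (trans e (arith n))
      where
      arith : ∀ n → suc (suc n ℕ.* suc n) ℕ.+ suc (suc n ℕ.* suc n) ≡ n ℕ.* n ℕ.+ suc (suc n) ℕ.* suc (suc n)
      arith = solve-∀

    next-stage : ∀ {n} → Stage n → Stage (suc n)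
    next-stage {n} s = record
      { U = U′ ; V = V′ ; U′ = U₊ ; V′ = V₊ ; coprime = coprime′ ; coprime′ = coprime₊ ; size₁ = size₂ ; size₂ = size₊
      ; related = KP.related-sym X U′ V′ U₊ V₊ (KP.splits-related {X} {U′} {V′} {U} {V} {U₊} {V₊} sp)
      ; low = low′ ; low′ = low₊ ; describes = describes′ ; describes′ = describes₊ ; even = λ h → inj₂ (even′ h) ; even′ = even₊ }
      where
      open Stage s
      next-pair : ∃₂ λ U₊ V₊ → KP.Splits (KP.formA X U′ V′) (KP.formB X U′ V′) (KP.formC X U′ V′) U V U₊ V₊
      next-pair = KP.split coprime related
      U₊ V₊ : Poly
      U₊ = proj₁ next-pair
      V₊ = proj₁ (proj₂ next-pair)
      sp : KP.Splits (KP.formA X U′ V′) (KP.formB X U′ V′) (KP.formC X U′ V′) U V U₊ V₊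
      sp = proj₂ (proj₂ next-pair)
      open KP.Splits sp
      coprime₊ : KP.Coprime U₊ V₊
      coprime₊ = KP.splits-coprime (unimodular-P coprime′) sp
      degrees : n ℕ.* n ℕ.+ proj₁ (coprime-size coprime₊) ≡ suc (suc n ℕ.* suc n) ℕ.+ suc (suc n ℕ.* suc n)
      degrees = step-size sp size₂ size₁ (proj₂ (coprime-size coprime₊))
      size₊ : Size U₊ V₊ (suc (suc n) ℕ.* suc (suc n))
      size₊ = subst (Size U₊ V₊) (squares degrees) (proj₂ (coprime-size coprime₊))
      m₋ m₊ : ℕ
      m₋ = n ℕ.* n
      m₊ = suc (suc n) ℕ.* suc (suc n)
      m₋+m₊ : m₋ ℕ.+ m₊ ≡ suc (suc n ℕ.* suc n) ℕ.+ suc (suc n ℕ.* suc n)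
      m₋+m₊ = trans (cong (m₋ ℕ.+_) (sym (squares degrees))) degrees
      -- The top coefficient of B = U V₊ + U₊ V vanishes and so does that of V, while that of U does
      -- not.
      low₊ : coeff V₊ m₊ ≡ 0#
      low₊ = *≡0 (trans (*-comm _ _) (trans (solve 1 (λ x → x := x :+ con 0) _) (trans (sym (trans (coeff-⊕ (U ⊗ V₊) (U₊ ⊗ V) (m₋ ℕ.+ m₊)) (cong₂ _+_
          (top-⊗ m₋ m₊ (Size.degU size₁) (Size.degV size₊))
          (trans (cong (coeff (U₊ ⊗ V)) (ℕ.+-comm m₋ m₊)) (trans (top-⊗ m₊ m₋ (Size.degU size₊) (Size.degV size₁)) (trans (cong (coeff U₊ m₊ *_) low) (zeroʳ _)))))))
          (trans (sym (at B≈ (m₋ ℕ.+ m₊))) (trans (cong (coeff (KP.formB X U′ V′)) m₋+m₊) (formB-low size₂ low′))))))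
        (λ u≡0 → Size.lead≢0 size₁ (u≡0 , low))
      describes₊ : ∀ {a y} → On (just (a , y)) → Describes U₊ V₊ a (pow (suc (suc n)) (just (a , y)))
      describes₊ {a} {y} on = describes-next sp (describes′ on) (describes on)
        (subst₂ (Proportional a Q) (⊞-comm Q P qon on) back (kummer Q a y qon on))
        where
        P = just (a , y)
        pn = pow n P
        pon : On pn
        pon = pow∈ n {P} on
        Q = pow (suc n) P
        qon : On Q
        qon = pow∈ (suc n) {P} on
        back : Q ⊞ (⊟ P) ≡ pn
        back = trans (cong (_⊞ (⊟ P)) (⊞-comm P pn on pon)) (trans (⊞-assoc pn P (⊟ P) pon on (⊟-on P on))
          (trans (cong (pn ⊞_) (⊞-inverse P)) (G.identityʳ pn pon)))
      V₊≢0 : ¬ V₊ ≋ []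
      V₊≢0 = low-nonzero coprime₊ size₊ low₊ (s≤s z≤n)
      even₊ : ∀ {a} → KF.formB a a 1# ≢ 0# → Even a V₊
      even₊ {a} h with even h
      -- At n = 0 the new denominator is formB at X : 1, which `h` says is nonzero at a.
      ... | inj₁ (u , v , u′ , v′) = even-nonroot λ e → h (trans (sym (trans (eval-formB a U′ V′) (cong₂ (KF.formB a) (trans (eval-cong a u′) (eval-X a)) (trans (eval-cong a v′) (eval-const a 1#)))))
          (trans (eval-cong a (P.trans B≈ (P.trans (P.+-cong (P.*-congʳ u) (P.*-congˡ v)) (PS.solve 2 (λ x y → one :* x :+ y :* con 0 := x) V₊ U₊)))) e))
      -- V V₊ = A is the square of U′ - X V′.
      ... | inj₂ E = even-quotient E (P.sym A≈) V₊≢0 (λ z → ⊗≢0 (even≢0 E) V₊≢0 (P.trans (P.sym A≈) (P.trans (P.*-congʳ z) (P.zeroˡ _))))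
        where
        even≢0 : ∀ {p} → Even a p → ¬ p ≋ []
        even≢0 (k , g , e , g≢0) z = ⊗≢0 (top-≋0 (top-^ a (k ℕ.+ k))) (λ g≋0 → g≢0 (eval-cong a g≋0)) (P.trans (P.sym e) z)

  abstract
    stage : ∀ n → Stage n
    stage zero    = stage-0
    stage (suc n) = next-stage (stage n)

  Killed : ℕ → Point → Set
  Killed L P = On P × pow L P ≡ nothing

  private
    affine? : (P : Point) → Dec (P ≢ nothing)
    affine? nothing  = no λ h → h refl
    affine? (just _) = yes λ ()

    x-of : Point → Carrier
    x-of nothing        = 0#
    x-of (just (x , _)) = x

  module _ (n : ℕ) {xs : List Point} (unique : Unique xs) (killed : ∀ {P} → P ∈ xs → Killed (suc n) P) where
    private
      L = suc n
      open Stage (stage n)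

      ys : List Point
      ys = filter affine? xs

      m : Carrier → ℕ
      m a = length (fibre _≟_ x-of ys a)

      in-fibre : ∀ {a P} → P ∈ fibre _≟_ x-of ys a → ∃ λ y → P ≡ just (a , y) × On (just (a , y)) × pow L (just (a , y)) ≡ nothing
      in-fibre {a} {P} i with ∈-filter⁻ (λ P → x-of P ≟ a) {xs = ys} i
      ... | P∈ys , refl with ∈-filter⁻ affine? {xs = xs} P∈ys
      in-fibre {a} {nothing} i | P∈ys , refl | P∈xs , h = contradiction refl h
      in-fibre {a} {just (x , y)} i | P∈ys , refl | P∈xs , h = y , refl , killed P∈xs

      vanishes : ∀ {a y} → On (just (a , y)) → pow L (just (a , y)) ≡ nothing → eval a V′ ≡ 0#
      vanishes on e with describes′ on
      ... | k , _ , _ , ev = trans ev (trans (cong (λ Q → k * κ₂ Q) e) (zeroʳ k))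

      opposite-y : ∀ {a y y′} → On (just (a , y)) → On (just (a , y′)) → y ≢ y′ → y + y′ + a₁ * a + a₃ ≡ 0#
      opposite-y {a} {y} {y′} on on′ ne with (y + y′ + a₁ * a + a₃) ≟ 0#
      ... | yes e = e
      ... | no h  = contradiction (same-y on on′ h) ne

      separable : ∀ {a y y′} → On (just (a , y)) → On (just (a , y′)) → y ≢ y′ → KF.formB a a 1# ≢ 0#
      separable {a} {y} {y′} on on′ ne e = *≢0 d≢0 d≢0 (trans (sym (formB-double on)) e)
        where
        d≢0 : fromℕ 2 * y + a₁ * a + a₃ ≢ 0#
        d≢0 z = ne (linear₂ (solve 5 (λ a₁ a₃ a y y′ → y :- y′ := one :* (con 2 :* y :+ a₁ :* a :+ a₃ :- con 0) :+ :- one :* (y :+ y′ :+ a₁ :* a :+ a₃ :- con 0)) a₁ a₃ a y y′) z (opposite-y on on′ ne))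

      square-root : ∀ {a} → Even a V′ → eval a V′ ≡ 0# → ∃ λ g → V′ ≋ (X- a) PP.^ 2 ⊗ g
      square-root {a} (zero , g , e , g≢0) z = contradiction (trans (sym (eval-cong a (P.trans e (P.*-identityˡ g)))) z) g≢0
      square-root {a} (suc k , g , e , _) _ = (X- a) PP.^ (k ℕ.+ k) ⊗ g , P.trans e (P.trans (P.*-congʳ (P.reflexive (cong (λ i → (X- a) PP.^ suc i) (ℕ.+-suc k k))))
        (PS.solve 3 (λ l p g → l :* (l :* p) :* g := l :* (l :* one) :* (p :* g)) (X- a) _ g))

      -- One killed point over a gives a root of V′. Two of them have distinct ordinates, so a is
      -- not the abscissa of a 2-torsion point, and the order, being even and positive, is at least
      -- 2. Three cannot occur.
      divides-m : ∀ a → ∃ λ g → V′ ≋ (X- a) PP.^ m a ⊗ g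
      divides-m a = go (fibre _≟_ x-of ys a) (filter⁺ (λ P → x-of P ≟ a) (filter⁺ affine? unique)) in-fibre
        where
        go : ∀ zs → Unique zs → (∀ {P} → P ∈ zs → ∃ λ y → P ≡ just (a , y) × On (just (a , y)) × pow L (just (a , y)) ≡ nothing) →
          ∃ λ g → V′ ≋ (X- a) PP.^ length zs ⊗ g
        go [] _ _ = V′ , P.sym (P.*-identityˡ V′)
        go (P ∷ []) _ h with h (here refl)
        ... | y , refl , on , e = quot a V′ , P.trans (root-factor (vanishes on e)) (P.*-congʳ (P.sym (P.*-identityʳ (X- a))))
        go (P ∷ Q ∷ []) ((P≢Q ∷ []) ∷ _) h with h (here refl) | h (there (here refl))
        ... | y , refl , on , e | y′ , refl , on′ , _ = square-root (even′ (separable on on′ (λ z → P≢Q (cong (λ y → just (a , y)) z)))) (vanishes on e)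
        go (P ∷ Q ∷ S ∷ _) ((P≢Q ∷ P≢S ∷ _) ∷ (Q≢S ∷ _) ∷ _) h with h (here refl) | h (there (here refl)) | h (there (there (here refl)))
        ... | y , refl , on , e | y′ , refl , on′ , _ | y″ , refl , on″ , _ = ⊥-elim (Q≢S (cong (λ y → just (a , y)) (linear₂
          (solve 6 (λ a₁ a₃ a y y′ y″ → y′ :- y″ := one :* (y :+ y′ :+ a₁ :* a :+ a₃ :- con 0) :+ :- one :* (y :+ y″ :+ a₁ :* a :+ a₃ :- con 0)) a₁ a₃ a y y′ y″)
          (opposite-y on on′ (λ z → P≢Q (cong (λ y → just (a , y)) z))) (opposite-y on on″ (λ z → P≢S (cong (λ y → just (a , y)) z))))))

      length-xs : length xs ≤ suc (length ys)
      length-xs = unique-length unique λ {P} i → sort P i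
        where
        sort : ∀ P → P ∈ xs → P ∈ nothing ∷ ys
        sort nothing  i = here refl
        sort (just p) i = there (∈-filter⁺ affine? i λ ())

      V′≢0 : ¬ V′ ≋ []
      V′≢0 = low-nonzero coprime′ size₂ low′ (s≤s z≤n)

      -- Strict because deg V′ < L²; this leaves room for the point at infinity.
      degree-bound : ∑ m elements < L ℕ.* L
      degree-bound with zero-or-top V′ | ∏X-^-divides m elements unique-elements (λ {a} _ → divides-m a)
      ... | inj₁ z | _ = contradiction z V′≢0
      ... | inj₂ (k , t) | g , e with zero-or-top g
      ...   | inj₁ z = contradiction (P.trans e (P.trans (P.*-congˡ z) (P.zeroʳ _))) V′≢0
      ...   | inj₂ (j , s) = ℕ.≤-<-trans (ℕ.m≤m+n _ j) (ℕ.≤-<-trans (ℕ.≤-reflexive (top-unique (top-⊗′ (top-∏X-^ m elements) s) (top-cong e t)))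
          (ℕ.≤∧≢⇒< (top≤ (Size.degV size₂) t) λ { refl → lead t low′ }))

    torsion-bound : length xs ≤ L ℕ.* L
    torsion-bound = ℕ.≤-trans length-xs (ℕ.≤-trans (s≤s (ℕ.≤-reflexive (sym (∑-fibres _≟_ x-of unique-elements ys (λ {P} _ → ∈-elements (x-of P)))))) degree-bound)

-- The quadratic extension field generated by θ with θ² + θ + D = 0.

module QuadraticField (F : FiniteField) (D : FiniteField.Carrier F) (param : ∀ x → FiniteField._+_ F (FiniteField._+_ F (FiniteField._*_ F x x) x) D ≢ FiniteField.0# F) where
  open import Relation.Binary.PropositionalEquality

  open FiniteField F
  open FieldKit F
  open Quadratic fieldRing 1# (- D)
  open QuadraticRoots F 1# (- D) using (module Inert)
  open RingHom
  open import Algebra.Structures using (IsCommutativeRing)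
  open import Data.Fin.Properties using (*↔×)
  open import Data.Nat as ℕ using (ℕ)
  open import Data.Product.Properties using (≡-dec)
  open import Data.Product.Function.NonDependent.Propositional using (_×-↔_)
  open import Function.Construct.Composition using (_↔-∘_)
  open import Function.Construct.Symmetry using (↔-sym)
  private module Q = CommutativeRing quadRing

  ≃⇒≡ : ∀ {z w} → z ≃ w → z ≡ w
  ≃⇒≡ e = cong₂ _,_ (re e) (im e)

  private
    irreducible : ∀ y → y * y + 1# * y ≢ - D
    irreducible y e = param y (linear₁ (solve 2 (λ y D → y :* y :+ y :+ D :- con 0 := one :* (y :* y :+ one :* y :- :- D)) y D) e)

    open Inert irreducible using (norm≢0)

    abstract
      isCommutativeRing′ : IsCommutativeRing _≡_ _+q_ _*q_ -q_ (0# , 0#) (1# , 0#)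
      isCommutativeRing′ = record
        { isRing = record
          { +-isAbelianGroup = record
            { isGroup = record
              { isMonoid = record
                { isSemigroup = record
                  { isMagma = record { isEquivalence = isEquivalence ; ∙-cong = cong₂ _+q_ }
                  ; assoc = λ x y z → ≃⇒≡ (Q.+-assoc x y z) }
                ; identity = (λ x → ≃⇒≡ (Q.+-identityˡ x)) , (λ x → ≃⇒≡ (Q.+-identityʳ x)) }
              ; inverse = (λ x → ≃⇒≡ (Q.-‿inverseˡ x)) , (λ x → ≃⇒≡ (Q.-‿inverseʳ x))
              ; ⁻¹-cong = cong -q_ }
            ; comm = λ x y → ≃⇒≡ (Q.+-comm x y) }
          ; *-cong = cong₂ _*q_
          ; *-assoc = λ x y z → ≃⇒≡ (Q.*-assoc x y z)
          ; *-identity = (λ x → ≃⇒≡ (Q.*-identityˡ x)) , (λ x → ≃⇒≡ (Q.*-identityʳ x))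
          ; distrib = (λ x y z → ≃⇒≡ (Q.distribˡ x y z)) , (λ x y z → ≃⇒≡ (Q.distribʳ x y z)) }
        ; *-comm = λ x y → ≃⇒≡ (Q.*-comm x y) }

      inverse′ : ∀ z → z ≢ (0# , 0#) → z *q (conj z *q embed (norm z ⁻¹)) ≡ (1# , 0#)
      inverse′ z z≢0 = ≃⇒≡ (Q.trans (Q.sym (Q.*-assoc z (conj z) _)) (Q.trans (Q.*-congʳ (norm-conj z))
        (Q.trans (Q.sym (embed-* (norm z) (norm z ⁻¹))) (embed-cong (inverseʳ (norm z) (norm≢0 z (λ e → z≢0 (≃⇒≡ e))))))))

  quadraticField : FiniteField
  quadraticField = record
    { Carrier = Quad ; _+_ = _+q_ ; _*_ = _*q_ ; -_ = -q_ ; 0# = 0# , 0# ; 1# = 1# , 0#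
    ; isCommutativeRing = isCommutativeRing′
    ; _⁻¹ = λ z → conj z *q embed (norm z ⁻¹)
    ; inverseʳ = inverse′
    ; 0≢1 = λ e → 0≢1 (cong proj₁ e)
    ; _≟_ = ≡-dec _≟_ _≟_
    ; size = size ℕ.* size
    ; enum = ↔-sym *↔× ↔-∘ (enum ×-↔ enum) }

  inclusion : Hom fieldRing (FieldKit.fieldRing quadraticField)
  inclusion = record { φ = embed ; cong = cong embed
    ; +-hom = λ a b → ≃⇒≡ (embed-+ a b) ; *-hom = λ a b → ≃⇒≡ (embed-* a b) ; ⊖-hom = λ a → ≃⇒≡ (embed-⊖ a)
    ; 0-hom = refl ; 1-hom = refl }

  θ : Quad
  θ = root

  θ-equation : θ *q θ +q θ +q embed D ≡ (0# , 0#)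
  θ-equation = cong₂ _,_ (solve 1 (λ D → con 0 :* con 0 :+ one :* one :* :- D :+ con 0 :+ D := con 0) D)
    (solve 0 (con 0 :* one :+ one :* con 0 :- one :* one :* one :+ one :+ con 0 := con 0))

-- Changes of variables over a field extension are homomorphisms.

-- The map (X , Y) ↦ (v² X , v³ Y + s v² X + t) after a field homomorphism ι.
module CurveMap (F K : FiniteField) (ι : RingHom.Hom (FieldKit.fieldRing F) (FieldKit.fieldRing K)) (W : Weierstrass F)
  (v s t : FiniteField.Carrier K) (v≢0 : v ≢ FiniteField.0# K) where
  open RingHom
  open import Relation.Binary.PropositionalEquality

  open FiniteField K
  open FieldKit K
  open Weierstrass W using () renaming (a₁ to A₁; a₂ to A₂; a₃ to A₃; a₄ to A₄; a₆ to A₆)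
  open Hom ι hiding (cong)
  private
    module F = FiniteField F
    module FF = FieldKit F

  -- The standard transformation formulas without translation in x, solved for the coefficients of
  -- the target so that nothing is divided by v.
  c₁ c₂ c₃ c₄ c₆ : Carrier
  c₁ = v * φ A₁ - fromℕ 2 * s
  c₂ = v * v * φ A₂ + s * c₁ + s * s
  c₃ = v * v * v * φ A₃ - fromℕ 2 * t
  c₄ = v * v * v * v * φ A₄ + s * c₃ + t * c₁ + fromℕ 2 * s * t
  c₆ = v * v * v * v * v * v * φ A₆ + t * c₃ + t * t

  image : Weierstrass K
  image = weier c₁ c₂ c₃ c₄ c₆

  module S = Addition F W
  module T = Addition K image

  mapX : F.Carrier → Carrier
  mapX X = v * v * φ X

  mapY : F.Carrier → F.Carrier → Carrier
  mapY X Y = v * v * v * φ Y + s * (v * v) * φ X + t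

  mapPoint : S.Point → T.Point
  mapPoint nothing        = nothing
  mapPoint (just (X , Y)) = just (mapX X , mapY X Y)

  φ-injective : ∀ {x y} → φ x ≡ φ y → x ≡ y
  φ-injective {x} {y} e with x F.≟ y
  ... | yes h = h
  ... | no h  = contradiction (trans (sym 1-hom) (trans (sym (Hom.cong ι (F.inverseʳ (x F.- y) (FF.x-y≢0 h))))
      (trans (*-hom (x F.- y) _) (trans (cong (_* φ ((x F.- y) F.⁻¹)) (trans (+-hom x (F.- y)) (trans (cong (φ x +_) (⊖-hom y)) (x≈y⇒x-y≈0 e)))) (zeroˡ _)))))
      (λ z → 0≢1 (sym z))

  v²≢0 : v * v ≢ 0#
  v²≢0 = *≢0 v≢0 v≢0

  v³≢0 : v * v * v ≢ 0#
  v³≢0 = *≢0 v²≢0 v≢0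

  mapX-injective : ∀ {x y} → mapX x ≡ mapX y → x ≡ y
  mapX-injective {x} {y} e = φ-injective (*-cancelʳ v²≢0 (trans (*-comm _ _) (trans e (*-comm _ _))))

  mapPoint-injective : ∀ {P Q} → mapPoint P ≡ mapPoint Q → P ≡ Q
  mapPoint-injective {nothing} {nothing} _ = refl
  mapPoint-injective {just (x , y)} {just (x′ , y′)} e with mapX-injective (cong (x-of) e)
    where
    x-of : T.Point → Carrier
    x-of nothing        = 0#
    x-of (just (x , _)) = x
  ... | refl = cong (λ y → just (x , y)) (φ-injective (*-cancelʳ v³≢0 (linear₁ (solve 6 (λ v s t x y y′ →
      y :* (v :* v :* v) :- y′ :* (v :* v :* v) := one :* (v :* v :* v :* y :+ s :* (v :* v) :* x :+ t :- (v :* v :* v :* y′ :+ s :* (v :* v) :* x :+ t)))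
      v s t (φ x) (φ y) (φ y′)) (cong y-of e))))
    where
    y-of : T.Point → Carrier
    y-of nothing        = 0#
    y-of (just (_ , y)) = y

  map-on : ∀ P → S.On P → T.On (mapPoint P)
  map-on nothing _ = tt
  map-on (just (X , Y)) on = linear₁ (solve 10 (λ A₁ A₂ A₃ A₄ A₆ v s t X Y →
      let c₁ = v :* A₁ :- con 2 :* s in
      let c₂ = v :* v :* A₂ :+ s :* c₁ :+ s :* s in
      let c₃ = v :* v :* v :* A₃ :- con 2 :* t in
      let c₄ = v :* v :* v :* v :* A₄ :+ s :* c₃ :+ t :* c₁ :+ con 2 :* s :* t in
      let c₆ = v :* v :* v :* v :* v :* v :* A₆ :+ t :* c₃ :+ t :* t in
      let x = v :* v :* X in
      let y = v :* v :* v :* Y :+ s :* (v :* v) :* X :+ t in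
      y :* y :+ c₁ :* x :* y :+ c₃ :* y :- (x :* x :* x :+ c₂ :* x :* x :+ c₄ :* x :+ c₆)
      := v :* v :* v :* v :* v :* v :* (Y :* Y :+ A₁ :* X :* Y :+ A₃ :* Y :- (X :* X :* X :+ A₂ :* X :* X :+ A₄ :* X :+ A₆)))
      (φ A₁) (φ A₂) (φ A₃) (φ A₄) (φ A₆) v s t (φ X) (φ Y))
    (transfer 7 (λ A₁ A₂ A₃ A₄ A₆ X Y → Y :* Y :+ A₁ :* X :* Y :+ A₃ :* Y := X :* X :* X :+ A₂ :* X :* X :+ A₄ :* X :+ A₆) A₁ A₂ A₃ A₄ A₆ X Y on)

  private
    opposite-sum-maps : ∀ {x y y′} → y F.+ y′ F.+ A₁ F.* x F.+ A₃ ≡ F.0# → mapY x y + mapY x y′ + c₁ * mapX x + c₃ ≡ 0#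
    opposite-sum-maps {x} {y} {y′} e = linear₁ (solve 8 (λ A₁ A₃ v s t x y y′ →
        v :* v :* v :* y :+ s :* (v :* v) :* x :+ t :+ (v :* v :* v :* y′ :+ s :* (v :* v) :* x :+ t) :+ (v :* A₁ :- con 2 :* s) :* (v :* v :* x) :+ (v :* v :* v :* A₃ :- con 2 :* t) :- con 0
        := v :* v :* v :* (y :+ y′ :+ A₁ :* x :+ A₃ :- con 0)) (φ A₁) (φ A₃) v s t (φ x) (φ y) (φ y′))
      (transfer 5 (λ A₁ A₃ x y y′ → y :+ y′ :+ A₁ :* x :+ A₃ := con 0) A₁ A₃ x y y′ e)

    slope : F.Carrier → Carrier
    slope l = v * φ l + s

    double≢0 : ∀ {x y} → F.fromℕ 2 F.* y F.+ A₁ F.* x F.+ A₃ ≢ F.0# → fromℕ 2 * mapY x y + c₁ * mapX x + c₃ ≢ 0#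
    double≢0 {x} {y} d≢0 e = *≢0 v³≢0 (λ z → d≢0 (φ-injective (trans z (sym 0-hom)))) (trans (sym D≡) e)
      where
      D≡ : fromℕ 2 * mapY x y + c₁ * mapX x + c₃ ≡ v * v * v * φ (F.fromℕ 2 F.* y F.+ A₁ F.* x F.+ A₃)
      D≡ = trans (solve 7 (λ A₁ A₃ v s t x y →
          con 2 :* (v :* v :* v :* y :+ s :* (v :* v) :* x :+ t) :+ (v :* A₁ :- con 2 :* s) :* (v :* v :* x) :+ (v :* v :* v :* A₃ :- con 2 :* t)
          := v :* v :* v :* (con 2 :* y :+ A₁ :* x :+ A₃)) (φ A₁) (φ A₃) v s t (φ x) (φ y))
        (cong (v * v * v *_) (sym (push 4 (λ A₁ A₃ x y → con 2 :* y :+ A₁ :* x :+ A₃) A₁ A₃ x y)))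

    -- A line through the images of two points is the image of the line through the points.
    slope-determined : ∀ {x₁ y₁ x₂ y₂ l m l′ m′} → S.Line x₁ y₁ x₂ y₂ l m →
      x₁ ≢ x₂ ⊎ (x₁ ≡ x₂ × y₁ ≡ y₂ × F.fromℕ 2 F.* y₁ F.+ A₁ F.* x₁ F.+ A₃ ≢ F.0#) →
      T.Line (mapX x₁) (mapY x₁ y₁) (mapX x₂) (mapY x₂ y₂) l′ m′ → l′ ≡ slope l
    slope-determined {x₁} {y₁} {x₂} {y₂} {l} {m} {l′} {m′} L (inj₁ ne) L′ = *-cancelʳ (x-y≢0 (λ e → ne (mapX-injective e)))
      (linear₄ (solve 11 (λ v s t x₁ y₁ x₂ y₂ l m l′ m′ →
        let X₁ = v :* v :* x₁ in let X₂ = v :* v :* x₂ in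
        let Y₁ = v :* v :* v :* y₁ :+ s :* (v :* v) :* x₁ :+ t in let Y₂ = v :* v :* v :* y₂ :+ s :* (v :* v) :* x₂ :+ t in
        l′ :* (X₁ :- X₂) :- (v :* l :+ s) :* (X₁ :- X₂)
        := :- one :* (Y₁ :- (l′ :* X₁ :+ m′)) :+ one :* (Y₂ :- (l′ :* X₂ :+ m′))
          :+ v :* v :* v :* (y₁ :- (l :* x₁ :+ m)) :+ :- (v :* v :* v) :* (y₂ :- (l :* x₂ :+ m)))
        v s t (φ x₁) (φ y₁) (φ x₂) (φ y₂) (φ l) (φ m) l′ m′)
        (T.Line.thr₁ L′) (T.Line.thr₂ L′)
        (transfer 4 (λ x y l m → y := l :* x :+ m) x₁ y₁ l m (S.Line.thr₁ L)) (transfer 4 (λ x y l m → y := l :* x :+ m) x₂ y₂ l m (S.Line.thr₂ L)))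
    slope-determined {x} {y} {l = l} {l′ = l′} L (inj₂ (refl , refl , d≢0)) L′ = *-cancelʳ D≢0 (trans (T.tangent-slope L′) (sym (linear₁
      (solve 10 (λ A₁ A₂ A₃ A₄ v s t x y l →
        let c₁ = v :* A₁ :- con 2 :* s in
        let c₂ = v :* v :* A₂ :+ s :* c₁ :+ s :* s in
        let c₃ = v :* v :* v :* A₃ :- con 2 :* t in
        let c₄ = v :* v :* v :* v :* A₄ :+ s :* c₃ :+ t :* c₁ :+ con 2 :* s :* t in
        let X = v :* v :* x in let Y = v :* v :* v :* y :+ s :* (v :* v) :* x :+ t in
        (v :* l :+ s) :* (con 2 :* Y :+ c₁ :* X :+ c₃) :- (con 3 :* X :* X :+ con 2 :* c₂ :* X :+ c₄ :- c₁ :* Y)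
        := v :* v :* v :* v :* (l :* (con 2 :* y :+ A₁ :* x :+ A₃) :- (con 3 :* x :* x :+ con 2 :* A₂ :* x :+ A₄ :- A₁ :* y)))
        (φ A₁) (φ A₂) (φ A₃) (φ A₄) v s t (φ x) (φ y) (φ l))
      (transfer 7 (λ A₁ A₂ A₃ A₄ x y l → l :* (con 2 :* y :+ A₁ :* x :+ A₃) := con 3 :* x :* x :+ con 2 :* A₂ :* x :+ A₄ :- A₁ :* y)
        A₁ A₂ A₃ A₄ x y l (S.tangent-slope L)))))
      where
      D = fromℕ 2 * mapY x y + c₁ * mapX x + c₃
      D≢0 : D ≢ 0#
      D≢0 = double≢0 d≢0

    third-point : ∀ {x₁ y₁ x₂ y₂ l m m′} → S.Line x₁ y₁ x₂ y₂ l m → T.Line (mapX x₁) (mapY x₁ y₁) (mapX x₂) (mapY x₂ y₂) (slope l) m′ →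
      (let x₃ = l F.* l F.+ A₁ F.* l F.- A₂ F.- x₁ F.- x₂)
      (let X₃ = slope l * slope l + c₁ * slope l - c₂ - mapX x₁ - mapX x₂) →
      mapPoint (just (x₃ , F.- ((l F.+ A₁) F.* x₃) F.- m F.- A₃)) ≡ just (X₃ , - ((slope l + c₁) * X₃) - m′ - c₃)
    third-point {x₁} {y₁} {x₂} {y₂} {l} {m} {m′} L L′ = cong₂ (λ x y → just (x , y)) eqX eqY
      where
      x₃ = l F.* l F.+ A₁ F.* l F.- A₂ F.- x₁ F.- x₂
      φx₃ : φ x₃ ≡ φ l * φ l + φ A₁ * φ l - φ A₂ - φ x₁ - φ x₂
      φx₃ = push 5 (λ l A₁ A₂ x₁ x₂ → l :* l :+ A₁ :* l :- A₂ :- x₁ :- x₂) l A₁ A₂ x₁ x₂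
      eqX : mapX x₃ ≡ slope l * slope l + c₁ * slope l - c₂ - mapX x₁ - mapX x₂
      eqX = trans (cong (v * v *_) φx₃) (solve 7 (λ A₁ A₂ v s l x₁ x₂ →
          let c₁ = v :* A₁ :- con 2 :* s in let c₂ = v :* v :* A₂ :+ s :* c₁ :+ s :* s in
          v :* v :* (l :* l :+ A₁ :* l :- A₂ :- x₁ :- x₂)
          := (v :* l :+ s) :* (v :* l :+ s) :+ c₁ :* (v :* l :+ s) :- c₂ :- v :* v :* x₁ :- v :* v :* x₂) (φ A₁) (φ A₂) v s (φ l) (φ x₁) (φ x₂))
      m′≡ : m′ ≡ v * v * v * φ m + t
      m′≡ = linear₂ (solve 8 (λ v s t x₁ y₁ l m m′ → m′ :- (v :* v :* v :* m :+ t)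
          := :- one :* (v :* v :* v :* y₁ :+ s :* (v :* v) :* x₁ :+ t :- ((v :* l :+ s) :* (v :* v :* x₁) :+ m′))
            :+ v :* v :* v :* (y₁ :- (l :* x₁ :+ m))) v s t (φ x₁) (φ y₁) (φ l) (φ m) m′)
        (T.Line.thr₁ L′) (transfer 4 (λ x y l m → y := l :* x :+ m) x₁ y₁ l m (S.Line.thr₁ L))
      eqY : mapY x₃ (F.- ((l F.+ A₁) F.* x₃) F.- m F.- A₃) ≡ - ((slope l + c₁) * (slope l * slope l + c₁ * slope l - c₂ - mapX x₁ - mapX x₂)) - m′ - c₃
      eqY = trans (cong (λ z → v * v * v * z + s * (v * v) * φ x₃ + t) (push 5 (λ l A₁ x₃ m A₃ → :- ((l :+ A₁) :* x₃) :- m :- A₃) l A₁ x₃ m A₃))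
        (trans (solve 8 (λ A₁ A₃ v s t l m x₃ → let c₁ = v :* A₁ :- con 2 :* s in
            v :* v :* v :* (:- ((l :+ A₁) :* x₃) :- m :- A₃) :+ s :* (v :* v) :* x₃ :+ t
            := :- ((v :* l :+ s :+ c₁) :* (v :* v :* x₃)) :- (v :* v :* v :* m :+ t) :- (v :* v :* v :* A₃ :- con 2 :* t)) (φ A₁) (φ A₃) v s t (φ l) (φ m) (φ x₃))
          (cong₂ (λ X m → - ((slope l + c₁) * X) - m - c₃) eqX (sym m′≡)))

  private
    opposite-image : ∀ {x y y′ X Y Y′ R} → y F.+ y′ F.+ A₁ F.* x F.+ A₃ ≡ F.0# → T.AddView (just (X , Y)) (just (X , Y′)) R →
      X ≡ mapX x → Y ≡ mapY x y → Y′ ≡ mapY x y′ → nothing ≡ R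
    opposite-image e (T.opposite _) _ _ _ = refl
    opposite-image e (T.line _ _ _ (inj₁ ne)) _ _ _ = contradiction refl ne
    opposite-image {x} {y} {y′} e (T.line _ _ _ (inj₂ (_ , e′ , d≢0))) refl refl refl = contradiction
      (trans (solve 4 (λ c₁ c₃ x y → con 2 :* y :+ c₁ :* x :+ c₃ := y :+ y :+ c₁ :* x :+ c₃) c₁ c₃ (mapX x) (mapY x y))
        (trans (cong (λ z → mapY x y + z + c₁ * mapX x + c₃) e′) (opposite-sum-maps e))) d≢0

    line-image : ∀ {x₁ y₁ x₂ y₂ l m X₁ Y₁ X₂ Y₂ R} → S.Line x₁ y₁ x₂ y₂ l m →
      x₁ ≢ x₂ ⊎ (x₁ ≡ x₂ × y₁ ≡ y₂ × F.fromℕ 2 F.* y₁ F.+ A₁ F.* x₁ F.+ A₃ ≢ F.0#) →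
      T.AddView (just (X₁ , Y₁)) (just (X₂ , Y₂)) R → X₁ ≡ mapX x₁ → Y₁ ≡ mapY x₁ y₁ → X₂ ≡ mapX x₂ → Y₂ ≡ mapY x₂ y₂ →
      (let x₃ = l F.* l F.+ A₁ F.* l F.- A₂ F.- x₁ F.- x₂) →
      mapPoint (just (x₃ , F.- ((l F.+ A₁) F.* x₃) F.- m F.- A₃)) ≡ R
    line-image L (inj₁ ne) (T.opposite _) eX₁ _ eX₂ _ = contradiction (mapX-injective (trans (sym eX₁) eX₂)) ne
    line-image {x₁} {y₁} L (inj₂ (refl , refl , d≢0)) (T.opposite e) refl refl _ refl = contradiction
      (trans (solve 4 (λ c₁ c₃ x y → con 2 :* y :+ c₁ :* x :+ c₃ := y :+ y :+ c₁ :* x :+ c₃) c₁ c₃ (mapX x₁) (mapY x₁ y₁)) e) (double≢0 d≢0)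
    line-image L distinct (T.line l′ m′ L′ _) refl refl refl refl with slope-determined L distinct L′
    ... | refl = third-point L L′

  abstract
    map-⊞ : ∀ P Q → S.On P → S.On Q → mapPoint (P S.⊞ Q) ≡ mapPoint P T.⊞ mapPoint Q
    map-⊞ P Q p q = go (S.addView P Q p q) p q
      where
      go : ∀ {P Q R} → S.AddView P Q R → S.On P → S.On Q → mapPoint R ≡ mapPoint P T.⊞ mapPoint Q
      go (S.O+ Q) _ _ = refl
      go (p S.+O) _ _ = refl
      go (S.opposite {x} {y} {y′} e) p q = opposite-image e (T.addView _ _ (map-on (just (x , y)) p) (map-on (just (x , y′)) q)) refl refl refl
      go (S.line {x₁} {y₁} {x₂} {y₂} l m L distinct) p q =
        line-image L distinct (T.addView _ _ (map-on (just (x₁ , y₁)) p) (map-on (just (x₂ , y₂)) q)) refl refl refl refl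

-- The curve and its twist become one curve over the quadratic extension.

module TwistMap (F : FiniteField) (W : Weierstrass F) (nonsing : disc F W ≢ FiniteField.0# F)
  (D : FiniteField.Carrier F) (param : TwistParam F D) where
  open import Relation.Binary.PropositionalEquality

  open RingHom
  module QF = QuadraticField F D param
  module TC = TwistCount F W D param

  K : FiniteField
  K = QF.quadraticField

  private
    module F = FiniteField F
    module FF = FieldKit F
  open FiniteField K
  open FieldKit K
  open Weierstrass W
  open QF using (inclusion; θ; θ-equation)
  open Hom inclusion hiding (cong)

  module M₁ = CurveMap F K inclusion W 1# 0# 0# (λ e → 0≢1 (sym e))

  Wᴷ : Weierstrass K
  Wᴷ = M₁.image

  private
    module U = Addition K Wᴷ

  W″ : Weierstrass F
  W″ = weier (a₁ F.* TC.i) (a₂ F.* TC.i F.- D F.* a₁ F.* a₁ F.* (TC.i F.* TC.i)) (a₃ F.* (TC.i F.* TC.i))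
    (a₄ F.* (TC.i F.* TC.i) F.- F.fromℕ 2 F.* D F.* a₁ F.* a₃ F.* (TC.i F.* TC.i F.* TC.i))
    (a₆ F.* (TC.i F.* TC.i F.* TC.i) F.- D F.* a₃ F.* a₃ F.* (TC.i F.* TC.i F.* TC.i F.* TC.i))

  -- v² = 4(θ² + θ) + 1 = 1 - 4D = u, so v I = 1/v. Matching the first coefficient asks for 2s = a₁
  -- (1 - v)/v; since 1 - v = -2θ, the value s = -θ a₁ / v is available in characteristic two as
  -- well. The same holds for t with a₃.
  I v s t : Carrier
  I = φ TC.i
  v = fromℕ 2 * θ + 1#
  s = - (θ * φ a₁ * (v * I))
  t = - (θ * φ a₃ * (v * I))

  private
    abstract
      θ-eq : θ * θ + θ + φ D ≡ 0#
      θ-eq = θ-equation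

      uI : I * (1# - fromℕ 4 * φ D) ≡ 1#
      uI = trans (cong (I *_) (sym (push 1 (λ D → one :- con 4 :* D) D))) (trans (sym (*-hom TC.i TC.u)) (trans (cong φ TC.iu) 1-hom))

      v²I : v * v * I ≡ 1#
      v²I = linear₂ (solve 3 (λ θ D I → (con 2 :* θ :+ one) :* (con 2 :* θ :+ one) :* I :- one
        := con 4 :* I :* (θ :* θ :+ θ :+ D :- con 0) :+ one :* (I :* (one :- con 4 :* D) :- one)) θ (φ D) I) θ-eq uI

  v≢0 : v ≢ 0#
  v≢0 e = 0≢1 (trans (sym (trans (cong (λ z → z * v * I) e) (trans (cong (_* I) (zeroˡ v)) (zeroˡ I)))) v²I)

  module M₂ = CurveMap F K inclusion W″ v s t v≢0

  private
    module _ where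
      c₁≡ : M₁.c₁ ≡ φ a₁
      c₁≡ = solve 1 (λ a → one :* a :- con 2 :* con 0 := a) (φ a₁)
      c₂≡ : M₁.c₂ ≡ φ a₂
      c₂≡ = solve 2 (λ a c → one :* one :* a :+ con 0 :* c :+ con 0 :* con 0 := a) (φ a₂) M₁.c₁
      c₃≡ : M₁.c₃ ≡ φ a₃
      c₃≡ = solve 1 (λ a → one :* one :* one :* a :- con 2 :* con 0 := a) (φ a₃)
      c₄≡ : M₁.c₄ ≡ φ a₄
      c₄≡ = solve 3 (λ a c d → one :* one :* one :* one :* a :+ con 0 :* c :+ con 0 :* d :+ con 2 :* con 0 :* con 0 := a) (φ a₄) M₁.c₃ M₁.c₁
      c₆≡ : M₁.c₆ ≡ φ a₆
      c₆≡ = solve 2 (λ a c → one :* one :* one :* one :* one :* one :* a :+ con 0 :* c :+ con 0 :* con 0 := a) (φ a₆) M₁.c₃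

    base-coefficients : Wᴷ ≡ weier (φ a₁) (φ a₂) (φ a₃) (φ a₄) (φ a₆)
    base-coefficients = trans (cong₂ (λ x y → weier x y M₁.c₃ M₁.c₄ M₁.c₆) c₁≡ c₂≡)
      (trans (cong₂ (λ x y → weier (φ a₁) (φ a₂) x y M₁.c₆) c₃≡ c₄≡) (cong (weier (φ a₁) (φ a₂) (φ a₃) (φ a₄)) c₆≡))

    d₁≡ : M₂.c₁ ≡ φ a₁
    d₁≡ = trans (cong (λ z → v * z - fromℕ 2 * s) (*-hom a₁ TC.i)) (linear₁ (solve 3 (λ a₁ θ I → let v = con 2 :* θ :+ one in
      v :* (a₁ :* I) :- con 2 :* :- (θ :* a₁ :* (v :* I)) :- a₁ := a₁ :* (v :* v :* I :- one)) (φ a₁) θ I) v²I)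

    d₂≡ : M₂.c₂ ≡ φ a₂
    d₂≡ = trans (cong₂ (λ z c → v * v * z + s * c + s * s) (push 4 (λ a₁ a₂ D i → a₂ :* i :- D :* a₁ :* a₁ :* (i :* i)) a₁ a₂ D TC.i) d₁≡)
      (linear₂ (solve 5 (λ a₁ a₂ D θ I → let v = con 2 :* θ :+ one in let s = :- (θ :* a₁ :* (v :* I)) in
        v :* v :* (a₂ :* I :- D :* a₁ :* a₁ :* (I :* I)) :+ s :* a₁ :+ s :* s :- a₂
        := (a₂ :+ a₁ :* a₁ :* I :* (θ :* θ :- D)) :* (v :* v :* I :- one) :+ :- (a₁ :* a₁ :* I) :* (θ :* θ :+ θ :+ D :- con 0)) (φ a₁) (φ a₂) (φ D) θ I) v²I θ-eq)

    d₃≡ : M₂.c₃ ≡ φ a₃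
    d₃≡ = trans (cong (λ z → v * v * v * z - fromℕ 2 * t) (push 2 (λ a₃ i → a₃ :* (i :* i)) a₃ TC.i)) (linear₁ (solve 3 (λ a₃ θ I → let v = con 2 :* θ :+ one in
      v :* v :* v :* (a₃ :* (I :* I)) :- con 2 :* :- (θ :* a₃ :* (v :* I)) :- a₃ := (a₃ :* (one :+ v :* I)) :* (v :* v :* I :- one)) (φ a₃) θ I) v²I)

    d₄≡ : M₂.c₄ ≡ φ a₄
    d₄≡ = trans (cong (λ z → v * v * v * v * z + s * M₂.c₃ + t * M₂.c₁ + fromℕ 2 * s * t)
        (push 5 (λ a₁ a₃ a₄ D i → a₄ :* (i :* i) :- con 2 :* D :* a₁ :* a₃ :* (i :* i :* i)) a₁ a₃ a₄ D TC.i))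
      (trans (cong₂ (λ c₃ c₁ → v * v * v * v * (φ a₄ * (I * I) - fromℕ 2 * φ D * φ a₁ * φ a₃ * (I * I * I)) + s * c₃ + t * c₁ + fromℕ 2 * s * t) d₃≡ d₁≡)
      (linear₂ (solve 6 (λ a₁ a₃ a₄ D θ I → let v = con 2 :* θ :+ one in let s = :- (θ :* a₁ :* (v :* I)) in let t = :- (θ :* a₃ :* (v :* I)) in
        v :* v :* v :* v :* (a₄ :* (I :* I) :- con 2 :* D :* a₁ :* a₃ :* (I :* I :* I)) :+ s :* a₃ :+ t :* a₁ :+ con 2 :* s :* t :- a₄
        := (a₄ :* (v :* v :* I :+ one) :- con 2 :* D :* a₁ :* a₃ :* I :* (v :* v :* I :+ one) :+ con 2 :* θ :* θ :* a₁ :* a₃ :* I) :* (v :* v :* I :- one)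
          :+ :- (con 2 :* a₁ :* a₃ :* I) :* (θ :* θ :+ θ :+ D :- con 0)) (φ a₁) (φ a₃) (φ a₄) (φ D) θ I) v²I θ-eq))

    d₆≡ : M₂.c₆ ≡ φ a₆
    d₆≡ = trans (cong₂ (λ z c → v * v * v * v * v * v * z + t * c + t * t)
        (push 4 (λ a₃ a₆ D i → a₆ :* (i :* i :* i) :- D :* a₃ :* a₃ :* (i :* i :* i :* i)) a₃ a₆ D TC.i) d₃≡)
      (linear₂ (solve 5 (λ a₃ a₆ D θ I → let v = con 2 :* θ :+ one in let t = :- (θ :* a₃ :* (v :* I)) in
        let k = v :* v :* I :* (v :* v :* I) :+ v :* v :* I :+ one in
        v :* v :* v :* v :* v :* v :* (a₆ :* (I :* I :* I) :- D :* a₃ :* a₃ :* (I :* I :* I :* I)) :+ t :* a₃ :+ t :* t :- a₆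
        := (a₆ :* k :- D :* a₃ :* a₃ :* I :* k :+ θ :* θ :* a₃ :* a₃ :* I) :* (v :* v :* I :- one) :+ :- (a₃ :* a₃ :* I) :* (θ :* θ :+ θ :+ D :- con 0))
        (φ a₃) (φ a₆) (φ D) θ I) v²I θ-eq)

  abstract
    same-curve : M₂.image ≡ Wᴷ
    same-curve = trans (trans (cong₂ (λ x y → weier x y M₂.c₃ M₂.c₄ M₂.c₆) d₁≡ d₂≡)
      (trans (cong₂ (λ x y → weier (φ a₁) (φ a₂) x y M₂.c₆) d₃≡ d₄≡) (cong (weier (φ a₁) (φ a₂) (φ a₃) (φ a₄)) d₆≡))) (sym base-coefficients)

    nonsingᴷ : disc K Wᴷ ≢ 0#
    nonsingᴷ e = nonsing (M₁.φ-injective (trans (push 5 (λ a₁ a₂ a₃ a₄ a₆ →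
        let b₂ = a₁ :* a₁ :+ con 4 :* a₂ in
        let b₄ = con 2 :* a₄ :+ a₁ :* a₃ in
        let b₆ = a₃ :* a₃ :+ con 4 :* a₆ in
        let b₈ = a₁ :* a₁ :* a₆ :+ con 4 :* a₂ :* a₆ :- a₁ :* a₃ :* a₄ :+ a₂ :* a₃ :* a₃ :- a₄ :* a₄ in
        (:- (b₂ :* b₂ :* b₈)) :- con 8 :* b₄ :* b₄ :* b₄ :- con 27 :* b₆ :* b₆ :+ con 9 :* b₂ :* b₄ :* b₆) a₁ a₂ a₃ a₄ a₆)
      (trans (sym (cong (disc K) base-coefficients)) (trans e (sym 0-hom)))))

  private
    module Q = CommutativeRing (FieldKit.fieldRing K)
    conjᴷ : Hom (FieldKit.fieldRing K) (FieldKit.fieldRing K)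
    conjᴷ = record { φ = conj ; cong = cong conj
      ; +-hom = λ x y → QF.≃⇒≡ (Hom.+-hom conjHom x y) ; *-hom = λ x y → QF.≃⇒≡ (Hom.*-hom conjHom x y) ; ⊖-hom = λ x → QF.≃⇒≡ (Hom.⊖-hom conjHom x)
      ; 0-hom = QF.≃⇒≡ (Hom.0-hom conjHom) ; 1-hom = QF.≃⇒≡ (Hom.1-hom conjHom) }
      where open Quadratic FF.fieldRing F.1# (F.- D) using (conj; conjHom)
    module σ = Hom conjᴷ

    σ-φ : ∀ a → σ.φ (φ a) ≡ φ a
    σ-φ a = cong₂ _,_ (FF.solve 1 (λ a → a FF.:- FF.con 0 FF.:* FF.one FF.:= a) a) (FF.solve 0 (FF.:- FF.con 0 FF.:= FF.con 0))

    σ-θ : σ.φ θ ≡ - 1# - θ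
    σ-θ = cong₂ _,_ (FF.solve 0 (FF.con 0 FF.:- FF.one FF.:* FF.one FF.:= FF.:- FF.one FF.:- FF.con 0)) (FF.solve 0 (FF.:- FF.one FF.:= FF.:- FF.con 0 FF.:- FF.one))

  -- Conjugation fixes the points of E and acts as −1 on the points of the twist.
  private
    common-point′′ : ∀ {x y X Y} → M₁.mapPoint (just (x , y)) ≡ M₂.mapPoint (just (X , Y)) →
      (let y′ = M₁.mapY x y) → y′ + y′ + M₁.c₁ * M₁.mapX x + M₁.c₃ ≡ 0#
    common-point′′ {x} {y} {X} {Y} e = trans (cong₂ (λ c₁ c₃ → y′ + y′ + c₁ * M₁.mapX x + c₃) c₁≡ c₃≡)
      (trans (cong₂ (λ z w → z + w + φ a₁ * M₁.mapX x + φ a₃) y≡ y≡′) (trans (cong (λ z → M₂.mapY X Y + conjugate + φ a₁ * z + φ a₃) x≡) anti))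
      where
      y′ : Carrier
      y′ = M₁.mapY x y
      x-of y-of : RawPoint K → Carrier
      x-of nothing        = 0#
      x-of (just (x , _)) = x
      y-of nothing        = 0#
      y-of (just (_ , y)) = y
      x≡ : M₁.mapX x ≡ M₂.mapX X
      x≡ = cong x-of e
      y≡ : y′ ≡ M₂.mapY X Y
      y≡ = cong y-of e
      yE : ∀ {n} → Expr n → Expr n → Expr n → Expr n → Expr n → Expr n → Expr n
      yE θ I a₁ a₃ X Y = let v = con 2 :* θ :+ one in
        v :* v :* v :* Y :+ :- (θ :* a₁ :* (v :* I)) :* (v :* v) :* X :+ :- (θ :* a₃ :* (v :* I))
      fixed : σ.φ y′ ≡ y′
      fixed = trans (cong σ.φ y-scalar) (trans (σ-φ y) (sym y-scalar))
        where
        y-scalar : y′ ≡ φ y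
        y-scalar = solve 2 (λ x y → one :* one :* one :* y :+ con 0 :* (one :* one) :* x :+ con 0 := y) (φ x) (φ y)
      conjugate : Carrier
      conjugate = let θ = - 1# - θ in let v = fromℕ 2 * θ + 1# in v * v * v * φ Y + - (θ * φ a₁ * (v * I)) * (v * v) * φ X + - (θ * φ a₃ * (v * I))
      σ-y : σ.φ (M₂.mapY X Y) ≡ conjugate
      σ-y = trans (σ.push 6 yE θ I (φ a₁) (φ a₃) (φ X) (φ Y))
        (trans (cong₂ (λ θ I → expr θ I (σ.φ (φ a₁)) (σ.φ (φ a₃)) (σ.φ (φ X)) (σ.φ (φ Y))) σ-θ (σ-φ TC.i))
        (trans (cong₂ (λ a₁ a₃ → expr (- 1# - θ) I a₁ a₃ (σ.φ (φ X)) (σ.φ (φ Y))) (σ-φ a₁) (σ-φ a₃))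
          (cong₂ (expr (- 1# - θ) I (φ a₁) (φ a₃)) (σ-φ X) (σ-φ Y))))
        where
        expr : (θ I a₁ a₃ X Y : Carrier) → Carrier
        expr θ I a₁ a₃ X Y = let v = fromℕ 2 * θ + 1# in v * v * v * Y + - (θ * a₁ * (v * I)) * (v * v) * X + - (θ * a₃ * (v * I))
      y≡′ : y′ ≡ conjugate
      y≡′ = trans (sym fixed) (trans (cong σ.φ y≡) σ-y)
      anti : M₂.mapY X Y + conjugate + φ a₁ * M₂.mapX X + φ a₃ ≡ 0#
      anti = linear₁ (solve 6 (λ θ I a₁ a₃ X Y → let v = con 2 :* θ :+ one in
          yE θ I a₁ a₃ X Y :+ yE (:- one :- θ) I a₁ a₃ X Y :+ a₁ :* (v :* v :* X) :+ a₃ :- con 0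
          := :- (a₁ :* (v :* v :* X) :+ a₃) :* (v :* v :* I :- one)) θ I (φ a₁) (φ a₃) (φ X) (φ Y)) v²I

  abstract
    common-point : ∀ {x y X Y} → M₁.mapPoint (just (x , y)) ≡ M₂.mapPoint (just (X , Y)) →
      (let y′ = M₁.mapY x y) → y′ + y′ + M₁.c₁ * M₁.mapX x + M₁.c₃ ≡ 0#
    common-point = common-point′′

-- Both groups of rational points inside the group over the extension.

module TwistGroups (F : FiniteField) (W W′ : Weierstrass F) (nonsing : disc F W ≢ FiniteField.0# F) (nonsing′ : disc F W′ ≢ FiniteField.0# F)
  (D : FiniteField.Carrier F) (param : TwistParam F D) (W′≡ : W′ ≡ twistEqn F D W) where
  open import Relation.Binary.PropositionalEquality

  open TwistMap F W nonsing D param using (K; Wᴷ; W″; nonsingᴷ; module M₁; module M₂; module TC; same-curve; common-point; module QF)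
  open FiniteField K using (0#; _≟_)
  open FieldKit K using (con)
  open RingHom
  open Hom QF.inclusion using (φ; 0-hom; push)
  open Compatible using (Compatible)
  open import Data.List using (List; map; length)
  open import Data.Maybe.Properties using () renaming (≡-dec to Maybe-≡-dec)
  open import Data.Nat as ℕ using (ℕ; zero; suc)
  open import Data.Nat.DivMod using (_%_)
  open import Data.Product.Properties using () renaming (≡-dec to ×-≡-dec)
  open Lists using (unique-map)

  private
    module G = GroupLaw K Wᴷ nonsingᴷ

    _≟ᴾ_ : DecidableEquality (RawPoint K)
    _≟ᴾ_ = Maybe-≡-dec (×-≡-dec _≟_ _≟_)

    module Tors = Torsion K Wᴷ nonsingᴷ

  open PairCompatible G.On G._⊞_ nothing G.⊞-on tt G.⊞-assoc G.⊞-comm (λ _ → refl) G.⊟_ G.⊟-on (λ P _ → G.⊞-inverse P) _≟ᴾ_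

  -- Bundled with both curves as parameters, so that it can be transported along the equalities
  -- identifying the twist with its explicit equation and the two image curves with each other.
  record Embedding (f : RawPoint F → RawPoint K) (W₀ : Weierstrass F) (W₁ : Weierstrass K) : Set where
    private
      module S = Addition F W₀
      module T = Addition K W₁
    field
      zero-map  : f nothing ≡ nothing
      injective : ∀ {P Q} → f P ≡ f Q → P ≡ Q
      on        : ∀ P → S.On P → T.On (f P)
      hom       : ∀ P Q → S.On P → S.On Q → f (P S.⊞ Q) ≡ f P T.⊞ f Q

  base-change : Embedding M₁.mapPoint W Wᴷ
  base-change = record { zero-map = refl ; injective = M₁.mapPoint-injective ; on = M₁.map-on ; hom = M₁.map-⊞ }

  untwist : Embedding M₂.mapPoint W′ Wᴷ
  untwist = subst₂ (Embedding M₂.mapPoint) (sym (trans W′≡ TC.twist-coefficients)) same-curve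
    (record { zero-map = refl ; injective = M₂.mapPoint-injective ; on = M₂.map-on ; hom = M₂.map-⊞ })

  module Image {f W₀} (nonsing₀ : disc F W₀ ≢ FiniteField.0# F) (emb : Embedding f W₀ Wᴷ) where
    open Embedding emb
    private
      module A = GroupLaw F W₀ nonsing₀
      module E = Exponent F W₀ nonsing₀
      open Points F W₀ using (points-sound; points-complete; points-unique)

    image : List (RawPoint K)
    image = map f (points F W₀)

    private
      f-inverse : ∀ P → A.On P → f (A.⊟ P) ≡ G.⊟ f P
      f-inverse P p = cancelˡ (f P) _ _ (on P p) (on (A.⊟ P) (A.⊟-on P p)) (G.⊟-on (f P) (on P p))
        (trans (sym (hom P (A.⊟ P) p (A.⊟-on P p))) (trans (cong f (A.⊞-inverse P)) (trans zero-map (sym (G.⊞-inverse (f P))))))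

      f-pow : ∀ n P → A.On P → f (E.G.pow n P) ≡ pow n (f P)
      f-pow zero    P p = zero-map
      f-pow (suc n) P p = trans (hom P (E.G.pow n P) p (E.G.pow∈ n p)) (cong (f P G.⊞_) (f-pow n P p))

      f-sum : ∀ {Q R} → Q ∈ image → R ∈ image → Q G.⊞ R ∈ image
      f-sum i j with ∈-map⁻ f i | ∈-map⁻ f j
      ... | P , P∈ , refl | P′ , P′∈ , refl = subst (_∈ image) (hom P P′ (points-sound P∈) (points-sound P′∈))
        (∈-map⁺ f (points-complete (A.⊞-on P P′ (points-sound P∈) (points-sound P′∈))))

      f-neg : ∀ {Q} → Q ∈ image → G.⊟ Q ∈ image
      f-neg i with ∈-map⁻ f i
      ... | P , P∈ , refl = subst (_∈ image) (f-inverse P (points-sound P∈)) (∈-map⁺ f (points-complete (A.⊟-on P (points-sound P∈))))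

      f-on : ∀ {Q} → Q ∈ image → G.On Q
      f-on i with ∈-map⁻ f i
      ... | P , P∈ , refl = on P (points-sound P∈)

    subgroup : Subgroup image
    subgroup = record
      { unique = unique-map (λ _ _ → injective) points-unique ; sound = f-on ; ∙∈ = f-sum ; inv∈H = f-neg
      ; ε∈H = subst (_∈ image) zero-map (∈-map⁺ f (points-complete tt)) }

    killed : ∀ {m} → E.λE ≡ m → ∀ {Q} → Q ∈ image → Kills m Q
    killed {m} e {Q} i = let (P , P∈ , Q≡) = ∈-map⁻ f i in subst₂ Kills e (sym Q≡) (kills P (points-sound P∈))
      where
      kills : ∀ P → A.On P → Kills E.λE (f P)
      kills P p = on P p , trans (sym (f-pow E.λE P p)) (trans (cong f (E.exponent-kills p)) zero-map)

  private
    module I = Image nonsing base-change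
    module I′ = Image nonsing′ untwist

    common : ∀ {Q} → Q ∈ I.image → Q ∈ I′.image → Kills 2 Q
    common i i′ with ∈-map⁻ M₁.mapPoint i | ∈-map⁻ M₂.mapPoint i′
    ... | nothing , _ , refl | _ = tt , refl
    ... | just _ , P∈ , refl | nothing , _ , ()
    ... | just (x , y) , P∈ , refl | just (X , Y) , _ , e = Subgroup.sound I.subgroup i ,
      trans (cong (Q G.⊞_) (identityʳ Q (Subgroup.sound I.subgroup i))) (G.opposite-sum (common-point e))
      where
      Q : RawPoint K
      Q = M₁.mapPoint (just (x , y))

    even-torsion : FiniteField.size F % 2 ≡ 0 → FiniteField.fromℕ K 2 ≡ 0#
    even-torsion e = trans (sym (push 0 (con 2))) (trans (cong φ (EvenSize.even⇒2≡0 F e)) 0-hom)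

  -- Both orientations are provided, because `order-unique` wants the group of order at most q + 1
  -- in first place and either one may be it.
  compatible-orders : ∀ {m n} → exponent F (ell W nonsing) ≡ suc m → exponent F (ell W′ nonsing′) ≡ suc n →
    Compatible (FiniteField.size F) (length (points F W)) (length (points F W′)) (suc m) (suc n)
      × Compatible (FiniteField.size F) (length (points F W′)) (length (points F W)) (suc n) (suc m)
  compatible-orders {m} {n} M≡ N≡ =
      subst₂ (λ A B → Compatible q A B (suc m) (suc n)) len len′ (compatible Tors.torsion-bound I.subgroup I′.subgroup common (I.killed M≡) (I′.killed N≡) two)
    , subst₂ (λ A B → Compatible q A B (suc n) (suc m)) len′ len (compatible Tors.torsion-bound I′.subgroup I.subgroup (λ i i′ → common i′ i) (I′.killed N≡) (I.killed M≡) two)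
    where
    q = FiniteField.size F
    len = length-map M₁.mapPoint (points F W)
    len′ = length-map M₂.mapPoint (points F W′)
    two : q % 2 ≡ 0 → ∀ {zs} → _ → (∀ {z} → z ∈ zs → Kills 2 z) → length zs ℕ.≤ 2
    two e = CharTwo.two-torsion≤2 K Wᴷ nonsingᴷ (even-torsion e)

open import Data.Nat using (ℕ)
open import Data.Integer using (ℤ; +_; _+_; _-_; _*_; _≤_)
open import Data.Integer.Divisibility using (_∣_)
open import Data.List using (List; _∷_; [])
open import Relation.Binary.PropositionalEquality using (_≡_)

open Numerics using (exceptional; distance)
open Compatible using (Compatible; order-unique; positive-divisor)
import Data.Integer as ℤ
import Data.Integer.Properties as ℤ
import Data.List as List
import Data.Nat as ℕ
import Data.Nat.Divisibility as ℕ
import Data.Nat.Properties as ℕ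
open import Data.Nat.Tactic.RingSolver using (solve-∀)
open import Relation.Binary.PropositionalEquality using (refl; sym; trans; cong; subst; _≢_)

-- Existence and uniqueness of the trace.

module _ (F : FiniteField) (W W′ : Weierstrass F) (nonsing : disc F W ≢ FiniteField.0# F) (nonsing′ : disc F W′ ≢ FiniteField.0# F)
  (D : FiniteField.Carrier F) (param : TwistParam F D) (W′≡ : W′ ≡ twistEqn F D W) (q∉ : FiniteField.size F ∉ exceptional) where

  private
    q N N′ M M′ : ℕ
    q  = FiniteField.size F
    N  = List.length (points F W)
    N′ = List.length (points F W′)
    M  = exponent F (ell W nonsing)
    M′ = exponent F (ell W′ nonsing′)

  M∣N : M ℕ.∣ N
  M∣N = Exponent.exponent∣N F W nonsing

  M′∣N′ : M′ ℕ.∣ N′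
  M′∣N′ = Exponent.exponent∣N F W′ nonsing′

  N+N′ : N ℕ.+ N′ ≡ ℕ.suc q ℕ.+ ℕ.suc q
  N+N′ = trans (cong (λ W → N ℕ.+ List.length (points F W)) W′≡) (trans (TwistCount.points-sum F W D param) (arith q))
    where
    arith : ∀ q → q ℕ.+ 1 ℕ.+ (q ℕ.+ 1) ≡ ℕ.suc q ℕ.+ ℕ.suc q
    arith = solve-∀

  -- The absolute value x of the trace, with A the order that does not exceed q + 1.
  Defect : ℕ → ℕ → Set
  Defect A B = ∃ λ x → A ℕ.+ x ≡ ℕ.suc q × B ≡ ℕ.suc q ℕ.+ x × x ℕ.* x ℕ.≤ 4 ℕ.* q

  private
    complement : ∀ {A B s x} → A ℕ.+ x ≡ s → A ℕ.+ B ≡ s ℕ.+ s → B ≡ s ℕ.+ x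
    complement {A} {B} {_} {x} refl e = ℕ.+-cancelˡ-≡ A B _ (trans e (shuffle A x))
      where
      shuffle : ∀ A x → A ℕ.+ x ℕ.+ (A ℕ.+ x) ≡ A ℕ.+ (A ℕ.+ x ℕ.+ x)
      shuffle = solve-∀

    below : ∀ {A s} → A ℕ.≤ s → ∃ λ x → A ℕ.+ x ≡ s
    below {A} {s} h = s ℕ.∸ A , ℕ.m+[n∸m]≡n h

    smaller : ∀ {A B s} → A ℕ.+ B ≡ s ℕ.+ s → A ℕ.≤ s ⊎ B ℕ.≤ s
    smaller {A} {B} {s} e with ℕ.≤-total A s
    ... | inj₁ h = inj₁ h
    ... | inj₂ h = inj₂ (ℕ.+-cancelˡ-≤ s B s (ℕ.≤-trans (ℕ.+-monoˡ-≤ B h) (ℕ.≤-reflexive e)))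

    length≡ : N ≡ ℕ.suc _
    length≡ = Points.length-points F W

    length′≡ : N′ ≡ ℕ.suc _
    length′≡ = trans (cong (λ W → List.length (points F W)) W′≡) (TwistCount.length-points-twist F W D param)

    module H = Hasse F W nonsing
    open Heights F W nonsing using (hasse; Adjacent)

  -- The orders add up to 2(q + 1), so one of them is at most q + 1 and has a natural trace. The
  -- degree of x(ΦP - P) serves if it is `N`, that of x(ΦP + P) if it is `N′`.
  defect : Defect N N′ ⊎ Defect N′ N
  defect with smaller {N} {N′} N+N′
  ... | inj₁ h = inj₁ (let (x , e) = below h in x , e , complement {N} e N+N′ , hasse (subst (Adjacent q) (sym length≡) H.adjacent-minus) e)
  ... | inj₂ h = inj₂ (let (x , e) = below h in x , e , complement {N′} e (trans (ℕ.+-comm N′ N) N+N′) , hasse (subst (Adjacent q) (sym length′≡) H.adjacent-plus) e)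

  private
    1<q : 1 ℕ.< q
    1<q = EvenSize.1<size F

  open Traces q

  trace : Defect N N′ ⊎ Defect N′ N → ∃ λ t → t * t ≤ + 4 * + q × Trace t N N′
  trace (inj₁ (x , e , e′ , h)) = + x , subst (_ ≤_) (ℤ.pos-* 4 q) (square⁺ {x} h) , subst (Trace (+ x) N) (sym e′) (trace⁺ e)
  trace (inj₂ (x , e , e′ , h)) = ℤ.- (+ x) , subst (_ ≤_) (ℤ.pos-* 4 q) (square⁻ {x} h) , subst (λ A → Trace (ℤ.- (+ x)) A N′) (sym e′) (trace⁻ e)

  trace-divides : ∀ {t A B} → Trace t A B → M ℕ.∣ A → M′ ℕ.∣ B → + M ∣ (+ q + + 1 - t) × + M′ ∣ (+ q + + 1 + t)
  trace-divides τ h h′ = subst (+ M ∣_) (sym (Trace.first τ)) h , subst (+ M′ ∣_) (sym (Trace.second τ)) h′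

  divides-trace : ∀ {t A B} → Trace t A B → + M ∣ (+ q + + 1 - t) → + M′ ∣ (+ q + + 1 + t) → M ℕ.∣ A × M′ ℕ.∣ B
  divides-trace τ h h′ = subst (+ M ∣_) (Trace.first τ) h , subst (+ M′ ∣_) (Trace.second τ) h′

  -- If the smaller order is `N′`, it is B that gets identified, and A follows from the common sum.
  orders-unique : ∀ {A B} → A ℕ.+ B ≡ ℕ.suc q ℕ.+ ℕ.suc q →
    distance A (ℕ.suc q) ℕ.* distance A (ℕ.suc q) ℕ.≤ 4 ℕ.* q → distance B (ℕ.suc q) ℕ.* distance B (ℕ.suc q) ℕ.≤ 4 ℕ.* q →
    M ℕ.∣ A → M′ ℕ.∣ B → A ≡ N
  orders-unique {A} {B} A+B dA dB MA M′B = go (positive-divisor (subst (M ℕ.∣_) length≡ M∣N)) (positive-divisor (subst (M′ ℕ.∣_) length′≡ M′∣N′))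
    where
    go : (∃ λ m → M ≡ ℕ.suc m) → (∃ λ n → M′ ≡ ℕ.suc n) → A ≡ N
    go (m , M≡) (n , M′≡) = by-defect (TwistGroups.compatible-orders F W W′ nonsing nonsing′ D param W′≡ M≡ M′≡) defect
      where
      m∣ : ∀ {k} → M ℕ.∣ k → ℕ.suc m ℕ.∣ k
      m∣ {k} = subst (ℕ._∣ k) M≡
      n∣ : ∀ {k} → M′ ℕ.∣ k → ℕ.suc n ℕ.∣ k
      n∣ {k} = subst (ℕ._∣ k) M′≡
      by-defect : Compatible q N N′ (ℕ.suc m) (ℕ.suc n) × Compatible q N′ N (ℕ.suc n) (ℕ.suc m) → Defect N N′ ⊎ Defect N′ N → A ≡ N
      by-defect (c , _) (inj₁ (x , e , _ , h)) = order-unique 1<q q∉ c e h N+N′ A+B dA (m∣ M∣N) (n∣ M′∣N′) (m∣ MA) (n∣ M′B)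
      by-defect (_ , c) (inj₂ (x , e , _ , h)) = ℕ.+-cancelʳ-≡ B A N (trans A+B (trans (sym N+N′) (cong (N ℕ.+_) (sym B≡N′))))
        where
        B≡N′ : B ≡ N′
        B≡N′ = order-unique 1<q q∉ c e h (trans (ℕ.+-comm N′ N) N+N′) (trans (ℕ.+-comm B A) A+B) dB (n∣ M′∣N′) (m∣ M∣N) (n∣ M′B) (m∣ MA)

  trace-unique : ∀ {t} → Trace t N N′ → ∀ s → s * s ≤ + 4 * + q → + M ∣ (+ q + + 1 - s) → + M′ ∣ (+ q + + 1 + s) → s ≡ t
  trace-unique {t} τ s bound h h′ = let (A , B , σ , dA , dB) = orders bound ; (MA , M′B) = divides-trace σ h h′ in
    trans (Trace.determined σ) (trans (cong (λ A → + q + + 1 - + A) (orders-unique (Trace.sum σ) dA dB MA M′B)) (sym (Trace.determined τ)))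

  exponents-determine-trace : ∃ λ (t : ℤ) → (t * t ≤ + 4 * + q × + M ∣ (+ q + + 1 - t) × + M′ ∣ (+ q + + 1 + t))
    × (∀ (s : ℤ) → s * s ≤ + 4 * + q → + M ∣ (+ q + + 1 - s) → + M′ ∣ (+ q + + 1 + s) → s ≡ t)
  exponents-determine-trace = let (t , bound , τ) = trace defect in t , (bound , trace-divides τ M∣N M′∣N′) , trace-unique τ

theorem2 : (F : FiniteField) →
    let q = FiniteField.size F in
    q ∉ (3 ∷ 4 ∷ 5 ∷ 7 ∷ 9 ∷ 11 ∷ 16 ∷ 17 ∷ 23 ∷ 25 ∷ 29 ∷ 49 ∷ []) →
    (E E' : EllipticCurve F) → IsQuadraticTwist F E E' →
    ∃ λ (t : ℤ) →
    (t * t ≤ + 4 * + q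
    × + exponent F E ∣ (+ q + + 1 - t)
    × + exponent F E' ∣ (+ q + + 1 + t))
    × (∀ (s : ℤ) → s * s ≤ + 4 * + q
    → + exponent F E ∣ (+ q + + 1 - s)
    → + exponent F E' ∣ (+ q + + 1 + s)
    → s ≡ t)
theorem2 F q∉ (ell W nonsing) (ell W′ nonsing′) twist = exponents-determine-trace F W W′ nonsing nonsing′ D param eqn≡ q∉
  where open IsQuadraticTwist twist
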